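{- Let $r\geq 3$, $k\geq 1$, $p\geq 0$, $\ell_1,\dots,\ell_k\geq 5$ be integers, and if $p\geq 1$ let $t_1,\dots,t_p\geq 2$ be integers. Let $s\geq r$ be an integer and $t=\sum_{i=1}^k\lfloor\frac{\ell_i+1}{2}\rfloor+p-1$. Suppose either $Q_i=P_{\ell_i}^r$ for all $i\in[k]$, or $Q_i=C_{\ell_i}^r$ for all $i\in[k]$. Let $n\to\infty$. (i) If $s\leq t+r-1$, then $$\mathrm{ex}_r(n,K_s^{(r)},Q_1\cup\cdots\cup Q_k\cup S^r_{t_1}\cup\cdots\cup S^r_{t_p})=(1+o(1))\,\mathcal{N}(K_s^{(r)},S_{n,t}^r)=\binom{t}{s-r+1}\frac{n^{r-1}}{(r-1)!}+o(n^{r-1}).$$ (ii) If $s\geq t+r$, then $\mathrm{ex}_r(n,K_s^{(r)},Q_1\cup\cdots\cup Q_k\cup S^r_{t_1}\cup\cdots\cup S^r_{t_p})=o(n^{r-1})$.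
   Context: An $r$-graph is a hypergraph all of whose hyperedges have exactly $r$ vertices. $K_s^{(r)}$ is the complete $r$-graph on $s$ vertices. $P_\ell$, $C_\ell$, $S_\ell$ are the path, cycle and star with $\ell$ edges. For a graph $F$, the $r$-expansion $F^r$ is obtained from $F$ by adding $r-2$ new vertices to each edge, all new vertices distinct from each other and from $V(F)$. $\cup$ denotes vertex-disjoint union (when $p=0$ there are no star components). $S_{n,t}^r$ is the $n$-vertex $r$-graph whose hyperedges are all $r$-sets intersecting a fixed set of $t$ vertices. $\mathcal{N}(\mathcal{G}_1,\mathcal{G}_2)$ is the number of copies of $\mathcal{G}_1$ in $\mathcal{G}_2$. $\mathrm{ex}_r(n,\mathcal{H},\mathcal{F})$ is the maximum number of copies of $\mathcal{H}$ in an $n$-vertex $r$-graph containing no copy of $\mathcal{F}$. -}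

module Defs where

open import Data.Nat using (ℕ; zero; suc; _+_; _*_; _∸_; _^_; _≤_; _<ᵇ_; _≡ᵇ_; ⌊_/2⌋)
open import Data.Nat.ListAction using (sum)
open import Data.Bool.ListAction using (any; all)
open import Relation.Nullary using (¬_)
open import Data.Nat.Properties using (≡ᵇ⇒≡)
open import Data.Nat.DivMod using (_mod_)
open import Data.Bool using (Bool; true; false; T; _∧_; _∨_; not; if_then_else_)
open import Data.Bool.Properties using (T-∧)
open import Data.Fin using (Fin; zero; suc; toℕ; inject₁; _≟_)
open import Data.Fin.Subset using (Subset; ∣_∣; ⁅_⁆; _∪_; ⊥)
open import Data.Vec using (Vec; []; _∷_; lookup)
open import Data.List using (List; []; _∷_; map; foldr; allFin; length; filter; _++_)
open import Data.Product using (Σ; _×_; _,_; proj₁; proj₂; ∃)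
open import Data.Sum using (_⊎_; inj₁; inj₂)
open import Function using (_∘_; Injective)
open import Function.Bundles using (Equivalence)
open import Relation.Binary.PropositionalEquality using (_≡_)
open import Relation.Nullary.Decidable using (⌊_⌋)

record RGraph (r n : ℕ) : Set where
  field
    edge    : Subset n → Bool
    uniform : ∀ S → T (edge S) → ∣ S ∣ ≡ r
open RGraph public

record Hyp : Set₁ where
  field
    V     : Set
    E     : Set
    verts : E → List V
open Hyp public

toSubset : ∀ {n} → List (Fin n) → Subset n
toSubset = foldr (λ x S → ⁅ x ⁆ ∪ S) ⊥

Contains : ∀ {r n} → RGraph r n → Hyp → Set
Contains {r} {n} G H =
  Σ (V H → Fin n) λ φ →
    Injective _≡_ _≡_ φ × (∀ (e : E H) → T (edge G (toSubset (map φ (verts H e)))))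

record Graph : Set₁ where
  field
    GV   : Set
    GE   : Set
    ends : GE → GV × GV
open Graph public

expansion : ℕ → Graph → Hyp
expansion r F = record
  { V     = GV F ⊎ (GE F × Fin (r ∸ 2))
  ; E     = GE F
  ; verts = λ e → inj₁ (proj₁ (ends F e)) ∷ inj₁ (proj₂ (ends F e))
                    ∷ map (λ j → inj₂ (e , j)) (allFin (r ∸ 2))
  }

path : ℕ → Graph
path ℓ = record { GV = Fin (suc ℓ) ; GE = Fin ℓ ; ends = λ i → inject₁ i , suc i }

cycle : ℕ → Graph
cycle zero    = record { GV = Fin zero ; GE = Fin zero ; ends = λ () }
cycle (suc m) = record { GV = Fin (suc m) ; GE = Fin (suc m)
                       ; ends = λ i → i , (suc (toℕ i) mod (suc m)) }

star : ℕ → Graph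
star ℓ = record { GV = Fin (suc ℓ) ; GE = Fin ℓ ; ends = λ i → zero , suc i }

⨆ : ∀ {k} → (Fin k → Hyp) → Hyp
⨆ {k} H = record
  { V     = Σ (Fin k) (λ i → V (H i))
  ; E     = Σ (Fin k) (λ i → E (H i))
  ; verts = λ { (i , e) → map (λ v → i , v) (verts (H i) e) }
  }

_⊔_ : Hyp → Hyp → Hyp
H ⊔ H' = record
  { V     = V H ⊎ V H'
  ; E     = E H ⊎ E H'
  ; verts = λ { (inj₁ e) → map inj₁ (verts H e) ; (inj₂ e) → map inj₂ (verts H' e) }
  }

allSubsets : (n : ℕ) → List (Subset n)
allSubsets zero    = [] ∷ []
allSubsets (suc n) = map (true ∷_) (allSubsets n) ++ map (false ∷_) (allSubsets n)

_⊆ᵇ_ : ∀ {n} → Subset n → Subset n → Bool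
[]      ⊆ᵇ []      = true
(a ∷ A) ⊆ᵇ (b ∷ B) = (not a ∨ b) ∧ (A ⊆ᵇ B)

isClique : ∀ {r n} → RGraph r n → ℕ → Subset n → Bool
isClique {r} {n} G s S =
  (∣ S ∣ ≡ᵇ s) ∧ all (λ T' → not ((T' ⊆ᵇ S) ∧ (∣ T' ∣ ≡ᵇ r)) ∨ edge G T') (allSubsets n)

-- N(K_s^(r), G): a copy of K_s^(r) is determined by its vertex set
numK : ∀ {r n} → ℕ → RGraph r n → ℕ
numK s G = length (filter (λ S → T? (isClique G s S)) (allSubsets _))
  where
  open import Data.Bool.Properties using (T?)

Snt : (r n t : ℕ) → RGraph r n
Snt r n t = record { edge = e ; uniform = u }
  where
  e : Subset n → Bool
  e S = (∣ S ∣ ≡ᵇ r) ∧ any (λ i → lookup S i ∧ (toℕ i <ᵇ t)) (allFin n)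
  u : ∀ S → T (e S) → ∣ S ∣ ≡ r
  u S p = ≡ᵇ⇒≡ ∣ S ∣ r (proj₁ (Equivalence.to T-∧ p))

data Kind : Set where
  paths cycles : Kind

base : Kind → ℕ → Graph
base paths  = path
base cycles = cycle

Forb : (r : ℕ) → Kind → (k : ℕ) → (Fin k → ℕ) → (p : ℕ) → (Fin p → ℕ) → Hyp
Forb r κ k ℓ p ts =
  ⨆ (λ i → expansion r (base κ (ℓ i))) ⊔ ⨆ (λ j → expansion r (star (ts j)))

tParam : (k : ℕ) → (Fin k → ℕ) → ℕ → ℕ
tParam k ℓ p = sum (map (λ i → ⌊ ℓ i + 1 /2⌋) (allFin k)) + p ∸ 1

Free : ∀ {r n} → RGraph r n → Hyp → Set
Free G H = ¬ Contains G H

{-# OPTIONS --safe #-}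
module Submission where

-- Lower bound: a vertex of a path or a cycle lies on at most two of its edges, so t vertices cannot meet all edges of
-- the forbidden hypergraph F, and S_{n,t} is F-free.
--
-- Upper bound: repeatedly take an (r-1)-set f whose extensions inside the remaining s-cliques use at most t vertices
-- and delete the at most t C (s-r+1) cliques through f.  If o(n^{r-1}) faces survive, the survivors are negligible,
-- because an r-graph in which every face has many extensions contains F greedily.  Otherwise the shadow H of the
-- survivors has positively many faces, each with t+1 extensions, and F is found as follows.  A Kővári–Sós–Turán
-- argument on the faces gives a complete bipartite family of faces {x, y} ∪ Z, each with a list of extension vertices
-- ("colours"), and a canonical Ramsey argument makes every colour either constant, or a function of y, or injective
-- in x.  Constant colours serve as centres of F, non-constant ones make the y (or x) themselves unlimited centres; two
-- centres are joined by a cherry (a path of two edges), and odd cycles get one connection of length three.  The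
-- components of F are embedded one at a time: a component with cover number q uses only q vertices that occur in the
-- lists of many faces, so that after its removal most faces keep all but q of their extensions.

open import Defs
open import Data.Nat using (ℕ; zero; suc; _+_; _*_; _∸_; _^_; _≤_; _<_; _!; _⊓_; z≤n; s≤s; _≤?_; _<?_; ⌊_/2⌋; NonZero; >-nonZero; pred; _≡ᵇ_; _<ᵇ_)
open import Data.Nat.Properties hiding (_≟_; suc-injective)
import Data.Nat.Properties as ℕₚ
open import Data.Nat.Combinatorics using (_C_; nCk+nC[k+1]≡[n+1]C[k+1]; k>n⇒nCk≡0; nCn≡1; nCk≡nC[n∸k])
open import Data.Nat.Tactic.RingSolver using (solve-∀)
open import Data.Nat.ListAction using (sum)
open import Data.Bool.ListAction using (any; all)
open import Data.Nat.DivMod using (_mod_; m<n⇒m%n≡m; n%n≡0; _%_)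
open import Data.Bool using (Bool; true; false; T; _∧_; _∨_; not; if_then_else_)
open import Data.Bool.Properties using (T-∧; T-∨; T-≡; T?) renaming (_≟_ to _≟ᵇ_)
open import Data.Fin using (Fin; zero; suc; toℕ; inject₁; fromℕ; fromℕ<; inject≤; punchIn; _≟_; combine; remQuot)
open import Data.Fin.Properties using (any?; all?; toℕ<n; toℕ-injective; toℕ-inject₁; toℕ-fromℕ; toℕ-fromℕ<; inject≤-injective; pigeonhole; suc-injective; punchInᵢ≢i; remQuot-combine; combine-injective; inject₁-injective)
open import Data.Fin.Subset using (Subset; ∣_∣; ⁅_⁆; _∪_; ⊥; ⊤; _⊆_) renaming (_∈_ to _∈ₛ_; _∉_ to _∉ₛ_)
open import Data.Fin.Subset.Properties using (x∈⁅x⁆; x∈⁅y⁆⇒x≡y; ⊆-antisym; x∈p∪q⁻; x∈p∪q⁺; p⊆q⇒∣p∣≤∣q∣; ∉⊥; ∣⊥∣≡0; ∪-identityˡ; _⊆?_; drop-∷-⊆; ∣p∣≤n; ∈⊤) renaming (_∈?_ to _∈ₛ?_)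
open import Data.Vec as Vec using (Vec; []; _∷_; lookup; toList; tabulate; _[_]≔_)
import Data.Vec.Properties as Vecₚ
open import Data.List using (List; []; _∷_; map; allFin; length; filter; _++_; concatMap; take; [_])
import Data.List as List
open import Data.List.Properties using (length-++; length-map; length-tabulate; map-tabulate; length-take; ++-assoc; ++-identityʳ; length-filter; map-++; map-∘)
open import Data.List.Membership.Propositional using (_∈_; _∉_; lose; find)
open import Data.List.Membership.Propositional.Properties using (∈-++⁺ˡ; ∈-++⁺ʳ; ∈-++⁻; ∈-∃++; ∈-filter⁺; ∈-filter⁻; ∈-allFin; ∈-map⁺; ∈-map⁻; ∈-lookup)
import Data.List.Membership.DecPropositional as DecMem
open import Data.List.Relation.Unary.Any as Any using (Any; here; there)
open import Data.List.Relation.Unary.Any.Properties using (lookup-index)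
open import Data.List.Relation.Unary.All as All using (All; []; _∷_)
import Data.List.Relation.Unary.All.Properties as Allₚ
open import Data.List.Relation.Unary.AllPairs as AllPairs using ([]; _∷_)
open import Data.List.Relation.Unary.Unique.Propositional using (Unique)
open import Data.List.Relation.Unary.Unique.Propositional.Properties as Uniqueₚ using (allFin⁺; Unique[x∷xs]⇒x∉xs)
open import Data.List.Relation.Binary.Permutation.Propositional as Perm using (_↭_; prep; swap; ↭-refl; ↭-sym; ↭-trans)
import Data.List.Relation.Binary.Permutation.Propositional.Properties as Permₚ
import Data.List.Relation.Binary.Permutation.Setoid.Properties as PermₛProps
open import Data.Product using (Σ; _×_; _,_; proj₁; proj₂; ∃; ∃₂)
open import Data.Sum using (_⊎_; inj₁; inj₂; [_,_]′)
open import Data.Sum.Properties using (inj₁-injective)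
open import Data.Empty using (⊥-elim)
open import Data.Unit using (tt)
open import Function using (_∘_; id; case_of_)
open import Function.Bundles using (Equivalence)
open import Relation.Nullary using (¬_; Dec; yes; no; does; contradiction)
open import Relation.Nullary.Decidable using (¬?; _×-dec_; _⊎-dec_; _→-dec_; map′; dec-true; dec-false)
open import Relation.Binary.PropositionalEquality using (_≡_; _≢_; refl; sym; trans; cong; cong₂; subst; subst₂; setoid; module ≡-Reasoning)

-- Sums and counting over lists

-- The count `t + 1` leaves no slack. A face of the shadow is only known to have `t + 1` extensions,
-- so vertices to be avoided can be kept out of the faces themselves, since few tuples meet a
-- bounded set, but not out of their lists of extensions. Hence every construction carries a list
-- `A` of earlier vertices and a list `P` of at most `q` vertices that may lie in `A` all the same.
-- Copies made one after the other, each with `A` the union of its predecessors, meet only in such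
-- lists `P`. So an extension belongs to the rest of at most one copy, and averaging over many
-- copies finds one whose rest occurs in few lists; deleting it costs a typical face the vertices of
-- `P` only. The connection that corrects the parity of odd cycles meets the same difficulty: it is
-- built from extensions and may put three vertices into `P`. This is within the allowance, because
-- paths and cycles with at least five edges have cover number at least three. It also uses faces in
-- which one vertex has been exchanged for an extension, so their lists must be long too, a property
-- that the deletion has to preserve.

private variable
  𝒜 ℬ : Set
  n : ℕ

-- A record rather than a function type, so that `f` can be inferred when injections are composed by
-- `⨾`.
record Inj {A B : Set} (f : A → B) : Set where
  constructor mkInj
  field inj : ∀ {x y} → f x ≡ f y → x ≡ y
open Inj public

infixl 9 _⨾_
_⨾_ : {A B D : Set} {f : A → B} {g : B → D} → Inj f → Inj g → Inj (g ∘ f)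
i ⨾ j = mkInj (inj i ∘ inj j)

inject≤-Inj : ∀ {m n} (le : m ≤ n) → Inj (λ i → inject≤ i le)
inject≤-Inj le = mkInj (inject≤-injective le le _ _)

inject₁-Inj : ∀ {n} → Inj (inject₁ {n})
inject₁-Inj = mkInj inject₁-injective

suc-Inj : ∀ {n} → Inj (Fin.suc {n})
suc-Inj = mkInj suc-injective

IsConst : {A B : Set} → (A → B) → Set
IsConst f = ∀ i j → f i ≡ f j

witness : {P : Set} (d : Dec P) → T (does d) → P
witness (yes p) _ = p

ind : {P : Set} → Dec P → ℕ
ind d = if does d then 1 else 0

ind-yes : {P : Set} (d : Dec P) → P → ind d ≡ 1
ind-yes d p rewrite dec-true d p = refl

ind-no : {P : Set} (d : Dec P) → ¬ P → ind d ≡ 0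
ind-no d p rewrite dec-false d p = refl

ind-≤1 : {P : Set} (d : Dec P) → ind d ≤ 1
ind-≤1 (yes _) = ≤-refl
ind-≤1 (no _)  = z≤n

ind-mono : {P Q : Set} (d : Dec P) (e : Dec Q) → (P → Q) → ind d ≤ ind e
ind-mono (yes p) e f = ≤-reflexive (sym (ind-yes e (f p)))
ind-mono (no _)  e f = z≤n

ind-∪ : {P Q R : Set} (d : Dec P) (e : Dec Q) (f : Dec R) → (P → Q ⊎ R) → ind d ≤ ind e + ind f
ind-∪ (no _) e f _ = z≤n
ind-∪ (yes p) e f h with h p
... | inj₁ q rewrite dec-true e q = s≤s z≤n
... | inj₂ r rewrite dec-true f r = m≤n+m 1 (ind e)

∑ : List 𝒜 → (𝒜 → ℕ) → ℕ
∑ []       f = 0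
∑ (x ∷ xs) f = f x + ∑ xs f

∑-mono∈ : ∀ (xs : List 𝒜) {f g : 𝒜 → ℕ} → (∀ x → x ∈ xs → f x ≤ g x) → ∑ xs f ≤ ∑ xs g
∑-mono∈ []       h = z≤n
∑-mono∈ (x ∷ xs) h = +-mono-≤ (h x (here refl)) (∑-mono∈ xs (λ y y∈ → h y (there y∈)))

∑-mono : ∀ (xs : List 𝒜) {f g : 𝒜 → ℕ} → (∀ x → f x ≤ g x) → ∑ xs f ≤ ∑ xs g
∑-mono xs h = ∑-mono∈ xs (λ x _ → h x)

∑-cong : ∀ (xs : List 𝒜) {f g : 𝒜 → ℕ} → (∀ x → f x ≡ g x) → ∑ xs f ≡ ∑ xs g
∑-cong []       h = refl
∑-cong (x ∷ xs) h = cong₂ _+_ (h x) (∑-cong xs h)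

∑-+ : ∀ (xs : List 𝒜) (f g : 𝒜 → ℕ) → ∑ xs (λ x → f x + g x) ≡ ∑ xs f + ∑ xs g
∑-+ []       f g = refl
∑-+ (x ∷ xs) f g rewrite ∑-+ xs f g = lem (f x) (g x) (∑ xs f) (∑ xs g)
  where
  lem : ∀ a b c d → a + b + (c + d) ≡ a + c + (b + d)
  lem = solve-∀

∑-* : ∀ (xs : List 𝒜) c (f : 𝒜 → ℕ) → ∑ xs (λ x → c * f x) ≡ c * ∑ xs f
∑-* []       c f = sym (*-zeroʳ c)
∑-* (x ∷ xs) c f rewrite ∑-* xs c f = sym (*-distribˡ-+ c (f x) (∑ xs f))

∑-const : ∀ (xs : List 𝒜) c → ∑ xs (λ _ → c) ≡ length xs * c
∑-const []       c = refl
∑-const (x ∷ xs) c = cong (c +_) (∑-const xs c)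

∑-0 : ∀ (xs : List 𝒜) → ∑ xs (λ _ → 0) ≡ 0
∑-0 xs = trans (∑-const xs 0) (*-zeroʳ (length xs))

∑-swap : ∀ (xs : List 𝒜) (ys : List ℬ) (f : 𝒜 → ℬ → ℕ) → ∑ xs (λ x → ∑ ys (f x)) ≡ ∑ ys (λ y → ∑ xs (λ x → f x y))
∑-swap []       ys f = sym (∑-0 ys)
∑-swap (x ∷ xs) ys f rewrite ∑-swap xs ys f = sym (∑-+ ys (f x) (λ y → ∑ xs (λ x₁ → f x₁ y)))

∑-++ : ∀ (xs ys : List 𝒜) (f : 𝒜 → ℕ) → ∑ (xs ++ ys) f ≡ ∑ xs f + ∑ ys f
∑-++ []       ys f = refl
∑-++ (x ∷ xs) ys f rewrite ∑-++ xs ys f = sym (+-assoc (f x) (∑ xs f) (∑ ys f))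

∑-map : ∀ (g : 𝒜 → ℬ) (xs : List 𝒜) (f : ℬ → ℕ) → ∑ (map g xs) f ≡ ∑ xs (f ∘ g)
∑-map g []       f = refl
∑-map g (x ∷ xs) f = cong (f (g x) +_) (∑-map g xs f)

∑-concatMap : ∀ (g : 𝒜 → List ℬ) (xs : List 𝒜) (f : ℬ → ℕ) → ∑ (concatMap g xs) f ≡ ∑ xs (λ x → ∑ (g x) f)
∑-concatMap g []       f = refl
∑-concatMap g (x ∷ xs) f = trans (∑-++ (g x) (concatMap g xs) f) (cong (∑ (g x) f +_) (∑-concatMap g xs f))

∑-≤* : ∀ (xs : List 𝒜) (f : 𝒜 → ℕ) c → (∀ x → f x ≤ c) → ∑ xs f ≤ length xs * c
∑-≤* xs f c h = ≤-trans (∑-mono xs h) (≤-reflexive (∑-const xs c))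

∑-≥ : ∀ {xs : List 𝒜} {x} (f : 𝒜 → ℕ) → x ∈ xs → f x ≤ ∑ xs f
∑-≥ {xs = _ ∷ xs} f (here refl) = m≤m+n _ (∑ xs f)
∑-≥ {xs = y ∷ xs} f (there x∈)  = ≤-trans (∑-≥ f x∈) (m≤n+m _ (f y))

∑-exceeds : ∀ (xs : List 𝒜) (f : 𝒜 → ℕ) c → length xs * c < ∑ xs f → ∃ λ x → x ∈ xs × c < f x
∑-exceeds (x ∷ xs) f c h with c <? f x
... | yes p = x , here refl , p
... | no ¬p with ∑-exceeds xs f c (+-cancelˡ-< c _ _ (≤-trans h (+-monoˡ-≤ (∑ xs f) (≮⇒≥ ¬p))))
... | y , y∈ , q = y , there y∈ , q

count : {P : 𝒜 → Set} → (∀ x → Dec (P x)) → List 𝒜 → ℕ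
count P? xs = ∑ xs (λ x → ind (P? x))

module _ {P Q : 𝒜 → Set} (P? : ∀ x → Dec (P x)) (Q? : ∀ x → Dec (Q x)) where

  count-mono : ∀ xs → (∀ x → P x → Q x) → count P? xs ≤ count Q? xs
  count-mono xs h = ∑-mono xs (λ x → ind-mono (P? x) (Q? x) (h x))

  count-∪ : {R : 𝒜 → Set} (R? : ∀ x → Dec (R x)) → ∀ xs → (∀ x → P x → Q x ⊎ R x) → count P? xs ≤ count Q? xs + count R? xs
  count-∪ R? xs h = ≤-trans (∑-mono xs (λ x → ind-∪ (P? x) (Q? x) (R? x) (h x))) (≤-reflexive (∑-+ xs _ _))

length-filter-count : {P : 𝒜 → Set} (P? : ∀ x → Dec (P x)) → ∀ xs → length (filter P? xs) ≡ count P? xs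
length-filter-count P? [] = refl
length-filter-count P? (x ∷ xs) with P? x
... | yes _ = cong suc (length-filter-count P? xs)
... | no _  = length-filter-count P? xs

count-∃ : {P : 𝒜 → Set} (P? : ∀ x → Dec (P x)) → ∀ xs → 0 < count P? xs → ∃ λ x → x ∈ xs × P x
count-∃ P? xs h with ∑-exceeds xs (λ x → ind (P? x)) 0 (subst (_< count P? xs) (sym (*-zeroʳ (length xs))) h)
... | x , x∈ , q with P? x
... | yes p = x , x∈ , p
count-∃ P? xs h | x , x∈ , () | no _

Unique-⊆⇒≤ : ∀ {xs ys : List 𝒜} → Unique xs → (∀ {x} → x ∈ xs → x ∈ ys) → length xs ≤ length ys
Unique-⊆⇒≤ {xs = []} u h = z≤n
Unique-⊆⇒≤ {xs = x ∷ xs} {ys} (x≢ ∷ u) h with ∈-∃++ (h (here refl))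
... | as , bs , refl = subst (suc (length xs) ≤_) (sym len) (s≤s (subst (length xs ≤_) (length-++ as) (Unique-⊆⇒≤ u g)))
  where
  len : length (as ++ x ∷ bs) ≡ suc (length as + length bs)
  len = trans (length-++ as) (+-suc (length as) (length bs))
  g : ∀ {y} → y ∈ xs → y ∈ as ++ bs
  g {y} y∈ with ∈-++⁻ as (h (there y∈))
  ... | inj₁ p = ∈-++⁺ˡ p
  ... | inj₂ (here refl) = ⊥-elim (All.lookup x≢ y∈ refl)
  ... | inj₂ (there p) = ∈-++⁺ʳ as p

_∈?_ : (x : Fin n) (xs : List (Fin n)) → Dec (x ∈ xs)
_∈?_ {n} = DecMem._∈?_ (_≟_ {n})

Unique-escape : ∀ {xs W : List (Fin n)} → Unique xs → length W < length xs → ∃ λ x → x ∈ xs × x ∉ W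
Unique-escape {xs = xs} {W} u h with All.all? (λ x → x ∈? W) xs
... | yes a = contradiction (Unique-⊆⇒≤ u (λ x∈ → All.lookup a x∈)) (<⇒≱ h)
... | no ¬a with Allₚ.¬All⇒Any¬ (λ x → x ∈? W) xs ¬a
... | any = find any

count-∈≤ : (W : List (Fin n)) → count (_∈? W) (allFin n) ≤ length W
count-∈≤ {n} W = ≤-trans (≤-reflexive (sym (length-filter-count (_∈? W) (allFin n))))
  (Unique-⊆⇒≤ (Uniqueₚ.filter⁺ (_∈? W) (allFin⁺ n)) (λ x∈ → proj₂ (∈-filter⁻ (_∈? W) {xs = allFin n} x∈)))

Unique-lookup : ∀ {xs : List 𝒜} → Unique xs → ∀ {i j} → List.lookup xs i ≡ List.lookup xs j → i ≡ j
Unique-lookup (x≢ ∷ u) {zero}  {zero}  eq = refl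
Unique-lookup (x≢ ∷ u) {zero}  {suc j} eq = ⊥-elim (All.lookup x≢ (∈-lookup j) eq)
Unique-lookup (x≢ ∷ u) {suc i} {zero}  eq = ⊥-elim (All.lookup x≢ (∈-lookup i) (sym eq))
Unique-lookup (x≢ ∷ u) {suc i} {suc j} eq = cong suc (Unique-lookup u eq)

-- Turns a counting bound into an indexed choice, the form in which the pigeonhole and Ramsey
-- arguments hand over their vertices.
count-select : {P : Fin n → Set} (P? : ∀ x → Dec (P x)) → ∀ c → c ≤ count P? (allFin n) →
  Σ (Fin c → Fin n) λ ι → Inj ι × (∀ i → P (ι i))
count-select {n} P? c h = (λ i → List.lookup ys (inject≤ i h′)) ,
  (mkInj λ eq → inject≤-injective h′ h′ _ _ (Unique-lookup u eq)) ,
  (λ i → proj₂ (∈-filter⁻ P? {xs = allFin n} (∈-lookup (inject≤ i h′))))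
  where
  ys = filter P? (allFin n)
  u  = Uniqueₚ.filter⁺ P? (allFin⁺ n)
  h′ : c ≤ length ys
  h′ = subst (c ≤_) (sym (length-filter-count P? (allFin n))) h

length-allFin : ∀ n → length (allFin n) ≡ n
length-allFin n = length-tabulate id

-- Each of the m injective slots sends at most one index to each point of W.
fresh : ∀ {M m} (σ : Fin m → Fin M → Fin n) → (∀ j → Inj (σ j)) → (W : List (Fin n)) → m * length W < M →
  ∃ λ x → ∀ j → σ j x ∉ W
fresh {n} {M} {m} σ σ-inj W h with any? (λ x → all? (λ j → ¬? (σ j x ∈? W)))
... | yes p = p
... | no ¬p = contradiction clash λ ()
  where
  hit : ∀ x → ∃ λ j → σ j x ∈ W
  hit x with any? (λ j → σ j x ∈? W)
  ... | yes q = q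
  ... | no ¬q = ⊥-elim (¬p (x , λ j q → ¬q (j , q)))
  code : Fin M → Fin (m * length W)
  code x = combine (proj₁ (hit x)) (Any.index (proj₂ (hit x)))
  clash : 1 ≡ 0
  clash with pigeonhole h code
  ... | x , y , x<y , eq with combine-injective (proj₁ (hit x)) (Any.index (proj₂ (hit x))) (proj₁ (hit y)) (Any.index (proj₂ (hit y))) eq
  ... | e₁ , e₂ = ⊥-elim (<-irrefl (cong toℕ (inj (σ-inj (proj₁ (hit x))) (trans (lookup-index (proj₂ (hit x))) (trans (cong (List.lookup W) e₂) (trans (sym (lookup-index (proj₂ (hit y)))) (cong (λ j → σ j y) (sym e₁))))))) x<y)

-- Ramsey-type lemmas

count-fibres : ∀ {N n M} (c : Fin N → Fin n) (W : List (Fin n)) → (∀ v → count (λ i → c i ≟ v) (allFin N) ≤ M) →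
  count (λ i → c i ∈? W) (allFin N) ≤ length W * M
count-fibres {N} c [] h = ≤-trans (∑-mono (allFin N) (λ i → ≤-reflexive (ind-no (c i ∈? []) λ ()))) (≤-reflexive (∑-0 (allFin N)))
count-fibres {N} c (w ∷ W) h = ≤-trans
  (count-∪ (λ i → c i ∈? (w ∷ W)) (λ i → c i ≟ w) (λ i → c i ∈? W) (allFin N) λ { i (here p) → inj₁ p ; i (there p) → inj₂ p })
  (+-mono-≤ (h w) (count-fibres c W h))

count-complement : ∀ {N} {P : Fin N → Set} (P? : ∀ i → Dec (P i)) → N ≤ count P? (allFin N) + count (¬? ∘ P?) (allFin N)
count-complement {N} P? = ≤-trans (≤-reflexive (sym (trans (∑-const (allFin N) 1) (trans (*-identityʳ _) (length-allFin N)))))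
  (≤-trans (∑-mono (allFin N) one) (≤-reflexive (∑-+ (allFin N) _ _)))
  where
  one : ∀ i → 1 ≤ ind (P? i) + ind (¬? (P? i))
  one i with P? i
  ... | yes _ = ≤-refl
  ... | no _  = ≤-refl

-- If no value is taken `M` times, distinct values are picked greedily: while fewer than `M` are
-- chosen, at most `M * M` indices carry a chosen value, and `N` is larger.
ramsey : ∀ {N n} M (c : Fin N → Fin n) → M * M < N → Σ (Fin M → Fin N) λ ι → Inj ι × (IsConst (c ∘ ι) ⊎ Inj (c ∘ ι))
ramsey {N} {n} M c h with any? (λ v → M ≤? count (λ i → c i ≟ v) (allFin N))
... | yes (v , p) with count-select (λ i → c i ≟ v) M p
... | ι , ι-inj , q = ι , ι-inj , inj₁ (λ i j → trans (q i) (sym (q j)))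
ramsey {N} {n} M c h | no ¬p = proj₁ big , mkInj (λ eq → inj (proj₂ big) (cong c eq)) , inj₂ (proj₂ big)
  where
  small : ∀ v → count (λ i → c i ≟ v) (allFin N) ≤ M
  small v with M ≤? count (λ i → c i ≟ v) (allFin N)
  ... | yes q = ⊥-elim (¬p (v , q))
  ... | no ¬q = ≰⇒≥ ¬q
  build : ∀ j → j ≤ M → Σ (Fin j → Fin N) λ ι → Inj (c ∘ ι)
  build zero _ = (λ ()) , mkInj λ {i} → case i of λ ()
  build (suc j) j<M with build j (≤-trans (n≤1+n j) j<M)
  ... | ι , ι-inj = ext , mkInj ext-inj
    where
    W = List.tabulate (c ∘ ι)
    few : count (λ i → c i ∈? W) (allFin N) < N
    few = ≤-<-trans (≤-trans (count-fibres c W small) (*-monoˡ-≤ M (≤-trans (≤-reflexive (length-tabulate (c ∘ ι))) (≤-trans (n≤1+n j) j<M)))) h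
    pick : ∃ λ i → i ∈ allFin N × c i ∉ W
    pick = count-∃ (λ i → ¬? (c i ∈? W)) (allFin N)
      (+-cancelˡ-< _ 0 _ (subst (_< count (λ i → c i ∈? W) (allFin N) + count (λ i → ¬? (c i ∈? W)) (allFin N)) (sym (+-identityʳ _))
        (<-≤-trans few (count-complement (λ i → c i ∈? W)))))
    ext : Fin (suc j) → Fin N
    ext zero    = proj₁ pick
    ext (suc i) = ι i
    mem : ∀ {j} (f : Fin j → Fin n) i → f i ∈ List.tabulate f
    mem f zero    = here refl
    mem f (suc i) = there (mem (f ∘ suc) i)
    ext-inj : ∀ {i l} → c (ext i) ≡ c (ext l) → i ≡ l
    ext-inj {zero}  {zero}  eq = refl
    ext-inj {zero}  {suc i} eq = ⊥-elim (proj₂ (proj₂ pick) (subst (_∈ W) (sym eq) (mem (c ∘ ι) i)))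
    ext-inj {suc i} {zero}  eq = ⊥-elim (proj₂ (proj₂ pick) (subst (_∈ W) eq (mem (c ∘ ι) i)))
    ext-inj {suc i} {suc l} eq = cong suc (inj ι-inj eq)
  big = build M ≤-refl

-- The columns are treated in turn, each on the rows that the previous ones left; both alternatives
-- survive the passage to fewer rows.
ramsey-columns : ∀ K M → ∃ λ N → ∀ {n} (c : Fin N → Fin K → Fin n) →
  Σ (Fin M → Fin N) λ ι → Inj ι × (∀ y → IsConst (λ x → c (ι x) y) ⊎ Inj (λ x → c (ι x) y))
ramsey-columns zero    M = M , λ c → id , mkInj id , λ ()
ramsey-columns (suc K) M with ramsey-columns K M
... | N , ih = suc (N * N) , λ {n} c → step c
  where
  step : ∀ {n} (c : Fin (suc (N * N)) → Fin (suc K) → Fin n) →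
    Σ (Fin M → Fin (suc (N * N))) λ ι → Inj ι × (∀ y → IsConst (λ x → c (ι x) y) ⊎ Inj (λ x → c (ι x) y))
  step c with ramsey N (λ x → c x zero) ≤-refl
  ... | ι , ι-inj , t₀ with ih (λ x y → c (ι x) (suc y))
  ... | α , α-inj , t = (ι ∘ α) , (α-inj ⨾ ι-inj) , λ { zero → [ (λ e → inj₁ (λ i j → e (α i) (α j))) , (λ e → inj₂ (α-inj ⨾ e)) ]′ t₀ ; (suc y) → t y }

-- A coarse canonical partition: `x-inj` covers both a function of `x` alone and a colouring
-- injective in the pair, because it compares no two columns. The asymmetry is made up for later by
-- exchanging the sides of a box.
data Colouring {Mx My n : ℕ} (c : Fin Mx → Fin My → Fin n) : Set where
  const : ∀ a → (∀ x y → c x y ≡ a) → Colouring c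
  y-inj : ∀ h → Inj h → (∀ x y → c x y ≡ h y) → Colouring c
  x-inj : (∀ y → Inj (λ x → c x y)) → Colouring c

restrict : ∀ {Mx My Mx′ My′ n} {c : Fin Mx → Fin My → Fin n} (α : Fin Mx′ → Fin Mx) (β : Fin My′ → Fin My) → Inj α → Inj β →
  Colouring c → Colouring (λ x y → c (α x) (β y))
restrict α β iα iβ (const a e)   = const a (λ x y → e (α x) (β y))
restrict α β iα iβ (y-inj h i e) = y-inj (h ∘ β) (iβ ⨾ i) (λ x y → e (α x) (β y))
restrict α β iα iβ (x-inj i)     = x-inj (λ y → iα ⨾ i (β y))

canonical₁ : ∀ Mx My → 1 ≤ Mx → ∃ λ N → ∀ {n} (c : Fin N → Fin N → Fin n) →
  Σ (Fin Mx → Fin N) λ α → Σ (Fin My → Fin N) λ β → Inj α × Inj β × Colouring (λ x y → c (α x) (β y))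
canonical₁ (suc Mx₁) My _ = N , λ c → main c
  where
  Mx = suc Mx₁
  -- `My` injective columns already give `x-inj`; failing that, `My * My + 1` columns are constant,
  -- as many as `ramsey` needs to sort their values.
  K  = My + suc (My * My)
  N₁ = proj₁ (ramsey-columns K Mx)
  N  = N₁ + K
  ιx : Fin N₁ → Fin N
  ιx x = inject≤ x (m≤m+n N₁ K)
  ιy : Fin K → Fin N
  ιy y = inject≤ y (m≤n+m K N₁)
  ιx-inj : Inj ιx
  ιx-inj = inject≤-Inj (m≤m+n N₁ K)
  ιy-inj : Inj ιy
  ιy-inj = inject≤-Inj (m≤n+m K N₁)
  main : ∀ {n} (c : Fin N → Fin N → Fin n) →
    Σ (Fin Mx → Fin N) λ α → Σ (Fin My → Fin N) λ β → Inj α × Inj β × Colouring (λ x y → c (α x) (β y))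
  main {n} c with proj₂ (ramsey-columns K Mx) (λ x y → c (ιx x) (ιy y))
  ... | α , α-inj , t = split (My ≤? count I? (allFin K))
    where
    I : Fin K → Set
    I y = Inj (λ x → c (ιx (α x)) (ιy y))
    C′ : Fin K → Set
    C′ y = IsConst (λ x → c (ιx (α x)) (ιy y))
    -- The alternative found for a column is read off as a Boolean, so that the columns of either
    -- sort can be counted without deciding injectivity.
    tag : ∀ {y} → C′ y ⊎ I y → Bool
    tag (inj₁ _) = false
    tag (inj₂ _) = true
    Tag : Fin K → Set
    Tag y = T (tag (t y))
    I? : ∀ y → Dec (Tag y)
    I? y = T? (tag (t y))
    Tag⇒I : ∀ y → Tag y → I y
    Tag⇒I y with t y
    ... | inj₂ i = λ _ → i
    ¬Tag⇒C : ∀ y → ¬ Tag y → C′ y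
    ¬Tag⇒C y with t y
    ... | inj₁ k = λ _ → k
    ... | inj₂ i = λ f → ⊥-elim (f tt)
    split : Dec (My ≤ count I? (allFin K)) → Σ (Fin Mx → Fin N) λ α → Σ (Fin My → Fin N) λ β → Inj α × Inj β × Colouring (λ x y → c (α x) (β y))
    split (yes p) with count-select I? My p
    ... | β , β-inj , q = (ιx ∘ α) , (ιy ∘ β) , (α-inj ⨾ ιx-inj) , (β-inj ⨾ ιy-inj) , x-inj (λ y → Tag⇒I (β y) (q y))
    split (no ¬p) with count-select (¬? ∘ I?) (suc (My * My)) many
      where
      many : suc (My * My) ≤ count (¬? ∘ I?) (allFin K)
      many = +-cancelˡ-≤ My _ _ (≤-trans (count-complement I?) (+-monoˡ-≤ _ (≰⇒≥ ¬p)))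
    ... | β , β-inj , q with ramsey My (λ y → c (ιx (α zero)) (ιy (β y))) ≤-refl
    ... | γ , γ-inj , inj₁ k = (ιx ∘ α) , (ιy ∘ β ∘ γ) , (α-inj ⨾ ιx-inj) , (γ-inj ⨾ β-inj ⨾ ιy-inj) , fin My refl
      where
      fin : ∀ My′ → My′ ≡ My → Colouring (λ x y → c (ιx (α x)) (ιy (β (γ y))))
      -- Without columns there is no entry to name as the constant, so the empty injection is
      -- returned.
      fin zero    refl = y-inj (λ ()) (mkInj λ {i} → case i of λ ()) (λ x ())
      fin (suc _) refl = const (c (ιx (α zero)) (ιy (β (γ zero)))) (λ x y → trans (¬Tag⇒C (β (γ y)) (q (γ y)) x zero) (k y zero))
    ... | γ , γ-inj , inj₂ i = (ιx ∘ α) , (ιy ∘ β ∘ γ) , (α-inj ⨾ ιx-inj) , (γ-inj ⨾ β-inj ⨾ ιy-inj) ,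
      y-inj (λ y → c (ιx (α zero)) (ιy (β (γ y)))) i (λ x y → ¬Tag⇒C (β (γ y)) (q (γ y)) x zero)

-- One colour at a time: a colouring keeps its kind on a subgrid, so the grid left by the other
-- colours only has to be large enough for one application of `canonical₁`.
canonical : ∀ q Mx My → 1 ≤ Mx → ∃ λ N → ∀ {n} (c : Fin q → Fin N → Fin N → Fin n) →
  Σ (Fin Mx → Fin N) λ α → Σ (Fin My → Fin N) λ β → Inj α × Inj β × (∀ k → Colouring (λ x y → c k (α x) (β y)))
canonical zero Mx My 1≤ = Mx + My , λ c →
  (λ x → inject≤ x (m≤m+n Mx My)) , (λ y → inject≤ y (m≤n+m My Mx)) ,
  inject≤-Inj (m≤m+n Mx My) , inject≤-Inj (m≤n+m My Mx) , λ ()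
canonical (suc q) Mx My 1≤ = N , λ c → main c
  where
  -- The successor supplies the hypothesis that the grid is not empty; `inject₁` drops the spare row
  -- and column.
  N₁ = suc (proj₁ (canonical₁ Mx My 1≤))
  N  = proj₁ (canonical q N₁ N₁ (s≤s z≤n))
  main : ∀ {n} (c : Fin (suc q) → Fin N → Fin N → Fin n) →
    Σ (Fin Mx → Fin N) λ α → Σ (Fin My → Fin N) λ β → Inj α × Inj β × (∀ k → Colouring (λ x y → c k (α x) (β y)))
  main c with proj₂ (canonical q N₁ N₁ (s≤s z≤n)) (λ k → c (suc k))
  ... | α , β , iα , iβ , t with proj₂ (canonical₁ Mx My 1≤) (λ x y → c zero (α (inject₁ x)) (β (inject₁ y)))
  ... | α′ , β′ , iα′ , iβ′ , t′ = (α ∘ inject₁ ∘ α′) , (β ∘ inject₁ ∘ β′) , (iα′ ⨾ inject₁-Inj ⨾ iα) , (iβ′ ⨾ inject₁-Inj ⨾ iβ) ,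
    λ { zero → t′ ; (suc k) → restrict (inject₁ ∘ α′) (inject₁ ∘ β′) (iα′ ⨾ inject₁-Inj) (iβ′ ⨾ inject₁-Inj) (t k) }

-- Bicliques in dense relations, by double counting

heavy : ∀ {A : Set} (xs : List A) (f : A → ℕ) m m₂ B → .{{_ : NonZero B}} → m₂ ≡ 2 * m → (∀ x → f x ≤ B) → length xs * B ≤ m * ∑ xs f →
  length xs ≤ m₂ * count (λ x → B ≤? m₂ * f x) xs
heavy xs f m m₂ B m₂≡ f≤ h = *-cancelʳ-≤ (length xs) _ B (+-cancelʳ-≤ (length xs * B) _ _ (begin
  length xs * B + length xs * B                            ≤⟨ +-mono-≤ h h ⟩
  m * ∑ xs f + m * ∑ xs f                                  ≡⟨ e₁ m (∑ xs f) ⟩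
  2 * m * ∑ xs f                                           ≡⟨ cong (_* ∑ xs f) m₂≡ ⟨
  m₂ * ∑ xs f                                              ≡⟨ ∑-* xs m₂ f ⟨
  ∑ xs (λ x → m₂ * f x)                                    ≤⟨ ∑-mono xs (λ x → point x (good? x)) ⟩
  ∑ xs (λ x → m₂ * B * ind (good? x) + B)                  ≡⟨ ∑-+ xs _ _ ⟩
  ∑ xs (λ x → m₂ * B * ind (good? x)) + ∑ xs (λ _ → B)     ≡⟨ cong₂ _+_ (∑-* xs (m₂ * B) _) (∑-const xs B) ⟩
  m₂ * B * count good? xs + length xs * B                  ≡⟨ cong (_+ length xs * B) (e₂ m₂ B (count good? xs)) ⟩
  m₂ * count good? xs * B + length xs * B                  ∎))
  where
  open ≤-Reasoning
  good? = λ x → B ≤? m₂ * f x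
  e₁ : ∀ m s → m * s + m * s ≡ 2 * m * s
  e₁ = solve-∀
  e₂ : ∀ m b g → m * b * g ≡ m * g * b
  e₂ = solve-∀
  -- A good value is at most `B`, and any other contributes less than `B` to the scaled sum; the
  -- factor two in `m₂` leaves half of the total for the good ones.
  point : ∀ x (d : Dec (B ≤ m₂ * f x)) → m₂ * f x ≤ m₂ * B * ind d + B
  point x (yes p) = ≤-trans (*-monoʳ-≤ m₂ (f≤ x)) (≤-trans (≤-reflexive (sym (*-identityʳ _))) (m≤m+n _ B))
  point x (no ¬p) = ≤-trans (≰⇒≥ ¬p) (m≤n+m B _)

∈-allSubsets : (S : Subset n) → S ∈ allSubsets n
∈-allSubsets [] = here refl
∈-allSubsets {suc n} (true ∷ S)  = ∈-++⁺ˡ (∈-map⁺ (true ∷_) (∈-allSubsets S))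
∈-allSubsets {suc n} (false ∷ S) = ∈-++⁺ʳ (map (true ∷_) (allSubsets n)) (∈-map⁺ (false ∷_) (∈-allSubsets S))

count≤length : ∀ {A : Set} {P : A → Set} (P? : ∀ x → Dec (P x)) xs → count P? xs ≤ length xs
count≤length P? xs = ≤-trans (∑-≤* xs _ 1 (λ x → ind-≤1 (P? x))) (≤-reflexive (*-identityʳ _))

count≤n : ∀ {n} {P : Fin n → Set} (P? : ∀ x → Dec (P x)) → count P? (allFin n) ≤ n
count≤n {n} P? = ≤-trans (count≤length P? (allFin n)) (≤-reflexive (length-allFin n))

does-≡ : {P Q : Set} (d : Dec P) (e : Dec Q) → does d ≡ does e → Q → P
does-≡ (yes p) e eq q = p
does-≡ (no _)  e eq q with trans eq (dec-true e q)
... | ()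

-- Pigeonhole over the subsets of a `K`-set. One element more than `M` is produced, because the
-- caller gives one up as the representative of the common pattern.
fibre : ∀ {n} {P : Fin n → Set} (P? : ∀ x → Dec (P x)) {K} (φ : Fin n → Subset K) M → length (allSubsets K) * M < count P? (allFin n) →
  ∃ λ S → Σ (Fin (suc M) → Fin n) λ X → Inj X × (∀ i → φ (X i) ≡ S × P (X i))
fibre {n} {P} P? {K} φ M h = S , count-select (Fib? S) (suc M) (proj₂ (proj₂ best))
  where
  Fib? : ∀ S x → Dec (φ x ≡ S × P x)
  Fib? S x = Vecₚ.≡-dec _≟ᵇ_ (φ x) S ×-dec P? x
  lots : length (allSubsets K) * M < ∑ (allSubsets K) (λ S → count (Fib? S) (allFin n))
  lots = ≤-trans h (≤-trans (∑-mono (allFin n) (λ x → ≤-trans (ind-mono (P? x) (Fib? (φ x) x) (refl ,_))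
        (∑-≥ (λ S → ind (Fib? S x)) (∈-allSubsets (φ x)))))
        (≤-reflexive (∑-swap (allFin n) (allSubsets K) (λ x S → ind (Fib? S x)))))
  best = ∑-exceeds (allSubsets K) (λ S → count (Fib? S) (allFin n)) M lots
  S = proj₁ best

module _ {n : ℕ} {Γ : Fin n → Fin n → Set} (Γ? : ∀ x y → Dec (Γ x y)) where

  -- On average a row sees one `b`-th of the chosen columns, so at least `n / c` rows see `K / c` of
  -- them. Some pattern is shared by more than `M` of these rows, and those rows together with `M`
  -- columns of the pattern form the biclique.
  biclique-rows : ∀ b c M K (Y : Fin K → Fin n) → Inj Y → .{{_ : NonZero K}} → .{{_ : NonZero c}} →
    c ≡ 2 * b → c * suc M ≤ K → c * suc (length (allSubsets K) * M) ≤ n → (∀ j → n ≤ b * count (λ x → Γ? x (Y j)) (allFin n)) →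
    Σ (Fin M → Fin n) λ X → Σ (Fin M → Fin n) λ Y → Inj X × Inj Y × (∀ i j → Γ (X i) (Y j))
  biclique-rows b c M K Y Y-inj c≡ cM≤K N₁≤ Y-deg = finish (fibre good? row M lots)
    where
    deg : Fin n → ℕ
    deg x = count (λ j → Γ? x (Y j)) (allFin K)
    good? : ∀ x → Dec (K ≤ c * deg x)
    good? x = K ≤? c * deg x
    row : Fin n → Subset K
    row x = tabulate (λ j → does (Γ? x (Y j)))
    dense : length (allFin n) * K ≤ b * ∑ (allFin n) deg
    dense = begin
      length (allFin n) * K                                             ≡⟨ cong (_* K) (length-allFin n) ⟩
      n * K                                                             ≡⟨ *-comm n K ⟩
      K * n                                                             ≡⟨ cong (_* n) (length-allFin K) ⟨
      length (allFin K) * n                                             ≡⟨ ∑-const (allFin K) n ⟨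
      ∑ (allFin K) (λ _ → n)                                            ≤⟨ ∑-mono (allFin K) Y-deg ⟩
      ∑ (allFin K) (λ j → b * count (λ x → Γ? x (Y j)) (allFin n))      ≡⟨ ∑-* (allFin K) b _ ⟩
      b * ∑ (allFin K) (λ j → count (λ x → Γ? x (Y j)) (allFin n))      ≡⟨ cong (b *_) (∑-swap (allFin K) (allFin n) (λ j x → ind (Γ? x (Y j)))) ⟩
      b * ∑ (allFin n) deg                                              ∎
      where open ≤-Reasoning
    lots : length (allSubsets K) * M < count good? (allFin n)
    lots = *-cancelˡ-≤ c (≤-trans N₁≤ (≤-trans (≤-reflexive (sym (length-allFin n)))
      (heavy (allFin n) deg b c K c≡ (λ x → count≤n (λ j → Γ? x (Y j))) dense)))
    finish : (∃ λ S → Σ (Fin (suc M) → Fin n) λ X → Inj X × (∀ i → row (X i) ≡ S × K ≤ c * deg (X i))) →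
      Σ (Fin M → Fin n) λ X → Σ (Fin M → Fin n) λ Y → Inj X × Inj Y × (∀ i j → Γ (X i) (Y j))
    finish (S , X , X-inj , p) with count-select (λ j → Γ? (X zero) (Y j)) M (≤-trans (n≤1+n M) (*-cancelˡ-≤ c (≤-trans cM≤K (proj₂ (p zero)))))
    ... | ι , ι-inj , q = X ∘ suc , Y ∘ ι , suc-Inj ⨾ X-inj , ι-inj ⨾ Y-inj , λ i j →
      does-≡ (Γ? (X (suc i)) (Y (ι j))) (Γ? (X zero) (Y (ι j)))
        (trans (sym (Vecₚ.lookup∘tabulate _ (ι j))) (trans (cong (λ S → lookup S (ι j)) (trans (proj₁ (p (suc i))) (sym (proj₁ (p zero)))))
          (Vecₚ.lookup∘tabulate _ (ι j)))) (q j)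

  -- The columns are first cut down to `K` of high degree. As `K` does not grow with `n`, neither
  -- does the number of patterns that a row can show on them, and the pigeonhole principle applies.
  biclique : ∀ m b c M K → .{{_ : NonZero n}} → .{{_ : NonZero K}} → .{{_ : NonZero b}} → .{{_ : NonZero c}} →
    b ≡ 2 * m → c ≡ 2 * b → c * suc M ≤ K → c * suc (length (allSubsets K) * M) ≤ n → b * K ≤ n →
    n * n ≤ m * ∑ (allFin n) (λ x → count (Γ? x) (allFin n)) →
    Σ (Fin M → Fin n) λ X → Σ (Fin M → Fin n) λ Y → Inj X × Inj Y × (∀ i j → Γ (X i) (Y j))
  biclique m b c M K b≡ c≡ cM≤K N₁≤ bK≤ dense = finish (count-select good? K (*-cancelˡ-≤ b (≤-trans bK≤ (≤-trans (≤-reflexive (sym (length-allFin n)))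
      (heavy (allFin n) deg m b n b≡ (λ y → count≤n (λ x → Γ? x y))
        (≤-trans (≤-reflexive (cong (_* n) (length-allFin n)))
          (≤-trans dense (≤-reflexive (cong (m *_) (∑-swap (allFin n) (allFin n) (λ x y → ind (Γ? x y))))))))))))
    where
    deg : Fin n → ℕ
    deg y = count (λ x → Γ? x y) (allFin n)
    good? : ∀ y → Dec (n ≤ b * deg y)
    good? y = n ≤? b * deg y
    finish : (Σ (Fin K → Fin n) λ Y → Inj Y × (∀ j → n ≤ b * deg (Y j))) →
      Σ (Fin M → Fin n) λ X → Σ (Fin M → Fin n) λ Y → Inj X × Inj Y × (∀ i j → Γ (X i) (Y j))
    finish (Y , Y-inj , Y-deg) = biclique-rows b c M K Y Y-inj c≡ cM≤K N₁≤ Y-deg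

kővári-sós-turán : ∀ m M → ∃ λ N → ∀ {n} → N ≤ n → {Γ : Fin n → Fin n → Set} (Γ? : ∀ x y → Dec (Γ x y)) →
  n * n ≤ suc m * ∑ (allFin n) (λ x → count (Γ? x) (allFin n)) →
  Σ (Fin M → Fin n) λ X → Σ (Fin M → Fin n) λ Y → Inj X × Inj Y × (∀ i j → Γ (X i) (Y j))
kővári-sós-turán m M = suc (N₁ + b * K) , λ { {suc n} (s≤s N≤) Γ? dense →
    biclique Γ? (suc m) b c M K refl refl (≤-refl {c * suc M}) (m≤n⇒m≤1+n (m+n≤o⇒m≤o N₁ N≤)) (m≤n⇒m≤1+n (m+n≤o⇒n≤o N₁ N≤)) dense }
  where
  b = 2 * suc m
  c = 2 * b
  K = c * suc M
  N₁ = c * suc (length (allSubsets K) * M)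

-- Embeddings of expansions

Unique-++⁻ : ∀ {A : Set} (xs : List A) {ys} → Unique (xs ++ ys) → Unique xs × Unique ys × (∀ {x} → x ∈ xs → x ∉ ys)
Unique-++⁻ []       u = [] , u , λ ()
Unique-++⁻ (x ∷ xs) (x≢ ∷ u) with Unique-++⁻ xs u
... | a , b , d = (Allₚ.++⁻ˡ xs x≢ ∷ a) , b , λ { (here refl) q → All.lookup (Allₚ.++⁻ʳ xs x≢) q refl ; (there p) q → d p q }

∉⇒All≢ : ∀ {A : Set} {x : A} {xs} → x ∉ xs → All (x ≢_) xs
∉⇒All≢ {xs = []}     h = []
∉⇒All≢ {xs = y ∷ xs} h = (λ e → h (here e)) ∷ ∉⇒All≢ (h ∘ there)

Unique-∷ : ∀ {A : Set} {x : A} {xs} → x ∉ xs → Unique xs → Unique (x ∷ xs)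
Unique-∷ h u = ∉⇒All≢ h ∷ u

Unique-++ : ∀ {A : Set} {xs ys : List A} → Unique xs → Unique ys → (∀ {x} → x ∈ xs → x ∉ ys) → Unique (xs ++ ys)
Unique-++ u v d = Uniqueₚ.++⁺ u v (λ { (p , q) → d p q })

lookup∈toList : ∀ {A : Set} {m} (E : Vec A m) j → lookup E j ∈ toList E
lookup∈toList (x ∷ E) zero    = here refl
lookup∈toList (x ∷ E) (suc j) = there (lookup∈toList E j)

∈toList⇒lookup : ∀ {A : Set} {m} (E : Vec A m) {x} → x ∈ toList E → ∃ λ j → x ≡ lookup E j
∈toList⇒lookup (x ∷ E) (here p) = zero , p
∈toList⇒lookup (x ∷ E) (there p) with ∈toList⇒lookup E p
... | j , q = suc j , q

lookup-toList-injective : ∀ {A : Set} {m} (E : Vec A m) → Unique (toList E) → ∀ {i j} → lookup E i ≡ lookup E j → i ≡ j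
lookup-toList-injective (x ∷ E) (x≢ ∷ u) {zero}  {zero}  e = refl
lookup-toList-injective (x ∷ E) (x≢ ∷ u) {zero}  {suc j} e = ⊥-elim (All.lookup x≢ (lookup∈toList E j) e)
lookup-toList-injective (x ∷ E) (x≢ ∷ u) {suc i} {zero}  e = ⊥-elim (All.lookup x≢ (lookup∈toList E i) (sym e))
lookup-toList-injective (x ∷ E) (x≢ ∷ u) {suc i} {suc j} e = cong suc (lookup-toList-injective E u e)

map-allFin : ∀ {A : Set} {m} (h : Fin m → A) (E : Vec A m) → (∀ j → h j ≡ lookup E j) → map h (allFin m) ≡ toList E
map-allFin {m = m} h E eq = trans (map-tabulate id h) (go h E eq)
  where
  go : ∀ {A : Set} {m} (h : Fin m → A) (E : Vec A m) → (∀ j → h j ≡ lookup E j) → List.tabulate h ≡ toList E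
  go h []      eq = refl
  go h (x ∷ E) eq = cong₂ _∷_ (eq zero) (go (h ∘ suc) E (eq ∘ suc))

∈-toSubset⁺ : ∀ {v : Fin n} {l} → v ∈ l → v ∈ₛ toSubset l
∈-toSubset⁺ {l = x ∷ l} (here refl) = x∈p∪q⁺ (inj₁ (x∈⁅x⁆ x))
∈-toSubset⁺ {l = x ∷ l} (there p)   = x∈p∪q⁺ {p = ⁅ x ⁆} (inj₂ (∈-toSubset⁺ p))

∈-toSubset⁻ : ∀ {v : Fin n} l → v ∈ₛ toSubset l → v ∈ l
∈-toSubset⁻ []      p = ⊥-elim (∉⊥ p)
∈-toSubset⁻ (x ∷ l) p with x∈p∪q⁻ ⁅ x ⁆ (toSubset l) p
... | inj₁ q = here (x∈⁅y⁆⇒x≡y x q)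
... | inj₂ q = there (∈-toSubset⁻ l q)

toSubset-cong : ∀ {l l′ : List (Fin n)} → (∀ {v} → v ∈ l → v ∈ l′) → (∀ {v} → v ∈ l′ → v ∈ l) → toSubset l ≡ toSubset l′
toSubset-cong {l = l} {l′} f g = ⊆-antisym (λ p → ∈-toSubset⁺ (f (∈-toSubset⁻ l p))) (λ p → ∈-toSubset⁺ (g (∈-toSubset⁻ l′ p)))

toSubset-↭ : ∀ {l l′ : List (Fin n)} → l ↭ l′ → toSubset l ≡ toSubset l′
toSubset-↭ p = toSubset-cong (Permₚ.∈-resp-↭ p) (Permₚ.∈-resp-↭ (↭-sym p))

∣⁅x⁆∪S∣ : ∀ (x : Fin n) S → x ∉ₛ S → ∣ ⁅ x ⁆ ∪ S ∣ ≡ suc ∣ S ∣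
∣⁅x⁆∪S∣ zero    (true ∷ S)  h = ⊥-elim (h Vec.here)
∣⁅x⁆∪S∣ zero    (false ∷ S) h = cong (λ S → suc ∣ S ∣) (∪-identityˡ S)
∣⁅x⁆∪S∣ (suc x) (true ∷ S)  h = cong suc (∣⁅x⁆∪S∣ x S (h ∘ Vec.there))
∣⁅x⁆∪S∣ (suc x) (false ∷ S) h = ∣⁅x⁆∪S∣ x S (h ∘ Vec.there)

Unique⇒∣toSubset∣ : ∀ {l : List (Fin n)} → Unique l → ∣ toSubset l ∣ ≡ length l
Unique⇒∣toSubset∣ {n} {[]} u = ∣⊥∣≡0 n
Unique⇒∣toSubset∣ {n} {x ∷ l} (x≢ ∷ u) = trans (∣⁅x⁆∪S∣ x (toSubset l) (λ p → All.lookup x≢ (∈-toSubset⁻ l p) refl)) (cong suc (Unique⇒∣toSubset∣ u))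

∣toSubset∣≤ : ∀ (l : List (Fin n)) → ∣ toSubset l ∣ ≤ length l
∣toSubset∣≤ {n} [] = ≤-reflexive (∣⊥∣≡0 n)
∣toSubset∣≤ (x ∷ l) with x ∈? l
... | yes p = ≤-trans (≤-trans (≤-reflexive (cong ∣_∣ (toSubset-cong {l = x ∷ l} {l} (λ { (here refl) → p ; (there q) → q }) there))) (∣toSubset∣≤ l)) (n≤1+n _)
... | no ¬p = ≤-trans (≤-reflexive (∣⁅x⁆∪S∣ x (toSubset l) (¬p ∘ ∈-toSubset⁻ l))) (s≤s (∣toSubset∣≤ l))

∣toSubset∣⇒Unique : ∀ (l : List (Fin n)) → ∣ toSubset l ∣ ≡ length l → Unique l
∣toSubset∣⇒Unique [] e = []
∣toSubset∣⇒Unique (x ∷ l) e with x ∈? l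
... | yes p = ⊥-elim (<-irrefl refl (≤-trans (≤-reflexive (trans (sym e) (cong ∣_∣ (toSubset-cong {l = x ∷ l} {l} (λ { (here refl) → p ; (there q) → q }) there)))) (∣toSubset∣≤ l)))
... | no ¬p = Unique-∷ ¬p (∣toSubset∣⇒Unique l (cong pred (trans (sym (∣⁅x⁆∪S∣ x (toSubset l) (¬p ∘ ∈-toSubset⁻ l))) e)))

-- A record around the Boolean test, which would otherwise compute and put the list `l` beyond the
-- reach of inference.
record Edge {r n : ℕ} (G : RGraph r n) (l : List (Fin n)) : Set where
  constructor mkEdge
  field isEdge : T (edge G (toSubset l))
open Edge public

Edge-↭ : ∀ {r n} (G : RGraph r n) {l l′} → l ↭ l′ → Edge G l → Edge G l′
Edge-↭ G p (mkEdge e) = mkEdge (subst (λ S → T (edge G S)) (toSubset-↭ p) e)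

Edge-Unique : ∀ {r n} (G : RGraph r n) {l} → length l ≡ r → Edge G l → Unique l
Edge-Unique G {l} e h = ∣toSubset∣⇒Unique l (trans (uniform G _ (isEdge h)) (sym e))

-- `L` need only contain the image. Copies are kept apart from each other and from forbidden
-- vertices through these lists.
record Emb {r n : ℕ} (G : RGraph r n) (H : Hyp) (L : List (Fin n)) : Set where
  constructor mkEmb
  field
    φ       : V H → Fin n
    φ-inj   : ∀ {v w} → φ v ≡ φ w → v ≡ w
    φ-edge  : ∀ e → Edge G (map φ (verts H e))
    φ-image : ∀ v → φ v ∈ L
open Emb

Emb⇒Contains : ∀ {r n} {G : RGraph r n} {H L} → Emb G H L → Contains G H
Emb⇒Contains e = φ e , φ-inj e , λ x → isEdge (φ-edge e x)

Emb-mono : ∀ {r n} {G G′ : RGraph r n} {H L} → (∀ S → T (edge G S) → T (edge G′ S)) → Emb G H L → Emb G′ H L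
Emb-mono h (mkEmb f i e m) = mkEmb f i (λ x → mkEdge (h _ (isEdge (e x)))) m

Emb-⊔ : ∀ {r n} {G : RGraph r n} {H H′ L L′} → Emb G H L → Emb G H′ L′ → (∀ {v} → v ∈ L → v ∉ L′) → Emb G (H ⊔ H′) (L ++ L′)
Emb-⊔ {G = G} {H} {H′} {L} {L′} a b d = mkEmb f f-inj f-edge f-image
  where
  f : V H ⊎ V H′ → _
  f (inj₁ v) = φ a v
  f (inj₂ v) = φ b v
  f-inj : ∀ {v w} → f v ≡ f w → v ≡ w
  f-inj {inj₁ v} {inj₁ w} e = cong inj₁ (φ-inj a e)
  f-inj {inj₁ v} {inj₂ w} e = ⊥-elim (d (φ-image a v) (subst (_∈ L′) (sym e) (φ-image b w)))
  f-inj {inj₂ v} {inj₁ w} e = ⊥-elim (d (φ-image a w) (subst (_∈ L′) e (φ-image b v)))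
  f-inj {inj₂ v} {inj₂ w} e = cong inj₂ (φ-inj b e)
  f-edge : ∀ e → Edge G (map f (verts (H ⊔ H′) e))
  f-edge (inj₁ e) = subst (Edge G) (map-∘ (verts H e)) (φ-edge a e)
  f-edge (inj₂ e) = subst (Edge G) (map-∘ (verts H′ e)) (φ-edge b e)
  f-image : ∀ v → f v ∈ L ++ L′
  f-image (inj₁ v) = ∈-++⁺ˡ (φ-image a v)
  f-image (inj₂ v) = ∈-++⁺ʳ L (φ-image b v)

data Embs {r n : ℕ} (G : RGraph r n) : List Hyp → List (Fin n) → Set₁ where
  []  : Embs G [] []
  emb : ∀ {H Hs L L′} → Emb G H L → (∀ {v} → v ∈ L → v ∉ L′) → Embs G Hs L′ → Embs G (H ∷ Hs) (L ++ L′)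

Embs-++⁻ : ∀ {r n} {G : RGraph r n} Hs {Hs′ L} → Embs G (Hs ++ Hs′) L →
  ∃₂ λ L₁ L₂ → Embs G Hs L₁ × Embs G Hs′ L₂ × (∀ {v} → v ∈ L₁ → v ∉ L₂) × (∀ {v} → v ∈ L₁ ++ L₂ → v ∈ L)
Embs-++⁻ [] es = [] , _ , [] , es , (λ ()) , id
Embs-++⁻ (H ∷ Hs) (emb {L = L} e d es) with Embs-++⁻ Hs es
... | L₁ , L₂ , e₁ , e₂ , d′ , s = L ++ L₁ , L₂ , emb e (λ p q → d p (s (∈-++⁺ˡ q))) e₁ , e₂ ,
  (λ p q → [ (λ p′ → d p′ (s (∈-++⁺ʳ L₁ q))) , (λ p′ → d′ p′ q) ]′ (∈-++⁻ L p)) ,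
  λ p → case ∈-++⁻ (L ++ L₁) p of λ { (inj₁ q) → case ∈-++⁻ L q of λ { (inj₁ q′) → ∈-++⁺ˡ q′ ; (inj₂ q′) → ∈-++⁺ʳ L (s (∈-++⁺ˡ q′)) } ; (inj₂ q) → ∈-++⁺ʳ L (s (∈-++⁺ʳ L₁ q)) }

Emb-⨆ : ∀ {r n k} {G : RGraph r n} (H : Fin k → Hyp) {L} → Embs G (List.tabulate H) L → Emb G (⨆ H) L
Emb-⨆ {k = zero} H es = mkEmb (λ { (() , _) }) (λ { {() , _} }) (λ { (() , _) }) (λ { (() , _) })
Emb-⨆ {k = suc k} {G} H (emb {L = L} {L′} a d es) = mkEmb f f-inj f-edge f-image
  where
  b = Emb-⨆ (H ∘ suc) es
  f : V (⨆ H) → _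
  f (zero  , v) = φ a v
  f (suc i , v) = φ b (i , v)
  f-inj : ∀ {v w} → f v ≡ f w → v ≡ w
  f-inj {zero , v}  {zero , w}  e with φ-inj a e
  ... | refl = refl
  f-inj {zero , v}  {suc j , w} e = ⊥-elim (d (φ-image a v) (subst (_∈ L′) (sym e) (φ-image b (j , w))))
  f-inj {suc i , v} {zero , w}  e = ⊥-elim (d (φ-image a w) (subst (_∈ L′) e (φ-image b (i , v))))
  f-inj {suc i , v} {suc j , w} e with φ-inj b {i , v} {j , w} e
  ... | refl = refl
  f-edge : ∀ e → Edge G (map f (verts (⨆ H) e))
  f-edge (zero  , e) = subst (Edge G) (map-∘ (verts (H zero) e)) (φ-edge a e)
  f-edge (suc i , e) = subst (Edge G) (trans (sym (map-∘ (verts (H (suc i)) e))) (map-∘ (verts (H (suc i)) e))) (φ-edge b (i , e))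
  f-image : ∀ v → f v ∈ L ++ L′
  f-image (zero  , v) = ∈-++⁺ˡ (φ-image a v)
  f-image (suc i , v) = ∈-++⁺ʳ L (φ-image b (i , v))

-- Chains and spokes, and the paths, cycles and stars that they embed

module _ {κ n : ℕ} (G : RGraph (3 + κ) n) where

  -- The list collects every vertex of the chain except its last one, so a closed chain with a repetition-free list is a cycle.
  data Chain : ℕ → Fin n → Fin n → List (Fin n) → Set where
    []   : ∀ {u} → Chain 0 u u []
    link : ∀ {ℓ u w v L} (E : Vec (Fin n) (suc κ)) → Edge G (u ∷ w ∷ toList E) → Chain ℓ w v L → Chain (suc ℓ) u v (u ∷ toList E ++ L)

  -- The centre stays out of the list, since all spokes share it.
  data Spokes (c : Fin n) : ℕ → List (Fin n) → Set where
    []    : Spokes c 0 []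
    spoke : ∀ {ℓ L} w (E : Vec (Fin n) (suc κ)) → Edge G (c ∷ w ∷ toList E) → Spokes c ℓ L → Spokes c (suc ℓ) (w ∷ toList E ++ L)

module _ {κ n : ℕ} {G : RGraph (3 + κ) n} where

  infixr 5 _++ᶜ_
  _++ᶜ_ : ∀ {ℓ ℓ′ u v w L L′} → Chain G ℓ u v L → Chain G ℓ′ v w L′ → Chain G (ℓ + ℓ′) u w (L ++ L′)
  [] ++ᶜ d = d
  _++ᶜ_ {L′ = L′} (link {L = L} E e c) d = subst (Chain G _ _ _) (cong (_ ∷_) (sym (++-assoc (toList E) L L′))) (link E e (c ++ᶜ d))

  chain-length : ∀ {ℓ u v L} → Chain G ℓ u v L → length L ≡ ℓ * (2 + κ)
  chain-length [] = refl
  chain-length (link {L = L} E e c) = cong suc (trans (length-++ (toList E)) (cong₂ _+_ (Vecₚ.length-toList E) (chain-length c)))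

  spokes-length : ∀ {ℓ c L} → Spokes G c ℓ L → length L ≡ ℓ * (2 + κ)
  spokes-length [] = refl
  spokes-length (spoke {L = L} w E e c) = cong suc (trans (length-++ (toList E)) (cong₂ _+_ (Vecₚ.length-toList E) (spokes-length c)))

  at : ∀ {ℓ u v L} → Chain G ℓ u v L → Fin (suc ℓ) → Fin n
  at {u = u} [] i = u
  at {u = u} (link E e c) zero = u
  at (link E e c) (suc i) = at c i

  ext : ∀ {ℓ u v L} → Chain G ℓ u v L → Fin ℓ → Fin (suc κ) → Fin n
  ext (link E e c) zero    = lookup E
  ext (link E e c) (suc i) = ext c i

  at-zero : ∀ {ℓ u v L} (c : Chain G ℓ u v L) → at c zero ≡ u
  at-zero [] = refl
  at-zero (link E e c) = refl

  at-last : ∀ {ℓ u v L} (c : Chain G ℓ u v L) → at c (fromℕ ℓ) ≡ v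
  at-last [] = refl
  at-last (link E e c) = at-last c

  ext∈ : ∀ {ℓ u v L} (c : Chain G ℓ u v L) i j → ext c i j ∈ L
  ext∈ (link E e c) zero    j = there (∈-++⁺ˡ (lookup∈toList E j))
  ext∈ (link E e c) (suc i) j = there (∈-++⁺ʳ (toList E) (ext∈ c i j))

  at∈ : ∀ {ℓ u v L} (c : Chain G ℓ u v L) i → at c i ∈ L ++ [ v ]
  at∈ [] i = here refl
  at∈ (link E e c) zero = here refl
  at∈ {v = v} (link {L = L} E e c) (suc i) = there (subst (_ ∈_) (sym (++-assoc (toList E) L [ v ])) (∈-++⁺ʳ (toList E) (at∈ c i)))

  chain-edge : ∀ {ℓ u v L} (c : Chain G ℓ u v L) i → Edge G (at c (inject₁ i) ∷ at c (suc i) ∷ toList (tabulate (ext c i)))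
  chain-edge {u = u} (link E e c) zero = subst₂ (λ w l → Edge G (u ∷ w ∷ l)) (sym (at-zero c)) (cong toList (sym (Vecₚ.tabulate∘lookup E))) e
  chain-edge (link E e c) (suc i) = chain-edge c i

  chainMap : ∀ {ℓ u v L} → Chain G ℓ u v L → Fin (suc ℓ) ⊎ (Fin ℓ × Fin (suc κ)) → Fin n
  chainMap c (inj₁ i)       = at c i
  chainMap c (inj₂ (i , j)) = ext c i j

  chainMap∈ : ∀ {ℓ u v L} (c : Chain G ℓ u v L) x → chainMap c x ∈ L ++ [ v ]
  chainMap∈ c (inj₁ i)       = at∈ c i
  chainMap∈ c (inj₂ (i , j)) = ∈-++⁺ˡ (ext∈ c i j)

  private
    shift : ∀ {ℓ} → Fin (suc ℓ) ⊎ (Fin ℓ × Fin (suc κ)) → Fin (suc (suc ℓ)) ⊎ (Fin (suc ℓ) × Fin (suc κ))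
    shift (inj₁ i)       = inj₁ (suc i)
    shift (inj₂ (i , j)) = inj₂ (suc i , j)

    data View {ℓ} : Fin (suc (suc ℓ)) ⊎ (Fin (suc ℓ) × Fin (suc κ)) → Set where
      first : View (inj₁ zero)
      extra : ∀ j → View (inj₂ (zero , j))
      later : ∀ x → View (shift x)

    view : ∀ {ℓ} x → View {ℓ} x
    view (inj₁ zero)          = first
    view (inj₁ (suc i))       = later (inj₁ i)
    view (inj₂ (zero  , j))   = extra j
    view (inj₂ (suc i , j))   = later (inj₂ (i , j))

    chainMap-shift : ∀ {ℓ u w v L} (E : Vec (Fin n) (suc κ)) (e : Edge G (u ∷ w ∷ toList E)) (c : Chain G ℓ w v L) x →
      chainMap (link E e c) (shift x) ≡ chainMap c x
    chainMap-shift E e c (inj₁ i)       = refl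
    chainMap-shift E e c (inj₂ (i , j)) = refl

  chainMap-inj : ∀ {ℓ u v L} (c : Chain G ℓ u v L) → Unique (L ++ [ v ]) → ∀ {x y} → chainMap c x ≡ chainMap c y → x ≡ y
  chainMap-inj [] u {inj₁ zero} {inj₁ zero} eq = refl
  chainMap-inj {u = u₀} {v} (link {L = L} E e c) (u≢ ∷ u) {x} {y} eq with Unique-++⁻ (toList E) (subst Unique (++-assoc (toList E) L [ v ]) u)
  ... | uE , uL , dis = go (view x) (view y) eq
    where
    u∉ : ∀ {z} → u₀ ≡ z → z ∉ toList E ++ (L ++ [ v ])
    u∉ refl z∈ = All.lookup u≢ (subst (_ ∈_) (sym (++-assoc (toList E) L [ v ])) z∈) refl
    go : ∀ {x y} → View x → View y → chainMap (link E e c) x ≡ chainMap (link E e c) y → x ≡ y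
    go first first eq = refl
    go first (extra j) eq = ⊥-elim (u∉ eq (∈-++⁺ˡ (lookup∈toList E j)))
    go first (later y) eq = ⊥-elim (u∉ (trans eq (chainMap-shift E e c y)) (∈-++⁺ʳ (toList E) (chainMap∈ c y)))
    go (extra i) first eq = ⊥-elim (u∉ (sym eq) (∈-++⁺ˡ (lookup∈toList E i)))
    go (extra i) (extra j) eq with lookup-toList-injective E uE eq
    ... | refl = refl
    go (extra i) (later y) eq = ⊥-elim (dis (lookup∈toList E i) (subst (_∈ L ++ [ v ]) (sym (trans eq (chainMap-shift E e c y))) (chainMap∈ c y)))
    go (later x) first eq = ⊥-elim (u∉ (trans (sym eq) (chainMap-shift E e c x)) (∈-++⁺ʳ (toList E) (chainMap∈ c x)))
    go (later x) (extra j) eq = ⊥-elim (dis (lookup∈toList E j) (subst (_∈ L ++ [ v ]) (trans (sym (chainMap-shift E e c x)) eq) (chainMap∈ c x)))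
    go (later x) (later y) eq with chainMap-inj c uL {x} {y} (trans (sym (chainMap-shift E e c x)) (trans eq (chainMap-shift E e c y)))
    ... | refl = refl

  path-emb : ∀ {ℓ u v L} → Chain G ℓ u v L → Unique (L ++ [ v ]) → Emb G (expansion (3 + κ) (path ℓ)) (L ++ [ v ])
  path-emb {ℓ} {L = L} c u = mkEmb (chainMap c) (chainMap-inj c u) edges (chainMap∈ c)
    where
    edges : ∀ i → Edge G (map (chainMap c) (verts (expansion (3 + κ) (path ℓ)) i))
    edges i = subst (λ l → Edge G (at c (inject₁ i) ∷ at c (suc i) ∷ l))
      (sym (trans (sym (map-∘ (allFin (suc κ)))) (map-allFin _ (tabulate (ext c i)) (λ j → sym (Vecₚ.lookup∘tabulate (ext c i) j))))) (chain-edge c i)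

  -- Without its first edge the closed chain is a path that ends in `v`. Injectivity is borrowed
  -- from that path, whose last vertex is left out because `v` is already vertex zero.
  cycle-emb : ∀ {m v L} → Chain G (suc (suc m)) v v L → Unique L → Emb G (expansion (3 + κ) (cycle (suc (suc m)))) L
  cycle-emb {m} {v} {L₀} (link {L = L} E e c) (v≢ ∷ u) with Unique-++⁻ (toList E) u
  ... | uE , uL , dis = mkEmb f f-inj f-edge f∈
    where
    uL⁺ : Unique (L ++ [ v ])
    uL⁺ = Unique-++ uL ([] ∷ []) (λ { p (here refl) → All.lookup v≢ (∈-++⁺ʳ (toList E) p) refl })
    emb-later : Fin (suc m) ⊎ (Fin (suc m) × Fin (suc κ)) → Fin (suc (suc m)) ⊎ (Fin (suc m) × Fin (suc κ))
    emb-later (inj₁ i) = inj₁ (inject₁ i)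
    emb-later (inj₂ x) = inj₂ x
    later-inj : ∀ x y → emb-later x ≡ emb-later y → x ≡ y
    later-inj (inj₁ i) (inj₁ j) eq = cong inj₁ (inject₁-injective (inj₁-injective eq))
    later-inj (inj₂ _) (inj₂ _) refl = refl
    rest : Fin (suc m) ⊎ (Fin (suc m) × Fin (suc κ)) → Fin n
    rest x = chainMap c (emb-later x)
    rest-inj : ∀ {x y} → rest x ≡ rest y → x ≡ y
    rest-inj {x} {y} eq = later-inj x y (chainMap-inj c uL⁺ eq)
    not-last : ∀ x → emb-later x ≢ inj₁ (fromℕ (suc m))
    not-last (inj₁ i) eq = <-irrefl (trans (sym (toℕ-inject₁ i)) (trans (cong toℕ (inj₁-injective eq)) (toℕ-fromℕ (suc m)))) (toℕ<n i)
    rest≢v : ∀ x → rest x ≢ v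
    rest≢v x eq = not-last x (chainMap-inj c uL⁺ (trans eq (sym (at-last c))))
    rest∈ : ∀ x → rest x ∈ L
    rest∈ x with ∈-++⁻ L (chainMap∈ c (emb-later x))
    ... | inj₁ p = p
    ... | inj₂ (here p) = ⊥-elim (rest≢v x p)
    f : Fin (suc (suc m)) ⊎ (Fin (suc (suc m)) × Fin (suc κ)) → Fin n
    f (inj₁ zero)          = v
    f (inj₁ (suc i))       = rest (inj₁ i)
    f (inj₂ (zero  , j))   = lookup E j
    f (inj₂ (suc i , j))   = rest (inj₂ (i , j))
    f∈ : ∀ x → f x ∈ v ∷ toList E ++ L
    f∈ (inj₁ zero)        = here refl
    f∈ (inj₁ (suc i))     = there (∈-++⁺ʳ (toList E) (rest∈ (inj₁ i)))
    f∈ (inj₂ (zero  , j)) = there (∈-++⁺ˡ (lookup∈toList E j))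
    f∈ (inj₂ (suc i , j)) = there (∈-++⁺ʳ (toList E) (rest∈ (inj₂ (i , j))))
    up : Fin (suc m) ⊎ (Fin (suc m) × Fin (suc κ)) → Fin (suc (suc m)) ⊎ (Fin (suc (suc m)) × Fin (suc κ))
    up (inj₁ i)       = inj₁ (suc i)
    up (inj₂ (i , j)) = inj₂ (suc i , j)
    f-up : ∀ x → f (up x) ≡ rest x
    f-up (inj₁ i) = refl
    f-up (inj₂ x) = refl
    data CView : Fin (suc (suc m)) ⊎ (Fin (suc (suc m)) × Fin (suc κ)) → Set where
      first : CView (inj₁ zero)
      extra : ∀ j → CView (inj₂ (zero , j))
      later : ∀ x → CView (up x)
    cview : ∀ x → CView x
    cview (inj₁ zero)        = first
    cview (inj₁ (suc i))     = later (inj₁ i)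
    cview (inj₂ (zero  , j)) = extra j
    cview (inj₂ (suc i , j)) = later (inj₂ (i , j))
    v∉E : ∀ j → v ≢ lookup E j
    v∉E j eq = All.lookup v≢ (∈-++⁺ˡ (lookup∈toList E j)) eq
    E∉rest : ∀ j x → lookup E j ≢ rest x
    E∉rest j x eq = dis (lookup∈toList E j) (subst (_∈ L) (sym eq) (rest∈ x))
    go : ∀ {x y} → CView x → CView y → f x ≡ f y → x ≡ y
    go first     first     eq = refl
    go first     (extra j) eq = ⊥-elim (v∉E j eq)
    go first     (later y) eq = ⊥-elim (rest≢v y (sym (trans eq (f-up y))))
    go (extra i) first     eq = ⊥-elim (v∉E i (sym eq))
    go (extra i) (extra j) eq with lookup-toList-injective E uE eq
    ... | refl = refl
    go (extra i) (later y) eq = ⊥-elim (E∉rest i y (trans eq (f-up y)))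
    go (later x) first     eq = ⊥-elim (rest≢v x (trans (sym (f-up x)) eq))
    go (later x) (extra j) eq = ⊥-elim (E∉rest j x (trans (sym eq) (f-up x)))
    go (later x) (later y) eq with rest-inj {x} {y} (trans (sym (f-up x)) (trans eq (f-up y)))
    ... | refl = refl
    f-inj : ∀ {x y} → f x ≡ f y → x ≡ y
    f-inj {x} {y} = go (cview x) (cview y)
    next : Fin (suc (suc m)) → Fin (suc (suc m))
    next i = suc (toℕ i) mod (suc (suc m))
    f-next : ∀ (i : Fin (suc m)) → f (inj₁ (next (suc i))) ≡ at c (suc i)
    f-next i with suc (suc (toℕ i)) <? suc (suc m)
    ... | yes (s≤s lt) = trans (cong (f ∘ inj₁) (toℕ-injective (trans (toℕ-fromℕ< _) (trans (m<n⇒m%n≡m (s≤s lt)) (cong suc (sym (toℕ-fromℕ< lt)))))))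
        (cong (at c) (toℕ-injective (trans (toℕ-inject₁ (fromℕ< lt)) (toℕ-fromℕ< lt))))
    -- The last edge: the index wraps to zero, that is to `v`, where the opened path ends.
    ... | no ¬lt = trans (cong (f ∘ inj₁) (toℕ-injective {j = zero} (trans (toℕ-fromℕ< _) (trans (cong (_% suc (suc m)) i-last) (n%n≡0 (suc (suc m)))))))
        (trans (sym (at-last c)) (cong (at c) (toℕ-injective (trans (toℕ-fromℕ (suc m)) (cong pred (sym i-last))))))
      where
      i-last : suc (suc (toℕ i)) ≡ suc (suc m)
      i-last = ≤-antisym (s≤s (toℕ<n i)) (≮⇒≥ ¬lt)
    f-ext : ∀ i → map f (map (λ j → inj₂ (suc i , j)) (allFin (suc κ))) ≡ toList (tabulate (ext c i))
    f-ext i = trans (sym (map-∘ (allFin (suc κ)))) (map-allFin _ (tabulate (ext c i)) (λ j → sym (Vecₚ.lookup∘tabulate (ext c i) j)))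
    f-edge : ∀ i → Edge G (map f (verts (expansion (3 + κ) (cycle (suc (suc m)))) i))
    f-edge zero = subst₂ (λ w l → Edge G (v ∷ w ∷ l)) (sym (at-zero c))
      (sym (trans (sym (map-∘ (allFin (suc κ)))) (map-allFin _ E (λ j → refl)))) e
    f-edge (suc i) = subst₂ (λ w l → Edge G (at c (inject₁ i) ∷ w ∷ l)) (sym (f-next i)) (sym (f-ext i)) (chain-edge c i)

  star-emb : ∀ {ℓ c L} → Spokes G c ℓ L → Unique (c ∷ L) → Emb G (expansion (3 + κ) (star ℓ)) (c ∷ L)
  star-emb {ℓ} {c} {L} sp u = mkEmb f (f-inj sp u) (f-edge sp) f∈
    where
    tip : ∀ {ℓ L} → Spokes G c ℓ L → Fin ℓ → Fin n
    tip (spoke w E e sp) zero    = w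
    tip (spoke w E e sp) (suc i) = tip sp i
    fin : ∀ {ℓ L} → Spokes G c ℓ L → Fin ℓ → Vec (Fin n) (suc κ)
    fin (spoke w E e sp) zero    = E
    fin (spoke w E e sp) (suc i) = fin sp i
    g : ∀ {ℓ L} → Spokes G c ℓ L → Fin ℓ ⊎ (Fin ℓ × Fin (suc κ)) → Fin n
    g sp (inj₁ i)       = tip sp i
    g sp (inj₂ (i , j)) = lookup (fin sp i) j
    g∈ : ∀ {ℓ L} (sp : Spokes G c ℓ L) x → g sp x ∈ L
    g∈ (spoke w E e sp) (inj₁ zero)    = here refl
    g∈ (spoke w E e sp) (inj₁ (suc i)) = there (∈-++⁺ʳ (toList E) (g∈ sp (inj₁ i)))
    g∈ (spoke w E e sp) (inj₂ (zero , j))  = there (∈-++⁺ˡ (lookup∈toList E j))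
    g∈ (spoke w E e sp) (inj₂ (suc i , j)) = there (∈-++⁺ʳ (toList E) (g∈ sp (inj₂ (i , j))))
    g-inj : ∀ {ℓ L} (sp : Spokes G c ℓ L) → Unique L → ∀ x y → g sp x ≡ g sp y → x ≡ y
    g-inj [] u (inj₁ ())
    g-inj [] u (inj₂ (() , _))
    g-inj (spoke {L = L} w E e sp) (w≢ ∷ u) with Unique-++⁻ (toList E) u
    ... | uE , uL , dis = go
      where
      w∉E : ∀ j → w ≢ lookup E j
      w∉E j = All.lookup w≢ (∈-++⁺ˡ (lookup∈toList E j))
      w∉g : ∀ x → w ≢ g sp x
      w∉g x = All.lookup w≢ (∈-++⁺ʳ (toList E) (g∈ sp x))
      E∉g : ∀ j x → lookup E j ≢ g sp x
      E∉g j x eq = dis (lookup∈toList E j) (subst (_∈ L) (sym eq) (g∈ sp x))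
      go : ∀ x y → g (spoke w E e sp) x ≡ g (spoke w E e sp) y → x ≡ y
      go (inj₁ zero) (inj₁ zero) eq = refl
      go (inj₁ zero) (inj₁ (suc j)) eq = ⊥-elim (w∉g (inj₁ j) eq)
      go (inj₁ zero) (inj₂ (zero , j)) eq = ⊥-elim (w∉E j eq)
      go (inj₁ zero) (inj₂ (suc i , j)) eq = ⊥-elim (w∉g (inj₂ (i , j)) eq)
      go (inj₁ (suc i)) (inj₁ zero) eq = ⊥-elim (w∉g (inj₁ i) (sym eq))
      go (inj₁ (suc i)) (inj₁ (suc j)) eq with g-inj sp uL (inj₁ i) (inj₁ j) eq
      ... | refl = refl
      go (inj₁ (suc i)) (inj₂ (zero , j)) eq = ⊥-elim (E∉g j (inj₁ i) (sym eq))
      go (inj₁ (suc i)) (inj₂ (suc k , j)) eq with g-inj sp uL (inj₁ i) (inj₂ (k , j)) eq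
      ... | ()
      go (inj₂ (zero , i)) (inj₁ zero) eq = ⊥-elim (w∉E i (sym eq))
      go (inj₂ (zero , i)) (inj₁ (suc j)) eq = ⊥-elim (E∉g i (inj₁ j) eq)
      go (inj₂ (zero , i)) (inj₂ (zero , j)) eq with lookup-toList-injective E uE eq
      ... | refl = refl
      go (inj₂ (zero , i)) (inj₂ (suc k , j)) eq = ⊥-elim (E∉g i (inj₂ (k , j)) eq)
      go (inj₂ (suc h , i)) (inj₁ zero) eq = ⊥-elim (w∉g (inj₂ (h , i)) (sym eq))
      go (inj₂ (suc h , i)) (inj₁ (suc j)) eq with g-inj sp uL (inj₂ (h , i)) (inj₁ j) eq
      ... | ()
      go (inj₂ (suc h , i)) (inj₂ (zero , j)) eq = ⊥-elim (E∉g j (inj₂ (h , i)) (sym eq))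
      go (inj₂ (suc h , i)) (inj₂ (suc k , j)) eq with g-inj sp uL (inj₂ (h , i)) (inj₂ (k , j)) eq
      ... | refl = refl
    f : Fin (suc ℓ) ⊎ (Fin ℓ × Fin (suc κ)) → Fin n
    f (inj₁ zero)    = c
    f (inj₁ (suc i)) = tip sp i
    f (inj₂ x)       = g sp (inj₂ x)
    f∈ : ∀ x → f x ∈ c ∷ L
    f∈ (inj₁ zero)    = here refl
    f∈ (inj₁ (suc i)) = there (g∈ sp (inj₁ i))
    f∈ (inj₂ x)       = there (g∈ sp (inj₂ x))
    f-inj : (sp : Spokes G c ℓ L) → Unique (c ∷ L) → ∀ {x y} → f x ≡ f y → x ≡ y
    f-inj _ (c≢ ∷ u) {inj₁ zero}    {inj₁ zero}    eq = refl
    f-inj _ (c≢ ∷ u) {inj₁ zero}    {inj₁ (suc j)} eq = ⊥-elim (All.lookup c≢ (g∈ sp (inj₁ j)) eq)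
    f-inj _ (c≢ ∷ u) {inj₁ zero}    {inj₂ y}       eq = ⊥-elim (All.lookup c≢ (g∈ sp (inj₂ y)) eq)
    f-inj _ (c≢ ∷ u) {inj₁ (suc i)} {inj₁ zero}    eq = ⊥-elim (All.lookup c≢ (g∈ sp (inj₁ i)) (sym eq))
    f-inj _ (c≢ ∷ u) {inj₁ (suc i)} {inj₁ (suc j)} eq with g-inj sp u (inj₁ i) (inj₁ j) eq
    ... | refl = refl
    f-inj _ (c≢ ∷ u) {inj₁ (suc i)} {inj₂ y} eq with g-inj sp u (inj₁ i) (inj₂ y) eq
    ... | ()
    f-inj _ (c≢ ∷ u) {inj₂ x} {inj₁ zero} eq = ⊥-elim (All.lookup c≢ (g∈ sp (inj₂ x)) (sym eq))
    f-inj _ (c≢ ∷ u) {inj₂ x} {inj₁ (suc j)} eq with g-inj sp u (inj₂ x) (inj₁ j) eq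
    ... | ()
    f-inj _ (c≢ ∷ u) {inj₂ x} {inj₂ y} eq with g-inj sp u (inj₂ x) (inj₂ y) eq
    ... | refl = refl
    sp-edge : ∀ {ℓ L} (sp : Spokes G c ℓ L) i → Edge G (c ∷ tip sp i ∷ toList (fin sp i))
    sp-edge (spoke w E e sp) zero    = e
    sp-edge (spoke w E e sp) (suc i) = sp-edge sp i
    f-edge : (sp : Spokes G c ℓ L) → ∀ i → Edge G (map f (verts (expansion (3 + κ) (star ℓ)) i))
    f-edge _ i = subst (λ l → Edge G (c ∷ tip sp i ∷ l)) (sym (trans (sym (map-∘ (allFin (suc κ)))) (map-allFin _ (fin sp i) (λ j → refl)))) (sp-edge sp i)

-- Cherries and systems of centres

module _ {κ n : ℕ} (G : RGraph (3 + κ) n) where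

  -- Only the interior is controlled; `a` and `b` are kept out of it by putting them into `W`.
  record Cherry (a b : Fin n) (W : List (Fin n)) : Set where
    constructor mkCherry
    field
      mid     : Fin n
      E₁ E₂   : Vec (Fin n) (suc κ)
      edge₁   : Edge G (a ∷ mid ∷ toList E₁)
      edge₂   : Edge G (mid ∷ b ∷ toList E₂)
      unique  : Unique (toList E₁ ++ mid ∷ toList E₂)
      avoids  : ∀ {z} → z ∈ toList E₁ ++ mid ∷ toList E₂ → z ∉ W

  CherryProp : ℕ → Fin n → Fin n → Set
  CherryProp w a b = ∀ W → length W ≤ w → Cherry a b W

  Links : ℕ → Fin n → List (Fin n) → Fin n → Set
  Links w v []       u = CherryProp w v u
  Links w v (c ∷ cs) u = CherryProp w v c × Links w c cs u

  -- The starter closes up with the cherries v → cs → u to a cycle; only the vertices in P may lie in A.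
  record System (A : List (Fin n)) (w ℓ₀ j q : ℕ) : Set where
    field
      u v     : Fin n
      {L₀}    : List (Fin n)
      starter : Chain G ℓ₀ u v L₀
      cs      : List (Fin n)
      cs-len  : length cs ≡ j
      uniq    : Unique (L₀ ++ v ∷ cs)
      links   : Links w v cs u
      P       : List (Fin n)
      P≤q     : length P ≤ q
      off     : ∀ {z} → z ∈ L₀ ++ v ∷ cs → z ∈ P ⊎ z ∉ A

  -- After the deletion of a copy every live vertex lies outside it, which is what makes the copies
  -- found later disjoint from it.
  Live : Fin n → Set
  Live z = Σ (List (Fin n)) λ l → Edge G l × z ∈ l

  record Copy (H : Hyp) (A : List (Fin n)) (q N : ℕ) : Set where
    field
      {L}   : List (Fin n)
      copy  : Emb G H L
      L≤N   : length L ≤ N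
      P     : List (Fin n)
      P≤q   : length P ≤ q
      off   : ∀ {z} → z ∈ L → z ∈ P ⊎ z ∉ A
      live  : ∀ {z} → z ∈ L → Live z

module _ {κ n : ℕ} {G : RGraph (3 + κ) n} where

  private
    ++[]⁻ : ∀ {A : Set} {x : A} (xs : List A) → x ∈ xs ++ [] → x ∈ xs
    ++[]⁻ xs p = [ id , (λ ()) ]′ (∈-++⁻ xs p)

  chain-live : ∀ {ℓ u v L} → Chain G ℓ u v L → ∀ {z} → z ∈ L → Live G z
  chain-live (link E e c) (here refl) = _ , e , here refl
  chain-live (link E e c) (there p) with ∈-++⁻ (toList E) p
  ... | inj₁ q = _ , e , there (there q)
  ... | inj₂ q = chain-live c q

  end-live : ∀ {ℓ u v L} → Chain G (suc ℓ) u v L → Live G v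
  end-live (link E e [])              = _ , e , there (here refl)
  end-live (link E e c@(link _ _ _)) = end-live c

  path-live : ∀ {ℓ u v L} → Chain G (suc ℓ) u v L → ∀ {z} → z ∈ L ++ [ v ] → Live G z
  path-live {L = L} c p with ∈-++⁻ L p
  ... | inj₁ q           = chain-live c q
  ... | inj₂ (here refl) = end-live c

  spokes-live : ∀ {ℓ c L} → Spokes G c ℓ L → ∀ {z} → z ∈ L → Live G z
  spokes-live (spoke w E e s) (here refl) = _ , e , there (here refl)
  spokes-live (spoke w E e s) (there p) with ∈-++⁻ (toList E) p
  ... | inj₁ q = _ , e , there (there q)
  ... | inj₂ q = spokes-live s q

  centre-live : ∀ {ℓ c L} → Spokes G c (suc ℓ) L → Live G c
  centre-live (spoke w E e s) = _ , e , here refl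

  cherry-list : ∀ {a b W} → Cherry G a b W → List (Fin n)
  cherry-list c = toList E₁ ++ mid ∷ toList E₂ ++ []
    where open Cherry c

  cherry-chain : ∀ {a b W} (c : Cherry G a b W) → Chain G 2 a b (a ∷ cherry-list c)
  cherry-chain c = link E₁ edge₁ (link E₂ edge₂ [])
    where open Cherry c

  cherry-list∈ : ∀ {a b W} (c : Cherry G a b W) {z} → z ∈ cherry-list c → z ∈ toList (Cherry.E₁ c) ++ Cherry.mid c ∷ toList (Cherry.E₂ c)
  cherry-list∈ c p with ∈-++⁻ (toList (Cherry.E₁ c)) p
  ... | inj₁ q         = ∈-++⁺ˡ q
  ... | inj₂ (here q)  = ∈-++⁺ʳ (toList (Cherry.E₁ c)) (here q)
  ... | inj₂ (there q) = ∈-++⁺ʳ (toList (Cherry.E₁ c)) (there (++[]⁻ (toList (Cherry.E₂ c)) q))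

  cherry-list-unique : ∀ {a b W} (c : Cherry G a b W) → Unique (cherry-list c)
  cherry-list-unique c = subst Unique (cong (λ l → toList E₁ ++ mid ∷ l) (sym (++-identityʳ (toList E₂)))) unique
    where open Cherry c

  -- The links are realised from the far end backwards, each cherry avoiding `W` and all that is
  -- woven already; hence the budget `w` has to cover `W` and the whole chain.
  weave : ∀ {w} v cs {u} → Links G w v cs u → ∀ W → length W + 2 * suc (length cs) * (2 + κ) ≤ w → Unique (v ∷ cs) → (∀ {z} → z ∈ v ∷ cs → z ∈ W) →
    ∃ λ L → Chain G (2 * suc (length cs)) v u L × Unique L × (∀ {z} → z ∈ L → z ∈ v ∷ cs ⊎ z ∉ W)
  weave v [] {u} lk W W≤ uq sub with lk W (≤-trans (m≤m+n _ _) W≤)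
  ... | c = v ∷ cherry-list c , cherry-chain c , Unique-∷ (λ p → Cherry.avoids c (cherry-list∈ c p) (sub (here refl))) (cherry-list-unique c) ,
    λ { (here e) → inj₁ (here e) ; (there p) → inj₂ (Cherry.avoids c (cherry-list∈ c p)) }
  weave {w} v (c₁ ∷ cs) {u} (lk , lks) W W≤ (v≢ ∷ uq) sub with weave c₁ cs lks W (≤-trans (+-monoʳ-≤ (length W) (*-monoˡ-≤ (2 + κ) (*-monoʳ-≤ 2 (n≤1+n (suc (length cs)))))) W≤) uq (sub ∘ there)
  ... | L , ch , uL , offL with lk (W ++ L) (≤-trans (≤-reflexive (trans (length-++ W) (cong (length W +_) (chain-length ch)))) (≤-trans (+-monoʳ-≤ (length W) (*-monoˡ-≤ (2 + κ) (*-monoʳ-≤ 2 (n≤1+n (suc (length cs)))))) W≤))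
  ... | c = (v ∷ cherry-list c) ++ L ,
    subst (λ ℓ → Chain G ℓ v u ((v ∷ cherry-list c) ++ L)) (sym (*-suc 2 (suc (length cs)))) (cherry-chain c ++ᶜ ch) ,
    Unique-++ (Unique-∷ (λ p → av p (∈-++⁺ˡ (sub (here refl)))) (cherry-list-unique c)) uL
      (λ { (here refl) q → v∉L q ; (there p) q → av p (∈-++⁺ʳ W q) }) ,
    mem
    where
    av : ∀ {z} → z ∈ cherry-list c → z ∉ W ++ L
    av p = Cherry.avoids c (cherry-list∈ c p)
    v∉L : v ∉ L
    v∉L q with offL q
    ... | inj₁ p  = All.lookup v≢ p refl
    ... | inj₂ ¬W = ¬W (sub (here refl))
    mem : ∀ {z} → z ∈ (v ∷ cherry-list c) ++ L → z ∈ v ∷ c₁ ∷ cs ⊎ z ∉ W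
    mem (here e) = inj₁ (here e)
    mem (there p) with ∈-++⁻ (cherry-list c) p
    ... | inj₁ q = inj₂ (λ r → av q (∈-++⁺ˡ r))
    ... | inj₂ q with offL q
    ... | inj₁ r = inj₁ (there r)
    ... | inj₂ r = inj₂ r

  SpokeProp : ℕ → Fin n → Set
  SpokeProp w v = ∀ W → length W ≤ w → Σ (Fin n) λ x → Σ (Vec (Fin n) (suc κ)) λ E →
    Edge G (v ∷ x ∷ toList E) × Unique (x ∷ toList E) × (∀ {z} → z ∈ x ∷ toList E → z ∉ W)

  -- The first half of a cherry that leaves `v` is a spoke.
  Links⇒Spoke : ∀ {w} v cs {u} → Links G w v cs u → SpokeProp w v
  Links⇒Spoke v cs lk W W≤ with first v cs lk
    where
    first : ∀ {w} v cs {u} → Links G w v cs u → ∃ λ b → CherryProp G w v b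
    first v []       lk       = _ , lk
    first v (c ∷ cs) (lk , _) = c , lk
  ... | b , lk′ with lk′ W W≤
  ... | mkCherry x E₁ E₂ e₁ e₂ uq av with Unique-++⁻ (toList E₁) uq
  ... | u₁ , _ , dis = x , E₁ , e₁ , Unique-∷ (λ p → dis p (here refl)) u₁ , λ { (here refl) → av (∈-++⁺ʳ (toList E₁) (here refl)) ; (there p) → av (∈-++⁺ˡ p) }

  spokes : ∀ {w} v → SpokeProp w v → ∀ ℓ W → v ∈ W → length W + ℓ * (2 + κ) ≤ w →
    ∃ λ L → Spokes G v ℓ L × Unique L × (∀ {z} → z ∈ L → z ∉ W)
  spokes v sp zero    W v∈ W≤ = [] , [] , [] , λ ()
  spokes v sp (suc ℓ) W v∈ W≤ with spokes v sp ℓ W v∈ (≤-trans (+-monoʳ-≤ (length W) (m≤n+m _ (2 + κ))) W≤)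
  ... | L , s , uL , avL with sp (W ++ L) (≤-trans (≤-reflexive (trans (length-++ W) (cong (length W +_) (spokes-length s)))) (≤-trans (+-monoʳ-≤ (length W) (m≤n+m _ (2 + κ))) W≤))
  ... | x , E , e , uq , av = (x ∷ toList E) ++ L , spoke x E e s , Unique-++ uq uL (λ p q → av p (∈-++⁺ʳ W q)) ,
    λ p → [ (λ q r → av q (∈-++⁺ˡ r)) , avL ]′ (∈-++⁻ (x ∷ toList E) p)

  module _ {A : List (Fin n)} {w ℓ₀ j q : ℕ} (sys : System G A w ℓ₀ j q) where
    open System sys

    private
      W : List (Fin n)
      W = A ++ (L₀ ++ v ∷ cs)

      W-length : length W ≡ length A + (ℓ₀ * (2 + κ) + suc j)
      W-length = trans (length-++ A) (cong (length A +_) (trans (length-++ L₀) (cong₂ _+_ (chain-length starter) (cong suc cs-len))))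

      fixed : ∀ {z} → z ∈ L₀ ++ v ∷ cs → z ∈ W
      fixed = ∈-++⁺ʳ A

      uL₀   = proj₁ (Unique-++⁻ L₀ uniq)
      uv    = proj₁ (proj₂ (Unique-++⁻ L₀ uniq))
      dis₀  = proj₂ (proj₂ (Unique-++⁻ L₀ uniq))

      off-fresh : ∀ {z} → z ∉ W → z ∈ P ⊎ z ∉ A
      off-fresh h = inj₂ (λ p → h (∈-++⁺ˡ p))

      off-weave : ∀ {z} → z ∈ v ∷ cs ⊎ z ∉ W → z ∈ P ⊎ z ∉ A
      off-weave (inj₁ p) = off (∈-++⁺ʳ L₀ p)
      off-weave (inj₂ p) = off-fresh p

      weave-disjoint : ∀ {z} → z ∈ v ∷ cs ⊎ z ∉ W → z ∉ L₀
      weave-disjoint (inj₁ p) q = dis₀ q p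
      weave-disjoint (inj₂ p) q = p (fixed (∈-++⁺ˡ q))

    -- The cherries contribute an even length; the starter, of length two or three, settles the
    -- parity.
    cycle-copy : ∀ m → suc (suc m) ≡ 2 * suc j + ℓ₀ → length A + (ℓ₀ * (2 + κ) + suc j) + 2 * suc j * (2 + κ) ≤ w →
      Copy G (expansion (3 + κ) (cycle (suc (suc m)))) A q (suc (suc m) * (2 + κ))
    cycle-copy m eq w≥ with weave v cs links W (subst₂ (λ a b → a + 2 * suc b * (2 + κ) ≤ w) (sym W-length) (sym cs-len) w≥) uv (λ p → fixed (∈-++⁺ʳ L₀ p))
    ... | L , ch , uL , offL = record
      { copy = cycle-emb closed (Unique-++ uL uL₀ (λ p → weave-disjoint (offL p)))
      ; L≤N  = ≤-reflexive (chain-length closed)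
      ; P = P ; P≤q = P≤q
      ; off = λ p → [ (λ r → off-weave (offL r)) , (λ r → off (∈-++⁺ˡ r)) ]′ (∈-++⁻ L p)
      ; live = chain-live closed }
      where
      closed : Chain G (suc (suc m)) v v (L ++ L₀)
      closed = subst (λ ℓ → Chain G ℓ v v (L ++ L₀)) (trans (cong (λ x → 2 * suc x + ℓ₀) cs-len) (sym eq)) (ch ++ᶜ starter)

    star-copy : ∀ ℓ → 1 ≤ ℓ → length A + (ℓ₀ * (2 + κ) + suc j) + ℓ * (2 + κ) ≤ w →
      Copy G (expansion (3 + κ) (star ℓ)) A 1 (suc (ℓ * (2 + κ)))
    star-copy (suc ℓ₁) _ w≥ with spokes v (Links⇒Spoke v cs links) (suc ℓ₁) W (fixed (∈-++⁺ʳ L₀ (here refl))) (subst (λ a → a + suc ℓ₁ * (2 + κ) ≤ w) (sym W-length) w≥)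
    ... | L , sp , uL , avL = record
      { copy = star-emb sp (Unique-∷ (λ p → avL p (fixed (∈-++⁺ʳ L₀ (here refl)))) uL)
      ; L≤N  = s≤s (≤-reflexive (spokes-length sp))
      ; P = [ v ] ; P≤q = ≤-refl
      ; off = λ { (here e) → inj₁ (here e) ; (there p) → inj₂ (λ r → avL p (∈-++⁺ˡ r)) }
      ; live = λ { (here refl) → centre-live sp ; (there p) → spokes-live sp p } }

  path-tail : ∀ {ℓ u v L} → Chain G (suc ℓ) u v L → Unique (L ++ [ v ]) →
    ∃₂ λ u′ L′ → Chain G ℓ u′ v L′ × Unique (L′ ++ [ v ]) × (∀ {z} → z ∈ L′ ++ [ v ] → z ∈ L ++ [ v ])
  path-tail {v = v} (link {L = L} E e c) (_ ∷ u) with Unique-++⁻ (toList E) (subst Unique (++-assoc (toList E) L [ v ]) u)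
  ... | _ , uL , _ = _ , L , c , uL , λ p → there (subst (_ ∈_) (sym (++-assoc (toList E) L [ v ])) (∈-++⁺ʳ (toList E) p))

  -- The closed chain is opened at the middle vertex `x` of the starter: its edge at `u` is kept,
  -- and a fresh spoke at `v` replaces the other one. The centres `v`, `cs` and `u` then occupy
  -- every second place, so `j + 2` of them carry `2 * (j + 2)` edges.
  long-path : ∀ {A : List (Fin n)} {w j q} (sys : System G A w 2 j q) →
    length A + (2 * (2 + κ) + suc j) + (2 * suc j * (2 + κ) + (2 + κ)) ≤ w →
    ∃₂ λ y L → ∃ λ x → Chain G (suc (2 * suc j + 1)) y x L × Unique (L ++ [ x ]) × (∀ {z} → z ∈ L ++ [ x ] → z ∈ System.P sys ⊎ z ∉ A)
  long-path {A} {w} {j} {q} record { u = u ; v = v ; starter = st@(link E e (link {u = x} E′ e′ [])) ; cs = cs ; cs-len = refl ; uniq = uniq ; links = links ; P = P ; off = off } w≥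
    with weave v cs links W (≤-trans (≤-reflexive (cong (_+ 2 * suc (length cs) * (2 + κ)) W-length)) (≤-trans (+-monoʳ-≤ (length A + (2 * (2 + κ) + suc (length cs))) (m≤m+n _ (2 + κ))) w≥)) (proj₁ (proj₂ (Unique-++⁻ L₀ uniq))) (λ p → ∈-++⁺ʳ A (∈-++⁺ʳ L₀ p))
    where
    L₀ = u ∷ toList E ++ (x ∷ toList E′ ++ [])
    W = A ++ (L₀ ++ v ∷ cs)
    W-length : length W ≡ length A + (2 * (2 + κ) + suc (length cs))
    W-length = trans (length-++ A) (cong (length A +_) (trans (length-++ L₀) (cong (_+ suc (length cs)) (chain-length st))))
  ... | L , ch , uL , offL with Links⇒Spoke v cs links ((A ++ (L₀ ++ v ∷ cs)) ++ L) (≤-trans (≤-reflexive (trans (length-++ (A ++ (L₀ ++ v ∷ cs))) (cong₂ _+_ W-length (chain-length ch))))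
        (≤-trans (+-monoʳ-≤ (length A + (2 * (2 + κ) + suc (length cs))) (m≤m+n _ (2 + κ))) w≥))
    where
    L₀ = u ∷ toList E ++ (x ∷ toList E′ ++ [])
    W-length : length (A ++ (L₀ ++ v ∷ cs)) ≡ length A + (2 * (2 + κ) + suc (length cs))
    W-length = trans (length-++ A) (cong (length A +_) (trans (length-++ L₀) (cong (_+ suc (length cs)) (chain-length st))))
  ... | y , F , f , uF , avF = y , (y ∷ toList F ++ (L ++ (u ∷ toList E ++ []))) , x , link F (Edge-↭ G (swap v y ↭-refl) f) (ch ++ᶜ link E e []) ,
      subst Unique (cong (y ∷_) shape) (Unique-++ uF (Unique-++ uL uEnd L∩End) F∩rest) , (λ {z} p → mem (subst (z ∈_) (sym (cong (y ∷_) shape)) p))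
    where
    L₀ = u ∷ toList E ++ (x ∷ toList E′ ++ [])
    W = A ++ (L₀ ++ v ∷ cs)
    End = u ∷ toList E ++ [ x ]
    shape : toList F ++ (L ++ End) ≡ (toList F ++ (L ++ (u ∷ toList E ++ []))) ++ [ x ]
    shape = trans (cong (λ l → toList F ++ (L ++ (u ∷ l))) (sym (++-assoc (toList E) [] [ x ])))
      (trans (cong (toList F ++_) (sym (++-assoc L (u ∷ toList E ++ []) [ x ]))) (sym (++-assoc (toList F) (L ++ (u ∷ toList E ++ [])) [ x ])))
    dis₀ = proj₂ (proj₂ (Unique-++⁻ L₀ uniq))
    End⊆L₀ : ∀ {z} → z ∈ End → z ∈ L₀
    End⊆L₀ (here p) = here p
    End⊆L₀ (there p) with ∈-++⁻ (toList E) p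
    ... | inj₁ r = there (∈-++⁺ˡ r)
    ... | inj₂ (here r) = there (∈-++⁺ʳ (toList E) (here r))
    uEnd : Unique End
    uEnd with proj₁ (Unique-++⁻ L₀ uniq)
    ... | u≢ ∷ r with Unique-++⁻ (toList E) r
    ... | uE , _ , d = Unique-∷ (λ p → All.lookup u≢ (case End⊆L₀ (there p) of λ { (there t) → t ; (here refl) → ⊥-elim (bad p u≢) }) refl) (Unique-++ uE ([] ∷ []) (λ { p (here refl) → d p (here refl) }))
      where
      bad : u ∈ toList E ++ [ x ] → All (u ≢_) (toList E ++ (x ∷ toList E′ ++ [])) → _
      bad p u≢ with ∈-++⁻ (toList E) p
      ... | inj₁ t = All.lookup u≢ (∈-++⁺ˡ t) refl
      ... | inj₂ (here t) = All.lookup u≢ (∈-++⁺ʳ (toList E) (here refl)) t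
    L∩End : ∀ {z} → z ∈ L → z ∉ End
    L∩End p r with offL p
    ... | inj₁ t = dis₀ (End⊆L₀ r) t
    ... | inj₂ t = t (∈-++⁺ʳ A (∈-++⁺ˡ (End⊆L₀ r)))
    F∩rest : ∀ {z} → z ∈ y ∷ toList F → z ∉ L ++ End
    F∩rest p r with ∈-++⁻ L r
    ... | inj₁ t = avF p (∈-++⁺ʳ W t)
    ... | inj₂ t = avF p (∈-++⁺ˡ (∈-++⁺ʳ A (∈-++⁺ˡ (End⊆L₀ t))))
    mem : ∀ {z} → z ∈ (y ∷ toList F) ++ (L ++ End) → z ∈ P ⊎ z ∉ A
    mem p with ∈-++⁻ (y ∷ toList F) p
    ... | inj₁ t = inj₂ (λ a → avF t (∈-++⁺ˡ (∈-++⁺ˡ a)))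
    ... | inj₂ t with ∈-++⁻ L t
    ... | inj₂ s = off (∈-++⁺ˡ (End⊆L₀ s))
    ... | inj₁ s with offL s
    ... | inj₁ r = off (∈-++⁺ʳ L₀ r)
    ... | inj₂ r = inj₂ (λ a → r (∈-++⁺ˡ a))

  path-copy : ∀ {A : List (Fin n)} {w j q} (sys : System G A w 2 j q) ℓ₁ (let ℓ = suc ℓ₁) → ℓ ≡ suc (2 * suc j + 1) ⊎ suc ℓ ≡ suc (2 * suc j + 1) →
    length A + (2 * (2 + κ) + suc j) + (2 * suc j * (2 + κ) + (2 + κ)) ≤ w →
    Copy G (expansion (3 + κ) (path ℓ)) A q (suc (ℓ * (2 + κ)))
  path-copy {A} {w} {j} {q} sys ℓ₁ len w≥ = build len (long-path sys w≥)
    where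
    build : suc ℓ₁ ≡ suc (2 * suc j + 1) ⊎ suc (suc ℓ₁) ≡ suc (2 * suc j + 1) →
      (∃₂ λ y L → ∃ λ x → Chain G (suc (2 * suc j + 1)) y x L × Unique (L ++ [ x ]) × (∀ {z} → z ∈ L ++ [ x ] → z ∈ System.P sys ⊎ z ∉ A)) → Copy G (expansion (3 + κ) (path (suc ℓ₁))) A q (suc (suc ℓ₁ * (2 + κ)))
    from : ∀ {y L x} → Chain G (suc ℓ₁) y x L → Unique (L ++ [ x ]) → (∀ {z} → z ∈ L ++ [ x ] → z ∈ System.P sys ⊎ z ∉ A) → Copy G (expansion (3 + κ) (path (suc ℓ₁))) A q (suc (suc ℓ₁ * (2 + κ)))
    from {L = L} ch uq mem = record
      { copy = path-emb ch uq ; L≤N = ≤-reflexive (trans (length-++ L) (trans (cong (_+ 1) (chain-length ch)) (+-comm _ 1)))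
      ; P = System.P sys ; P≤q = System.P≤q sys ; off = mem ; live = path-live ch }
    build (inj₁ refl) (y , L , x , ch , uq , mem) = from ch uq mem
    -- A path of odd length loses the spoke at `v`, and with it no centre.
    build (inj₂ e) (y , L , x , ch , uq , mem) with path-tail (subst (λ ℓ → Chain G ℓ y x L) (sym e) ch) uq
    ... | _ , L′ , ch′ , uq′ , sub = from ch′ uq′ (λ p → mem (sub p))

-- Boxes of faces

fresh-list : ∀ {n M} (σs : List (Fin M → Fin n)) → All Inj σs → (W : List (Fin n)) → length σs * length W < M → ∃ λ x → All (λ σ → σ x ∉ W) σs
fresh-list σs inj W h with fresh (List.lookup σs) (λ j → All.lookup inj (∈-lookup j)) W h
... | x , p = x , All.tabulate (λ {σ} σ∈ → subst (λ τ → τ x ∉ W) (sym (lookup-index σ∈)) (p (Any.index σ∈)))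

Unique-↭ : ∀ {A : Set} {xs ys : List A} → xs ↭ ys → Unique xs → Unique ys
Unique-↭ {A} p = PermₛProps.Unique-resp-↭ (setoid A) (Perm.↭⇒↭ₛ p)

module _ {κ n : ℕ} (G : RGraph (3 + κ) n) where

  -- A single connection of the two sides, for the correction of parity. Unlike a cherry it cannot
  -- avoid prescribed vertices: it is made with extensions of faces, which may lie in `A` and are
  -- then recorded in `P`.
  record Bridge (A : List (Fin n)) (x y : Fin n) : Set where
    constructor mkBridge
    field
      mid    : Fin n
      E₁ E₂  : Vec (Fin n) (suc κ)
      edge₁  : Edge G (x ∷ mid ∷ toList E₁)
      edge₂  : Edge G (mid ∷ y ∷ toList E₂)
      unique : Unique (x ∷ y ∷ mid ∷ toList E₁ ++ toList E₂)
      P      : List (Fin n)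
      P≤3    : length P ≤ 3
      off    : ∀ {z} → z ∈ mid ∷ toList E₁ ++ toList E₂ → z ∈ P ⊎ z ∉ A

  -- Faces arranged in a grid, with `q` of their extensions as colours. Rows, columns and fillings
  -- `Z` are distinct and off `A`. Colours are only known to differ from all these vertices and from
  -- each other at the same place; they may lie in `A` and recur elsewhere.
  record Box (A : List (Fin n)) (q Mx My : ℕ) : Set where
    field
      X      : Fin Mx → Fin n
      Y      : Fin My → Fin n
      Z      : Fin Mx → Fin My → Vec (Fin n) κ
      C      : Fin q → Fin Mx → Fin My → Fin n
      X-inj  : Inj X
      Y-inj  : Inj Y
      Z-inj  : ∀ {x y c x′ y′ c′} → lookup (Z x y) c ≡ lookup (Z x′ y′) c′ → x ≡ x′ × y ≡ y′ × c ≡ c′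
      X≢Y    : ∀ {x y} → X x ≢ Y y
      X∉Z    : ∀ {x x′ y} → X x ∉ toList (Z x′ y)
      Y∉Z    : ∀ {y x y′} → Y y ∉ toList (Z x y′)
      X∉A    : ∀ {x} → X x ∉ A
      Y∉A    : ∀ {y} → Y y ∉ A
      Z∉A    : ∀ {x y z} → z ∈ toList (Z x y) → z ∉ A
      C-edge : ∀ k x y → Edge G (C k x y ∷ X x ∷ Y y ∷ toList (Z x y))
      C-dist : ∀ {k k′ x y} → C k x y ≡ C k′ x y → k ≡ k′
      C≢X    : ∀ {k x y x′} → C k x y ≢ X x′
      C≢Y    : ∀ {k x y y′} → C k x y ≢ Y y′
      C∉Z    : ∀ {k x y x′ y′} → C k x y ∉ toList (Z x′ y′)
      fullX  : ∀ k x y W → length W ≤ 2 → ∃ λ w → w ∉ W × Edge G (w ∷ C k x y ∷ Y y ∷ toList (Z x y))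
      fullY  : ∀ k x y W → length W ≤ 2 → ∃ λ w → w ∉ W × Edge G (w ∷ X x ∷ C k x y ∷ toList (Z x y))
      bridge : ∀ x y → Bridge A (X x) (Y y)

module _ {κ n : ℕ} {G : RGraph (3 + κ) n} where

  Cherry-sym : ∀ {a b W} → Cherry G a b W → Cherry G b a W
  Cherry-sym (mkCherry m E₁ E₂ e₁ e₂ u av) = mkCherry m E₂ E₁ (Edge-↭ G (swap _ _ ↭-refl) e₂) (Edge-↭ G (swap _ _ ↭-refl) e₁)
    (Unique-↭ flip u) (λ p → av (Permₚ.∈-resp-↭ (↭-sym flip) p))
    where
    flip : toList E₁ ++ m ∷ toList E₂ ↭ toList E₂ ++ m ∷ toList E₁
    flip = ↭-trans (Permₚ.shift m (toList E₁) (toList E₂)) (↭-trans (prep m (Permₚ.++-comm (toList E₁) (toList E₂))) (↭-sym (Permₚ.shift m (toList E₂) (toList E₁))))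

  Bridge-sym : ∀ {A x y} → Bridge G A x y → Bridge G A y x
  Bridge-sym {x = x} {y} (mkBridge m E₁ E₂ e₁ e₂ u P P≤ off) = mkBridge m E₂ E₁ (Edge-↭ G (swap _ _ ↭-refl) e₂) (Edge-↭ G (swap _ _ ↭-refl) e₁)
    (Unique-↭ (swap x y (prep m flip)) u) P P≤ (λ p → off (Permₚ.∈-resp-↭ (↭-sym (prep m flip)) p))
    where
    flip : toList E₁ ++ toList E₂ ↭ toList E₂ ++ toList E₁
    flip = Permₚ.++-comm (toList E₁) (toList E₂)

  Box-sym : ∀ {A q Mx My} → Box G A q Mx My → Box G A q My Mx
  Box-sym b = record
    { X = Y ; Y = X ; Z = λ y x → Z x y ; C = λ k y x → C k x y ; X-inj = Y-inj ; Y-inj = X-inj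
    ; Z-inj = λ e → case Z-inj e of λ { (p , q , r) → q , p , r }
    ; X≢Y = λ e → X≢Y (sym e) ; X∉Z = Y∉Z ; Y∉Z = X∉Z ; X∉A = Y∉A ; Y∉A = X∉A ; Z∉A = Z∉A
    ; C-edge = λ k y x → Edge-↭ G (prep _ (swap _ _ ↭-refl)) (C-edge k x y)
    ; C-dist = C-dist ; C≢X = C≢Y ; C≢Y = C≢X ; C∉Z = C∉Z
    ; fullX = λ k y x W h → case fullY k x y W h of λ { (w , p , e) → w , p , Edge-↭ G (prep _ (swap _ _ ↭-refl)) e }
    ; fullY = λ k y x W h → case fullX k x y W h of λ { (w , p , e) → w , p , Edge-↭ G (prep _ (swap _ _ ↭-refl)) e }
    ; bridge = λ y x → Bridge-sym (bridge x y) }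
    where open Box b

  Box-restrict : ∀ {A q Mx My Mx′ My′} (α : Fin Mx′ → Fin Mx) (β : Fin My′ → Fin My) → Inj α → Inj β → Box G A q Mx My → Box G A q Mx′ My′
  Box-restrict α β α-inj β-inj b = record
    { X = X ∘ α ; Y = Y ∘ β ; Z = λ x y → Z (α x) (β y) ; C = λ k x y → C k (α x) (β y) ; X-inj = α-inj ⨾ X-inj ; Y-inj = β-inj ⨾ Y-inj
    ; Z-inj = λ e → case Z-inj e of λ { (p , q , r) → inj α-inj p , inj β-inj q , r }
    ; X≢Y = X≢Y ; X∉Z = X∉Z ; Y∉Z = Y∉Z ; X∉A = X∉A ; Y∉A = Y∉A ; Z∉A = Z∉A
    ; C-edge = λ k x y → C-edge k (α x) (β y)
    ; C-dist = C-dist ; C≢X = C≢X ; C≢Y = C≢Y ; C∉Z = C∉Z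
    ; fullX = λ k x y → fullX k (α x) (β y) ; fullY = λ k x y → fullY k (α x) (β y) ; bridge = λ x y → bridge (α x) (β y) }
    where open Box b

  even-system : ∀ {A w q W₀} u v cs → Unique (u ∷ v ∷ cs) → (c : Cherry G u v W₀) → (∀ {z} → z ∈ u ∷ v ∷ cs → z ∈ W₀) → Links G w v cs u →
    (P : List (Fin n)) → length P ≤ q → (∀ {z} → z ∈ u ∷ v ∷ cs → z ∈ P ⊎ z ∉ A) → (∀ {z} → z ∈ cherry-list c → z ∈ P ⊎ z ∉ A) →
    System G A w 2 (length cs) q
  even-system {A} {w} {q} u v cs (u≢ ∷ uq) c sub lk P P≤ off₁ off₂ = record
    { u = u ; v = v ; starter = cherry-chain c ; cs = cs ; cs-len = refl ; links = lk ; P = P ; P≤q = P≤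
    ; uniq = Unique-∷ (λ p → case ∈-++⁻ (cherry-list c) p of λ { (inj₁ r) → av r (sub (here refl)) ; (inj₂ r) → All.lookup u≢ r refl })
        (Unique-++ (cherry-list-unique c) uq (λ p r → av p (sub (there r))))
    ; off = λ { (here refl) → off₁ (here refl) ; (there p) → case ∈-++⁻ (cherry-list c) p of λ { (inj₁ r) → off₂ r ; (inj₂ r) → off₁ (there r) } } }
    where
    av : ∀ {z} → z ∈ cherry-list c → z ∉ _
    av p = Cherry.avoids c (cherry-list∈ c p)

  -- The starter consists of a cherry from `u` to `m` and one more edge from `m` to `v`; no cherry
  -- of the links ends in `m`.
  odd-system : ∀ {A w q W₀} u m v cs → Unique (u ∷ m ∷ v ∷ cs) → (c : Cherry G u m W₀) → (∀ {z} → z ∈ u ∷ m ∷ v ∷ cs → z ∈ W₀) →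
    (E : Vec (Fin n) (suc κ)) → Edge G (m ∷ v ∷ toList E) → Unique (toList E) → (∀ {z} → z ∈ toList E → z ∉ (u ∷ m ∷ v ∷ cs) ++ cherry-list c) →
    Links G w v cs u → (P : List (Fin n)) → length P ≤ q → (∀ {z} → z ∈ u ∷ m ∷ v ∷ cs → z ∈ P ⊎ z ∉ A) →
    (∀ {z} → z ∈ cherry-list c → z ∈ P ⊎ z ∉ A) → (∀ {z} → z ∈ toList E → z ∈ P ⊎ z ∉ A) →
    System G A w 3 (length cs) q
  odd-system {A} {w} {q} u m v cs (u≢ ∷ m≢ ∷ uq) c sub E e uE avE lk P P≤ off₁ off₂ off₃ = record
    { u = u ; v = v ; starter = cherry-chain c ++ᶜ link E e [] ; cs = cs ; cs-len = refl ; links = lk ; P = P ; P≤q = P≤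
    ; uniq = subst Unique (sym shape) (Unique-∷ u∉ (Unique-++ (cherry-list-unique c) (Unique-∷ m∉ (Unique-++ uE uq E∩)) cl∩))
    ; off = λ {z} p → offs (subst (z ∈_) shape p) }
    where
    R = v ∷ cs
    cl = cherry-list c
    shape : ((u ∷ cl) ++ (m ∷ toList E ++ [])) ++ R ≡ u ∷ (cl ++ (m ∷ (toList E ++ R)))
    shape = trans (++-assoc (u ∷ cl) (m ∷ toList E ++ []) R) (cong (λ l → u ∷ (cl ++ (m ∷ l))) (++-assoc (toList E) [] R))
    av : ∀ {z} → z ∈ cl → z ∉ _
    av p = Cherry.avoids c (cherry-list∈ c p)
    E∩ : ∀ {z} → z ∈ toList E → z ∉ R
    E∩ p r = avE p (∈-++⁺ˡ {xs = u ∷ m ∷ R} (there (there r)))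
    m∉ : m ∉ toList E ++ R
    m∉ p = case ∈-++⁻ (toList E) p of λ { (inj₁ r) → avE r (∈-++⁺ˡ {xs = u ∷ m ∷ R} (there (here refl))) ; (inj₂ r) → All.lookup m≢ r refl }
    cl∩ : ∀ {z} → z ∈ cl → z ∉ m ∷ (toList E ++ R)
    cl∩ p (here refl) = av p (sub (there (here refl)))
    cl∩ p (there r) = case ∈-++⁻ (toList E) r of λ { (inj₁ s) → avE s (∈-++⁺ʳ (u ∷ m ∷ R) p) ; (inj₂ s) → av p (sub (there (there s))) }
    u∉ : u ∉ cl ++ (m ∷ (toList E ++ R))
    u∉ p with ∈-++⁻ cl p
    ... | inj₁ r = av r (sub (here refl))
    ... | inj₂ (here refl) = All.lookup u≢ (here refl) refl
    ... | inj₂ (there r) = case ∈-++⁻ (toList E) r of λ { (inj₁ s) → avE s (∈-++⁺ˡ {xs = u ∷ m ∷ R} (here refl)) ; (inj₂ s) → All.lookup u≢ (there s) refl }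
    offs : ∀ {z} → z ∈ u ∷ (cl ++ (m ∷ (toList E ++ R))) → z ∈ P ⊎ z ∉ A
    offs (here refl) = off₁ (here refl)
    offs (there p) with ∈-++⁻ cl p
    ... | inj₁ r = off₂ r
    ... | inj₂ (here refl) = off₁ (there (here refl))
    ... | inj₂ (there r) = case ∈-++⁻ (toList E) r of λ { (inj₁ s) → off₃ s ; (inj₂ s) → off₁ (there (there s)) }

  module BoxLemmas {A : List (Fin n)} {q Mx My : ℕ} (b : Box G A q Mx My) where
    open Box b

    Z-unique : ∀ x y → Unique (toList (Z x y))
    Z-unique x y = unique-from-lookup (Z x y) (λ e → proj₂ (proj₂ (Z-inj e)))
      where
      unique-from-lookup : ∀ {m} (E : Vec (Fin n) m) → (∀ {i j} → lookup E i ≡ lookup E j → i ≡ j) → Unique (toList E)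
      unique-from-lookup []      h = []
      unique-from-lookup (z ∷ E) h = Unique-∷ (λ p → case ∈toList⇒lookup E p of λ { (j , e) → case h {zero} {suc j} e of λ () })
        (unique-from-lookup E (λ e → suc-injective (h e)))

    Z-disjoint : ∀ {x y y′} → y ≢ y′ → ∀ {z} → z ∈ toList (Z x y) → z ∉ toList (Z x y′)
    Z-disjoint {x} {y} {y′} ne p r with ∈toList⇒lookup (Z x y) p | ∈toList⇒lookup (Z x y′) r
    ... | i , refl | j , e = ne (proj₁ (proj₂ (Z-inj e)))

    -- An edge over a place of the grid consists of `X x`, the filling and two more vertices, a `Y`
    -- and a colour. Whichever of the two is the end of a cherry, the other is a head, and
    -- `box-cherry` treats both cases at once.
    record Head (h : Fin n) : Set where
      constructor mkHead
      field
        ≢X : ∀ {x} → h ≢ X x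
        ∉Z : ∀ {x y} → h ∉ toList (Z x y)
    open Head

    headY : ∀ y → Head (Y y)
    headY y = mkHead (λ e → X≢Y (sym e)) Y∉Z

    headC : ∀ k x y → Head (C k x y)
    headC k x y = mkHead C≢X C∉Z

    box-cherry : ∀ {a c W} y y′ x h h′ → y ≢ y′ → Head h → Head h′ → h ≢ h′ → Edge G (a ∷ X x ∷ h ∷ toList (Z x y)) → Edge G (X x ∷ c ∷ h′ ∷ toList (Z x y′)) →
      X x ∉ W → (∀ {z} → z ∈ toList (Z x y) → z ∉ W) → (∀ {z} → z ∈ toList (Z x y′) → z ∉ W) → h ∉ W → h′ ∉ W → Cherry G a c W
    box-cherry {a} {c} {W} y y′ x h h′ y≢ H H′ h≢ e₁ e₂ aX aZ aZ′ ah ah′ = mkCherry (X x) (h ∷ Z x y) (h′ ∷ Z x y′) e₁ e₂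
      (Unique-∷ h∉ (Unique-++ (Z-unique x y) (Unique-∷ X∉ (Unique-∷ (∉Z H′) (Z-unique x y′))) Z∩))
      (λ p → avs p)
      where
      h∉ : h ∉ toList (Z x y) ++ X x ∷ h′ ∷ toList (Z x y′)
      h∉ p with ∈-++⁻ (toList (Z x y)) p
      ... | inj₁ r = ∉Z H r
      ... | inj₂ (here r) = ≢X H r
      ... | inj₂ (there (here r)) = h≢ r
      ... | inj₂ (there (there r)) = ∉Z H r
      X∉ : X x ∉ h′ ∷ toList (Z x y′)
      X∉ (here r)  = ≢X H′ (sym r)
      X∉ (there r) = X∉Z r
      Z∩ : ∀ {z} → z ∈ toList (Z x y) → z ∉ X x ∷ h′ ∷ toList (Z x y′)
      Z∩ p (here refl) = X∉Z p
      Z∩ p (there (here refl)) = ∉Z H′ p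
      Z∩ p (there (there r)) = Z-disjoint y≢ p r
      avs : ∀ {z} → z ∈ (h ∷ toList (Z x y)) ++ X x ∷ h′ ∷ toList (Z x y′) → z ∉ W
      avs (here refl) = ah
      avs (there p) with ∈-++⁻ (toList (Z x y)) p
      ... | inj₁ r = aZ r
      ... | inj₂ (here refl) = aX
      ... | inj₂ (there (here refl)) = ah′
      ... | inj₂ (there (there r)) = aZ′ r

    Zslots : Fin My → List (Fin Mx → Fin n)
    Zslots y = List.tabulate (λ c x → lookup (Z x y) c)

    -- For fixed columns the vertices of a place move injectively with `x`, so a vertex of `W`
    -- blocks at most one `x` per slot: one slot for `X`, `κ` for either filling and one for each
    -- extra map.
    fresh-x : ∀ y y′ (es : List (Fin Mx → Fin n)) → All Inj es → ∀ W → (1 + (κ + κ) + length es) * length W < Mx →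
      ∃ λ x → X x ∉ W × (∀ {z} → z ∈ toList (Z x y) → z ∉ W) × (∀ {z} → z ∈ toList (Z x y′) → z ∉ W) × All (λ e → e x ∉ W) es
    fresh-x y y′ es es-inj W big with fresh-list (X ∷ Zslots y ++ Zslots y′ ++ es) (X-inj ∷ Allₚ.++⁺ (zi y) (Allₚ.++⁺ (zi y′) es-inj)) W
        (subst (λ m → m * length W < Mx) (sym len) big)
      where
      zi : ∀ y → All Inj (Zslots y)
      zi y = Allₚ.tabulate⁺ (λ c → mkInj (λ e → proj₁ (Z-inj e)))
      len : length (X ∷ Zslots y ++ Zslots y′ ++ es) ≡ 1 + (κ + κ) + length es
      len = cong suc (trans (length-++ (Zslots y)) (trans (cong₂ _+_ (length-tabulate {A = Fin Mx → Fin n} (λ c x → lookup (Z x y) c))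
        (trans (length-++ (Zslots y′)) (cong (_+ length es) (length-tabulate {A = Fin Mx → Fin n} (λ c x → lookup (Z x y′) c))))) (sym (+-assoc κ κ (length es)))))
    ... | x , aX ∷ rest = x , aX , zav y (Allₚ.++⁻ˡ (Zslots y) rest) , zav y′ (Allₚ.++⁻ˡ (Zslots y′) (Allₚ.++⁻ʳ (Zslots y) rest)) , Allₚ.++⁻ʳ (Zslots y′) (Allₚ.++⁻ʳ (Zslots y) rest)
      where
      zav : ∀ y → All (λ σ → σ x ∉ W) (Zslots y) → ∀ {z} → z ∈ toList (Z x y) → z ∉ W
      zav y al p with ∈toList⇒lookup (Z x y) p
      ... | c , refl = Allₚ.tabulate⁻ {f = λ c x → lookup (Z x y) c} al c

    fresh-y : ∀ W → length W < My → ∃ λ y → Y y ∉ W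
    fresh-y W h with fresh-list [ Y ] (Y-inj ∷ []) W (subst (_< My) (sym (+-identityʳ _)) h)
    ... | y , p ∷ [] = y , p

    fresh-ys : ∀ j W → length W + j < My → Σ (List (Fin My)) λ ys → length ys ≡ j × Unique ys × (∀ {y} → y ∈ ys → Y y ∉ W)
    fresh-ys zero    W h = [] , refl , [] , λ ()
    fresh-ys (suc j) W h with fresh-ys j W (≤-trans (s≤s (+-monoʳ-≤ (length W) (n≤1+n j))) h)
    ... | ys , refl , uq , av with fresh-y (W ++ map Y ys) (≤-trans (s≤s (≤-trans (≤-reflexive (trans (length-++ W) (cong (length W +_) (length-map Y ys)))) (+-monoʳ-≤ (length W) (n≤1+n _)))) h)
    ... | y , y∉ = y ∷ ys , refl , Unique-∷ (λ p → y∉ (∈-++⁺ʳ W (∈-map⁺ Y p))) uq , λ { (here refl) p → y∉ (∈-++⁺ˡ p) ; (there p) → av p }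

    Const : Fin q → Set
    Const k = ∀ x y x′ y′ → C k x y ≡ C k x′ y′

    XInj : Fin q → Set
    XInj k = ∀ y → Inj (λ x → C k x y)

    module _ (w : ℕ) (bigX : (4 + (κ + κ)) * (3 + w) < Mx) (bigY : (4 + (κ + κ)) * (3 + w) < My) where

      -- The bound on `Mx` allows three extra maps besides `X` and two fillings, and three vertices
      -- added to the avoided list.
      room : ∀ {s} {W : List (Fin n)} {m} → s ≤ 4 + (κ + κ) → m ≤ 3 → length W ≤ m + w → s * length W < Mx
      room s≤ m≤ W≤ = ≤-<-trans (*-mono-≤ s≤ (≤-trans W≤ (+-monoˡ-≤ w m≤))) bigX

      roomY : ∀ {W : List (Fin n)} {m} → m ≤ 3 → length W ≤ m + w → length W < My
      roomY {W} m≤ W≤ = ≤-<-trans (≤-trans (≤-trans W≤ (+-monoˡ-≤ w m≤)) (m≤m+n _ _)) bigY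

      const-const : ∀ {a c k k′} → (∀ x y → C k x y ≡ a) → (∀ x y → C k′ x y ≡ c) → CherryProp G w a c
      const-const {a} {c} {k} {k′} ca cc W W≤ with fresh-y W (roomY {W} z≤n W≤)
      ... | y , y∉ with fresh-y (Y y ∷ W) (roomY {Y y ∷ W} {1} (s≤s z≤n) (s≤s W≤))
      ... | y′ , y′∉ with fresh-x y y′ [] [] (Y y ∷ Y y′ ∷ W) (room {W = Y y ∷ Y y′ ∷ W} {2} (≤-trans (≤-reflexive (+-identityʳ _)) (m≤n+m _ 3)) (s≤s (s≤s z≤n)) (s≤s (s≤s W≤)))
      ... | x , aX , aZ , aZ′ , _ = box-cherry y y′ x (Y y) (Y y′) (λ e → y′∉ (here (cong Y (sym e)))) (headY y) (headY y′) (λ e → y′∉ (here (sym e)))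
        (subst (λ v → Edge G (v ∷ _)) (ca x y) (C-edge k x y))
        (Edge-↭ G (swap _ _ ↭-refl) (subst (λ v → Edge G (v ∷ X x ∷ Y y′ ∷ toList (Z x y′))) (cc x y′) (C-edge k′ x y′)))
        (λ p → aX (there (there p))) (λ p r → aZ p (there (there r))) (λ p r → aZ′ p (there (there r))) y∉ (λ p → y′∉ (there p))

      -- The second edge passes through Y y₂ and the colour k₂ at y₂, which need not be spread out.
      const-Y : ∀ {a k} y₂ → (∀ x y → C k x y ≡ a) → ∀ W → length W ≤ w → (es : List (Fin Mx → Fin n)) → All Inj es → length es ≤ 1 →
        (h′ : Fin Mx → Fin n) → (∀ x → ∃ λ k₂ → h′ x ≡ C k₂ x y₂) → (∀ x → All (λ e → e x ∉ W) es → h′ x ∉ W) → Cherry G a (Y y₂) W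
      const-Y {a} {k} y₂ ca W W≤ es esi es≤ h′ h′C h′W with fresh-y (Y y₂ ∷ W) (roomY {Y y₂ ∷ W} {1} (s≤s z≤n) (s≤s W≤))
      ... | y , y∉ with fresh-x y y₂ es esi W (room {W = W} {0} (≤-trans (+-monoʳ-≤ (1 + (κ + κ)) es≤) (≤-trans (≤-reflexive (+-comm (1 + (κ + κ)) 1)) (m≤n+m _ 2))) z≤n W≤)
      ... | x , aX , aZ , aZ′ , aes with h′C x
      ... | k₂ , eq = box-cherry y y₂ x (Y y) (h′ x) (λ e → y∉ (here (cong Y e))) (headY y) (subst Head (sym eq) (headC k₂ x y₂)) (λ e → C≢Y (trans (sym eq) (sym e)))
        (subst (λ v → Edge G (v ∷ _)) (ca x y) (C-edge k x y))
        (subst (λ v → Edge G (X x ∷ Y y₂ ∷ v ∷ toList (Z x y₂))) (sym eq) (Edge-↭ G (↭-trans (swap _ _ ↭-refl) (prep _ (swap _ _ ↭-refl))) (C-edge k₂ x y₂)))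
        aX aZ aZ′ (λ p → y∉ (there p)) (h′W x aes)

      const-spread : ∀ {a k k₂} y₂ → (∀ x y → C k x y ≡ a) → XInj k₂ → CherryProp G w a (Y y₂)
      const-spread {k₂ = k₂} y₂ ca xi W W≤ = const-Y y₂ ca W W≤ [ (λ x → C k₂ x y₂) ] (xi y₂ ∷ []) ≤-refl (λ x → C k₂ x y₂) (λ x → k₂ , refl) (λ { x (p ∷ []) → p })

      Y-Y : ∀ {k} y₁ y₂ → y₁ ≢ y₂ → XInj k → ∀ W → length W ≤ w → (es : List (Fin Mx → Fin n)) → All Inj es → length es ≤ 2 →
        (h′ : Fin Mx → Fin n) → (∀ x → ∃ λ k₂ → h′ x ≡ C k₂ x y₂) → (∀ x → C k x y₁ ∉ W → All (λ e → e x ∉ W) es → h′ x ∉ W × C k x y₁ ≢ h′ x) → Cherry G (Y y₁) (Y y₂) W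
      Y-Y {k} y₁ y₂ y≢ xi W W≤ es esi es≤ h′ h′C h′W with fresh-x y₁ y₂ ((λ x → C k x y₁) ∷ es) (xi y₁ ∷ esi) W (room {W = W} {0} (≤-trans (+-monoʳ-≤ (1 + (κ + κ)) (s≤s es≤)) (≤-reflexive (+-comm (1 + (κ + κ)) 3))) z≤n W≤)
      ... | x , aX , aZ , aZ′ , aC ∷ aes with h′C x
      ... | k₂ , eq = box-cherry y₁ y₂ x (C k x y₁) (h′ x) y≢ (headC k x y₁) (subst Head (sym eq) (headC k₂ x y₂)) (proj₂ (h′W x aC aes))
        (Edge-↭ G (↭-trans (swap _ _ ↭-refl) (↭-trans (prep _ (swap _ _ ↭-refl)) (swap _ _ ↭-refl))) (C-edge k x y₁))
        (subst (λ v → Edge G (X x ∷ Y y₂ ∷ v ∷ toList (Z x y₂))) (sym eq) (Edge-↭ G (↭-trans (swap _ _ ↭-refl) (prep _ (swap _ _ ↭-refl))) (C-edge k₂ x y₂)))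
        aX aZ aZ′ aC (proj₁ (h′W x aC aes))

      -- The two edges must not share their colours. At `y₂` the colour `k` is used unless it equals
      -- colour `k` at `y₁`; in that case `k′` differs from it, being another colour at the same
      -- place.
      spread-spread : ∀ {k k′} y₁ y₂ → y₁ ≢ y₂ → k ≢ k′ → XInj k → XInj k′ → CherryProp G w (Y y₁) (Y y₂)
      spread-spread {k} {k′} y₁ y₂ y≢ k≢ xi xi′ W W≤ = Y-Y {k} y₁ y₂ y≢ xi W W≤ ((λ x → C k x y₂) ∷ (λ x → C k′ x y₂) ∷ []) (xi y₂ ∷ xi′ y₂ ∷ []) ≤-refl
        pick pickC (λ { x aC (p ∷ r ∷ []) → avoid x p r , differ x })
        where
        choose : ∀ x → Dec (C k x y₁ ≡ C k x y₂) → Fin n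
        choose x (yes _) = C k′ x y₂
        choose x (no _)  = C k x y₂
        pick : Fin Mx → Fin n
        pick x = choose x (C k x y₁ ≟ C k x y₂)
        pickC : ∀ x → ∃ λ k₂ → pick x ≡ C k₂ x y₂
        pickC x with C k x y₁ ≟ C k x y₂
        ... | yes _ = k′ , refl
        ... | no _  = k , refl
        avoid : ∀ x → C k x y₂ ∉ W → C k′ x y₂ ∉ W → pick x ∉ W
        avoid x p r with C k x y₁ ≟ C k x y₂
        ... | yes _ = r
        ... | no _  = p
        differ : ∀ x → C k x y₁ ≢ pick x
        differ x with C k x y₁ ≟ C k x y₂
        ... | yes e = λ e′ → k≢ (C-dist (trans (sym e) e′))
        ... | no ¬e = ¬e

      -- With a single spread colour the head at `y₂` is the fixed vertex `ρ`. Such a cherry cannot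
      -- avoid `ρ`, so it is no link; it serves once, in the starter, with `ρ` entered into `P`.
      spread-ρ : ∀ {k k* ρ} y₁ y₂ → y₁ ≢ y₂ → XInj k → (∀ x → C k* x y₂ ≡ ρ) → ∀ W → length W < w → ρ ∉ W → Cherry G (Y y₁) (Y y₂) W
      spread-ρ {k} {k*} {ρ} y₁ y₂ y≢ xi eρ W W< ρ∉ = weaken (fresh-x y₁ y₂ [ (λ x → C k x y₁) ] (xi y₁ ∷ []) (ρ ∷ W) (room {W = ρ ∷ W} {0} (≤-trans (≤-reflexive (+-comm (1 + (κ + κ)) 1)) (m≤n+m _ 2)) z≤n W<))
        where
        weaken : (∃ λ x → X x ∉ ρ ∷ W × (∀ {z} → z ∈ toList (Z x y₁) → z ∉ ρ ∷ W) × (∀ {z} → z ∈ toList (Z x y₂) → z ∉ ρ ∷ W) × All (λ e → e x ∉ ρ ∷ W) [ (λ x → C k x y₁) ]) → _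
        weaken (x , aX , aZ , aZ′ , aC ∷ []) = box-cherry y₁ y₂ x (C k x y₁) ρ y≢ (headC k x y₁) (subst Head (eρ x) (headC k* x y₂)) (λ e → aC (here e))
          (Edge-↭ G (↭-trans (swap _ _ ↭-refl) (↭-trans (prep _ (swap _ _ ↭-refl)) (swap _ _ ↭-refl))) (C-edge k x y₁))
          (subst (λ v → Edge G (X x ∷ Y y₂ ∷ v ∷ toList (Z x y₂))) (eρ x) (Edge-↭ G (↭-trans (swap _ _ ↭-refl) (prep _ (swap _ _ ↭-refl))) (C-edge k* x y₂)))
          (aX ∘ there) (λ p → aZ p ∘ there) (λ p → aZ′ p ∘ there) (aC ∘ there) ρ∉

      -- Supplies the single edge that lengthens a starter to three.
      Y-const : ∀ {a k} y → (∀ x y → C k x y ≡ a) → ∀ W → length W ≤ w → Σ (Vec (Fin n) (suc κ)) λ E →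
        Edge G (Y y ∷ a ∷ toList E) × Unique (toList E) × (∀ {z} → z ∈ toList E → z ∉ W × z ∉ A)
      Y-const {a} {k} y ca W W≤ with fresh-x y y [] [] W (room {W = W} {0} (≤-trans (≤-reflexive (+-identityʳ _)) (m≤n+m _ 3)) z≤n W≤)
      ... | x , aX , aZ , _ , _ = X x ∷ Z x y ,
        Edge-↭ G (↭-trans (prep _ (swap _ _ ↭-refl)) (swap _ _ ↭-refl)) (subst (λ v → Edge G (v ∷ X x ∷ Y y ∷ toList (Z x y))) (ca x y) (C-edge k x y)) ,
        Unique-∷ X∉Z (Z-unique x y) , λ { (here refl) → aX , X∉A ; (there p) → aZ p , Z∉A p }

-- Systems of centres in a box

≤-by : ∀ {a c} d → a + d ≡ c → a ≤ c
≤-by {a} d e = ≤-trans (m≤m+n a d) (≤-reflexive e)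

cherry-list-length : ∀ {κ n} {G : RGraph (3 + κ) n} {a c W} (ch : Cherry G a c W) → suc (length (cherry-list ch)) ≡ 2 * (2 + κ)
cherry-list-length ch = chain-length (cherry-chain ch)

-- A starter may use one colour `ρ` even if it lies in `A`; its cherry is asked to avoid `A` without
-- `ρ`.
remove : Fin n → List (Fin n) → List (Fin n)
remove ρ = filter (λ z → ¬? (z ≟ ρ))

remove-length : ∀ (ρ : Fin n) A → length (remove ρ A) ≤ length A
remove-length ρ A = length-filter (λ z → ¬? (z ≟ ρ)) A

∉remove : ∀ {ρ z : Fin n} {A} → z ∉ remove ρ A → z ≡ ρ ⊎ z ∉ A
∉remove {ρ = ρ} {z} h with z ≟ ρ
... | yes e = inj₁ e
... | no ¬e = inj₂ (λ p → h (∈-filter⁺ (λ z → ¬? (z ≟ ρ)) p ¬e))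

ρ∉remove : ∀ {ρ : Fin n} {A} → ρ ∉ remove ρ A
ρ∉remove {ρ = ρ} {A} p = proj₂ (∈-filter⁻ (λ z → ¬? (z ≟ ρ)) {xs = A} p) refl

module Systems {κ n : ℕ} {G : RGraph (3 + κ) n} {A : List (Fin n)} {q′ Mx My : ℕ} (b : Box G A (3 + q′) Mx My) (w : ℕ)
  (bigX : (4 + (κ + κ)) * (3 + w) < Mx) (bigY : (4 + (κ + κ)) * (3 + w) < My) (A≤ : length A + (20 + q′ + 4 * κ) ≤ w)
  (x₀ : Fin Mx) (y₁ y₂ : Fin My) (y₁≢y₂ : y₁ ≢ y₂) where

  open Box b
  open BoxLemmas b

  Result : Set
  Result = System G A w 2 (suc q′) (3 + q′) × System G A w 3 q′ (3 + q′)

  private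
    -- The margin `20 + q′ + 4 * κ` dominates the lists of fixed vertices that occur below; `d` is
    -- the slack in each case.
    fits : ∀ {m} (L : List (Fin n)) d → length L ≡ m → m + d ≡ 20 + q′ + 4 * κ → length (A ++ L) ≤ w
    fits L d refl e = ≤-trans (≤-reflexive (length-++ A)) (≤-trans (+-monoʳ-≤ (length A) (≤-by d e)) A≤)

    fits′ : ∀ {m} (L : List (Fin n)) d → length L ≡ m → m + d ≡ 20 + q′ + 4 * κ → length L ≤ w
    fits′ L d l e = ≤-trans (m≤n+m (length L) (length A)) (≤-trans (≤-reflexive (sym (length-++ A))) (fits L d l e))

    fitsR : ∀ ρ {m} (L : List (Fin n)) d → length L ≡ m → m + d ≡ 20 + q′ + 4 * κ → length (remove ρ A ++ L) ≤ w
    fitsR ρ L d refl e = ≤-trans (≤-reflexive (length-++ (remove ρ A))) (≤-trans (+-mono-≤ (remove-length ρ A) (≤-by d e)) A≤)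

  val : Fin (3 + q′) → Fin n
  val k = C k x₀ y₁

  links-const : ∀ k ks {u} → Const k → (∀ {k} → k ∈ ks → Const k) → (∀ {k} → Const k → CherryProp G w (val k) u) → Links G w (val k) (map val ks) u
  links-const k []        ck h fin = fin ck
  links-const k (k′ ∷ ks) ck h fin =
    const-const w bigX bigY (λ x y → ck x y x₀ y₁) (λ x y → h (here refl) x y x₀ y₁) , links-const k′ ks (h (here refl)) (h ∘ there) fin

  val-inj : ∀ {k k′} → val k ≡ val k′ → k ≡ k′
  val-inj = C-dist

  Unique-vals : ∀ {ks} → Unique ks → Unique (map val ks)
  Unique-vals = Uniqueₚ.map⁺ val-inj

  Y∉vals : ∀ {y ks} → Y y ∉ map val ks
  Y∉vals {ks = ks} p with ∈-map⁻ val p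
  ... | k , _ , e = C≢Y (sym e)

  off-cherry : ∀ {ρ L a c P} (ch : Cherry G a c (remove ρ A ++ L)) → ρ ∈ P → ∀ {z} → z ∈ cherry-list ch → z ∈ P ⊎ z ∉ A
  off-cherry {ρ} ch ρ∈ p with ∉remove {ρ = ρ} (λ r → Cherry.avoids ch (cherry-list∈ ch p) (∈-++⁺ˡ r))
  ... | inj₁ refl = inj₁ ρ∈
  ... | inj₂ z∉ = inj₂ z∉

  Tail : Fin My → Fin n → List (Fin n) → Set
  Tail y a W = Σ (Vec (Fin n) (suc κ)) λ E → Edge G (Y y ∷ a ∷ toList E) × Unique (toList E) × (∀ {z} → z ∈ toList E → z ∉ W × z ∉ A)

  -- All links join colours. For even length every colour is a centre. For odd length the starter
  -- passes through `Y y₂`, and `k₂`, no longer a centre, fills its edge between `X x` and `Y y₂`;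
  -- either way `P` is the list of all `q` colours.
  all-const : (∀ k → Const k) → Result
  all-const cst = even , odd
    where
    cc : ∀ {k} x y → C k x y ≡ val k
    cc {k} x y = cst k x y x₀ y₁
    ι₃ : Fin q′ → Fin (3 + q′)
    ι₃ i = suc (suc (suc i))
    ks = List.tabulate ι₃
    k₀ k₁ k₂ : Fin (3 + q′)
    k₀ = zero
    k₁ = suc zero
    k₂ = suc (suc zero)
    ks⁺ = k₀ ∷ k₁ ∷ k₂ ∷ ks
    uks : Unique ks⁺
    uks = allFin⁺ (3 + q′)
    len : length (map val ks⁺) ≡ 3 + q′
    len = trans (length-map val ks⁺) (cong (λ x → suc (suc (suc x))) (length-tabulate ι₃))
    fin : ∀ {u k} → Const k → CherryProp G w (val k) (val u)
    fin {u} {k} _ = const-const w bigX bigY {k = k} {u} cc cc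
    even : System G A w 2 (suc q′) (3 + q′)
    even = build (const-const w bigX bigY {k = k₀} {k₁} cc cc (A ++ map val ks⁺) (fits (map val ks⁺) (17 + 4 * κ) len (e₁ q′ κ)))
      where
      e₁ : ∀ q κ → 3 + q + (17 + 4 * κ) ≡ 20 + q + 4 * κ
      e₁ = solve-∀
      build : Cherry G (val k₀) (val k₁) (A ++ map val ks⁺) → System G A w 2 (suc q′) (3 + q′)
      build ch = subst (λ j → System G A w 2 j (3 + q′)) (cong pred (cong pred len))
        (even-system (val k₀) (val k₁) (map val (k₂ ∷ ks)) (Unique-vals uks) ch (∈-++⁺ʳ A)
          (links-const k₁ (k₂ ∷ ks) (cst k₁) (λ {k} _ → cst k) (fin {k₀})) (map val ks⁺) (≤-reflexive len) inj₁
          (λ p → inj₂ (λ a → Cherry.avoids ch (cherry-list∈ ch p) (∈-++⁺ˡ a))))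
    odd : System G A w 3 q′ (3 + q′)
    odd = attach (const-Y w bigX bigY {k = k₀} y₂ cc (remove (val k₂) A ++ cen) (fitsR (val k₂) cen (17 + 4 * κ) len (e₁ q′ κ)) [] [] z≤n (λ _ → val k₂)
        (λ x → k₂ , sym (cc x y₂)) (λ x _ p → [ ρ∉remove {A = A} , k₂∉ ]′ (∈-++⁻ (remove (val k₂) A) p)))
      where
      cen = val k₀ ∷ Y y₂ ∷ val k₁ ∷ map val ks
      uv : Unique (map val ks⁺)
      uv = Unique-vals uks
      uq : Unique cen
      uq with uv
      ... | (a ∷ a₂ ∷ a₃) ∷ (b₂ ∷ b₃) ∷ _ ∷ r = (C≢Y ∷ a ∷ a₃) ∷ ((λ e → C≢Y (sym e)) ∷ ∉⇒All≢ (Y∉vals {ks = ks})) ∷ b₃ ∷ r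
      k₂∉ : val k₂ ∉ cen
      k₂∉ (here e) = case val-inj {k₂} {k₀} e of λ ()
      k₂∉ (there (here e)) = C≢Y e
      k₂∉ (there (there (here e))) = case val-inj {k₂} {k₁} e of λ ()
      k₂∉ (there (there (there p))) with uv
      ... | _ ∷ _ ∷ a ∷ _ = All.lookup a p refl
      e₁ : ∀ q κ → 3 + q + (17 + 4 * κ) ≡ 20 + q + 4 * κ
      e₁ = solve-∀
      e₂ : ∀ q κ → 3 + q + suc (κ + 1 * (2 + κ)) + (14 + 2 * κ) ≡ 20 + q + 4 * κ
      e₂ = solve-∀
      build : (ch : Cherry G (val k₀) (Y y₂) (remove (val k₂) A ++ cen)) → Tail y₂ (val k₁) (cen ++ cherry-list ch) → System G A w 3 q′ (3 + q′)
      build ch (E , e , uE , avE) = subst (λ j → System G A w 3 j (3 + q′)) (cong pred (cong pred (cong pred len)))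
        (odd-system (val k₀) (Y y₂) (val k₁) (map val ks) uq ch (∈-++⁺ʳ (remove (val k₂) A)) E e uE
          (λ p → proj₁ (avE p)) (links-const k₁ ks (cst k₁) (λ {k} _ → cst k) (fin {k₀})) (map val ks⁺) (≤-reflexive len)
          (λ { (here e) → inj₁ (here e) ; (there (here refl)) → inj₂ Y∉A ; (there (there (here e))) → inj₁ (there (here e)) ; (there (there (there p))) → inj₁ (there (there (there p))) })
          (off-cherry ch (there (there (here refl)))) (λ p → inj₂ (proj₂ (avE p))))
      attach : Cherry G (val k₀) (Y y₂) (remove (val k₂) A ++ cen) → System G A w 3 q′ (3 + q′)
      attach ch = build ch (Y-const w bigX bigY {k = k₁} y₂ cc (cen ++ cherry-list ch)
        (fits′ (cen ++ cherry-list ch) (14 + 2 * κ) (trans (length-++ cen) (cong₂ _+_ len (cong pred (cherry-list-length ch)))) (e₂ q′ κ)))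

  -- As `k` varies with `x`, the vertices `Y y₁` and `Y y₂` become centres off `A`, in place of the
  -- colours `k` and `k*`. The starter that joins them uses `ρ`, so `P` holds `ρ` and the `q′ + 1`
  -- constant colours.
  one-spread : ∀ {k k* ρ} k₀ ks → length ks ≡ q′ → Unique (k₀ ∷ ks) → (∀ {k} → k ∈ k₀ ∷ ks → Const k) → k* ∉ k₀ ∷ ks →
    XInj k → (∀ x → C k* x y₂ ≡ ρ) → Result
  one-spread {k} {k*} {ρ} k₀ ks lk uks cst k*∉ xi eρ = even ch , attach ch
    where
    vs = map val (k₀ ∷ ks)
    cen = Y y₁ ∷ Y y₂ ∷ vs
    len : length vs ≡ suc q′
    len = trans (length-map val (k₀ ∷ ks)) (cong suc lk)
    ρC : ρ ≡ C k* x₀ y₂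
    ρC = sym (eρ x₀)
    ρ∉vs : ρ ∉ vs
    ρ∉vs p with ∈-map⁻ val p
    ... | k′ , k′∈ , e = k*∉ (subst (_∈ k₀ ∷ ks) (C-dist (trans (cst k′∈ x₀ y₂ x₀ y₁) (trans (sym e) ρC))) k′∈)
    ρ∉cen : ρ ∉ cen
    ρ∉cen (here e) = C≢Y (trans (sym ρC) e)
    ρ∉cen (there (here e)) = C≢Y (trans (sym ρC) e)
    ρ∉cen (there (there p)) = ρ∉vs p
    W₀ = remove ρ A ++ cen
    uvs : Unique vs
    uvs = Unique-vals uks
    ucen : Unique cen
    ucen = ((λ e → y₁≢y₂ (inj Y-inj e)) ∷ ∉⇒All≢ (Y∉vals {ks = k₀ ∷ ks})) ∷ ∉⇒All≢ (Y∉vals {ks = k₀ ∷ ks}) ∷ uvs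
    e₁ : ∀ q κ → 3 + q + (17 + 4 * κ) ≡ 20 + q + 4 * κ
    e₁ = solve-∀
    ch : Cherry G (Y y₁) (Y y₂) W₀
    ch = spread-ρ w bigX bigY {k} {k*} y₁ y₂ y₁≢y₂ xi eρ W₀
      (≤-trans (≤-reflexive (sym (trans (length-++ (remove ρ A)) (trans (+-suc _ _) (cong suc (sym (length-++ (remove ρ A) {cen})))))))
        (fitsR ρ (Y y₁ ∷ cen) (16 + 4 * κ) (cong (λ x → suc (suc (suc x))) len) (e₃ q′ κ)))
      (λ p → [ ρ∉remove {A = A} , ρ∉cen ]′ (∈-++⁻ (remove ρ A) p))
      where
      e₃ : ∀ q κ → 4 + q + (16 + 4 * κ) ≡ 20 + q + 4 * κ
      e₃ = solve-∀
    fin : ∀ {k₁} → Const k₁ → CherryProp G w (val k₁) (Y y₁)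
    fin {k₁} c = const-spread w bigX bigY {k = k₁} {k} y₁ (λ x y → c x y x₀ y₁) xi
    lks : Links G w (val k₀) (map val ks) (Y y₁)
    lks = links-const k₀ ks (cst (here refl)) (cst ∘ there) fin
    offP : ∀ {z} → z ∈ cen → z ∈ ρ ∷ vs ⊎ z ∉ A
    offP (here refl) = inj₂ Y∉A
    offP (there (here refl)) = inj₂ Y∉A
    offP (there (there p)) = inj₁ (there p)
    P≤ : length (ρ ∷ vs) ≤ 3 + q′
    P≤ = s≤s (≤-trans (≤-reflexive len) (n≤1+n _))
    even : Cherry G (Y y₁) (Y y₂) W₀ → System G A w 2 (suc q′) (3 + q′)
    even ch = subst (λ j → System G A w 2 j (3 + q′)) len
      (even-system (Y y₁) (Y y₂) vs ucen ch (∈-++⁺ʳ (remove ρ A))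
        ((λ W h → Cherry-sym (const-spread w bigX bigY {k = k₀} {k} y₂ (λ x y → cst (here refl) x y x₀ y₁) xi W h)) , lks)
        (ρ ∷ vs) P≤ offP (off-cherry ch (here refl)))
    odd : (ch : Cherry G (Y y₁) (Y y₂) W₀) → Tail y₂ (val k₀) (cen ++ cherry-list ch) → System G A w 3 q′ (3 + q′)
    odd ch (E , e , uE , avE) = subst (λ j → System G A w 3 j (3 + q′)) (cong pred len)
      (odd-system (Y y₁) (Y y₂) (val k₀) (map val ks) ucen ch (∈-++⁺ʳ (remove ρ A)) E e uE
        (λ p → proj₁ (avE p)) lks (ρ ∷ vs) P≤ offP (off-cherry ch (here refl)) (λ p → inj₂ (proj₂ (avE p))))
    attach : Cherry G (Y y₁) (Y y₂) W₀ → System G A w 3 q′ (3 + q′)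
    attach ch = odd ch (Y-const w bigX bigY {k = k₀} y₂ (λ x y → cst (here refl) x y x₀ y₁) (cen ++ cherry-list ch)
        (fits′ (cen ++ cherry-list ch) (14 + 2 * κ) (trans (length-++ cen) (cong₂ _+_ (cong (λ x → suc (suc x)) len) (cong pred (cherry-list-length ch)))) (e₂ q′ κ)))
      where
      e₂ : ∀ q κ → 3 + q + suc (κ + 1 * (2 + κ)) + (14 + 2 * κ) ≡ 20 + q + 4 * κ
      e₂ = solve-∀

  module _ {k k′ : Fin (3 + q′)} (k≢k′ : k ≢ k′) (xi : XInj k) (xi′ : XInj k′) where

    links-Y : ∀ y ys u → Unique (y ∷ ys) → u ∉ y ∷ ys → Links G w (Y y) (map Y ys) (Y u)
    links-Y y []        u uq          u∉ = spread-spread w bigX bigY {k} {k′} y u (λ e → u∉ (here (sym e))) k≢k′ xi xi′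
    links-Y y (y′ ∷ ys) u (y≢ ∷ uq) u∉ = spread-spread w bigX bigY {k} {k′} y y′ (All.lookup y≢ (here refl)) k≢k′ xi xi′ , links-Y y′ ys u uq (u∉ ∘ there)

    Unique-Ys : ∀ {ys} → Unique ys → Unique (map Y ys)
    Unique-Ys = Uniqueₚ.map⁺ (inj Y-inj)

    off-Ys : ∀ {P ys} {z} → z ∈ map Y ys → z ∈ P ⊎ z ∉ A
    off-Ys p with ∈-map⁻ Y p
    ... | y , _ , refl = inj₂ Y∉A

    spread-even : System G A w 2 (suc q′) (3 + q′)
    spread-even = build (fresh-ys (3 + q′) [] (≤-<-trans (≤-trans (≤-by (17 + 4 * κ) (e₁ q′ κ)) (≤-trans (m≤n+m _ (length A)) (≤-trans A≤ (≤-trans (m≤n+m w 3) (m≤m+n _ _))))) bigY))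
      where
      e₁ : ∀ q κ → 3 + q + (17 + 4 * κ) ≡ 20 + q + 4 * κ
      e₁ = solve-∀
      attach : ∀ y y′ ys → suc (suc (length ys)) ≡ 3 + q′ → Unique (y ∷ y′ ∷ ys) → Cherry G (Y y) (Y y′) (A ++ map Y (y ∷ y′ ∷ ys)) → System G A w 2 (suc q′) (3 + q′)
      attach y y′ ys len uq@(y∉ ∷ uq′) ch = subst (λ j → System G A w 2 j (3 + q′)) (trans (length-map Y ys) (cong pred (cong pred len)))
        (even-system (Y y) (Y y′) (map Y ys) (Unique-Ys uq) ch (∈-++⁺ʳ A) (links-Y y′ ys y uq′ (λ p → All.lookup y∉ p refl)) [] z≤n (off-Ys {ys = y ∷ y′ ∷ ys})
          (λ p → inj₂ (λ a → Cherry.avoids ch (cherry-list∈ ch p) (∈-++⁺ˡ a))))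
      build : (Σ (List (Fin My)) λ ys → length ys ≡ 3 + q′ × Unique ys × (∀ {y} → y ∈ ys → Y y ∉ [])) → System G A w 2 (suc q′) (3 + q′)
      build (y ∷ y′ ∷ ys , len , uq@((y≢ ∷ _) ∷ _) , _) = attach y y′ ys len uq
        (spread-spread w bigX bigY {k} {k′} y y′ y≢ k≢k′ xi xi′ _ (fits (map Y (y ∷ y′ ∷ ys)) (17 + 4 * κ) (trans (length-map Y (y ∷ y′ ∷ ys)) len) (e₁ q′ κ)))

    fresh-spoke : ∀ (es : List (Fin My → Fin n)) → All Inj es → length es ≤ 1 → (W : List (Fin n)) → length W ≤ w →
      ∃ λ y → Y y ∉ W × (∀ {z} → z ∈ toList (Z x₀ y) → z ∉ W) × All (λ e → e y ∉ W) es
    fresh-spoke es esi es≤ W W≤ = forget (BoxLemmas.fresh-x (Box-sym b) x₀ x₀ es esi W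
      (≤-<-trans (*-mono-≤ (≤-trans (+-monoʳ-≤ (1 + (κ + κ)) es≤) (≤-trans (≤-reflexive (+-comm (1 + (κ + κ)) 1)) (m≤n+m _ 2))) (≤-trans W≤ (m≤n+m w 3))) bigY))
      where
      forget : (∃ λ y → Y y ∉ W × (∀ {z} → z ∈ toList (Z x₀ y) → z ∉ W) × (∀ {z} → z ∈ toList (Z x₀ y) → z ∉ W) × All (λ e → e y ∉ W) es) →
        ∃ λ y → Y y ∉ W × (∀ {z} → z ∈ toList (Z x₀ y) → z ∉ W) × All (λ e → e y ∉ W) es
      forget (y , aY , aZ , _ , ae) = y , aY , aZ , ae

    Ys : ℕ → List (Fin n) → Set
    Ys j W = Σ (List (Fin My)) λ ys → length ys ≡ j × Unique ys × (∀ {y} → y ∈ ys → Y y ∉ W)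

    more-ys : ∀ {m} (W : List (Fin n)) d → length W ≡ m → m + d ≡ 20 + 4 * κ → Ys q′ W
    more-ys W d refl e = fresh-ys q′ W (≤-<-trans (≤-trans (≤-by d (trans (e₀ (length W) q′ d) (trans (cong (_+ q′) e) (e₁ q′ κ))))
        (≤-trans (m≤n+m _ (length A)) (≤-trans A≤ (≤-trans (m≤n+m w 3) (m≤m+n _ _))))) bigY)
      where
      e₀ : ∀ l q d → l + q + d ≡ l + d + q
      e₀ = solve-∀
      e₁ : ∀ q κ → 20 + 4 * κ + q ≡ 20 + q + 4 * κ
      e₁ = solve-∀

    ∉Ys : ∀ {ys : List (Fin My)} {W : List (Fin n)} → (∀ {y} → y ∈ ys → Y y ∉ W) → ∀ {z} → z ∈ W → z ∉ map Y ys
    ∉Ys h z∈ p with ∈-map⁻ Y p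
    ... | y , y∈ , refl = h y∈ z∈

    module Rainbow (k₀ : Fin (3 + q′)) (m : Fin n) (E₁ E₂ : Vec (Fin n) (suc κ)) (e₁ : Edge G (X x₀ ∷ m ∷ toList E₁)) (e₂ : Edge G (m ∷ Y y₁ ∷ toList E₂))
      (uq : Unique (X x₀ ∷ Y y₁ ∷ m ∷ toList E₁ ++ toList E₂)) (P : List (Fin n)) (P≤ : length P ≤ 3)
      (offB : ∀ {z} → z ∈ m ∷ toList E₁ ++ toList E₂ → z ∈ P ⊎ z ∉ A) where

      B : List (Fin n)
      B = X x₀ ∷ Y y₁ ∷ m ∷ toList E₁ ++ toList E₂

      lenB : length B ≡ 3 + (suc κ + suc κ)
      lenB = cong (3 +_) (trans (length-++ (toList E₁)) (cong₂ _+_ (Vecₚ.length-toList E₁) (Vecₚ.length-toList E₂)))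

      module _ (y : Fin My) (aY : Y y ∉ A ++ B) (aZ : ∀ {z} → z ∈ toList (Z x₀ y) → z ∉ A ++ B) (aC : C k₀ x₀ y ∉ A ++ B)
        (ys : List (Fin My)) (uys : Unique ys) (aYs : ∀ {y′} → y′ ∈ ys → Y y′ ∉ Y y ∷ (C k₀ x₀ y ∷ toList (Z x₀ y)) ++ B) where

        private
          F : Vec (Fin n) (suc κ)
          F = C k₀ x₀ y ∷ Z x₀ y
          cen : List (Fin n)
          cen = Y y ∷ m ∷ Y y₁ ∷ map Y ys
          inB : ∀ {z} → z ∈ B → z ∉ map Y ys
          inB p = ∉Ys aYs (there (∈-++⁺ʳ (toList F) p))
          inF : ∀ {z} → z ∈ toList F → z ∉ map Y ys
          inF p = ∉Ys aYs (there (∈-++⁺ˡ p))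
          F∩B : ∀ {z} → z ∈ toList F → z ∉ B
          F∩B (here refl) r = aC (∈-++⁺ʳ A r)
          F∩B (there p)   r = aZ p (∈-++⁺ʳ A r)
          Yy∉B : Y y ∉ B
          Yy∉B p = aY (∈-++⁺ʳ A p)
          Yy∉F : Y y ∉ toList F
          Yy∉F (here e)  = C≢Y (sym e)
          Yy∉F (there p) = Y∉Z p
          E₁⊆B : ∀ {z} → z ∈ toList E₁ → z ∈ B
          E₁⊆B p = there (there (there (∈-++⁺ˡ p)))
          E₂⊆B : ∀ {z} → z ∈ toList E₂ → z ∈ B
          E₂⊆B p = there (there (there (∈-++⁺ʳ (toList E₁) p)))

        parts : Unique B → Unique (toList E₁) × Unique (toList E₂) × (∀ {z} → z ∈ toList E₁ → z ∉ toList E₂) ×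
          (X x₀ ∉ Y y₁ ∷ m ∷ toList E₁ ++ toList E₂) × (Y y₁ ∉ m ∷ toList E₁ ++ toList E₂) × (m ∉ toList E₁ ++ toList E₂)
        parts (a ∷ c ∷ d ∷ r) with Unique-++⁻ (toList E₁) r
        ... | u₁ , u₂ , dis = u₁ , u₂ , dis , (λ p → All.lookup a p refl) , (λ p → All.lookup c p refl) , (λ p → All.lookup d p refl)

        build : Unique (toList E₁) × Unique (toList E₂) × (∀ {z} → z ∈ toList E₁ → z ∉ toList E₂) ×
          (X x₀ ∉ Y y₁ ∷ m ∷ toList E₁ ++ toList E₂) × (Y y₁ ∉ m ∷ toList E₁ ++ toList E₂) × (m ∉ toList E₁ ++ toList E₂) → System G A w 3 (length (map Y ys)) (3 + q′)
        build (u₁ , u₂ , dis , x∉ , y₁∉ , m∉) = odd-system (Y y) m (Y y₁) (map Y ys) ucen ch id E₂ e₂ u₂ E₂∩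
            (links-Y y₁ ys y (Unique-∷ (λ p → inB (there (here refl)) (∈-map⁺ Y p)) uys)
              (λ { (here refl) → Yy∉B (there (here refl)) ; (there p) → ∉Ys aYs (here refl) (∈-map⁺ Y p) }))
            P (≤-trans P≤ (m≤m+n 3 q′))
            (λ { (here refl) → inj₂ Y∉A ; (there (here refl)) → offB (here refl) ; (there (there (here refl))) → inj₂ Y∉A ; (there (there (there p))) → off-Ys {ys = ys} p })
            off-ch (λ p → offB (there (∈-++⁺ʳ (toList E₁) p)))
          where
          ucen : Unique cen
          ucen = Unique-∷ (λ { (here refl) → Yy∉B (there (there (here refl))) ; (there (here e)) → Yy∉B (there (here e)) ; (there (there p)) → ∉Ys aYs (here refl) p })
            (Unique-∷ (λ { (here e) → y₁∉ (here (sym e)) ; (there p) → inB (there (there (here refl))) p })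
              (Unique-∷ (inB (there (here refl))) (Unique-Ys uys)))
          F∩ : ∀ {z} → z ∈ toList F → z ∉ X x₀ ∷ toList E₁
          F∩ p (here refl) = F∩B p (here refl)
          F∩ p (there r)   = F∩B p (E₁⊆B r)
          cu : Unique (toList F ++ X x₀ ∷ toList E₁)
          cu = Unique-++ {xs = toList F} (Unique-∷ C∉Z (Z-unique x₀ y)) (Unique-∷ (λ p → x∉ (there (there (∈-++⁺ˡ p)))) u₁) F∩
          avB : ∀ {z} → z ∈ X x₀ ∷ toList E₁ → z ∉ cen
          avB (here refl) (here e) = X≢Y e
          avB (here refl) (there (here e)) = x∉ (there (here e))
          avB (here refl) (there (there (here e))) = X≢Y e
          avB (here refl) (there (there (there r))) = inB (here refl) r
          avB (there p) (here refl) = Yy∉B (E₁⊆B p)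
          avB (there p) (there (here refl)) = m∉ (∈-++⁺ˡ p)
          avB (there p) (there (there (here refl))) = y₁∉ (there (∈-++⁺ˡ p))
          avB (there p) (there (there (there r))) = inB (E₁⊆B p) r
          avF : ∀ {z} → z ∈ toList F → z ∉ cen
          avF p (here refl) = Yy∉F p
          avF p (there (here refl)) = F∩B p (there (there (here refl)))
          avF p (there (there (here refl))) = F∩B p (there (here refl))
          avF p (there (there (there r))) = inF p r
          ch : Cherry G (Y y) m cen
          ch = mkCherry (X x₀) F E₁
            (Edge-↭ G (↭-trans (swap _ _ ↭-refl) (↭-trans (prep _ (swap _ _ ↭-refl)) (swap _ _ ↭-refl))) (C-edge k₀ x₀ y)) e₁ cu
            (λ p → [ avF , avB ]′ (∈-++⁻ (toList F) p))
          E₂∩ : ∀ {z} → z ∈ toList E₂ → z ∉ cen ++ cherry-list ch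
          E₂∩ {z} p r = [ in-cen , in-ch ]′ (∈-++⁻ cen r)
            where
            in-cen : z ∉ cen
            in-cen (here refl) = Yy∉B (E₂⊆B p)
            in-cen (there (here refl)) = m∉ (∈-++⁺ʳ (toList E₁) p)
            in-cen (there (there (here refl))) = y₁∉ (there (∈-++⁺ʳ (toList E₁) p))
            in-cen (there (there (there s))) = inB (E₂⊆B p) s
            in-ch : z ∉ cherry-list ch
            in-ch s with ∈-++⁻ (toList F) (cherry-list∈ ch s)
            ... | inj₁ t = F∩B t (E₂⊆B p)
            ... | inj₂ (here refl) = x∉ (there (there (∈-++⁺ʳ (toList E₁) p)))
            ... | inj₂ (there t) = dis t p
          off-ch : ∀ {z} → z ∈ cherry-list ch → z ∈ P ⊎ z ∉ A
          off-ch s with ∈-++⁻ (toList F) (cherry-list∈ ch s)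
          ... | inj₁ (here refl) = inj₂ (λ a → aC (∈-++⁺ˡ a))
          ... | inj₁ (there t) = inj₂ (Z∉A t)
          ... | inj₂ (here refl) = inj₂ X∉A
          ... | inj₂ (there t) = offB (there (∈-++⁺ˡ t))

        system : System G A w 3 (length (map Y ys)) (3 + q′)
        system = build (parts uq)

    -- The starter runs from `Y y` over `X x₀` and the middle of a bridge to `Y y₁`. Injectivity
    -- along the row `x₀` lets the colour on its first edge avoid `A`, so `P` is left to the bridge.
    spread-odd-rainbow : ∀ k₀ → Inj (λ y → C k₀ x₀ y) → System G A w 3 q′ (3 + q′)
    spread-odd-rainbow k₀ yi = main (bridge x₀ y₁)
      where
      main : Bridge G A (X x₀) (Y y₁) → System G A w 3 q′ (3 + q′)
      main (mkBridge m E₁ E₂ e₁ e₂ uq P P≤ offB) = step (fresh-spoke [ (λ y → C k₀ x₀ y) ] (yi ∷ []) ≤-refl (A ++ B) (fits B (15 + (q′ + 2 * κ)) lenB (f₁ q′ κ)))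
        where
        open Rainbow k₀ m E₁ E₂ e₁ e₂ uq P P≤ offB
        f₁ : ∀ q κ → 3 + (suc κ + suc κ) + (15 + (q + 2 * κ)) ≡ 20 + q + 4 * κ
        f₁ = solve-∀
        f₂ : ∀ κ → suc (suc κ + (3 + (suc κ + suc κ))) + (13 + κ) ≡ 20 + 4 * κ
        f₂ = solve-∀
        step : (∃ λ y → Y y ∉ A ++ B × (∀ {z} → z ∈ toList (Z x₀ y) → z ∉ A ++ B) × All (λ e → e y ∉ A ++ B) [ (λ y → C k₀ x₀ y) ]) → System G A w 3 q′ (3 + q′)
        step (y , aY , aZ , aC ∷ []) = last (more-ys (Y y ∷ (C k₀ x₀ y ∷ toList (Z x₀ y)) ++ B) (13 + κ)
            (cong suc (trans (length-++ (C k₀ x₀ y ∷ toList (Z x₀ y))) (cong₂ _+_ (cong suc (Vecₚ.length-toList (Z x₀ y))) lenB))) (f₂ κ))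
          where
          last : Ys q′ (Y y ∷ (C k₀ x₀ y ∷ toList (Z x₀ y)) ++ B) → System G A w 3 q′ (3 + q′)
          last (ys , len , uys , aYs) = subst (λ j → System G A w 3 j (3 + q′)) (trans (length-map Y ys) len) (system y aY aZ aC ys uys aYs)

    -- Colours constant along the row `x₀` are vertices `p` and `p′` that every column sees there,
    -- so the starter can run from `Y y′` over `X x₀` and `p` to `Y y₁`. Its edges are filled up by
    -- `p′`, by a further column `Y y″`, and by a vertex `u` that extends the face with `p` in place
    -- of `X x₀`; `P` consists of `p`, `p′` and `u`.
    spread-odd-constant : IsConst (λ y → C k x₀ y) → IsConst (λ y → C k′ x₀ y) → System G A w 3 q′ (3 + q′)
    spread-odd-constant ck ck′ = step₀ (fullX k x₀ y₁ (X x₀ ∷ p′ ∷ []) ≤-refl)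
      where
      p = C k x₀ y₁
      p′ = C k′ x₀ y₁
      p≢p′ : p ≢ p′
      p≢p′ e = k≢k′ (C-dist e)
      module Build (u : Fin n) (u∉ : u ∉ X x₀ ∷ p′ ∷ []) (eu : Edge G (u ∷ p ∷ Y y₁ ∷ toList (Z x₀ y₁)))
        (y″ : Fin My) (aY″ : Y y″ ∉ u ∷ Y y₁ ∷ []) (aZ″ : ∀ {z} → z ∈ toList (Z x₀ y″) → z ∉ u ∷ Y y₁ ∷ [])
        (y′ : Fin My) (aY′ : Y y′ ∉ Y y″ ∷ u ∷ Y y₁ ∷ []) (aZ′ : ∀ {z} → z ∈ toList (Z x₀ y′) → z ∉ Y y″ ∷ u ∷ Y y₁ ∷ [])
        (ys : List (Fin My)) (uys : Unique ys) (aYs : ∀ {y} → y ∈ ys → Y y ∉ Y y′ ∷ Y y″ ∷ u ∷ Y y₁ ∷ []) where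
        D : Vec (Fin n) (suc κ)
        D = u ∷ Z x₀ y₁
        cen : List (Fin n)
        cen = Y y′ ∷ p ∷ Y y₁ ∷ map Y ys
        pt∉ : ∀ {z} → (∀ {y} → z ≢ Y y) → z ∉ map Y ys
        pt∉ h r with ∈-map⁻ Y r
        ... | y , _ , e = h e
        ucen : Unique cen
        ucen = Unique-∷ (λ { (here e) → C≢Y (sym e) ; (there (here e)) → aY′ (there (there (here e))) ; (there (there r)) → ∉Ys aYs (here refl) r })
          (Unique-∷ (λ { (here e) → C≢Y e ; (there r) → pt∉ C≢Y r }) (Unique-∷ (λ r → ∉Ys aYs (there (there (there (here refl)))) r) (Unique-Ys uys)))
        Z∉cen : ∀ {y z} → z ∈ toList (Z x₀ y) → z ∉ cen
        Z∉cen r (here refl) = Y∉Z r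
        Z∉cen r (there (here refl)) = C∉Z r
        Z∉cen r (there (there (here refl))) = Y∉Z r
        Z∉cen r (there (there (there s))) = pt∉ (λ { refl → Y∉Z r }) s
        ch : Cherry G (Y y′) p cen
        ch = box-cherry y′ y″ x₀ p′ (Y y″) (λ { refl → aY′ (here refl) }) (headC k′ x₀ y₁) (headY y″) C≢Y
          (subst (λ c → Edge G (Y y′ ∷ X x₀ ∷ c ∷ toList (Z x₀ y′))) (ck′ y′ y₁)
            (Edge-↭ G (↭-trans (swap _ _ ↭-refl) (↭-trans (prep _ (swap _ _ ↭-refl)) (swap _ _ ↭-refl))) (C-edge k′ x₀ y′)))
          (subst (λ c → Edge G (X x₀ ∷ c ∷ Y y″ ∷ toList (Z x₀ y″))) (ck y″ y₁) (Edge-↭ G (swap _ _ ↭-refl) (C-edge k x₀ y″)))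
          (λ { (here e) → X≢Y e ; (there (here e)) → C≢X (sym e) ; (there (there (here e))) → X≢Y e ; (there (there (there r))) → pt∉ X≢Y r })
          Z∉cen Z∉cen
          (λ { (here e) → C≢Y e ; (there (here e)) → p≢p′ (sym e) ; (there (there (here e))) → C≢Y e ; (there (there (there r))) → pt∉ C≢Y r })
          (λ { (here e) → aY′ (here (sym e)) ; (there (here e)) → C≢Y (sym e) ; (there (there (here e))) → aY″ (there (here e)) ; (there (there (there r))) → ∉Ys aYs (there (here refl)) r })
        u-edge : Unique (u ∷ p ∷ Y y₁ ∷ toList (Z x₀ y₁))
        u-edge = Edge-Unique G (cong (3 +_) (Vecₚ.length-toList (Z x₀ y₁))) eu
        u∉edge : u ∉ p ∷ Y y₁ ∷ toList (Z x₀ y₁)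
        u∉edge = Unique[x∷xs]⇒x∉xs u-edge
        u∩ : u ∉ cen ++ cherry-list ch
        u∩ r = [ in-cen , in-ch ]′ (∈-++⁻ cen r)
          where
          in-cen : u ∉ cen
          in-cen (here e) = aY′ (there (here (sym e)))
          in-cen (there (here e)) = u∉edge (here e)
          in-cen (there (there (here e))) = u∉edge (there (here e))
          in-cen (there (there (there s))) = ∉Ys aYs (there (there (here refl))) s
          in-ch : u ∉ cherry-list ch
          in-ch s with ∈-++⁻ (p′ ∷ toList (Z x₀ y′)) (cherry-list∈ ch s)
          ... | inj₁ (here e) = u∉ (there (here e))
          ... | inj₁ (there t) = aZ′ t (there (here refl))
          ... | inj₂ (here e) = u∉ (here e)
          ... | inj₂ (there (here e)) = aY″ (here (sym e))
          ... | inj₂ (there (there t)) = aZ″ t (here refl)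
        Z∩ : ∀ {z} → z ∈ toList (Z x₀ y₁) → z ∉ cen ++ cherry-list ch
        Z∩ {z} q r = [ Z∉cen q , in-ch ]′ (∈-++⁻ cen r)
          where
          in-ch : z ∉ cherry-list ch
          in-ch s with ∈-++⁻ (p′ ∷ toList (Z x₀ y′)) (cherry-list∈ ch s)
          ... | inj₁ (here refl) = C∉Z q
          ... | inj₁ (there t) = Z-disjoint (λ { refl → aY′ (there (there (here refl))) }) q t
          ... | inj₂ (here refl) = X∉Z q
          ... | inj₂ (there (here refl)) = Y∉Z q
          ... | inj₂ (there (there t)) = Z-disjoint (λ { refl → aY″ (there (here refl)) }) q t
        off-ch : ∀ {z} → z ∈ cherry-list ch → z ∈ p ∷ p′ ∷ u ∷ [] ⊎ z ∉ A
        off-ch s with ∈-++⁻ (p′ ∷ toList (Z x₀ y′)) (cherry-list∈ ch s)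
        ... | inj₁ (here e) = inj₁ (there (here e))
        ... | inj₁ (there t) = inj₂ (Z∉A t)
        ... | inj₂ (here refl) = inj₂ X∉A
        ... | inj₂ (there (here refl)) = inj₂ Y∉A
        ... | inj₂ (there (there t)) = inj₂ (Z∉A t)
        system : System G A w 3 (length (map Y ys)) (3 + q′)
        system = odd-system (Y y′) p (Y y₁) (map Y ys) ucen ch id D (Edge-↭ G (↭-trans (swap _ _ ↭-refl) (prep _ (swap _ _ ↭-refl))) eu)
          (Unique-∷ (λ r → u∉edge (there (there r))) (Z-unique x₀ y₁))
          (λ { (here refl) → u∩ ; (there q) → Z∩ q })
          (links-Y y₁ ys y′ (Unique-∷ (λ r → ∉Ys aYs (there (there (there (here refl)))) (∈-map⁺ Y r)) uys)
            (λ { (here refl) → aY′ (there (there (here refl))) ; (there r) → ∉Ys aYs (here refl) (∈-map⁺ Y r) }))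
          (p ∷ p′ ∷ u ∷ []) (m≤m+n 3 q′)
          (λ { (here refl) → inj₂ Y∉A ; (there (here e)) → inj₁ (here e) ; (there (there (here refl))) → inj₂ Y∉A ; (there (there (there r))) → off-Ys {ys = ys} r })
          off-ch (λ { (here e) → inj₁ (there (there (here e))) ; (there q) → inj₂ (Z∉A q) })
      f₁ : ∀ q κ → 2 + (18 + (q + 4 * κ)) ≡ 20 + q + 4 * κ
      f₁ = solve-∀
      f₂ : ∀ q κ → 3 + (17 + (q + 4 * κ)) ≡ 20 + q + 4 * κ
      f₂ = solve-∀
      step₀ : (∃ λ u → u ∉ X x₀ ∷ p′ ∷ [] × Edge G (u ∷ p ∷ Y y₁ ∷ toList (Z x₀ y₁))) → System G A w 3 q′ (3 + q′)
      step₀ (u , u∉ , eu) = step₁ (fresh-spoke [] [] z≤n (u ∷ Y y₁ ∷ []) (fits′ (u ∷ Y y₁ ∷ []) (18 + (q′ + 4 * κ)) refl (f₁ q′ κ)))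
        where
        step₁ : (∃ λ y → Y y ∉ u ∷ Y y₁ ∷ [] × (∀ {z} → z ∈ toList (Z x₀ y) → z ∉ u ∷ Y y₁ ∷ []) × All (λ e → e y ∉ u ∷ Y y₁ ∷ []) []) → System G A w 3 q′ (3 + q′)
        step₁ (y″ , aY″ , aZ″ , _) = step₂ (fresh-spoke [] [] z≤n (Y y″ ∷ u ∷ Y y₁ ∷ []) (fits′ (Y y″ ∷ u ∷ Y y₁ ∷ []) (17 + (q′ + 4 * κ)) refl (f₂ q′ κ)))
          where
          step₂ : (∃ λ y → Y y ∉ Y y″ ∷ u ∷ Y y₁ ∷ [] × (∀ {z} → z ∈ toList (Z x₀ y) → z ∉ Y y″ ∷ u ∷ Y y₁ ∷ []) × All (λ e → e y ∉ Y y″ ∷ u ∷ Y y₁ ∷ []) []) → System G A w 3 q′ (3 + q′)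
          step₂ (y′ , aY′ , aZ′ , _) = step₃ (more-ys (Y y′ ∷ Y y″ ∷ u ∷ Y y₁ ∷ []) (16 + 4 * κ) refl refl)
            where
            step₃ : Ys q′ (Y y′ ∷ Y y″ ∷ u ∷ Y y₁ ∷ []) → System G A w 3 q′ (3 + q′)
            step₃ (ys , len , uys , aYs) = subst (λ j → System G A w 3 j (3 + q′)) (trans (length-map Y ys) len)
              (Build.system u u∉ eu y″ aY″ aZ″ y′ aY′ aZ′ ys uys aYs)

take⊆ : ∀ {A : Set} m (xs : List A) {x} → x ∈ take m xs → x ∈ xs
take⊆ (suc m) (x ∷ xs) (here p)  = here p
take⊆ (suc m) (x ∷ xs) (there p) = there (take⊆ m xs p)

others : ∀ {q′} (k k* : Fin (3 + q′)) → Σ (Fin (3 + q′)) λ k₀ → Σ (List (Fin (3 + q′))) λ ks →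
  length ks ≡ q′ × Unique (k₀ ∷ ks) × (∀ {i} → i ∈ k₀ ∷ ks → i ≢ k × i ≢ k*)
others {q′} k k* = cut (take (suc q′) F) (trans (length-take (suc q′) F) (m≤n⇒m⊓n≡m big)) (Uniqueₚ.take⁺ (suc q′) (Uniqueₚ.filter⁺ ok? (allFin⁺ _)))
    (λ p → proj₂ (∈-filter⁻ ok? {xs = allFin (3 + q′)} (take⊆ (suc q′) F p)))
  where
  ok? : ∀ i → Dec (i ≢ k × i ≢ k*)
  ok? i = ¬? (i ≟ k) ×-dec ¬? (i ≟ k*)
  F = filter ok? (allFin (3 + q′))
  cover : ∀ {i} → i ∈ allFin (3 + q′) → i ∈ k ∷ k* ∷ F
  cover {i} p with i ≟ k | i ≟ k*
  ... | yes e | _     = here e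
  ... | no _  | yes e = there (here e)
  ... | no a  | no c  = there (there (∈-filter⁺ ok? p (a , c)))
  big : suc q′ ≤ length F
  big = +-cancelˡ-≤ 2 _ _ (≤-trans (≤-reflexive (sym (length-allFin (3 + q′)))) (Unique-⊆⇒≤ (allFin⁺ (3 + q′)) cover))
  cut : ∀ ks → length ks ≡ suc q′ → Unique ks → (∀ {i} → i ∈ ks → i ≢ k × i ≢ k*) → Σ (Fin (3 + q′)) λ k₀ → Σ (List (Fin (3 + q′))) λ ks →
    length ks ≡ q′ × Unique (k₀ ∷ ks) × (∀ {i} → i ∈ k₀ ∷ ks → i ≢ k × i ≢ k*)
  cut (k₀ ∷ ks) len u h = k₀ , ks , cong pred len , u , h

-- Case analysis over the kinds of colours in a box

data Shade : Set where cst ysp xsp : Shade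

shade : ∀ {Mx My n} {c : Fin Mx → Fin My → Fin n} → Colouring c → Shade
shade (const _ _)   = cst
shade (y-inj _ _ _) = ysp
shade (x-inj _)     = xsp

_≟ₛ_ : (s t : Shade) → Dec (s ≡ t)
cst ≟ₛ cst = yes refl
cst ≟ₛ ysp = no λ ()
cst ≟ₛ xsp = no λ ()
ysp ≟ₛ cst = no λ ()
ysp ≟ₛ ysp = yes refl
ysp ≟ₛ xsp = no λ ()
xsp ≟ₛ cst = no λ ()
xsp ≟ₛ ysp = no λ ()
xsp ≟ₛ xsp = yes refl

module _ {κ : ℕ} (q′ w : ℕ) where

  private
    -- Grid sizes, to be read backwards from use: more than `S₀` rows and columns are what `Systems`
    -- needs, and two spread colours take two applications of `ramsey`, each at the cost of a
    -- square.
    S₀ S₁ S₂ S₃ : ℕ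
    S₀ = (4 + (κ + κ)) * (3 + w)
    S₁ = suc S₀
    S₂ = suc (S₁ * S₁)
    S₃ = suc (S₂ * S₂)
    S₀<S₁ : S₀ < S₁
    S₀<S₁ = ≤-refl
    S₀<S₃ : S₀ < S₃
    S₀<S₃ = s≤s (≤-trans (n≤1+n S₀) (≤-trans (m≤m*n S₁ S₁) (≤-trans (n≤1+n _) (m≤m*n S₂ S₂))))

  SystemPair : ∀ {n} → RGraph (3 + κ) n → List (Fin n) → Set
  SystemPair G A = System G A w 2 (suc q′) (3 + q′) × System G A w 3 q′ (3 + q′)

  module _ {n : ℕ} {G : RGraph (3 + κ) n} {A : List (Fin n)} (A≤ : length A + (20 + q′ + 4 * κ) ≤ w) where

    -- Along one row each spread colour is made constant or injective in `y`. One injective colour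
    -- is enough for the rainbow construction; otherwise both are constant.
    two-spread : ∀ (b : Box G A (3 + q′) S₃ S₃) {k k′} → k ≢ k′ → BoxLemmas.XInj b k → BoxLemmas.XInj b k′ → SystemPair G A
    two-spread b {k} {k′} k≢ xi xi′ = step₁ (ramsey S₂ (λ y → C k zero y) ≤-refl)
      where
      open Box b
      Types : (β : Fin S₁ → Fin S₃) → Fin (3 + q′) → Set
      Types β k = IsConst (λ y → C k zero (β y)) ⊎ Inj (λ y → C k zero (β y))
      finish : (β : Fin S₁ → Fin S₃) → Inj β → Types β k → Types β k′ → SystemPair G A
      finish β β-inj t t′ = spread-even k≢ (λ y → xi (β y)) xi″ , odd t t′
        where
        open Systems (Box-restrict {Mx′ = S₃} id β (mkInj id) β-inj b) w S₀<S₃ S₀<S₁ A≤ zero zero (suc zero) (λ ())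
        xi″ : ∀ y → Inj (λ x → C k′ x (β y))
        xi″ y = xi′ (β y)
        odd : Types β k → Types β k′ → System G A w 3 q′ (3 + q′)
        odd (inj₂ i) _         = spread-odd-rainbow k≢ (λ y → xi (β y)) xi″ k i
        odd (inj₁ _) (inj₂ i)  = spread-odd-rainbow k≢ (λ y → xi (β y)) xi″ k′ i
        odd (inj₁ c) (inj₁ c′) = spread-odd-constant k≢ (λ y → xi (β y)) xi″ c c′
      step₂ : (β : Fin S₂ → Fin S₃) → Inj β → IsConst (λ y → C k zero (β y)) ⊎ Inj (λ y → C k zero (β y)) →
        (Σ (Fin S₁ → Fin S₂) λ ι → Inj ι × (IsConst (λ y → C k′ zero (β (ι y))) ⊎ Inj (λ y → C k′ zero (β (ι y))))) → SystemPair G A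
      step₂ β β-inj t (ι , ι-inj , t′) = finish (β ∘ ι) (ι-inj ⨾ β-inj) (sub t) t′
        where
        sub : IsConst (λ y → C k zero (β y)) ⊎ Inj (λ y → C k zero (β y)) → Types (β ∘ ι) k
        sub (inj₁ c) = inj₁ (λ i j → c (ι i) (ι j))
        sub (inj₂ i) = inj₂ (ι-inj ⨾ i)
      step₁ : (Σ (Fin S₂ → Fin S₃) λ ι → Inj ι × (IsConst (λ y → C k zero (ι y)) ⊎ Inj (λ y → C k zero (ι y)))) → SystemPair G A
      step₁ (β , β-inj , t) = step₂ β β-inj t (ramsey S₁ (λ y → C k′ zero (β y)) ≤-refl)

    one-spread′ : ∀ (b : Box G A (3 + q′) S₃ S₃) (k k* : Fin (3 + q′)) (ρ : Fin n) → BoxLemmas.XInj b k → (∀ x → Box.C b k* x (suc zero) ≡ ρ) →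
      (∀ i → i ≢ k → i ≢ k* → BoxLemmas.Const b i) → SystemPair G A
    one-spread′ b k k* ρ xi eρ cs = build (others k k*)
      where
      open Systems b w S₀<S₃ S₀<S₃ A≤ zero zero (suc zero) (λ ())
      build : (Σ (Fin (3 + q′)) λ k₀ → Σ (List (Fin (3 + q′))) λ ks → length ks ≡ q′ × Unique (k₀ ∷ ks) × (∀ {i} → i ∈ k₀ ∷ ks → i ≢ k × i ≢ k*)) → SystemPair G A
      build (k₀ , ks , len , u , h) = one-spread {k} {k*} {ρ} k₀ ks len u (λ p → cs _ (proj₁ (h p)) (proj₂ (h p))) (λ p → proj₂ (h p) refl) xi eρ

    -- Two colours spread the same way settle the matter, after an exchange of the sides if need be.
    -- Otherwise at most one colour is spread each way. A colour that depends on `y` alone is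
    -- constant on a column, so it can be the `k*` of `one-spread′`; failing such a colour, any
    -- other one is taken.
    coloured-box : (b : Box G A (3 + q′) S₃ S₃) → (∀ k → Colouring (Box.C b k)) → SystemPair G A
    coloured-box b t = go₁ (pair? xsp)
      where
      open Box b
      Is : Shade → Fin (3 + q′) → Set
      Is s k = shade (t k) ≡ s
      Pair : Shade → Set
      Pair s = ∃ λ k → ∃ λ k′ → k ≢ k′ × Is s k × Is s k′
      pair? : ∀ s → Dec (Pair s)
      pair? s = any? (λ k → any? (λ k′ → ¬? (k ≟ k′) ×-dec (shade (t k) ≟ₛ s) ×-dec (shade (t k′) ≟ₛ s)))
      some? : ∀ s → Dec (∃ λ k → Is s k)
      some? s = any? (λ k → shade (t k) ≟ₛ s)
      isX : ∀ {k} → Is xsp k → ∀ y → Inj (λ x → C k x y)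
      isX {k} e with t k
      isX refl | x-inj i = i
      isY : ∀ {k} → Is ysp k → Σ (Fin S₃ → Fin n) λ h → Inj h × (∀ x y → C k x y ≡ h y)
      isY {k} e with t k
      isY refl | y-inj h i p = h , i , p
      isC : ∀ {k} → ¬ Is xsp k → ¬ Is ysp k → ∀ x y x′ y′ → C k x y ≡ C k x′ y′
      isC {k} ¬x ¬y with t k
      ... | const a p   = λ x y x′ y′ → trans (p x y) (sym (p x′ y′))
      ... | y-inj _ _ _ = ⊥-elim (¬y refl)
      ... | x-inj _     = ⊥-elim (¬x refl)
      isY′ : ∀ {k} → Is ysp k → ∀ x → Inj (λ y → C k x y)
      isY′ e x with isY e
      ... | h , i , p = mkInj (λ {y} {y′} eq → inj i (trans (sym (p x y)) (trans eq (p x y′))))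
      unique-shade : ∀ {s} → ¬ Pair s → ∀ {k i} → Is s k → i ≢ k → ¬ Is s i
      unique-shade ¬p {k} {i} e ne e′ = ¬p (i , k , ne , e′ , e)
      other : Fin (3 + q′) → Fin (3 + q′)
      other k = punchIn k zero
      go₄ : ¬ Pair ysp → ¬ (∃ λ k → Is xsp k) → Dec (∃ λ k → Is ysp k) → SystemPair G A
      go₄ ¬yy ¬x (no ¬y) = Systems.all-const b w S₀<S₃ S₀<S₃ A≤ zero zero (suc zero) (λ ()) (λ k → isC (λ e → ¬x (k , e)) (λ e → ¬y (k , e)))
      go₄ ¬yy ¬x (yes (k , e)) = one-spread′ (Box-sym b) k (other k) (C (other k) (suc zero) zero) (isY′ e)
        (λ y → isC (λ e → ¬x (_ , e)) (unique-shade ¬yy e (punchInᵢ≢i k zero)) (suc zero) y (suc zero) zero)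
        (λ i ne _ y x y′ x′ → isC (λ e → ¬x (_ , e)) (unique-shade ¬yy e ne) x y x′ y′)
      go₃ : ¬ Pair xsp → ¬ Pair ysp → Dec (∃ λ k → Is xsp k) → Dec (∃ λ k → Is ysp k) → SystemPair G A
      go₃ ¬xx ¬yy (no ¬x) y? = go₄ ¬yy ¬x y?
      go₃ ¬xx ¬yy (yes (k , e)) (yes (k* , e*)) = one-spread′ b k k* (proj₁ (isY e*) (suc zero)) (isX e) (λ x → proj₂ (proj₂ (isY e*)) x (suc zero))
        (λ i ne ne* → isC (unique-shade ¬xx e ne) (unique-shade ¬yy e* ne*))
      go₃ ¬xx ¬yy (yes (k , e)) (no ¬y) = one-spread′ b k (other k) (C (other k) zero (suc zero)) (isX e)
        (λ x → isC (unique-shade ¬xx e (punchInᵢ≢i k zero)) (λ e → ¬y (_ , e)) x (suc zero) zero (suc zero))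
        (λ i ne _ → isC (unique-shade ¬xx e ne) (λ e → ¬y (_ , e)))
      go₂ : ¬ Pair xsp → Dec (Pair ysp) → SystemPair G A
      go₂ ¬xx (yes (k , k′ , ne , e , e′)) = two-spread (Box-sym b) ne (isY′ e) (isY′ e′)
      go₂ ¬xx (no ¬yy) = go₃ ¬xx ¬yy (some? xsp) (some? ysp)
      go₁ : Dec (Pair xsp) → SystemPair G A
      go₁ (yes (k , k′ , ne , e , e′)) = two-spread b ne (isX e) (isX e′)
      go₁ (no ¬xx) = go₂ ¬xx (pair? ysp)

  box-size : ℕ
  box-size = proj₁ (canonical (3 + q′) S₃ S₃ (s≤s z≤n))

  box⇒systems : ∀ {n} {G : RGraph (3 + κ) n} {A : List (Fin n)} → length A + (20 + q′ + 4 * κ) ≤ w → Box G A (3 + q′) box-size box-size → SystemPair G A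
  box⇒systems {n} {G} {A} A≤ b = finish (proj₂ (canonical (3 + q′) S₃ S₃ (s≤s z≤n)) (Box.C b))
    where
    finish : (Σ (Fin S₃ → Fin box-size) λ α → Σ (Fin S₃ → Fin box-size) λ β → Inj α × Inj β × (∀ k → Colouring (λ x y → Box.C b k (α x) (β y)))) → SystemPair G A
    finish (α , β , iα , iβ , t) = coloured-box A≤ (Box-restrict α β iα iβ b) t

-- Tuples, random separation and robust pairs

-- Faces are counted as ordered tuples with repetitions allowed, which makes their total exactly
-- `n ^ k`.
allTup : (n k : ℕ) → List (Vec (Fin n) k)
allTup n zero    = [ [] ]
allTup n (suc k) = concatMap (λ x → map (x ∷_) (allTup n k)) (allFin n)

∑-allTup : ∀ n k (f : Vec (Fin n) (suc k) → ℕ) → ∑ (allTup n (suc k)) f ≡ ∑ (allFin n) (λ x → ∑ (allTup n k) (λ v → f (x ∷ v)))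
∑-allTup n k f = trans (∑-concatMap _ (allFin n) f) (∑-cong (allFin n) (λ x → ∑-map (x ∷_) (allTup n k) f))

length-allTup : ∀ n k → length (allTup n k) ≡ n ^ k
length-allTup n k = trans (sym (*-identityʳ _)) (trans (sym (∑-const (allTup n k) 1)) (go k))
  where
  go : ∀ k → ∑ (allTup n k) (λ _ → 1) ≡ n ^ k
  go zero    = refl
  go (suc k) = trans (∑-allTup n k (λ _ → 1)) (trans (∑-cong (allFin n) (λ _ → go k)) (trans (∑-const (allFin n) (n ^ k)) (cong (_* n ^ k) (length-allFin n))))

Hit : (W : List (Fin n)) → ∀ {k} → Vec (Fin n) k → Set
Hit W v = Any (_∈ W) (toList v)

Hit? : ∀ (W : List (Fin n)) {k} (v : Vec (Fin n) k) → Dec (Hit W v)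
Hit? W v = Any.any? (_∈? W) (toList v)

¬Hit⇒∉ : ∀ {W : List (Fin n)} {k} {v : Vec (Fin n) k} → ¬ Hit W v → ∀ {z} → z ∈ toList v → z ∉ W
¬Hit⇒∉ {v = v} h z∈ zW = h (lose z∈ zW)

-- A union bound over the `k` positions, multiplied by `n` so that no exponent below `k` has to be
-- written.
hit-count : ∀ {n} (W : List (Fin n)) k → n * count (Hit? W) (allTup n k) ≤ k * (length W * n ^ k)
hit-count {n} W zero = ≤-reflexive (*-zeroʳ n)
hit-count {n} W (suc k) = begin
  n * count (Hit? W) (allTup n (suc k))                                                       ≡⟨ cong (n *_) (∑-allTup n k _) ⟩
  n * ∑ (allFin n) (λ x → ∑ (allTup n k) (λ v → ind (Hit? W (x ∷ v))))                        ≤⟨ *-monoʳ-≤ n (∑-mono (allFin n) (λ x → ∑-mono (allTup n k) (λ v → ind-∪ (Hit? W (x ∷ v)) (x ∈? W) (Hit? W v) λ { (here p) → inj₁ p ; (there p) → inj₂ p }))) ⟩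
  n * ∑ (allFin n) (λ x → ∑ (allTup n k) (λ v → ind (x ∈? W) + ind (Hit? W v)))               ≡⟨ cong (n *_) (∑-cong (allFin n) (λ x → trans (∑-+ (allTup n k) _ _) (cong (_+ h) (trans (∑-const (allTup n k) _) (cong (_* ind (x ∈? W)) (length-allTup n k)))))) ⟩
  n * ∑ (allFin n) (λ x → n ^ k * ind (x ∈? W) + h)                                           ≡⟨ cong (n *_) (trans (∑-+ (allFin n) _ _) (cong₂ _+_ (∑-* (allFin n) (n ^ k) _) (trans (∑-const (allFin n) h) (cong (_* h) (length-allFin n))))) ⟩
  n * (n ^ k * count (_∈? W) (allFin n) + n * h)                                              ≡⟨ *-distribˡ-+ n (n ^ k * count (_∈? W) (allFin n)) (n * h) ⟩
  n * (n ^ k * count (_∈? W) (allFin n)) + n * (n * h)                                        ≤⟨ +-mono-≤ (*-monoʳ-≤ n (*-monoʳ-≤ (n ^ k) (count-∈≤ W))) (*-monoʳ-≤ n (hit-count W k)) ⟩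
  n * (n ^ k * length W) + n * (k * (length W * n ^ k))                                       ≡⟨ e n (n ^ k) (length W) k ⟩
  suc k * (length W * n ^ suc k)                                                              ∎
  where
  open ≤-Reasoning
  h = count (Hit? W) (allTup n k)
  e : ∀ n p w k → n * (p * w) + n * (k * (w * p)) ≡ suc k * (w * (n * p))
  e = solve-∀

-- Densities are kept as N ≤ m * X, so that no division occurs.
loss : ∀ n N m X Y Z c → .{{_ : NonZero n}} → N ≤ m * X → X ≤ Y + Z → n * Z ≤ c * N → 2 * m * c ≤ n → N ≤ 2 * m * Y
loss n N m X Y Z c d s z big = *-cancelˡ-≤ n (+-cancelʳ-≤ (n * N) _ _ (begin
  n * N + n * N                       ≤⟨ +-mono-≤ (*-monoʳ-≤ n d) (*-monoʳ-≤ n d) ⟩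
  n * (m * X) + n * (m * X)           ≤⟨ +-mono-≤ (*-monoʳ-≤ n (*-monoʳ-≤ m s)) (*-monoʳ-≤ n (*-monoʳ-≤ m s)) ⟩
  n * (m * (Y + Z)) + n * (m * (Y + Z)) ≡⟨ e₁ n m Y Z ⟩
  n * (2 * m * Y) + 2 * m * (n * Z)   ≤⟨ +-monoʳ-≤ (n * (2 * m * Y)) (*-monoʳ-≤ (2 * m) z) ⟩
  n * (2 * m * Y) + 2 * m * (c * N)   ≡⟨ cong (n * (2 * m * Y) +_) (sym (*-assoc (2 * m) c N)) ⟩
  n * (2 * m * Y) + 2 * m * c * N     ≤⟨ +-monoʳ-≤ (n * (2 * m * Y)) (*-monoˡ-≤ N big) ⟩
  n * (2 * m * Y) + n * N             ∎))
  where
  open ≤-Reasoning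
  e₁ : ∀ n m y z → n * (m * (y + z)) + n * (m * (y + z)) ≡ n * (2 * m * y) + 2 * m * (n * z)
  e₁ = solve-∀

∑-allFin-suc : ∀ n (f : Fin (suc n) → ℕ) → ∑ (allFin (suc n)) f ≡ f zero + ∑ (allFin n) (f ∘ suc)
∑-allFin-suc n f = cong (f zero +_) (trans (cong (λ l → ∑ l f) (sym (map-tabulate id suc))) (∑-map suc (allFin n) f))

-- Random vertex sets that separate colours from faces

data Demand : Set where wanted banned free : Demand

Agree : ∀ {n} → Vec Demand n → Subset n → Set
Agree d T = ∀ i → (lookup d i ≡ wanted → lookup T i ≡ true) × (lookup d i ≡ banned → lookup T i ≡ false)

agreeᵇ : Demand → Bool → Bool
agreeᵇ wanted b = b
agreeᵇ banned b = not b
agreeᵇ free   b = true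

agree : ∀ {n} → Vec Demand n → Subset n → Bool
agree []      []      = true
agree (d ∷ D) (t ∷ T) = agreeᵇ d t ∧ agree D T

agree-sound : ∀ {n} (D : Vec Demand n) S → T (agree D S) → Agree D S
agree-sound (d ∷ D) (t ∷ S) h with Equivalence.to (T-∧ {agreeᵇ d t}) h
... | h₁ , h₂ = λ { zero → one d t h₁ ; (suc i) → agree-sound D S h₂ i }
  where
  one : ∀ d t → T (agreeᵇ d t) → (d ≡ wanted → t ≡ true) × (d ≡ banned → t ≡ false)
  one wanted true  _ = (λ _ → refl) , λ ()
  one banned false _ = (λ ()) , λ _ → refl
  one free   t     _ = (λ ()) , λ ()

strict : Demand → ℕ
strict free = 0
strict _    = 1

strictness : ∀ {n} → Vec Demand n → ℕ
strictness []      = 0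
strictness (d ∷ D) = strict d + strictness D

agree-count : ∀ {n} (D : Vec Demand n) → 2 ^ n ≤ 2 ^ strictness D * count (λ S → T? (agree D S)) (allSubsets n)
agree-count [] = ≤-refl
agree-count {suc n} (d ∷ D) = ≤-trans (*-monoʳ-≤ 2 (agree-count D)) (≤-trans (step d) (≤-reflexive (cong (2 ^ (strict d + strictness D) *_)
    (sym (trans (∑-++ (map (true ∷_) (allSubsets n)) _ _) (cong₂ _+_ (∑-map (true ∷_) (allSubsets n) _) (∑-map (false ∷_) (allSubsets n) _)))))))
  where
  c = count (λ S → T? (agree D S)) (allSubsets n)
  s = 2 ^ strictness D
  step : ∀ d → 2 * (s * c) ≤ 2 ^ (strict d + strictness D) * (∑ (allSubsets n) (λ S → ind (T? (agreeᵇ d true ∧ agree D S))) + ∑ (allSubsets n) (λ S → ind (T? (agreeᵇ d false ∧ agree D S))))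
  step wanted = ≤-trans (≤-reflexive (sym (*-assoc 2 s c))) (*-monoʳ-≤ (2 * s) (m≤m+n c _))
  step banned = ≤-trans (≤-reflexive (sym (*-assoc 2 s c))) (*-monoʳ-≤ (2 * s) (m≤n+m c _))
  step free   = ≤-reflexive (e s c)
    where
    e : ∀ s c → 2 * (s * c) ≡ s * (c + c)
    e = solve-∀

length-allSubsets : ∀ n → length (allSubsets n) ≡ 2 ^ n
length-allSubsets zero = refl
length-allSubsets (suc n) = trans (length-++ (map (true ∷_) (allSubsets n)))
  (trans (cong₂ _+_ (trans (length-map _ (allSubsets n)) (length-allSubsets n)) (trans (length-map _ (allSubsets n)) (length-allSubsets n))) (cong (2 ^ n +_) (sym (+-identityʳ _))))

-- A uniformly random vertex set meets a demand of strictness d with probability at least 2⁻ᵈ.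
random-set : ∀ {A : Set} {n} (xs : List A) (D : A → Vec Demand n) d → (∀ a → strictness (D a) ≤ d) →
  ∃ λ (S : Subset n) → length xs ≤ 2 ^ d * count (λ a → T? (agree (D a) S)) xs
random-set {n = n} xs D d h = go (search (allSubsets n) (Any.any? (λ S → length xs ≤? 2 ^ d * f S) (allSubsets n)))
  where
  f : Subset n → ℕ
  f S = count (λ a → T? (agree (D a) S)) xs
  total : length xs * 2 ^ n ≤ 2 ^ d * ∑ (allSubsets n) f
  total = begin
    length xs * 2 ^ n                                                          ≡⟨ ∑-const xs (2 ^ n) ⟨
    ∑ xs (λ _ → 2 ^ n)                                                         ≤⟨ ∑-mono xs (λ a → ≤-trans (agree-count (D a)) (*-monoˡ-≤ _ (^-monoʳ-≤ 2 (h a)))) ⟩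
    ∑ xs (λ a → 2 ^ d * count (λ S → T? (agree (D a) S)) (allSubsets n))       ≡⟨ ∑-* xs (2 ^ d) _ ⟩
    2 ^ d * ∑ xs (λ a → count (λ S → T? (agree (D a) S)) (allSubsets n))       ≡⟨ cong (2 ^ d *_) (∑-swap xs (allSubsets n) _) ⟩
    2 ^ d * ∑ (allSubsets n) f                                                 ∎
    where open ≤-Reasoning
  search : ∀ Ss → Dec (Any (λ S → length xs ≤ 2 ^ d * f S) Ss) → (∃ λ S → length xs ≤ 2 ^ d * f S) ⊎ (∀ S → S ∈ Ss → 2 ^ d * f S < length xs)
  search Ss (yes a) = inj₁ (Any.satisfied a)
  search Ss (no ¬a) = inj₂ (λ S S∈ → ≰⇒> (λ le → ¬a (lose S∈ le)))
  go : (∃ λ S → length xs ≤ 2 ^ d * f S) ⊎ (∀ S → S ∈ allSubsets n → 2 ^ d * f S < length xs) → ∃ λ S → length xs ≤ 2 ^ d * f S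
  go (inj₁ p) = p
  go (inj₂ lt) = ⊥-elim (<-irrefl refl (begin-strict
    length xs * 2 ^ n                                 ≤⟨ total ⟩
    2 ^ d * ∑ (allSubsets n) f                        ≡⟨ ∑-* (allSubsets n) (2 ^ d) f ⟨
    ∑ (allSubsets n) (λ S → 2 ^ d * f S)              <⟨ ∑-< (allSubsets n) (λ S → 2 ^ d * f S) (length xs) nonempty (λ S S∈ → lt S S∈) ⟩
    length (allSubsets n) * length xs                 ≡⟨ cong (_* length xs) (length-allSubsets n) ⟩
    2 ^ n * length xs                                 ≡⟨ *-comm (2 ^ n) (length xs) ⟩
    length xs * 2 ^ n                                 ∎))
    where
    open ≤-Reasoning
    nonempty : 0 < length (allSubsets n)
    nonempty = subst (0 <_) (sym (length-allSubsets n)) (m^n>0 2 n)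
    ∑-< : ∀ {B : Set} (ys : List B) (g : B → ℕ) c → 0 < length ys → (∀ y → y ∈ ys → g y < c) → ∑ ys g < length ys * c
    ∑-< (y ∷ ys) g c _ h = +-mono-<-≤ (h y (here refl)) (≤-trans (∑-mono∈ ys (λ z z∈ → <⇒≤ (h z (there z∈)))) (≤-reflexive (∑-const ys c)))

count-filter : ∀ {A : Set} {P Q : A → Set} (P? : ∀ x → Dec (P x)) (Q? : ∀ x → Dec (Q x)) xs → count Q? (filter P? xs) ≡ count (λ x → P? x ×-dec Q? x) xs
count-filter P? Q? [] = refl
count-filter P? Q? (x ∷ xs) with P? x
... | no _ = count-filter P? Q? xs
... | yes p with Q? x
... | yes q = cong suc (count-filter P? Q? xs)
... | no _  = count-filter P? Q? xs

demand : ∀ {n} → List (Fin n) → List (Fin n) → Fin n → Demand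
demand I O v = if does (v ∈? I) then wanted else (if does (v ∈? O) then banned else free)

demand-wanted : ∀ {n} (I O : List (Fin n)) {v} → v ∈ I → demand I O v ≡ wanted
demand-wanted I O {v} p rewrite dec-true (v ∈? I) p = refl

demand-banned : ∀ {n} (I O : List (Fin n)) {v} → v ∉ I → v ∈ O → demand I O v ≡ banned
demand-banned I O {v} ¬p p rewrite dec-false (v ∈? I) ¬p | dec-true (v ∈? O) p = refl

demand-strictness : ∀ {n} (I O : List (Fin n)) → strictness (tabulate (demand I O)) ≤ length I + length O
demand-strictness {n} I O = ≤-trans (≤-reflexive (go (demand I O))) (≤-trans (∑-mono (allFin n) point)
    (≤-trans (≤-reflexive (∑-+ (allFin n) _ _)) (+-mono-≤ (count-∈≤ I) (count-∈≤ O))))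
  where
  go : ∀ {n} (g : Fin n → Demand) → strictness (tabulate g) ≡ ∑ (allFin n) (λ v → strict (g v))
  go {zero}  g = refl
  go {suc n} g = trans (cong (strict (g zero) +_) (go (g ∘ suc))) (sym (∑-allFin-suc n (λ v → strict (g v))))
  point : ∀ v → strict (demand I O v) ≤ ind (v ∈? I) + ind (v ∈? O)
  point v with does (v ∈? I) | does (v ∈? O)
  ... | true  | _     = s≤s z≤n
  ... | false | true  = ≤-refl
  ... | false | false = z≤n

-- Meant for colours as `I` and the vertices of the face as `O`. One set `S` serves many faces at
-- once, so a colour of one face never coincides with a vertex of another, at the price of a
-- constant factor in the density.
separate : ∀ {A : Set} {n} (xs : List A) (I O : A → List (Fin n)) i o → (∀ a → length (I a) ≤ i) → (∀ a → length (O a) ≤ o) →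
  ∃ λ (S : Subset n) → length xs ≤ 2 ^ (i + o) * count (λ a → T? (agree (tabulate (demand (I a) (O a))) S)) xs
separate xs I O i o hi ho = random-set xs (λ a → tabulate (demand (I a) (O a))) (i + o) (λ a → ≤-trans (demand-strictness (I a) (O a)) (+-mono-≤ (hi a) (ho a)))

separated : ∀ {n} (I O : List (Fin n)) S → T (agree (tabulate (demand I O)) S) → (∀ {v} → v ∈ I → lookup S v ≡ true) × (∀ {v} → v ∉ I → v ∈ O → lookup S v ≡ false)
separated I O S h = (λ {v} p → proj₁ (agree-sound (tabulate (demand I O)) S h v) (trans (Vecₚ.lookup∘tabulate (demand I O) v) (demand-wanted I O p))) ,
  (λ {v} ¬p p → proj₂ (agree-sound (tabulate (demand I O)) S h v) (trans (Vecₚ.lookup∘tabulate (demand I O) v) (demand-banned I O ¬p p)))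

-- Extensions of faces and robust pairs

Edge? : ∀ {r n} (G : RGraph r n) l → Dec (Edge G l)
Edge? G l = map′ mkEdge isEdge (T? (edge G (toSubset l)))

nbr : ∀ {r n} → RGraph r n → List (Fin n) → List (Fin n)
nbr {n = n} G l = filter (λ v → Edge? G (v ∷ l)) (allFin n)

deg : ∀ {r n} → RGraph r n → List (Fin n) → ℕ
deg G l = length (nbr G l)

nbr-edge : ∀ {r n} (G : RGraph r n) l {v} → v ∈ nbr G l → Edge G (v ∷ l)
nbr-edge {n = n} G l p = proj₂ (∈-filter⁻ (λ v → Edge? G (v ∷ l)) {xs = allFin n} p)

nbr-unique : ∀ {r n} (G : RGraph r n) l → Unique (nbr G l)
nbr-unique {n = n} G l = Uniqueₚ.filter⁺ (λ v → Edge? G (v ∷ l)) (allFin⁺ n)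

escape : ∀ {r n} (G : RGraph r n) l W → length W < deg G l → ∃ λ v → v ∉ W × Edge G (v ∷ l)
escape G l W h = pick (Unique-escape (nbr-unique G l) h)
  where
  pick : (∃ λ v → v ∈ nbr G l × v ∉ W) → ∃ λ v → v ∉ W × Edge G (v ∷ l)
  pick (v , p , r) = v , r , nbr-edge G l p

-- The second clause is what `fullX` and `fullY` of a box and the bridges for uniformity three draw
-- on.
Deep : ∀ {r n k} → ℕ → RGraph r n → Vec (Fin n) k → Set
Deep q G f = q ≤ deg G (toList f) × (∀ v → Edge G (v ∷ toList f) → ∀ i → q ≤ deg G (toList (f [ i ]≔ v)))

Deep? : ∀ {r n k} q (G : RGraph r n) (f : Vec (Fin n) k) → Dec (Deep q G f)
Deep? q G f = (q ≤? deg G (toList f)) ×-dec all? (λ v → Edge? G (v ∷ toList f) →-dec all? (λ i → q ≤? deg G (toList (f [ i ]≔ v))))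

take-lookup : ∀ {A : Set} q (xs : List A) (h : q ≤ length xs) i → List.lookup xs (inject≤ i h) ∈ take q xs
take-lookup (suc q) (x ∷ xs) (s≤s h) zero    = here refl
take-lookup (suc q) (x ∷ xs) (s≤s h) (suc i) = there (take-lookup q xs h i)

module Robust {n κ : ℕ} {g : Vec (Fin n) (2 + κ) → Set} (g? : ∀ f → Dec (g f)) (b : ℕ) where

  -- The threshold is the bound of `hit-count` for a list of length `b`: so many completions cannot
  -- all be blocked by `b` vertices.
  Rob : Fin n → Fin n → Set
  Rob u v = κ * (b * n ^ κ) < n * count (λ rest → g? (u ∷ v ∷ rest)) (allTup n κ)

  Rob? : ∀ u v → Dec (Rob u v)
  Rob? u v = κ * (b * n ^ κ) <? n * count (λ rest → g? (u ∷ v ∷ rest)) (allTup n κ)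

  rob-escape : ∀ {u v} → Rob u v → ∀ W → length W ≤ b → ∃ λ rest → g (u ∷ v ∷ rest) × ¬ Hit W rest
  rob-escape {u} {v} rob W W≤ = pick (count-∃ both? (allTup n κ) (≰⇒> none))
    where
    both? : ∀ rest → Dec (g (u ∷ v ∷ rest) × ¬ Hit W rest)
    both? rest = g? (u ∷ v ∷ rest) ×-dec ¬? (Hit? W rest)
    none : ¬ count both? (allTup n κ) ≤ 0
    none z = <-irrefl refl (begin-strict
      κ * (b * n ^ κ)                                             <⟨ rob ⟩
      n * count (λ rest → g? (u ∷ v ∷ rest)) (allTup n κ)         ≤⟨ *-monoʳ-≤ n (count-∪ (λ rest → g? (u ∷ v ∷ rest)) both? (Hit? W) (allTup n κ) (λ rest p → split rest p (Hit? W rest))) ⟩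
      n * (count both? (allTup n κ) + count (Hit? W) (allTup n κ)) ≤⟨ *-monoʳ-≤ n (+-monoˡ-≤ _ z) ⟩
      n * count (Hit? W) (allTup n κ)                             ≤⟨ hit-count W κ ⟩
      κ * (length W * n ^ κ)                                      ≤⟨ *-monoʳ-≤ κ (*-monoˡ-≤ (n ^ κ) W≤) ⟩
      κ * (b * n ^ κ)                                             ∎)
      where
      open ≤-Reasoning
      split : ∀ rest → g (u ∷ v ∷ rest) → Dec (Hit W rest) → (g (u ∷ v ∷ rest) × ¬ Hit W rest) ⊎ Hit W rest
      split rest p (yes h) = inj₂ h
      split rest p (no ¬h) = inj₁ (p , ¬h)
    pick : (∃ λ rest → rest ∈ allTup n κ × g (u ∷ v ∷ rest) × ¬ Hit W rest) → ∃ λ rest → g (u ∷ v ∷ rest) × ¬ Hit W rest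
    pick (rest , _ , p) = rest , p

  Frail : Vec (Fin n) (2 + κ) → Set
  Frail (x ∷ y ∷ rest) = g (x ∷ y ∷ rest) × ¬ Rob x y

  Frail? : ∀ f → Dec (Frail f)
  Frail? (x ∷ y ∷ rest) = g? (x ∷ y ∷ rest) ×-dec ¬? (Rob? x y)

  -- A pair that is not robust carries few tuples by definition. Summed over all `n * n` pairs this
  -- is still only a fraction of order `1 / n` of the tuples.
  frail-count : n * count Frail? (allTup n (2 + κ)) ≤ κ * b * n ^ (2 + κ)
  frail-count = begin
    n * count Frail? (allTup n (2 + κ))                                                        ≡⟨ cong (n *_) (trans (∑-allTup n (suc κ) _) (∑-cong (allFin n) (λ x → ∑-allTup n κ _))) ⟩
    n * ∑ (allFin n) (λ x → ∑ (allFin n) (λ y → ∑ (allTup n κ) (λ r → ind (Frail? (x ∷ y ∷ r))))) ≡⟨ trans (sym (∑-* (allFin n) n _)) (∑-cong (allFin n) (λ x → sym (∑-* (allFin n) n _))) ⟩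
    ∑ (allFin n) (λ x → ∑ (allFin n) (λ y → n * ∑ (allTup n κ) (λ r → ind (Frail? (x ∷ y ∷ r))))) ≤⟨ ∑-mono (allFin n) (λ x → ∑-mono (allFin n) (λ y → point x y (Rob? x y))) ⟩
    ∑ (allFin n) (λ x → ∑ (allFin n) (λ y → κ * (b * n ^ κ)))                                  ≡⟨ trans (∑-cong (allFin n) (λ x → trans (∑-const (allFin n) _) (cong (_* (κ * (b * n ^ κ))) (length-allFin n)))) (trans (∑-const (allFin n) _) (cong (_* (n * (κ * (b * n ^ κ)))) (length-allFin n))) ⟩
    n * (n * (κ * (b * n ^ κ)))                                                                ≡⟨ e n κ b (n ^ κ) ⟩
    κ * b * n ^ (2 + κ)                                                                        ∎
    where
    open ≤-Reasoning
    e : ∀ n κ b p → n * (n * (κ * (b * p))) ≡ κ * b * (n * (n * p))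
    e = solve-∀
    point : ∀ x y → Dec (Rob x y) → n * ∑ (allTup n κ) (λ r → ind (Frail? (x ∷ y ∷ r))) ≤ κ * (b * n ^ κ)
    point x y (yes rb) = ≤-trans (*-monoʳ-≤ n (≤-trans (∑-mono (allTup n κ) (λ r → ≤-reflexive (ind-no (Frail? (x ∷ y ∷ r)) (λ { (_ , nr) → nr rb })))) (≤-reflexive (∑-0 (allTup n κ))))) (≤-trans (≤-reflexive (*-zeroʳ n)) z≤n)
    point x y (no ¬rb) = ≤-trans (*-monoʳ-≤ n (∑-mono (allTup n κ) (λ r → ind-mono (Frail? (x ∷ y ∷ r)) (g? (x ∷ y ∷ r)) proj₁))) (≮⇒≥ ¬rb)

disjoint-choice : ∀ {n κ} N {R : Fin N → Vec (Fin n) κ → Set} b → (∀ i W → length W ≤ b → ∃ λ z → R i z × ¬ Hit W z) →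
  ∀ W → length W + N * κ ≤ b → Σ (Fin N → Vec (Fin n) κ) λ ζ → (∀ i → R i (ζ i)) × (∀ i → ¬ Hit W (ζ i)) ×
    (∀ {i j v} → v ∈ toList (ζ i) → v ∈ toList (ζ j) → i ≡ j)
disjoint-choice zero b h W W≤ = (λ ()) , (λ ()) , (λ ()) , λ { {()} }
disjoint-choice {n} {κ} (suc N) {R} b h W W≤ = first (h zero W (≤-trans (m≤m+n (length W) _) W≤))
  where
  first : (∃ λ z → R zero z × ¬ Hit W z) → _
  first (z , r , av) = rest (disjoint-choice N {λ i → R (suc i)} b (λ i → h (suc i)) (toList z ++ W)
      (≤-trans (≤-reflexive (trans (cong (_+ N * κ) (trans (length-++ (toList z)) (cong (_+ length W) (Vecₚ.length-toList z)))) (e κ (length W) (N * κ)))) W≤))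
    where
    e : ∀ k w m → k + w + m ≡ w + (k + m)
    e = solve-∀
    rest : (Σ (Fin N → Vec (Fin n) κ) λ ζ → (∀ i → R (suc i) (ζ i)) × (∀ i → ¬ Hit (toList z ++ W) (ζ i)) × (∀ {i j v} → v ∈ toList (ζ i) → v ∈ toList (ζ j) → i ≡ j)) →
      Σ (Fin (suc N) → Vec (Fin n) κ) λ ζ → (∀ i → R i (ζ i)) × (∀ i → ¬ Hit W (ζ i)) × (∀ {i j v} → v ∈ toList (ζ i) → v ∈ toList (ζ j) → i ≡ j)
    rest (ζ , rs , avs , dis) = ζ⁺ , (λ { zero → r ; (suc i) → rs i }) , (λ { zero → av ; (suc i) hit → avs i (Any.map (∈-++⁺ʳ (toList z)) hit) }) , λ {i} {j} → dis⁺ i j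
      where
      ζ⁺ : Fin (suc N) → Vec (Fin n) κ
      ζ⁺ zero    = z
      ζ⁺ (suc i) = ζ i
      dis⁺ : ∀ i j {v} → v ∈ toList (ζ⁺ i) → v ∈ toList (ζ⁺ j) → i ≡ j
      dis⁺ zero    zero    p q = refl
      dis⁺ zero    (suc j) p q = ⊥-elim (¬Hit⇒∉ (avs j) q (∈-++⁺ˡ p))
      dis⁺ (suc i) zero    p q = ⊥-elim (¬Hit⇒∉ (avs i) p (∈-++⁺ˡ q))
      dis⁺ (suc i) (suc j) p q = cong suc (dis p q)

module _ {κ n : ℕ} (G : RGraph (3 + κ) n) (A : List (Fin n)) (q′ : ℕ) (S : Subset n) where

  private
    q = 3 + q′

  -- Only the first `q` extensions have to lie in `S`, which keeps the strictness of the demand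
  -- independent of `n`.
  Good : Vec (Fin n) (2 + κ) → Set
  Good f = Deep q G f × ¬ Hit A f × T (agree (tabulate (demand (take q (nbr G (toList f))) (toList f))) S)

  Good? : ∀ f → Dec (Good f)
  Good? f = Deep? q G f ×-dec ¬? (Hit? A f) ×-dec T? (agree (tabulate (demand (take q (nbr G (toList f))) (toList f))) S)

  module _ {f : Vec (Fin n) (2 + κ)} (gf : Good f) where

    colour : Fin q → Fin n
    colour k = List.lookup (nbr G (toList f)) (inject≤ k (proj₁ (proj₁ gf)))

    colour-edge : ∀ k → Edge G (colour k ∷ toList f)
    colour-edge k = nbr-edge G (toList f) (∈-lookup (inject≤ k (proj₁ (proj₁ gf))))

    colour-inj : ∀ {k k′} → colour k ≡ colour k′ → k ≡ k′
    colour-inj e = inject≤-injective (proj₁ (proj₁ gf)) (proj₁ (proj₁ gf)) _ _ (Unique-lookup (nbr-unique G (toList f)) e)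

    private
      sep = separated (take q (nbr G (toList f))) (toList f) S (proj₂ (proj₂ gf))

    colour∈S : ∀ k → lookup S (colour k) ≡ true
    colour∈S k = proj₁ sep (take-lookup q (nbr G (toList f)) (proj₁ (proj₁ gf)) k)

    tuple∉S : ∀ {z} → z ∈ toList f → lookup S z ≡ false
    tuple∉S z∈ = proj₂ sep (λ p → Unique[x∷xs]⇒x∉xs (Edge-Unique G (cong suc (Vecₚ.length-toList f)) (nbr-edge G (toList f) (take⊆ q (nbr G (toList f)) p))) z∈) z∈

    tuple∉A : ∀ {z} → z ∈ toList f → z ∉ A
    tuple∉A = ¬Hit⇒∉ (proj₁ (proj₂ gf))

    tuple-unique : Unique (toList f)
    tuple-unique = AllPairs.tail (Edge-Unique G (cong suc (Vecₚ.length-toList f)) (colour-edge zero))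

  true≢false : ∀ {a b : Bool} → a ≡ true → b ≡ false → a ≢ b
  true≢false refl refl ()

  lookup-S : ∀ {u v} → lookup S u ≡ true → lookup S v ≡ false → u ≢ v
  lookup-S a b refl = true≢false a b refl

  module Assemble {M : ℕ} (X Y : Fin M → Fin n) (X-inj : Inj X) (Y-inj : Inj Y) (ζ : Fin (M * M) → Vec (Fin n) κ)
    (good : ∀ x y → Good (X x ∷ Y y ∷ ζ (combine x y))) (off : ∀ i → ¬ Hit (List.tabulate X ++ List.tabulate Y) (ζ i))
    (dis : ∀ {i j v} → v ∈ toList (ζ i) → v ∈ toList (ζ j) → i ≡ j) (br : ∀ x y → Bridge G A (X x) (Y y)) where

    private
      Z : Fin M → Fin M → Vec (Fin n) κ
      Z x y = ζ (combine x y)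
      tab∈ : ∀ {M} (f : Fin M → Fin n) i → f i ∈ List.tabulate f
      tab∈ f zero    = here refl
      tab∈ f (suc i) = there (tab∈ (f ∘ suc) i)
      Z-inj : ∀ {x y c x′ y′ c′} → lookup (Z x y) c ≡ lookup (Z x′ y′) c′ → x ≡ x′ × y ≡ y′ × c ≡ c′
      Z-inj {x} {y} {c} {x′} {y′} {c′} e = go (combine-injective x y x′ y′ (dis (lookup∈toList (Z x y) c) (subst (_∈ toList (Z x′ y′)) (sym e) (lookup∈toList (Z x′ y′) c′)))) e
        where
        go : x ≡ x′ × y ≡ y′ → lookup (Z x y) c ≡ lookup (Z x′ y′) c′ → x ≡ x′ × y ≡ y′ × c ≡ c′
        go (refl , refl) e = refl , refl , lookup-toList-injective (Z x y) (AllPairs.tail (AllPairs.tail (tuple-unique (good x y)))) e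
      full : ∀ x y k i W → length W ≤ 2 → ∃ λ w → w ∉ W × Edge G (w ∷ toList ((X x ∷ Y y ∷ Z x y) [ i ]≔ colour (good x y) k))
      full x y k i W W≤ = escape G _ W (≤-trans (s≤s W≤) (≤-trans (m≤m+n 3 q′) (proj₂ (proj₁ (good x y)) _ (colour-edge (good x y) k) i)))

    box : Box G A q M M
    box = record
      { X = X ; Y = Y ; Z = Z ; C = λ k x y → colour (good x y) k ; X-inj = X-inj ; Y-inj = Y-inj ; Z-inj = Z-inj
      ; X≢Y = λ {x} {y} e → Unique[x∷xs]⇒x∉xs (tuple-unique (good x y)) (here e)
      ; X∉Z = λ {x} {x′} {y} p → ¬Hit⇒∉ (off (combine x′ y)) p (∈-++⁺ˡ (tab∈ X x))
      ; Y∉Z = λ {y} {x} {y′} p → ¬Hit⇒∉ (off (combine x y′)) p (∈-++⁺ʳ (List.tabulate X) (tab∈ Y y))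
      ; X∉A = λ {x} → tuple∉A (good x x) (here refl) ; Y∉A = λ {y} → tuple∉A (good y y) (there (here refl))
      ; Z∉A = λ {x} {y} p → tuple∉A (good x y) (there (there p))
      ; C-edge = λ k x y → colour-edge (good x y) k ; C-dist = λ {_} {_} {x} {y} e → colour-inj (good x y) e
      ; C≢X = λ {k} {x} {y} {x′} → lookup-S (colour∈S (good x y) k) (tuple∉S (good x′ y) (here refl))
      ; C≢Y = λ {k} {x} {y} {y′} → lookup-S (colour∈S (good x y) k) (tuple∉S (good x y′) (there (here refl)))
      ; C∉Z = λ {k} {x} {y} {x′} {y′} p → true≢false (colour∈S (good x y) k) (tuple∉S (good x′ y′) (there (there p))) refl
      ; fullX = λ k x y → full x y k zero ; fullY = λ k x y → full x y k (suc zero)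
      ; bridge = br }

-- Bridges, for uniformity three and for larger uniformity

module _ {n : ℕ} (G : RGraph 3 n) (A : List (Fin n)) (q′ : ℕ) (S : Subset n) where

  -- A face has no filling here, so the middle is a colour `c`, and the exchanged faces, `x` with
  -- `c` and `c` with `y`, are extended by `w₁` and `w₂`. All three may lie in `A`, which exhausts
  -- `P`.
  bridge₀ : ∀ {x y} → Good G A q′ S (x ∷ y ∷ []) → Bridge G A x y
  bridge₀ {x} {y} gf = step₁ (escape G (x ∷ c ∷ []) [ y ] (≤-trans (s≤s (s≤s z≤n)) (deep (suc zero))))
    where
    c = colour G A q′ S gf zero
    ec : Edge G (c ∷ x ∷ y ∷ [])
    ec = colour-edge G A q′ S gf zero
    deep : ∀ i → 3 + q′ ≤ deg G (toList ((x ∷ y ∷ []) [ i ]≔ c))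
    deep = proj₂ (proj₁ gf) c ec
    step₂ : ∀ {w₁ w₂} → w₁ ∉ [ y ] → Edge G (w₁ ∷ x ∷ c ∷ []) → w₂ ∉ x ∷ w₁ ∷ [] → Edge G (w₂ ∷ c ∷ y ∷ []) → Unique (c ∷ x ∷ y ∷ []) → Unique (w₁ ∷ x ∷ c ∷ []) → Unique (w₂ ∷ c ∷ y ∷ []) → Bridge G A x y
    step₂ {w₁} {w₂} w₁≢ e₁ w₂≢ e₂ ((c≢x ∷ c≢y ∷ []) ∷ (x≢y ∷ []) ∷ _) ((w₁x ∷ w₁c ∷ []) ∷ _) ((w₂c ∷ w₂y ∷ []) ∷ _) =
      mkBridge c (w₁ ∷ []) (w₂ ∷ []) (Edge-↭ G (↭-trans (swap _ _ ↭-refl) (prep _ (swap _ _ ↭-refl))) e₁) (Edge-↭ G (↭-trans (swap _ _ ↭-refl) (prep _ (swap _ _ ↭-refl))) e₂)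
        ((x≢y ∷ c≢x ∘ sym ∷ w₁x ∘ sym ∷ (λ e → w₂≢ (here (sym e))) ∷ []) ∷ (c≢y ∘ sym ∷ (λ e → w₁≢ (here (sym e))) ∷ w₂y ∘ sym ∷ []) ∷
          (w₁c ∘ sym ∷ w₂c ∘ sym ∷ []) ∷ ((λ e → w₂≢ (there (here (sym e)))) ∷ []) ∷ [] ∷ [])
        (c ∷ w₁ ∷ w₂ ∷ []) ≤-refl inj₁
    step₁ : (∃ λ w₁ → w₁ ∉ [ y ] × Edge G (w₁ ∷ x ∷ c ∷ [])) → Bridge G A x y
    step₁ (w₁ , w₁∉ , e₁) = fin (escape G (c ∷ y ∷ []) (x ∷ w₁ ∷ []) (≤-trans (s≤s (s≤s (s≤s z≤n))) (deep zero)))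
      where
      fin : (∃ λ w₂ → w₂ ∉ x ∷ w₁ ∷ [] × Edge G (w₂ ∷ c ∷ y ∷ [])) → Bridge G A x y
      fin (w₂ , w₂∉ , e₂) = step₂ w₁∉ e₁ w₂∉ e₂ (Edge-Unique G refl ec) (Edge-Unique G refl e₁) (Edge-Unique G refl e₂)

module _ {κ n : ℕ} (G : RGraph (4 + κ) n) (A : List (Fin n)) (q′ : ℕ) (S : Subset n) where

  private
    GoodT : Vec (Fin n) (3 + κ) → Set
    GoodT = Good G A q′ S

    tuple-edge : ∀ {f} (w : Fin n) → Edge G (w ∷ toList {n = 3 + κ} f) → Unique (w ∷ toList f)
    tuple-edge {f} w = Edge-Unique G (cong suc (Vecₚ.length-toList f))

  -- The middle is a vertex `z` off `A`, common to a face through `x` and a face through `y`. Only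
  -- the extensions `w₁` and `w₂` of these faces enter `P`.
  triangle-bridge : ∀ {x y z y₁ r₁ x₂ r₂ w₁ w₂} → x ≢ y → GoodT (x ∷ y₁ ∷ z ∷ r₁) → Edge G (w₁ ∷ x ∷ y₁ ∷ z ∷ toList r₁) →
    GoodT (x₂ ∷ y ∷ z ∷ r₂) → Edge G (w₂ ∷ x₂ ∷ y ∷ z ∷ toList r₂) → w₁ ≢ y → w₁ ∉ x₂ ∷ toList r₂ → w₂ ≢ x → w₁ ≢ w₂ → x ∉ x₂ ∷ toList r₂ →
    (∀ {v} → v ∈ y₁ ∷ toList r₁ → v ∉ y ∷ w₂ ∷ x₂ ∷ toList r₂) → Bridge G A x y
  triangle-bridge {x} {y} {z} {y₁} {r₁} {x₂} {r₂} {w₁} {w₂} x≢y g₁ e₁ g₂ e₂ w₁≢y w₁∉ w₂≢x w₁≢w₂ x∉ v₁∩ =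
    go (tuple-edge {x ∷ y₁ ∷ z ∷ r₁} w₁ e₁) (tuple-edge {x₂ ∷ y ∷ z ∷ r₂} w₂ e₂)
    where
    v₁ = y₁ ∷ r₁
    v₂ = x₂ ∷ r₂
    go : Unique (w₁ ∷ x ∷ y₁ ∷ z ∷ toList r₁) → Unique (w₂ ∷ x₂ ∷ y ∷ z ∷ toList r₂) → Bridge G A x y
    go ((w₁x ∷ w₁y₁ ∷ w₁z ∷ w₁r) ∷ (xy₁ ∷ xz ∷ xr) ∷ (y₁z ∷ y₁r) ∷ zr ∷ ur) ((w₂x₂ ∷ w₂y ∷ w₂z ∷ w₂r) ∷ (x₂y ∷ x₂z ∷ x₂r) ∷ (yz ∷ yr) ∷ zr′ ∷ ur′) =
      mkBridge z (w₁ ∷ v₁) (w₂ ∷ v₂)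
        (Edge-↭ G (↭-trans (swap _ _ ↭-refl) (prep x (↭-trans (prep w₁ (swap y₁ z ↭-refl)) (swap w₁ z ↭-refl)))) e₁)
        (Edge-↭ G (↭-trans (Permₚ.++⁺ʳ (toList r₂) (Permₚ.++-comm (w₂ ∷ x₂ ∷ []) (y ∷ z ∷ []))) (swap y z ↭-refl)) e₂)
        (Unique-∷ x∉all (Unique-∷ y∉all (Unique-∷ z∉all (Unique-++ {xs = w₁ ∷ toList v₁} ((w₁y₁ ∷ w₁r) ∷ y₁r ∷ ur) ((w₂x₂ ∷ w₂r) ∷ x₂r ∷ ur′) E∩))))
        (w₁ ∷ w₂ ∷ []) (s≤s (s≤s z≤n)) offs
      where
      z∉v₁ : z ∉ toList v₁
      z∉v₁ (here e)  = y₁z (sym e)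
      z∉v₁ (there p) = All.lookup zr p refl
      z∉v₂ : z ∉ toList v₂
      z∉v₂ (here e)  = x₂z (sym e)
      z∉v₂ (there p) = All.lookup zr′ p refl
      y∉v₂ : y ∉ toList v₂
      y∉v₂ (here e)  = x₂y (sym e)
      y∉v₂ (there p) = All.lookup yr p refl
      x∉v₁ : x ∉ toList v₁
      x∉v₁ (here e)  = xy₁ e
      x∉v₁ (there p) = All.lookup xr p refl
      E∩ : ∀ {v} → v ∈ w₁ ∷ toList v₁ → v ∉ w₂ ∷ toList v₂
      E∩ (here refl) (here e)  = w₁≢w₂ e
      E∩ (here refl) (there p) = w₁∉ p
      E∩ (there p)   r         = v₁∩ p (there r)
      split : ∀ {v} → v ∈ (w₁ ∷ toList v₁) ++ (w₂ ∷ toList v₂) → v ∈ w₁ ∷ toList v₁ ⊎ v ∈ w₂ ∷ toList v₂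
      split = ∈-++⁻ (w₁ ∷ toList v₁)
      z∉all : z ∉ (w₁ ∷ toList v₁) ++ (w₂ ∷ toList v₂)
      z∉all p with split p
      ... | inj₁ (here e)  = w₁z (sym e)
      ... | inj₁ (there r) = z∉v₁ r
      ... | inj₂ (here e)  = w₂z (sym e)
      ... | inj₂ (there r) = z∉v₂ r
      y∉all : y ∉ z ∷ (w₁ ∷ toList v₁) ++ (w₂ ∷ toList v₂)
      y∉all (here e) = yz e
      y∉all (there p) with split p
      ... | inj₁ (here e)  = w₁≢y (sym e)
      ... | inj₁ (there r) = v₁∩ r (here refl)
      ... | inj₂ (here e)  = w₂y (sym e)
      ... | inj₂ (there r) = y∉v₂ r
      x∉all : x ∉ y ∷ z ∷ (w₁ ∷ toList v₁) ++ (w₂ ∷ toList v₂)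
      x∉all (here e) = x≢y e
      x∉all (there (here e)) = xz e
      x∉all (there (there p)) with split p
      ... | inj₁ (here e)  = w₁x (sym e)
      ... | inj₁ (there r) = x∉v₁ r
      ... | inj₂ (here e)  = w₂≢x (sym e)
      ... | inj₂ (there r) = x∉ r
      offs : ∀ {v} → v ∈ z ∷ (w₁ ∷ toList v₁) ++ (w₂ ∷ toList v₂) → v ∈ w₁ ∷ w₂ ∷ [] ⊎ v ∉ A
      offs (here refl) = inj₂ (tuple∉A G A q′ S g₁ (there (there (here refl))))
      offs (there p) with split p
      ... | inj₁ (here e)          = inj₁ (here e)
      ... | inj₁ (there (here refl)) = inj₂ (tuple∉A G A q′ S g₁ (there (here refl)))
      ... | inj₁ (there (there r)) = inj₂ (tuple∉A G A q′ S g₁ (there (there (there r))))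
      ... | inj₂ (here e)          = inj₁ (there (here e))
      ... | inj₂ (there (here refl)) = inj₂ (tuple∉A G A q′ S g₂ (here refl))
      ... | inj₂ (there (there r)) = inj₂ (tuple∉A G A q′ S g₂ (there (there (there r))))

  -- Two extensions besides `x` are kept, so that one of them differs from the extension chosen
  -- later on the other side of the bridge.
  record Wing (y z x : Fin n) (W : List (Fin n)) : Set where
    constructor mkWing
    field
      x₂   : Fin n
      r₂   : Vec (Fin n) κ
      good : GoodT (x₂ ∷ y ∷ z ∷ r₂)
      off  : ¬ Hit W (x₂ ∷ r₂)
      ω ω′ : Fin n
      ω≢x  : ω ≢ x
      ω′≢  : ω′ ∉ x ∷ ω ∷ []
      edge-ω  : Edge G (ω ∷ x₂ ∷ y ∷ z ∷ toList r₂)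
      edge-ω′ : Edge G (ω′ ∷ x₂ ∷ y ∷ z ∷ toList r₂)

  -- Two wings at {y, z} with disjoint bodies, so that at least one of them misses the extra vertex w₁ of the edge at {x, z}.
  bridge₊ : ∀ {x y z r} b → GoodT (x ∷ y ∷ z ∷ r) → 6 + (κ + κ) + 2 ≤ b →
    (∀ W → length W ≤ b → ∃ λ v → GoodT (x ∷ Vec.head v ∷ z ∷ Vec.tail v) × ¬ Hit W v) →
    (∀ W → length W ≤ b → ∃ λ v → GoodT (Vec.head v ∷ y ∷ z ∷ Vec.tail v) × ¬ Hit W v) → Bridge G A x y
  bridge₊ {x} {y} {z} {r} b gf b≥ R₁₃ R₂₃ = two (wing (x ∷ []) (≤-trans (s≤s z≤n) b≥))
    where
    wing : ∀ W → length W ≤ b → Wing y z x W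
    wing W W≤ = body (R₂₃ W W≤)
      where
      body : (∃ λ v → GoodT (Vec.head v ∷ y ∷ z ∷ Vec.tail v) × ¬ Hit W v) → Wing y z x W
      body (x₂ ∷ r₂ , g , h) = first (escape G _ [ x ] (≤-trans (s≤s (s≤s z≤n)) (proj₁ (proj₁ g))))
        where
        first : (∃ λ ω → ω ∉ [ x ] × Edge G (ω ∷ x₂ ∷ y ∷ z ∷ toList r₂)) → Wing y z x W
        first (ω , ω∉ , e) = second (escape G _ (x ∷ ω ∷ []) (≤-trans (s≤s (s≤s (s≤s z≤n))) (proj₁ (proj₁ g))))
          where
          second : (∃ λ ω′ → ω′ ∉ x ∷ ω ∷ [] × Edge G (ω′ ∷ x₂ ∷ y ∷ z ∷ toList r₂)) → Wing y z x W
          second (ω′ , ω′∉ , e′) = mkWing x₂ r₂ g h ω ω′ (ω∉ ∘ here) ω′∉ e e′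
    x≢y : x ≢ y
    x≢y e = Unique[x∷xs]⇒x∉xs (tuple-unique G A q′ S gf) (here e)
    body∉ : ∀ {W} (wg : Wing y z x W) → x ∈ W → x ∉ Wing.x₂ wg ∷ toList (Wing.r₂ wg)
    body∉ wg x∈ p = ¬Hit⇒∉ (Wing.off wg) p x∈
    list : ∀ {W} → Wing y z x W → List (Fin n)
    list wg = Wing.ω wg ∷ Wing.ω′ wg ∷ Wing.x₂ wg ∷ toList (Wing.r₂ wg)
    close : ∀ {W y₁ r₁ w₁} (wg : Wing y z x W) → x ∈ W → GoodT (x ∷ y₁ ∷ z ∷ r₁) → Edge G (w₁ ∷ x ∷ y₁ ∷ z ∷ toList r₁) → w₁ ≢ y → w₁ ∉ Wing.x₂ wg ∷ toList (Wing.r₂ wg) →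
      (∀ {v} → v ∈ y₁ ∷ toList r₁ → v ≢ y × v ∉ list wg) → Bridge G A x y
    close {W} {y₁} {r₁} {w₁} wg x∈ g₁ e₁ w₁≢y w₁∉ av = pick (w₁ ≟ ω)
      where
      open Wing wg
      pick : Dec (w₁ ≡ ω) → Bridge G A x y
      pick (no ne) = triangle-bridge x≢y g₁ e₁ good edge-ω w₁≢y w₁∉ ω≢x ne (body∉ wg x∈)
        (λ p → λ { (here e) → proj₁ (av p) e ; (there (here e)) → proj₂ (av p) (here e) ; (there (there r)) → proj₂ (av p) (there (there r)) })
      pick (yes refl) = triangle-bridge x≢y g₁ e₁ good edge-ω′ w₁≢y w₁∉ (ω′≢ ∘ here) (λ e → ω′≢ (there (here (sym e)))) (body∉ wg x∈)
        (λ p → λ { (here e) → proj₁ (av p) e ; (there (here e)) → proj₂ (av p) (there (here e)) ; (there (there r)) → proj₂ (av p) (there (there r)) })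
    two : Wing y z x (x ∷ []) → Bridge G A x y
    two wa = final (wing (x ∷ Wing.x₂ wa ∷ toList (Wing.r₂ wa)) (≤-trans (≤-reflexive (cong (2 +_) (Vecₚ.length-toList (Wing.r₂ wa)))) (≤-trans (≤-by (6 + κ) (e₁ κ)) b≥)))
      where
      e₁ : ∀ κ → 2 + κ + (6 + κ) ≡ 6 + (κ + κ) + 2
      e₁ = solve-∀
      final : Wing y z x (x ∷ Wing.x₂ wa ∷ toList (Wing.r₂ wa)) → Bridge G A x y
      final wb = third (R₁₃ U (≤-trans (≤-reflexive U-len) b≥′))
        where
        U = y ∷ list wa ++ list wb
        U-len : length U ≡ suc (3 + κ + (3 + κ))
        U-len = cong suc (trans (length-++ (list wa)) (cong₂ _+_ (cong (3 +_) (Vecₚ.length-toList (Wing.r₂ wa))) (cong (3 +_) (Vecₚ.length-toList (Wing.r₂ wb)))))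
        e₂ : ∀ κ → suc (3 + κ + (3 + κ)) + 1 ≡ 6 + (κ + κ) + 2
        e₂ = solve-∀
        b≥′ : suc (3 + κ + (3 + κ)) ≤ b
        b≥′ = ≤-trans (≤-by 1 (e₂ κ)) b≥
        third : (∃ λ v → GoodT (x ∷ Vec.head v ∷ z ∷ Vec.tail v) × ¬ Hit U v) → Bridge G A x y
        third (y₁ ∷ r₁ , g₁ , h) = fourth (escape G _ [ y ] (≤-trans (s≤s (s≤s z≤n)) (proj₁ (proj₁ g₁))))
          where
          av : ∀ {v} → v ∈ y₁ ∷ toList r₁ → v ∉ U
          av = ¬Hit⇒∉ h
          fourth : (∃ λ w₁ → w₁ ∉ [ y ] × Edge G (w₁ ∷ x ∷ y₁ ∷ z ∷ toList r₁)) → Bridge G A x y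
          fourth (w₁ , w₁∉ , e₁) = choose (w₁ ∈? (Wing.x₂ wa ∷ toList (Wing.r₂ wa)))
            where
            choose : Dec (w₁ ∈ Wing.x₂ wa ∷ toList (Wing.r₂ wa)) → Bridge G A x y
            choose (no ∉a) = close wa (here refl) g₁ e₁ (w₁∉ ∘ here) ∉a (λ p → (λ e → av p (here e)) , (λ s → av p (there (∈-++⁺ˡ s))))
            choose (yes ∈a) = close wb (here refl) g₁ e₁ (w₁∉ ∘ here) (λ s → ¬Hit⇒∉ (Wing.off wb) s (there ∈a)) (λ p → (λ e → av p (here e)) , (λ s → av p (there (∈-++⁺ʳ (list wa) s))))

-- Boxes in dense families of faces

private
  -- Robustness is tested on the first two entries of a tuple. These permutations bring the first
  -- and third entries, or the second and third, to the front.
  swap₁₃ : ∀ {n κ} → Vec (Fin n) (3 + κ) → Vec (Fin n) (3 + κ)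
  swap₁₃ (x ∷ y ∷ z ∷ r) = x ∷ z ∷ y ∷ r

  rotate : ∀ {n κ} → Vec (Fin n) (3 + κ) → Vec (Fin n) (3 + κ)
  rotate (x ∷ y ∷ z ∷ r) = y ∷ z ∷ x ∷ r

  rotate⁻¹ : ∀ {n κ} → Vec (Fin n) (3 + κ) → Vec (Fin n) (3 + κ)
  rotate⁻¹ (y ∷ z ∷ x ∷ r) = x ∷ y ∷ z ∷ r

  ∑-expand : ∀ n κ (f : Vec (Fin n) (3 + κ) → ℕ) →
    ∑ (allTup n (3 + κ)) f ≡ ∑ (allFin n) (λ x → ∑ (allFin n) (λ y → ∑ (allFin n) (λ z → ∑ (allTup n κ) (λ r → f (x ∷ y ∷ z ∷ r)))))
  ∑-expand n κ f = trans (∑-allTup n (2 + κ) f) (∑-cong (allFin n) (λ x → trans (∑-allTup n (suc κ) _) (∑-cong (allFin n) (λ y → ∑-allTup n κ _))))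

  ∑-swap₁₃ : ∀ n κ (f : Vec (Fin n) (3 + κ) → ℕ) → ∑ (allTup n (3 + κ)) (λ v → f (swap₁₃ v)) ≡ ∑ (allTup n (3 + κ)) f
  ∑-swap₁₃ n κ f = trans (∑-expand n κ (λ v → f (swap₁₃ v))) (trans (∑-cong (allFin n) (λ x → ∑-swap (allFin n) (allFin n) (λ y z → ∑ (allTup n κ) (λ r → f (x ∷ z ∷ y ∷ r))))) (sym (∑-expand n κ f)))

  ∑-rotate : ∀ n κ (f : Vec (Fin n) (3 + κ) → ℕ) → ∑ (allTup n (3 + κ)) (λ v → f (rotate v)) ≡ ∑ (allTup n (3 + κ)) f
  ∑-rotate n κ f = trans (∑-expand n κ (λ v → f (rotate v))) (trans (∑-swap (allFin n) (allFin n) _)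
    (trans (∑-cong (allFin n) (λ y → ∑-swap (allFin n) (allFin n) (λ x z → ∑ (allTup n κ) (λ r → f (y ∷ z ∷ x ∷ r))))) (sym (∑-expand n κ f))))

-- What remains of the good tuples when only their first two entries matter: a dense relation, ready
-- for `kővári-sós-turán`, whose pairs have a bridge and completions that avoid any `b` vertices.
Pairs : ∀ {κ n} (G : RGraph (3 + κ) n) (A : List (Fin n)) (q′ : ℕ) (S : Subset n) (b m : ℕ) → Set₁
Pairs {κ} {n} G A q′ S b m = Σ (Fin n → Fin n → Set) λ Γ → Σ (∀ x y → Dec (Γ x y)) λ Γ? →
  n * n ≤ m * ∑ (allFin n) (λ x → count (Γ? x) (allFin n)) ×
  (∀ x y → Γ x y → Bridge G A x y × (∀ W → length W ≤ b → ∃ λ r → Good G A q′ S (x ∷ y ∷ r) × ¬ Hit W r))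

module _ {n κ : ℕ} .{{_ : NonZero n}} {g : Vec (Fin n) (2 + κ) → Set} (g? : ∀ f → Dec (g f)) where

  Extendable? : ∀ x y → Dec (0 < count (λ r → g? (x ∷ y ∷ r)) (allTup n κ))
  Extendable? x y = 0 <? count (λ r → g? (x ∷ y ∷ r)) (allTup n κ)

  pairs-dense : ∀ m → n ^ (2 + κ) ≤ m * count g? (allTup n (2 + κ)) → n * n ≤ m * ∑ (allFin n) (λ x → count (Extendable? x) (allFin n))
  pairs-dense m d = *-cancelʳ-≤ (n * n) _ (n ^ κ) {{m^n≢0 n κ}} (begin
    n * n * n ^ κ                                                                      ≡⟨ *-assoc n n (n ^ κ) ⟩
    n ^ (2 + κ)                                                                        ≤⟨ d ⟩
    m * count g? (allTup n (2 + κ))                                                    ≡⟨ cong (m *_) (trans (∑-allTup n (suc κ) _) (∑-cong (allFin n) (λ x → ∑-allTup n κ _))) ⟩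
    m * ∑ (allFin n) (λ x → ∑ (allFin n) (λ y → count (λ r → g? (x ∷ y ∷ r)) (allTup n κ))) ≤⟨ *-monoʳ-≤ m (∑-mono (allFin n) (λ x → ∑-mono (allFin n) (λ y → point x y (Extendable? x y)))) ⟩
    m * ∑ (allFin n) (λ x → ∑ (allFin n) (λ y → n ^ κ * ind (Extendable? x y)))        ≡⟨ cong (m *_) (trans (∑-cong (allFin n) (λ x → ∑-* (allFin n) (n ^ κ) _)) (∑-* (allFin n) (n ^ κ) _)) ⟩
    m * (n ^ κ * ∑ (allFin n) (λ x → count (Extendable? x) (allFin n)))                ≡⟨ e m (n ^ κ) _ ⟩
    m * ∑ (allFin n) (λ x → count (Extendable? x) (allFin n)) * n ^ κ                  ∎)
    where
    open ≤-Reasoning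
    e : ∀ m p s → m * (p * s) ≡ m * s * p
    e = solve-∀
    point : ∀ x y (d : Dec (0 < count (λ r → g? (x ∷ y ∷ r)) (allTup n κ))) → count (λ r → g? (x ∷ y ∷ r)) (allTup n κ) ≤ n ^ κ * ind d
    point x y (yes p) = ≤-trans (count≤length (λ r → g? (x ∷ y ∷ r)) (allTup n κ)) (≤-reflexive (trans (length-allTup n κ) (sym (*-identityʳ _))))
    point x y (no ¬p) = ≤-trans (≮⇒≥ ¬p) z≤n

-- For uniformity three a pair is the whole face. Otherwise tuples with a pair that is not robust
-- among their first three entries are discarded. In the others the first pair has the completions,
-- and the two remaining pairs provide the faces that `bridge₊` asks for.
prune : ∀ {κ n} .{{_ : NonZero n}} (G : RGraph (3 + κ) n) A q′ S b m → n ^ (2 + κ) ≤ m * count (Good? G A q′ S) (allTup n (2 + κ)) →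
  8 + (κ + κ) ≤ b → 2 * m * (3 * (κ * b)) ≤ n → Pairs G A q′ S b (2 * m)
prune {zero} {n} G A q′ S b m dense b≥ big = _ , Extendable? (Good? G A q′ S) ,
  ≤-trans (pairs-dense (Good? G A q′ S) m dense) (*-monoˡ-≤ _ (m≤n*m m 2)) , λ x y p → get (count-∃ (λ r → Good? G A q′ S (x ∷ y ∷ r)) (allTup n 0) p)
  where
  get : ∀ {x y} → (∃ λ r → r ∈ allTup n 0 × Good G A q′ S (x ∷ y ∷ r)) → Bridge G A x y × (∀ W → length W ≤ b → ∃ λ r → Good G A q′ S (x ∷ y ∷ r) × ¬ Hit W r)
  get ([] , _ , g) = bridge₀ G A q′ S g , λ W _ → [] , g , λ ()
prune {suc κ} {n} G A q′ S b m dense b≥ big = _ , Extendable? keep? , pairs-dense keep? (2 * m) kept , λ x y p → get (count-∃ (λ r → keep? (x ∷ y ∷ r)) (allTup n (suc κ)) p)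
  where
  g : Vec (Fin n) (3 + κ) → Set
  g = Good G A q′ S
  g? : ∀ f → Dec (g f)
  g? = Good? G A q′ S
  module R₁₂ = Robust g? b
  module R₁₃ = Robust (λ f → g? (swap₁₃ f)) b
  module R₂₃ = Robust (λ f → g? (rotate⁻¹ f)) b
  Keep : Vec (Fin n) (3 + κ) → Set
  Keep (x ∷ y ∷ z ∷ r) = g (x ∷ y ∷ z ∷ r) × R₁₂.Rob x y × R₁₃.Rob x z × R₂₃.Rob y z
  keep? : ∀ f → Dec (Keep f)
  keep? (x ∷ y ∷ z ∷ r) = g? (x ∷ y ∷ z ∷ r) ×-dec R₁₂.Rob? x y ×-dec R₁₃.Rob? x z ×-dec R₂₃.Rob? y z
  N = n ^ (3 + κ)
  tup = allTup n (3 + κ)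
  f₁ f₂ f₃ : ℕ
  f₁ = count R₁₂.Frail? tup
  f₂ = count (λ v → R₁₃.Frail? (swap₁₃ v)) tup
  f₃ = count (λ v → R₂₃.Frail? (rotate v)) tup
  split : ∀ v → g v → Keep v ⊎ (R₁₂.Frail v ⊎ (R₁₃.Frail (swap₁₃ v) ⊎ R₂₃.Frail (rotate v)))
  split (x ∷ y ∷ z ∷ r) h = sel (R₁₂.Rob? x y) (R₁₃.Rob? x z) (R₂₃.Rob? y z)
    where
    sel : Dec (R₁₂.Rob x y) → Dec (R₁₃.Rob x z) → Dec (R₂₃.Rob y z) → Keep (x ∷ y ∷ z ∷ r) ⊎ (R₁₂.Frail (x ∷ y ∷ z ∷ r) ⊎ (R₁₃.Frail (x ∷ z ∷ y ∷ r) ⊎ R₂₃.Frail (y ∷ z ∷ x ∷ r)))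
    sel (yes a) (yes c) (yes d) = inj₁ (h , a , c , d)
    sel (no a) _ _ = inj₂ (inj₁ (h , a))
    sel (yes _) (no c) _ = inj₂ (inj₂ (inj₁ (h , c)))
    sel (yes _) (yes _) (no d) = inj₂ (inj₂ (inj₂ (h , d)))
  frail₁₃ = λ v → R₁₃.Frail? (swap₁₃ v)
  frail₂₃ = λ v → R₂₃.Frail? (rotate v)
  cover : count g? tup ≤ count keep? tup + (f₁ + (f₂ + f₃))
  cover = ≤-trans (count-∪ g? keep? (λ v → R₁₂.Frail? v ⊎-dec (frail₁₃ v ⊎-dec frail₂₃ v)) tup split)
    (+-monoʳ-≤ (count keep? tup) (≤-trans (count-∪ (λ v → R₁₂.Frail? v ⊎-dec (frail₁₃ v ⊎-dec frail₂₃ v)) R₁₂.Frail? (λ v → frail₁₃ v ⊎-dec frail₂₃ v) tup (λ v p → p))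
      (+-monoʳ-≤ f₁ (count-∪ (λ v → frail₁₃ v ⊎-dec frail₂₃ v) frail₁₃ frail₂₃ tup (λ v p → p)))))
  c = suc κ * b * N
  frail : n * (f₁ + (f₂ + f₃)) ≤ 3 * (suc κ * b) * N
  frail = begin
    n * (f₁ + (f₂ + f₃))           ≡⟨ trans (*-distribˡ-+ n f₁ (f₂ + f₃)) (cong (n * f₁ +_) (*-distribˡ-+ n f₂ f₃)) ⟩
    n * f₁ + (n * f₂ + n * f₃)     ≤⟨ +-mono-≤ R₁₂.frail-count (+-mono-≤
        (≤-trans (≤-reflexive (cong (n *_) (∑-swap₁₃ n κ (λ v → ind (R₁₃.Frail? v))))) R₁₃.frail-count)
        (≤-trans (≤-reflexive (cong (n *_) (∑-rotate n κ (λ v → ind (R₂₃.Frail? v))))) R₂₃.frail-count)) ⟩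
    c + (c + c)                    ≡⟨ e (suc κ * b) N ⟩
    3 * (suc κ * b) * N            ∎
    where
    open ≤-Reasoning
    e : ∀ c N → c * N + (c * N + c * N) ≡ 3 * c * N
    e = solve-∀
  kept : N ≤ 2 * m * count keep? tup
  kept = loss n N m (count g? tup) (count keep? tup) (f₁ + (f₂ + f₃)) (3 * (suc κ * b)) dense cover frail big
  b≥′ : 6 + (κ + κ) + 2 ≤ b
  b≥′ = ≤-trans (≤-by 2 (e κ)) b≥
    where
    e : ∀ κ → 6 + (κ + κ) + 2 + 2 ≡ 8 + (suc κ + suc κ)
    e = solve-∀
  get : ∀ {x y} → (∃ λ r → r ∈ allTup n (suc κ) × Keep (x ∷ y ∷ r)) → Bridge G A x y × (∀ W → length W ≤ b → ∃ λ r → g (x ∷ y ∷ r) × ¬ Hit W r)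
  get {x} {y} (z ∷ r , _ , h , r₁₂ , r₁₃ , r₂₃) = bridge₊ G A q′ S b h b≥′
      (λ W W≤ → case R₁₃.rob-escape r₁₃ W W≤ of λ { (y₁ ∷ r₁ , p) → y₁ ∷ r₁ , p })
      (λ W W≤ → case R₂₃.rob-escape r₂₃ W W≤ of λ { (x₂ ∷ r₂ , p) → x₂ ∷ r₂ , p }) ,
    R₁₂.rob-escape r₁₂

module _ {κ n : ℕ} .{{_ : NonZero n}} (G : RGraph (3 + κ) n) (A : List (Fin n)) (q′ : ℕ) where

  private
    k = 2 + κ
    q = 3 + q′
    tup = allTup n k

  good-dense : ∀ a m → length A ≤ a → n ^ k ≤ m * count (Deep? q G) tup → 2 * m * (k * a) ≤ n →
    ∃ λ S → n ^ k ≤ 2 * m * 2 ^ (q + k) * count (Good? G A q′ S) tup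
  good-dense a m A≤ dense big = finish (separate xs (λ f → take q (nbr G (toList f))) toList q k
      (λ f → ≤-trans (≤-reflexive (length-take q (nbr G (toList f)))) (m⊓n≤m q _)) (λ f → ≤-reflexive (Vecₚ.length-toList f)))
    where
    off? : ∀ f → Dec (Deep q G f × ¬ Hit A f)
    off? f = Deep? q G f ×-dec ¬? (Hit? A f)
    xs = filter off? tup
    dense₁ : n ^ k ≤ 2 * m * count off? tup
    dense₁ = loss n (n ^ k) m (count (Deep? q G) tup) (count off? tup) (count (Hit? A) tup) (k * a) dense
      (count-∪ (Deep? q G) off? (Hit? A) tup (λ f p → split f p (Hit? A f)))
      (≤-trans (hit-count A k) (≤-trans (*-monoʳ-≤ k (*-monoˡ-≤ (n ^ k) A≤)) (≤-reflexive (sym (*-assoc k a (n ^ k)))))) big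
      where
      split : ∀ f → Deep q G f → Dec (Hit A f) → (Deep q G f × ¬ Hit A f) ⊎ Hit A f
      split f p (yes h) = inj₂ h
      split f p (no ¬h) = inj₁ (p , ¬h)
    finish : (∃ λ S → length xs ≤ 2 ^ (q + k) * count (λ f → T? (agree (tabulate (demand (take q (nbr G (toList f))) (toList f))) S)) xs) →
      ∃ λ S → n ^ k ≤ 2 * m * 2 ^ (q + k) * count (Good? G A q′ S) tup
    finish (S , h) = S , (begin
      n ^ k                                               ≤⟨ dense₁ ⟩
      2 * m * count off? tup                              ≡⟨ cong (2 * m *_) (length-filter-count off? tup) ⟨
      2 * m * length xs                                   ≤⟨ *-monoʳ-≤ (2 * m) h ⟩
      2 * m * (2 ^ (q + k) * count agree? xs)             ≡⟨ cong (λ c → 2 * m * (2 ^ (q + k) * c)) (count-filter off? agree? tup) ⟩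
      2 * m * (2 ^ (q + k) * count (λ f → off? f ×-dec agree? f) tup) ≤⟨ *-monoʳ-≤ (2 * m) (*-monoʳ-≤ (2 ^ (q + k)) (count-mono (λ f → off? f ×-dec agree? f) (Good? G A q′ S) tup (λ { f ((d , o) , s) → d , o , s }))) ⟩
      2 * m * (2 ^ (q + k) * count (Good? G A q′ S) tup)  ≡⟨ *-assoc (2 * m) (2 ^ (q + k)) _ ⟨
      2 * m * 2 ^ (q + k) * count (Good? G A q′ S) tup    ∎)
      where
      open ≤-Reasoning
      agree? = λ f → T? (agree (tabulate (demand (take q (nbr G (toList f))) (toList f))) S)

  pairs-box : ∀ S b m M → Pairs G A q′ S b m → M + M + M * M * κ ≤ b →
    (∀ {Γ : Fin n → Fin n → Set} (Γ? : ∀ x y → Dec (Γ x y)) → n * n ≤ suc m * ∑ (allFin n) (λ x → count (Γ? x) (allFin n)) →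
      Σ (Fin M → Fin n) λ X → Σ (Fin M → Fin n) λ Y → Inj X × Inj Y × (∀ i j → Γ (X i) (Y j))) → Box G A q M M
  pairs-box S b m M (Γ , Γ? , dense , use) b≥ kst = step (kst Γ? (≤-trans dense (*-monoˡ-≤ _ (n≤1+n m))))
    where
    step : (Σ (Fin M → Fin n) λ X → Σ (Fin M → Fin n) λ Y → Inj X × Inj Y × (∀ i j → Γ (X i) (Y j))) → Box G A q M M
    step (X , Y , X-inj , Y-inj , adj) = fill (disjoint-choice (M * M) {R} b
        (λ i → proj₂ (use _ _ (adj (proj₁ (remQuot M i)) (proj₂ (remQuot {M} M i))))) W₀ (≤-trans (≤-reflexive (cong (_+ M * M * κ) W₀-len)) b≥))
      where
      R : Fin (M * M) → Vec (Fin n) κ → Set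
      R i z = Good G A q′ S (X (proj₁ (remQuot M i)) ∷ Y (proj₂ (remQuot {M} M i)) ∷ z)
      W₀ = List.tabulate X ++ List.tabulate Y
      W₀-len : length W₀ ≡ M + M
      W₀-len = trans (length-++ (List.tabulate X)) (cong₂ _+_ (length-tabulate X) (length-tabulate Y))
      fill : (Σ (Fin (M * M) → Vec (Fin n) κ) λ ζ → (∀ i → R i (ζ i)) × (∀ i → ¬ Hit W₀ (ζ i)) × (∀ {i j v} → v ∈ toList (ζ i) → v ∈ toList (ζ j) → i ≡ j)) → Box G A q M M
      fill (ζ , good , off , dis) = Assemble.box G A q′ S X Y X-inj Y-inj ζ
        (λ x y → subst (λ p → Good G A q′ S (X (proj₁ p) ∷ Y (proj₂ p) ∷ ζ (combine x y))) (remQuot-combine x y) (good (combine x y))) off dis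
        (λ x y → proj₁ (use _ _ (adj x y)))

dense-box : ∀ κ q′ M a m → ∃ λ N → ∀ {n} → N ≤ n → (G : RGraph (3 + κ) n) (A : List (Fin n)) → length A ≤ a →
  n ^ (2 + κ) ≤ m * count (Deep? (3 + q′) G) (allTup n (2 + κ)) → Box G A (3 + q′) M M
dense-box κ q′ M a m = suc (N₁ + (N₂ + N₃)) , main
  where
  k m₁ m₂ b N₁ N₂ N₃ : ℕ
  k  = 2 + κ
  m₁ = 2 * m * 2 ^ (3 + q′ + k)
  m₂ = 2 * m₁
  -- Room for all rows, columns and fillings of the grid, and for one bridge.
  b  = M + M + M * M * κ + (8 + (κ + κ))
  N₁ = 2 * m * (k * a)
  N₂ = 2 * m₁ * (3 * (κ * b))
  N₃ = proj₁ (kővári-sós-turán m₂ M)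
  main : ∀ {n} → suc (N₁ + (N₂ + N₃)) ≤ n → (G : RGraph (3 + κ) n) (A : List (Fin n)) → length A ≤ a →
    n ^ k ≤ m * count (Deep? (3 + q′) G) (allTup n k) → Box G A (3 + q′) M M
  main {n@(suc _)} N≤ G A A≤ dense = step (good-dense G A q′ a m A≤ dense (≤-trans (m≤m+n N₁ _) (<⇒≤ N≤)))
    where
    N₂≤ : N₂ ≤ n
    N₂≤ = ≤-trans (m≤m+n N₂ N₃) (≤-trans (m≤n+m _ N₁) (<⇒≤ N≤))
    N₃≤ : N₃ ≤ n
    N₃≤ = ≤-trans (m≤n+m N₃ N₂) (≤-trans (m≤n+m _ N₁) (<⇒≤ N≤))
    step : (∃ λ S → n ^ k ≤ m₁ * count (Good? G A q′ S) (allTup n k)) → Box G A (3 + q′) M M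
    step (S , d) = pairs-box G A q′ S b m₂ M (prune G A q′ S b m₁ d (m≤n+m _ (M + M + M * M * κ)) N₂≤) (m≤m+n _ _) (proj₂ (kővári-sós-turán m₂ M) N₃≤)

-- Embedding one component

data Comp : Set where
  starᶜ : (t : ℕ) → 1 ≤ t → Comp
  baseᶜ : Kind → (ℓ : ℕ) → 5 ≤ ℓ → Comp

hyp : ℕ → Comp → Hyp
hyp κ (starᶜ t _)   = expansion (3 + κ) (star t)
hyp κ (baseᶜ K ℓ _) = expansion (3 + κ) (base K ℓ)

-- The vertex cover number of the underlying graph.
cost : Comp → ℕ
cost (starᶜ t _)   = 1
cost (baseᶜ K ℓ _) = ⌊ ℓ + 1 /2⌋

order : Comp → ℕ
order (starᶜ t _)   = t
order (baseᶜ K ℓ _) = ℓ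

halve : ∀ ℓ → 5 ≤ ℓ → ∃ λ q′ → ⌊ ℓ + 1 /2⌋ ≡ 3 + q′ × (ℓ ≡ 6 + 2 * q′ ⊎ ℓ ≡ 5 + 2 * q′)
halve (suc (suc (suc (suc (suc j))))) (s≤s (s≤s (s≤s (s≤s (s≤s z≤n))))) = go j
  where
  go : ∀ j → ∃ λ q′ → ⌊ 5 + j + 1 /2⌋ ≡ 3 + q′ × (5 + j ≡ 6 + 2 * q′ ⊎ 5 + j ≡ 5 + 2 * q′)
  go zero          = 0 , refl , inj₂ refl
  go (suc zero)    = 0 , refl , inj₁ refl
  go (suc (suc j)) with go j
  ... | q′ , e , inj₁ p = suc q′ , cong suc e , inj₁ (trans (cong (2 +_) p) (e₁ q′))
    where
    e₁ : ∀ q → 2 + (6 + 2 * q) ≡ 6 + 2 * (1 + q)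
    e₁ = solve-∀
  ... | q′ , e , inj₂ p = suc q′ , cong suc e , inj₂ (trans (cong (2 +_) p) (e₁ q′))
    where
    e₁ : ∀ q → 2 + (5 + 2 * q) ≡ 5 + 2 * (1 + q)
    e₁ = solve-∀

-- `Θ` is the number of extensions still guaranteed. It may exceed the cost, since the components
-- still to come draw on the same lists.
Single : ℕ → Comp → Set
Single κ c = ∀ a m → ∃ λ N → ∀ {n} → N ≤ n → (G : RGraph (3 + κ) n) (A : List (Fin n)) → length A ≤ a → ∀ Θ → cost c ≤ Θ → 3 ≤ Θ →
  n ^ (2 + κ) ≤ m * count (Deep? Θ G) (allTup n (2 + κ)) → Copy G (hyp κ c) A (cost c) (suc (order c * (2 + κ)))

Deep-mono : ∀ {r n k} {G : RGraph r n} {q Θ} → q ≤ Θ → (f : Vec (Fin n) k) → Deep Θ G f → Deep q G f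
Deep-mono q≤ f (a , b) = ≤-trans q≤ a , λ v e i → ≤-trans q≤ (b v e i)

module _ (κ q′ ℓ : ℕ) where

  private
    k = 2 + κ
    -- Vertices to be avoided beyond `A`: the fixed lists of `Systems`, the starter with the
    -- centres, the woven cherries with one spoke, and the spokes of a star.
    c₁ c₂ c₃ c₄ : ℕ
    c₁ = 20 + q′ + 4 * κ
    c₂ = 3 * k + suc (suc q′)
    c₃ = 2 * suc (suc q′) * k + k
    c₄ = ℓ * k

  private
    2≤3 : 2 ≤ 3
    2≤3 = s≤s (s≤s z≤n)

  margin : ℕ
  margin = c₁ + (c₂ + (c₃ + c₄))

  private
    c₁≤ : c₁ ≤ margin
    c₁≤ = m≤m+n c₁ _
    c₂₃≤ : c₂ + c₃ ≤ margin
    c₂₃≤ = ≤-trans (+-monoʳ-≤ c₂ (m≤m+n c₃ c₄)) (m≤n+m _ c₁)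
    c₂₄≤ : c₂ + c₄ ≤ margin
    c₂₄≤ = ≤-trans (+-monoʳ-≤ c₂ (m≤n+m c₄ c₃)) (m≤n+m _ c₁)

  systems-from : ∀ a m → ∃ λ N → ∀ {n} → N ≤ n → (G : RGraph (3 + κ) n) (A : List (Fin n)) → length A ≤ a → ∀ Θ → 3 + q′ ≤ Θ →
    n ^ (2 + κ) ≤ m * count (Deep? Θ G) (allTup n (2 + κ)) → SystemPair q′ (a + margin) G A
  systems-from a m = proj₁ db , λ {n} N≤ G A A≤ Θ q≤ dense → box⇒systems q′ (a + margin) (+-mono-≤ A≤ c₁≤)
      (proj₂ db N≤ G A A≤ (≤-trans dense (*-monoʳ-≤ m (count-mono (Deep? Θ G) (Deep? (3 + q′) G) (allTup n (2 + κ)) (λ f → Deep-mono q≤ f)))))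
    where
    db = dense-box κ q′ (box-size {κ} q′ (a + margin)) a m

  module _ {n} {G : RGraph (3 + κ) n} {A : List (Fin n)} {a : ℕ} (A≤ : length A ≤ a) where

    private
      fit : ∀ {x y} → x ≤ c₂ → y ≤ c₃ → length A + x + y ≤ a + margin
      fit {x} {y} p r = ≤-trans (≤-reflexive (+-assoc (length A) x y)) (+-mono-≤ A≤ (≤-trans (+-mono-≤ p r) c₂₃≤))

      widen : ∀ {H q N} → Copy G H A q N → Copy G H A q (suc N)
      widen c = record { Copy c ; L≤N = ≤-trans (Copy.L≤N c) (n≤1+n _) }

    star-from : SystemPair q′ (a + margin) G A → 1 ≤ ℓ → Copy G (expansion (3 + κ) (star ℓ)) A 1 (suc (ℓ * k))
    star-from (sys , _) ℓ≥ = star-copy sys ℓ ℓ≥ (≤-trans (≤-reflexive (+-assoc (length A) _ (ℓ * k))) (+-mono-≤ A≤ (≤-trans (+-monoˡ-≤ c₄ (+-monoˡ-≤ (suc (suc q′)) (*-monoˡ-≤ k 2≤3))) c₂₄≤)))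

    base-from : ∀ K → SystemPair q′ (a + margin) G A → ℓ ≡ 6 + 2 * q′ ⊎ ℓ ≡ 5 + 2 * q′ → Copy G (expansion (3 + κ) (base K ℓ)) A (3 + q′) (suc (ℓ * k))
    base-from paths (sys , _) (inj₁ refl) = path-copy sys (5 + 2 * q′) (inj₁ (e q′)) (fit (+-monoˡ-≤ (suc (suc q′)) (*-monoˡ-≤ k 2≤3)) ≤-refl)
      where
      e : ∀ q → 6 + 2 * q ≡ 1 + (2 * (2 + q) + 1)
      e = solve-∀
    base-from paths (sys , _) (inj₂ refl) = path-copy sys (4 + 2 * q′) (inj₂ (e q′)) (fit (+-monoˡ-≤ (suc (suc q′)) (*-monoˡ-≤ k 2≤3)) ≤-refl)
      where
      e : ∀ q → 1 + (5 + 2 * q) ≡ 1 + (2 * (2 + q) + 1)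
      e = solve-∀
    base-from cycles (sys , _) (inj₁ refl) = widen (cycle-copy sys (4 + 2 * q′) (e q′) (fit (+-monoˡ-≤ (suc (suc q′)) (*-monoˡ-≤ k 2≤3)) (m≤m+n _ k)))
      where
      e : ∀ q → 6 + 2 * q ≡ 2 * (2 + q) + 2
      e = solve-∀
    base-from cycles (_ , sys) (inj₂ refl) = widen (cycle-copy sys (3 + 2 * q′) (e q′) (fit (+-monoʳ-≤ (3 * k) (n≤1+n (suc q′))) (≤-trans (*-monoˡ-≤ k (*-monoʳ-≤ 2 (n≤1+n (suc q′)))) (m≤m+n _ k))))
      where
      e : ∀ q → 5 + 2 * q ≡ 2 * (1 + q) + 3
      e = solve-∀

-- A star has one centre only, but takes it from a box with three colours, whence the requirement
-- `3 ≤ Θ`.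
single : ∀ κ c → Single κ c
single κ (starᶜ t t≥) a m = proj₁ sf , λ N≤ G A A≤ Θ _ 3≤ dense → star-from κ 0 t A≤ (proj₂ sf N≤ G A A≤ Θ 3≤ dense) t≥
  where
  sf = systems-from κ 0 t a m
single κ (baseᶜ K ℓ ℓ≥) a m = build (halve ℓ ℓ≥)
  where
  build : (∃ λ q′ → ⌊ ℓ + 1 /2⌋ ≡ 3 + q′ × (ℓ ≡ 6 + 2 * q′ ⊎ ℓ ≡ 5 + 2 * q′)) →
    ∃ λ N → ∀ {n} → N ≤ n → (G : RGraph (3 + κ) n) (A : List (Fin n)) → length A ≤ a → ∀ Θ → ⌊ ℓ + 1 /2⌋ ≤ Θ → 3 ≤ Θ →
      n ^ (2 + κ) ≤ m * count (Deep? Θ G) (allTup n (2 + κ)) → Copy G (hyp κ (baseᶜ K ℓ ℓ≥)) A ⌊ ℓ + 1 /2⌋ (suc (ℓ * (2 + κ)))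
  build (q′ , e , par) = proj₁ (systems-from κ q′ ℓ a m) , λ N≤ G A A≤ Θ q≤ _ dense → subst (λ q → Copy G (hyp κ (baseᶜ K ℓ ℓ≥)) A q (suc (ℓ * (2 + κ)))) (sym e)
    (base-from κ q′ ℓ A≤ K (proj₂ (systems-from κ q′ ℓ a m) N≤ G A A≤ Θ (≤-trans (≤-reflexive (sym e)) q≤) dense) par)

-- Removing a component

infixl 6 _∖_
_∖_ : ∀ {r n} → RGraph r n → List (Fin n) → RGraph r n
G ∖ L = record
  { edge    = λ S → edge G S ∧ does (All.all? (λ v → ¬? (v ∈ₛ? S)) L)
  ; uniform = λ S p → uniform G S (proj₁ (Equivalence.to T-∧ p)) }

∖-edge⁻ : ∀ {r n} {G : RGraph r n} {L l} → Edge (G ∖ L) l → Edge G l × (∀ {z} → z ∈ l → z ∉ L)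
∖-edge⁻ {G = G} {L} {l} (mkEdge e) = mkEdge (proj₁ parts) , λ z∈ zL → All.lookup every zL (∈-toSubset⁺ z∈)
  where
  parts = Equivalence.to (T-∧ {edge G (toSubset l)}) e
  every : All (λ v → v ∉ₛ toSubset l) L
  every = witness (All.all? (λ v → ¬? (v ∈ₛ? toSubset l)) L) (proj₂ parts)

∖-edge⁺ : ∀ {r n} {G : RGraph r n} {L l} → Edge G l → (∀ {z} → z ∈ l → z ∉ L) → Edge (G ∖ L) l
∖-edge⁺ {G = G} {L} {l} (mkEdge e) h = mkEdge (Equivalence.from (T-∧ {edge G (toSubset l)}) (e , subst T (sym (dec-true (All.all? (λ v → ¬? (v ∈ₛ? toSubset l)) L) every)) tt))
  where
  every : All (λ v → v ∉ₛ toSubset l) L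
  every = All.tabulate (λ v∈ p → h (∈-toSubset⁻ l p) v∈)

∖-⊆ : ∀ {r n} {G : RGraph r n} {L} S → T (edge (G ∖ L) S) → T (edge G S)
∖-⊆ {G = G} S p = proj₁ (Equivalence.to (T-∧ {edge G S}) p)

Live-∖ : ∀ {κ n} {G : RGraph (3 + κ) n} {L z} → Live (G ∖ L) z → Live G z × z ∉ L
Live-∖ {G = G} {L} (l , e , z∈) = (l , proj₁ (∖-edge⁻ {G = G} {L} e) , z∈) , proj₂ (∖-edge⁻ {G = G} {L} e) z∈

at-most-one : ∀ {R} {P : Fin R → Set} (P? : ∀ i → Dec (P i)) → (∀ i j → P i → P j → i ≡ j) → count P? (allFin R) ≤ 1
at-most-one {R} P? h = ≮⇒≥ (λ two → clash (count-select P? 2 two))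
  where
  clash : (Σ (Fin 2 → Fin R) λ ι → Inj ι × (∀ i → _)) → _
  clash (ι , ι-inj , p) = case inj ι-inj {zero} {suc zero} (h _ _ (p zero) (p (suc zero))) of λ ()

below-average : ∀ R (f : Fin (suc R) → ℕ) B → ∑ (allFin (suc R)) f ≤ B → ∃ λ i → suc R * f i ≤ B
below-average R f B h = go (any? (λ i → suc R * f i ≤? B))
  where
  go : Dec (∃ λ i → suc R * f i ≤ B) → ∃ λ i → suc R * f i ≤ B
  go (yes p) = p
  go (no ¬p) = ⊥-elim (<-irrefl refl (begin-strict
    suc R * B                              <⟨ *-monoʳ-< (suc R) (≤-refl {suc B}) ⟩
    suc R * suc B                          ≡⟨ trans (cong (_* suc B) (sym (length-allFin (suc R)))) (sym (∑-const (allFin (suc R)) (suc B))) ⟩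
    ∑ (allFin (suc R)) (λ _ → suc B)       ≤⟨ ∑-mono (allFin (suc R)) (λ i → ≰⇒> (λ le → ¬p (i , le))) ⟩
    ∑ (allFin (suc R)) (λ i → suc R * f i) ≡⟨ ∑-* (allFin (suc R)) (suc R) f ⟩
    suc R * ∑ (allFin (suc R)) f           ≤⟨ *-monoʳ-≤ (suc R) h ⟩
    suc R * B                              ∎))
    where open ≤-Reasoning

-- Exchanging the entry at `i` with the extra vertex is an involution on pairs of a tuple and a
-- vertex.
∑-update : ∀ n k (i : Fin k) (Φ : Vec (Fin n) k → Fin n → ℕ) →
  ∑ (allTup n k) (λ f → ∑ (allFin n) (λ v → Φ (f [ i ]≔ v) (lookup f i))) ≡ ∑ (allTup n k) (λ f → ∑ (allFin n) (Φ f))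
∑-update n (suc k) zero Φ = trans (∑-allTup n k _) (trans (∑-cong (allFin n) (λ x → ∑-swap (allTup n k) (allFin n) (λ f v → Φ (v ∷ f) x)))
  (trans (∑-swap (allFin n) (allFin n) (λ x v → ∑ (allTup n k) (λ f → Φ (v ∷ f) x)))
  (trans (∑-cong (allFin n) (λ v → ∑-swap (allFin n) (allTup n k) (λ x f → Φ (v ∷ f) x))) (sym (∑-allTup n k _)))))
∑-update n (suc k) (suc i) Φ = trans (∑-allTup n k _) (trans (∑-cong (allFin n) (λ x → ∑-update n k i (λ f → Φ (x ∷ f)))) (sym (∑-allTup n k _)))

update-↭ : ∀ {n k} (f : Vec (Fin n) k) i v → v ∷ toList f ↭ lookup f i ∷ toList (f [ i ]≔ v)
update-↭ (x ∷ f) zero    v = swap v x ↭-refl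
update-↭ (x ∷ f) (suc i) v = ↭-trans (swap v x ↭-refl) (↭-trans (prep x (update-↭ f i v)) (swap x (lookup f i) ↭-refl))

∈-update : ∀ {n k} (f : Vec (Fin n) k) i v {z} → z ∈ toList (f [ i ]≔ v) → z ≡ v ⊎ z ∈ toList f
∈-update f i v p with Permₚ.∈-resp-↭ (↭-sym (update-↭ f i v)) (there p)
... | here e  = inj₁ e
... | there q = inj₂ q

-- Deleting one copy L = P ∪ rest from G: a tuple keeps Θ′ = Θ - |P| extensions unless the first Θ of them meet the rest.
module Deletion {κ n : ℕ} (G : RGraph (3 + κ) n) (Θ Θ′ q : ℕ) (Θ≡ : Θ ≡ q + Θ′) (L P : List (Fin n)) (P≤ : length P ≤ q) where

  k : ℕ
  k = 2 + κ

  Rest : Fin n → Set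
  Rest v = v ∈ L × v ∉ P

  Rest? : ∀ v → Dec (Rest v)
  Rest? v = (v ∈? L) ×-dec ¬? (v ∈? P)

  Struck : Vec (Fin n) k → Set
  Struck f = Any Rest (take Θ (nbr G (toList f)))

  Struck? : ∀ f → Dec (Struck f)
  Struck? f = Any.any? Rest? (take Θ (nbr G (toList f)))

  deg-drop : ∀ f → ¬ Hit L f → Θ ≤ deg G (toList f) → ¬ Struck f → Θ′ ≤ deg (G ∖ L) (toList f)
  deg-drop f off big ¬st = ≤-trans (+-cancelˡ-≤ q _ _ (begin
      q + Θ′                       ≡⟨ Θ≡ ⟨
      Θ                            ≡⟨ trans (length-take Θ (nbr G (toList f))) (m≤n⇒m⊓n≡m big) ⟨
      length xs                    ≤⟨ Unique-⊆⇒≤ uxs cover ⟩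
      length (P ++ ys)             ≡⟨ length-++ P ⟩
      length P + length ys         ≤⟨ +-monoˡ-≤ (length ys) P≤ ⟩
      q + length ys                ∎)) (Unique-⊆⇒≤ (Uniqueₚ.filter⁺ out? uxs) sub)
    where
    open ≤-Reasoning
    xs = take Θ (nbr G (toList f))
    out? = λ v → ¬? (v ∈? L)
    ys = filter out? xs
    uxs : Unique xs
    uxs = Uniqueₚ.take⁺ Θ (nbr-unique G (toList f))
    cover : ∀ {v} → v ∈ xs → v ∈ P ++ ys
    cover {v} p = go (v ∈? L) (v ∈? P)
      where
      go : Dec (v ∈ L) → Dec (v ∈ P) → v ∈ P ++ ys
      go (no ¬l) _       = ∈-++⁺ʳ P (∈-filter⁺ out? p ¬l)
      go (yes l) (yes r) = ∈-++⁺ˡ r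
      go (yes l) (no ¬r) = ⊥-elim (¬st (lose p (l , ¬r)))
    sub : ∀ {v} → v ∈ ys → v ∈ nbr (G ∖ L) (toList f)
    sub {v} p with ∈-filter⁻ out? {xs = xs} p
    ... | v∈ , v∉ = ∈-filter⁺ (λ v → Edge? (G ∖ L) (v ∷ toList f)) (∈-allFin v)
      (∖-edge⁺ {G = G} (nbr-edge G (toList f) (take⊆ Θ _ v∈)) λ { (here refl) → v∉ ; (there r) → ¬Hit⇒∉ off r })

  -- A struck tuple that keeps `Θ′` extensions does no harm. Asking for fewer also bounds the number
  -- of tuples that can be spoilt through it.
  Poor : Vec (Fin n) k → Set
  Poor f = Struck f × deg (G ∖ L) (toList f) < Θ′

  Poor? : ∀ f → Dec (Poor f)
  Poor? f = Struck? f ×-dec (deg (G ∖ L) (toList f) <? Θ′)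

  Spoilt : Vec (Fin n) k → Set
  Spoilt f = ∃ λ i → ∃ λ v → Edge (G ∖ L) (v ∷ toList f) × Poor (f [ i ]≔ v)

  Spoilt? : ∀ f → Dec (Spoilt f)
  Spoilt? f = any? (λ i → any? (λ v → Edge? (G ∖ L) (v ∷ toList f) ×-dec Poor? (f [ i ]≔ v)))

  survives : ∀ f → Deep Θ G f → (Deep Θ′ (G ∖ L) f ⊎ Hit L f) ⊎ (Struck f ⊎ Spoilt f)
  survives f (d , dd) = go (Hit? L f) (Struck? f) (Spoilt? f)
    where
    go : Dec (Hit L f) → Dec (Struck f) → Dec (Spoilt f) → (Deep Θ′ (G ∖ L) f ⊎ Hit L f) ⊎ (Struck f ⊎ Spoilt f)
    go (yes h) _ _ = inj₁ (inj₂ h)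
    go (no _) (yes s) _ = inj₂ (inj₁ s)
    go (no _) (no _) (yes s) = inj₂ (inj₂ s)
    go (no h) (no s) (no sp) = inj₁ (inj₁ (deg-drop f h d s , next))
      where
      next : ∀ v → Edge (G ∖ L) (v ∷ toList f) → ∀ i → Θ′ ≤ deg (G ∖ L) (toList (f [ i ]≔ v))
      next v e i = poor (Struck? (f [ i ]≔ v)) (Θ′ ≤? deg (G ∖ L) (toList (f [ i ]≔ v)))
        where
        off : ¬ Hit L (f [ i ]≔ v)
        off hit = case find hit of λ { (z , z∈ , zL) → case ∈-update f i v z∈ of λ { (inj₁ refl) → proj₂ (∖-edge⁻ {G = G} {L} e) (here refl) zL ; (inj₂ r) → ¬Hit⇒∉ h r zL } }
        poor : Dec (Struck (f [ i ]≔ v)) → Dec (Θ′ ≤ deg (G ∖ L) (toList (f [ i ]≔ v))) → Θ′ ≤ deg (G ∖ L) (toList (f [ i ]≔ v))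
        poor _       (yes p) = p
        poor (no ¬s) (no _)  = deg-drop (f [ i ]≔ v) off (dd v (proj₁ (∖-edge⁻ {G = G} {L} e)) i) ¬s
        poor (yes s) (no ¬p) = ⊥-elim (sp (i , v , e , s , ≰⇒> ¬p))

  private
    tup = allTup n k

  -- A spoilt tuple is charged to the poor tuple reached by an exchange. Undoing the exchange
  -- inserts an extension of the poor tuple at one of `k` positions, and a poor tuple has fewer than
  -- `Θ′` extensions.
  spoilt-count : count Spoilt? tup ≤ k * (Θ′ * count Struck? tup)
  spoilt-count = begin
    count Spoilt? tup                                                                  ≤⟨ ∑-mono tup point ⟩
    ∑ tup (λ f → ∑ (allFin k) (λ i → ∑ (allFin n) (λ v → Φ (f [ i ]≔ v) (lookup f i))))  ≡⟨ ∑-swap tup (allFin k) _ ⟩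
    ∑ (allFin k) (λ i → ∑ tup (λ f → ∑ (allFin n) (λ v → Φ (f [ i ]≔ v) (lookup f i))))  ≡⟨ ∑-cong (allFin k) (λ i → ∑-update n k i Φ) ⟩
    ∑ (allFin k) (λ i → ∑ tup (λ f → ∑ (allFin n) (Φ f)))                              ≡⟨ trans (∑-const (allFin k) total) (cong (_* total) (length-allFin k)) ⟩
    k * ∑ tup (λ f → ∑ (allFin n) (Φ f))                                               ≤⟨ *-monoʳ-≤ k (∑-mono tup (λ f → cheap f (Poor? f) (Struck? f))) ⟩
    k * ∑ tup (λ f → Θ′ * ind (Struck? f))                                             ≡⟨ cong (k *_) (∑-* tup Θ′ _) ⟩
    k * (Θ′ * count Struck? tup)                                                       ∎
    where
    open ≤-Reasoning
    E′? = λ f v → Edge? (G ∖ L) (v ∷ toList {n = k} f)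
    Φ : Vec (Fin n) k → Fin n → ℕ
    Φ f v = ind (E′? f v ×-dec Poor? f)
    total : ℕ
    total = ∑ tup (λ f → ∑ (allFin n) (Φ f))
    point : ∀ f → ind (Spoilt? f) ≤ ∑ (allFin k) (λ i → ∑ (allFin n) (λ v → Φ (f [ i ]≔ v) (lookup f i)))
    point f = go (Spoilt? f)
      where
      go : (d : Dec (Spoilt f)) → ind d ≤ ∑ (allFin k) (λ i → ∑ (allFin n) (λ v → Φ (f [ i ]≔ v) (lookup f i)))
      go (no _) = z≤n
      go (yes (i , v , e , p)) = ≤-trans (≤-reflexive (sym (ind-yes (E′? (f [ i ]≔ v) (lookup f i) ×-dec Poor? (f [ i ]≔ v)) (Edge-↭ (G ∖ L) (update-↭ f i v) e , p))))
        (≤-trans (∑-≥ (λ v → Φ (f [ i ]≔ v) (lookup f i)) (∈-allFin v)) (∑-≥ (λ i → ∑ (allFin n) (λ v → Φ (f [ i ]≔ v) (lookup f i))) (∈-allFin i)))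
    cheap : ∀ f → Dec (Poor f) → (d : Dec (Struck f)) → ∑ (allFin n) (Φ f) ≤ Θ′ * ind d
    cheap f (no ¬p) d = ≤-trans (∑-mono (allFin n) (λ v → ≤-reflexive (ind-no (E′? f v ×-dec Poor? f) (¬p ∘ proj₂)))) (≤-trans (≤-reflexive (∑-0 (allFin n))) z≤n)
    cheap f (yes (s , lt)) (no ¬s) = ⊥-elim (¬s s)
    cheap f (yes (s , lt)) (yes _) = begin
      ∑ (allFin n) (Φ f)                ≤⟨ ∑-mono (allFin n) (λ v → ind-mono (E′? f v ×-dec Poor? f) (E′? f v) proj₁) ⟩
      count (E′? f) (allFin n)          ≡⟨ length-filter-count (E′? f) (allFin n) ⟨
      deg (G ∖ L) (toList f)            ≤⟨ <⇒≤ lt ⟩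
      Θ′                                ≡⟨ *-identityʳ Θ′ ⟨
      Θ′ * 1                            ∎

  remaining : ∀ .{{_ : NonZero n}} m R s → .{{_ : NonZero R}} → length L ≤ s → n ^ k ≤ m * count (Deep? Θ G) tup → R * count Struck? tup ≤ Θ * n ^ k →
    2 * m * ((1 + k * Θ′) * Θ) ≤ R → 2 * (2 * m) * (k * s) ≤ n → n ^ k ≤ 2 * (2 * m) * count (Deep? Θ′ (G ∖ L)) tup
  remaining m R s L≤ dense few R≥ n≥ = loss n (n ^ k) (2 * m) (count rem? tup) (count (Deep? Θ′ (G ∖ L)) tup) (count (Hit? L) tup) (k * s) step₁
      (count-∪ rem? (Deep? Θ′ (G ∖ L)) (Hit? L) tup (λ f p → p))
      (≤-trans (hit-count L k) (≤-trans (*-monoʳ-≤ k (*-monoˡ-≤ (n ^ k) L≤)) (≤-reflexive (sym (*-assoc k s (n ^ k)))))) n≥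
    where
    rem? = λ f → Deep? Θ′ (G ∖ L) f ⊎-dec Hit? L f
    bad? = λ f → Struck? f ⊎-dec Spoilt? f
    H = count Struck? tup
    bad≤ : count bad? tup ≤ (1 + k * Θ′) * H
    bad≤ = ≤-trans (count-∪ bad? Struck? Spoilt? tup (λ f p → p)) (≤-trans (+-monoʳ-≤ H spoilt-count) (≤-reflexive (e k Θ′ H)))
      where
      e : ∀ k t h → h + k * (t * h) ≡ (1 + k * t) * h
      e = solve-∀
    step₁ : n ^ k ≤ 2 * m * count rem? tup
    -- `loss` with the number `R` of competing copies in the role of `n`: the struck tuples are a
    -- fraction of order `1 / R`.
    step₁ = loss R (n ^ k) m (count (Deep? Θ G) tup) (count rem? tup) (count bad? tup) ((1 + k * Θ′) * Θ) dense
      (count-∪ (Deep? Θ G) rem? bad? tup survives)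
      (≤-trans (*-monoʳ-≤ R bad≤) (≤-trans (≤-reflexive (e₁ R (1 + k * Θ′) H)) (≤-trans (*-monoʳ-≤ (1 + k * Θ′) few) (≤-reflexive (sym (*-assoc (1 + k * Θ′) Θ (n ^ k))))))) R≥
      where
      e₁ : ∀ r c h → r * (c * h) ≡ c * (r * h)
      e₁ = solve-∀

-- Almost disjoint copies and the choice of the one to delete

ind-any : ∀ {A : Set} {P : A → Set} (P? : ∀ x → Dec (P x)) xs → ind (Any.any? P? xs) ≤ count P? xs
ind-any P? []       = z≤n
ind-any P? (x ∷ xs) = ≤-trans (ind-∪ (Any.any? P? (x ∷ xs)) (P? x) (Any.any? P? xs) λ { (here p) → inj₁ p ; (there p) → inj₂ p })
  (+-monoʳ-≤ (ind (P? x)) (ind-any P? xs))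

record Piece {κ n : ℕ} (G : RGraph (3 + κ) n) (H : Hyp) (q s : ℕ) : Set where
  constructor mkPiece
  field
    L P  : List (Fin n)
    copy : Emb G H L
    L≤s  : length L ≤ s
    P≤q  : length P ≤ q
    live : ∀ {z} → z ∈ L → Live G z
open Piece

Almost-disjoint : ∀ {κ n j} {G : RGraph (3 + κ) n} {H q s} → (Fin j → Piece G H q s) → Set
Almost-disjoint p = ∀ i j {z} → i ≢ j → z ∈ L (p i) → z ∈ L (p j) → z ∈ P (p i) ⊎ z ∈ P (p j)

pieces : ∀ {κ n} {G : RGraph (3 + κ) n} {H q s a} → (∀ A → length A ≤ a → Copy G H A q s) → ∀ j → j * s ≤ a →
  Σ (Fin j → Piece G H q s) Almost-disjoint
pieces {κ} {n} {G} {H} {q} {s} {a} cp j j≤ = forget (build j j≤)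
  where
  State : ℕ → Set
  State j = Σ (Fin j → Piece G H q s) λ p → Almost-disjoint p × Σ (List (Fin n)) λ A → length A ≤ j * s × (∀ i {z} → z ∈ L (p i) → z ∈ A)
  forget : ∀ {j} → State j → Σ (Fin j → Piece G H q s) Almost-disjoint
  forget (p , d , _) = p , d
  extend : ∀ {j} → State j → suc j * s ≤ a → State (suc j)
  extend {j} (p , d , A , A≤ , sub) j≤ = add (cp A (≤-trans A≤ (≤-trans (m≤n+m (j * s) s) j≤)))
    where
    add : Copy G H A q s → State (suc j)
    add c = p⁺ , d⁺ , (C.L ++ A) , ≤-trans (≤-reflexive (length-++ C.L)) (+-mono-≤ C.L≤N A≤) , sub⁺
      where
      module C = Copy c
      p⁺ : Fin (suc j) → Piece G H q s
      p⁺ zero    = mkPiece C.L C.P C.copy C.L≤N C.P≤q C.live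
      p⁺ (suc i) = p i
      new : ∀ i {z} → z ∈ C.L → z ∈ L (p i) → z ∈ C.P
      new i z∈ r with C.off z∈
      ... | inj₁ zP = zP
      ... | inj₂ z∉ = ⊥-elim (z∉ (sub i r))
      d⁺ : Almost-disjoint p⁺
      d⁺ zero    zero    ne a b = ⊥-elim (ne refl)
      d⁺ zero    (suc i) ne a b = inj₁ (new i a b)
      d⁺ (suc i) zero    ne a b = inj₂ (new i b a)
      d⁺ (suc i) (suc l) ne a b = d i l (λ e → ne (cong suc e)) a b
      sub⁺ : ∀ i {z} → z ∈ L (p⁺ i) → z ∈ C.L ++ A
      sub⁺ zero    r = ∈-++⁺ˡ r
      sub⁺ (suc i) r = ∈-++⁺ʳ C.L (sub i r)
  build : ∀ j → j * s ≤ a → State j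
  build zero    _  = (λ ()) , (λ ()) , [] , z≤n , (λ ())
  build (suc j) j≤ = extend (build j (≤-trans (m≤n+m (j * s) s) j≤)) j≤

total : List Comp → ℕ
total []       = 0
total (c ∷ cs) = cost c + total cs

-- Whenever a component is about to be embedded, the extensions still guaranteed must number at
-- least three, the least number of colours of a box.
Ok : List Comp → Set
Ok []       = 0 ≡ 0
Ok (c ∷ cs) = 3 ≤ total (c ∷ cs) × Ok cs

Embs-∖ : ∀ {κ n} {G : RGraph (3 + κ) n} {W Hs L} → Embs (G ∖ W) Hs L → Embs G Hs L
Embs-∖ [] = []
Embs-∖ {G = G} {W} (emb e d es) = emb (Emb-mono (∖-⊆ {G = G} {W}) e) d (Embs-∖ {W = W} es)

module _ {κ n : ℕ} .{{_ : NonZero n}} (G : RGraph (3 + κ) n) {H : Hyp} {q s : ℕ} (Θ Θ′ : ℕ) (Θ≡ : Θ ≡ q + Θ′) where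

  private
    k = 2 + κ
    tup = allTup n k

  -- Exchange of summation: a listed extension lies in the rest of at most one copy, and at most `Θ`
  -- extensions of a tuple are looked at.
  struck-total : ∀ {R} (p : Fin R → Piece G H q s) → Almost-disjoint p →
    ∑ (allFin R) (λ i → count (Deletion.Struck? G Θ Θ′ q Θ≡ (L (p i)) (P (p i)) (P≤q (p i))) tup) ≤ Θ * n ^ k
  struck-total {R} p d = begin
    ∑ (allFin R) (λ i → ∑ tup (λ f → ind (St? i f)))        ≡⟨ ∑-swap (allFin R) tup _ ⟩
    ∑ tup (λ f → ∑ (allFin R) (λ i → ind (St? i f)))        ≤⟨ ∑-mono tup point ⟩
    ∑ tup (λ _ → Θ)                                         ≡⟨ trans (∑-const tup Θ) (trans (cong (_* Θ) (length-allTup n k)) (*-comm (n ^ k) Θ)) ⟩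
    Θ * n ^ k                                               ∎
    where
    open ≤-Reasoning
    St? : ∀ i f → Dec (Deletion.Struck G Θ Θ′ q Θ≡ (L (p i)) (P (p i)) (P≤q (p i)) f)
    St? i = Deletion.Struck? G Θ Θ′ q Θ≡ (L (p i)) (P (p i)) (P≤q (p i))
    R? : ∀ i v → Dec (v ∈ L (p i) × v ∉ P (p i))
    R? i v = (v ∈? L (p i)) ×-dec ¬? (v ∈? P (p i))
    one : ∀ v i j → v ∈ L (p i) × v ∉ P (p i) → v ∈ L (p j) × v ∉ P (p j) → i ≡ j
    one v i j (a , b) (a′ , b′) = go (i ≟ j)
      where
      go : Dec (i ≡ j) → i ≡ j
      go (yes e) = e
      go (no ne) with d i j ne a a′
      ... | inj₁ x = ⊥-elim (b x)
      ... | inj₂ x = ⊥-elim (b′ x)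
    point : ∀ f → ∑ (allFin R) (λ i → ind (St? i f)) ≤ Θ
    point f = begin
      ∑ (allFin R) (λ i → ind (St? i f))                    ≤⟨ ∑-mono (allFin R) (λ i → ind-any (R? i) xs) ⟩
      ∑ (allFin R) (λ i → ∑ xs (λ v → ind (R? i v)))        ≡⟨ ∑-swap (allFin R) xs _ ⟩
      ∑ xs (λ v → count (λ i → R? i v) (allFin R))          ≤⟨ ∑-≤* xs _ 1 (λ v → at-most-one (λ i → R? i v) (one v)) ⟩
      length xs * 1                                         ≡⟨ *-identityʳ (length xs) ⟩
      length xs                                             ≡⟨ length-take Θ (nbr G (toList f)) ⟩
      Θ ⊓ length (nbr G (toList f))                         ≤⟨ m⊓n≤m Θ _ ⟩
      Θ                                                     ∎
      where
      xs = take Θ (nbr G (toList f))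

  embed-one : ∀ m → (∀ A → length A ≤ suc (2 * m * ((1 + k * Θ′) * Θ)) * s → Copy G H A q s) → n ^ k ≤ m * count (Deep? Θ G) tup → 2 * (2 * m) * (k * s) ≤ n →
    Σ (Piece G H q s) λ p → n ^ k ≤ 2 * (2 * m) * count (Deep? Θ′ (G ∖ L p)) tup
  embed-one m cp dense n≥ = pick (pieces cp R ≤-refl)
    where
    R₁ R : ℕ
    -- `Θ` bounds the strikes on one tuple by all copies, `1 + k * Θ′` counts a struck tuple
    -- together with those it spoils, and `2 * m` makes the loss at most half of a density `1 / m`.
    R₁ = 2 * m * ((1 + k * Θ′) * Θ)
    R = suc R₁
    pick : Σ (Fin R → Piece G H q s) Almost-disjoint → Σ (Piece G H q s) λ p → n ^ k ≤ 2 * (2 * m) * count (Deep? Θ′ (G ∖ L p)) tup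
    pick (p , d) = best (below-average R₁ _ (Θ * n ^ k) (struck-total p d))
      where
      best : (∃ λ i → R * count (Deletion.Struck? G Θ Θ′ q Θ≡ (L (p i)) (P (p i)) (P≤q (p i))) tup ≤ Θ * n ^ k) → Σ (Piece G H q s) λ p → n ^ k ≤ 2 * (2 * m) * count (Deep? Θ′ (G ∖ L p)) tup
      best (i , few) = p i , Deletion.remaining G Θ Θ′ q Θ≡ (L (p i)) (P (p i)) (P≤q (p i)) m R s (L≤s (p i)) dense few (n≤1+n R₁) n≥

Packing : ∀ {κ n} → RGraph (3 + κ) n → List Comp → Set₁
Packing {κ} {n} G cs = Σ (List (Fin n)) λ M → Embs G (map (hyp κ) cs) M × (∀ {z} → z ∈ M → Live G z)

-- Each component lowers the guaranteed density by the factor four, independently of `n`, so one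
-- threshold for `n` can be fixed in advance for all of them.
embed-all : ∀ κ cs → Ok cs → ∀ m → ∃ λ N → ∀ {n} → N ≤ n → (G : RGraph (3 + κ) n) →
  n ^ (2 + κ) ≤ m * count (Deep? (total cs) G) (allTup n (2 + κ)) → Packing G cs
embed-all κ [] _ m = 0 , λ _ G _ → [] , [] , λ ()
embed-all κ (c ∷ cs) (3≤ , ok) m = suc (N₁ + (N₂ + N₃)) , main
  where
  k s Θ Θ′ N₁ N₂ N₃ a : ℕ
  k  = 2 + κ
  s  = suc (order c * k)
  Θ′ = total cs
  Θ  = cost c + Θ′
  a  = suc (2 * m * ((1 + k * Θ′) * Θ)) * s
  N₁ = proj₁ (single κ c a m)
  N₂ = 2 * (2 * m) * (k * s)
  N₃ = proj₁ (embed-all κ cs ok (2 * (2 * m)))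
  main : ∀ {n} → suc (N₁ + (N₂ + N₃)) ≤ n → (G : RGraph (3 + κ) n) → n ^ k ≤ m * count (Deep? Θ G) (allTup n k) → Packing G (c ∷ cs)
  main {n@(suc _)} N≤ G dense = step (embed-one G Θ Θ′ refl m (λ A A≤ → proj₂ (single κ c a m) N₁≤ G A A≤ Θ (m≤m+n (cost c) Θ′) 3≤ dense) dense N₂≤)
    where
    N₁≤ : N₁ ≤ n
    N₁≤ = ≤-trans (m≤m+n N₁ _) (<⇒≤ N≤)
    N₂≤ : N₂ ≤ n
    N₂≤ = ≤-trans (m≤m+n N₂ N₃) (≤-trans (m≤n+m _ N₁) (<⇒≤ N≤))
    N₃≤ : N₃ ≤ n
    N₃≤ = ≤-trans (m≤n+m N₃ N₂) (≤-trans (m≤n+m _ N₁) (<⇒≤ N≤))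
    step : (Σ (Piece G (hyp κ c) (cost c) s) λ p → n ^ k ≤ 2 * (2 * m) * count (Deep? Θ′ (G ∖ L p)) (allTup n k)) → Packing G (c ∷ cs)
    step (p , d) = join (proj₂ (embed-all κ cs ok (2 * (2 * m))) N₃≤ (G ∖ L p) d)
      where
      join : Packing (G ∖ L p) cs → Packing G (c ∷ cs)
      join (M , es , lv) = L p ++ M , emb (Piece.copy p) (λ z∈ zM → proj₂ (Live-∖ {G = G} {L p} (lv zM)) z∈) (Embs-∖ {W = L p} es) ,
        λ z∈ → [ live p , (λ r → proj₁ (Live-∖ {G = G} {L p} (lv r))) ]′ (∈-++⁻ (L p) z∈)

-- Hypergraphs in which every face has many extensions

-- Needs no density of faces: with `D` large enough a single edge suffices to start a greedy
-- embedding.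
Full : ∀ {r n} → ℕ → RGraph r n → Set
Full {r} {n} D G = ∀ (f : List (Fin n)) v → suc (length f) ≡ r → Edge G (v ∷ f) → ∀ W → length W ≤ D → ∃ λ w → w ∉ W × Edge G (w ∷ f)

module _ {κ n : ℕ} (G : RGraph (3 + κ) n) (D : ℕ) (full : Full D G) where

  -- An edge without one of its vertices is a face, which a vertex outside `W` completes again. Done
  -- for each vertex beyond `keep`, this renews the edge around `keep`.
  refresh : ∀ keep {m} (E : Vec (Fin n) m) → length keep + m ≡ 3 + κ → Edge G (keep ++ toList E) → ∀ W → length W ≤ D →
    Σ (Vec (Fin n) m) λ E′ → Edge G (keep ++ toList E′) × (∀ {z} → z ∈ toList E′ → z ∉ W)
  refresh keep [] len e W W≤ = [] , e , λ ()
  refresh keep (x ∷ E) len e W W≤ = first (full (keep ++ toList E) x (trans (cong suc (trans (length-++ keep) (cong (length keep +_) (Vecₚ.length-toList E)))) (trans (sym (+-suc (length keep) _)) len)) (Edge-↭ G (Permₚ.shift x keep (toList E)) e) W W≤)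
    where
    first : (∃ λ w → w ∉ W × Edge G (w ∷ keep ++ toList E)) → Σ (Vec (Fin n) _) λ E′ → Edge G (keep ++ toList E′) × (∀ {z} → z ∈ toList E′ → z ∉ W)
    first (w , w∉ , e′) = rest (refresh (keep ++ [ w ]) E (trans (cong (_+ _) (trans (length-++ keep) (+-comm (length keep) 1))) (trans (sym (+-suc (length keep) _)) len)) (subst (Edge G) (sym (++-assoc keep [ w ] (toList E))) (Edge-↭ G (↭-sym (Permₚ.shift w keep (toList E))) e′)) W W≤)
      where
      rest : (Σ (Vec (Fin n) _) λ E′ → Edge G ((keep ++ [ w ]) ++ toList E′) × (∀ {z} → z ∈ toList E′ → z ∉ W)) → Σ (Vec (Fin n) _) λ E′ → Edge G (keep ++ toList E′) × (∀ {z} → z ∈ toList E′ → z ∉ W)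
      rest (E′ , e″ , av) = w ∷ E′ , subst (Edge G) (++-assoc keep [ w ] (toList E′)) e″ , λ { (here refl) → w∉ ; (there p) → av p }

  private
    edge-unique : ∀ {u v} (E : Vec (Fin n) (suc κ)) → Edge G (u ∷ v ∷ toList E) → Unique (u ∷ v ∷ toList E)
    edge-unique E = Edge-Unique G (cong (2 +_) (Vecₚ.length-toList E))

    tail₂ : ∀ {u v : Fin n} {l} → Unique (u ∷ v ∷ l) → Unique l
    tail₂ (_ ∷ _ ∷ u) = u

  -- The link of v: hopping along edges through v gives a path in the shadow, and the last hop returns to v.
  wheel : ∀ j {v x} (E : Vec (Fin n) (suc κ)) → Edge G (v ∷ x ∷ toList E) → ∀ W → v ∈ W → x ∉ W → length W + suc j * (3 + κ) ≤ D →
    ∃ λ L → Chain G (suc j) x v L × Unique L × (∀ {z} → z ∈ L → z ∉ W)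
  wheel zero {v} {x} E e W v∈ x∉ W≤ = close (refresh (v ∷ x ∷ []) E refl e (x ∷ W) (≤-trans (≤-by (2 + κ) (a (length W) κ)) W≤))
    where
    a : ∀ w κ → suc w + (2 + κ) ≡ w + 1 * (3 + κ)
    a = solve-∀
    close : (Σ (Vec (Fin n) (suc κ)) λ E′ → Edge G (v ∷ x ∷ toList E′) × (∀ {z} → z ∈ toList E′ → z ∉ x ∷ W)) → ∃ λ L → Chain G 1 x v L × Unique L × (∀ {z} → z ∈ L → z ∉ W)
    close (E′ , e′ , av) = x ∷ toList E′ ++ [] , link E′ (Edge-↭ G (swap v x ↭-refl) e′) [] ,
      Unique-∷ (λ p → av (++[]⁻ p) (here refl)) (subst Unique (sym (++-identityʳ (toList E′))) (tail₂ (edge-unique E′ e′))) ,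
      λ { (here refl) → x∉ ; (there p) r → av (++[]⁻ p) (there r) }
      where
      ++[]⁻ : ∀ {z} → z ∈ toList E′ ++ [] → z ∈ toList E′
      ++[]⁻ {z} = subst (z ∈_) (++-identityʳ (toList E′))
  wheel (suc j) {v} {x} E e W v∈ x∉ W≤ = hop (refresh (v ∷ x ∷ []) E refl e (x ∷ W) (≤-trans (≤-by (2 + κ + suc j * (3 + κ)) (a (length W) κ (suc j * (3 + κ)))) W≤))
    where
    Goal : Set
    Goal = ∃ λ L → Chain G (2 + j) x v L × Unique L × (∀ {z} → z ∈ L → z ∉ W)
    a : ∀ w κ m → suc w + (2 + κ + m) ≡ w + (3 + κ + m)
    a = solve-∀
    hop : (Σ (Vec (Fin n) (suc κ)) λ E′ → Edge G (v ∷ x ∷ toList E′) × (∀ {z} → z ∈ toList E′ → z ∉ x ∷ W)) → Goal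
    hop (y ∷ E₁ , e′ , av) = spin (wheel j (x ∷ E₁) (Edge-↭ G (prep v (swap x y ↭-refl)) e′) (x ∷ W) (there v∈) (av (here refl))
        (≤-trans (≤-by (2 + κ) (b (length W) κ (suc j * (3 + κ)))) W≤))
      where
      b : ∀ w κ m → suc w + m + (2 + κ) ≡ w + (3 + κ + m)
      b = solve-∀
      spin : (∃ λ L → Chain G (suc j) y v L × Unique L × (∀ {z} → z ∈ L → z ∉ x ∷ W)) → Goal
      spin (L , ch , uL , avL) = attach (refresh (x ∷ y ∷ []) (v ∷ E₁) refl (Edge-↭ G (↭-trans (swap v x ↭-refl) (prep x (swap v y ↭-refl))) e′) (x ∷ W ++ L)
          (≤-trans (≤-by (3 + κ + j) (trans (cong (λ l → suc l + (3 + κ + j)) (trans (length-++ W) (cong (length W +_) (chain-length ch)))) (c (length W) κ j))) W≤))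
        where
        c : ∀ w κ j → suc (w + (1 + j) * (2 + κ)) + (3 + κ + j) ≡ w + (2 + j) * (3 + κ)
        c = solve-∀
        attach : (Σ (Vec (Fin n) (suc κ)) λ E′ → Edge G (x ∷ y ∷ toList E′) × (∀ {z} → z ∈ toList E′ → z ∉ x ∷ W ++ L)) → Goal
        attach (E″ , e″ , av″) = x ∷ toList E″ ++ L , link E″ e″ ch ,
          Unique-∷ (λ p → case ∈-++⁻ (toList E″) p of λ { (inj₁ r) → av″ r (here refl) ; (inj₂ r) → avL r (here refl) })
            (Unique-++ (tail₂ (edge-unique E″ e″)) uL (λ p r → av″ p (there (∈-++⁺ʳ W r)))) ,
          λ { (here refl) → x∉ ; (there p) r → case ∈-++⁻ (toList E″) p of λ { (inj₁ s) → av″ s (there (∈-++⁺ˡ r)) ; (inj₂ s) → avL s (there r) } }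

  record Off (H : Hyp) (W : List (Fin n)) (s : ℕ) : Set where
    constructor mkOff
    field
      {L}   : List (Fin n)
      copy  : Emb G H L
      L≤s   : length L ≤ s
      avoid : ∀ {z} → z ∈ L → z ∉ W

  -- All three kinds grow from one edge on `v` and `x` that has been renewed off `W`. A wheel from
  -- `x` to `v` is a path, and one more edge on `v` and `x` closes it to a cycle.
  component : ∀ c W → (Σ (Vec (Fin n) (3 + κ)) λ l → Edge G (toList l)) → length W + (2 + order c) * (3 + κ) ≤ D → Off (hyp κ c) W ((2 + order c) * (3 + κ))
  component c W (l , e) W≤ = start (refresh [] l refl e W (≤-trans (m≤m+n (length W) _) W≤))
    where
    start : (Σ (Vec (Fin n) (3 + κ)) λ l → Edge G (toList l) × (∀ {z} → z ∈ toList l → z ∉ W)) → Off (hyp κ c) W ((2 + order c) * (3 + κ))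
    start (v ∷ x ∷ E , e , av) = pick c W≤
      where
      x∉ : x ∉ v ∷ W
      x∉ (here refl) = Unique[x∷xs]⇒x∉xs (edge-unique E e) (here refl)
      x∉ (there p)   = av (there (here refl)) p
      spin : ∀ j → length W + (3 + j) * (3 + κ) ≤ D → ∃ λ L → Chain G (suc j) x v L × Unique L × (∀ {z} → z ∈ L → z ∉ v ∷ W)
      spin j h = wheel j E e (v ∷ W) (here refl) x∉ (≤-trans (≤-by (5 + (κ + κ)) (a (length W) κ j)) h)
        where
        a : ∀ w κ j → suc (w + (1 + j) * (3 + κ)) + (5 + (κ + κ)) ≡ w + (3 + j) * (3 + κ)
        a = solve-∀
      spoke-prop : SpokeProp {G = G} D v
      spoke-prop W′ h = give (refresh [ v ] (x ∷ E) refl e W′ h)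
        where
        give : (Σ (Vec (Fin n) (2 + κ)) λ E′ → Edge G (v ∷ toList E′) × (∀ {z} → z ∈ toList E′ → z ∉ W′)) →
          Σ (Fin n) λ y → Σ (Vec (Fin n) (suc κ)) λ E′ → Edge G (v ∷ y ∷ toList E′) × Unique (y ∷ toList E′) × (∀ {z} → z ∈ y ∷ toList E′ → z ∉ W′)
        give (y ∷ E′ , e′ , av′) = y , E′ , e′ , AllPairs.tail (edge-unique E′ e′) , av′
      pick : ∀ c → length W + (2 + order c) * (3 + κ) ≤ D → Off (hyp κ c) W ((2 + order c) * (3 + κ))
      pick (starᶜ t t≥) h = put (spokes v spoke-prop t (v ∷ W) (here refl) (≤-trans (≤-by (5 + (κ + κ) + t) (a (length W) κ t)) h))
        where
        a : ∀ w κ t → suc (w + t * (2 + κ)) + (5 + (κ + κ) + t) ≡ w + (2 + t) * (3 + κ)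
        a = solve-∀
        put : (∃ λ L → Spokes G v t L × Unique L × (∀ {z} → z ∈ L → z ∉ v ∷ W)) → Off (expansion (3 + κ) (star t)) W ((2 + t) * (3 + κ))
        put (L , sp , uL , avL) = mkOff (star-emb sp (Unique-∷ (λ p → avL p (here refl)) uL))
          (≤-trans (≤-reflexive (cong suc (spokes-length sp))) (≤-by (5 + (κ + κ) + t) (a 0 κ t)))
          λ { (here refl) → av (here refl) ; (there p) r → avL p (there r) }
      pick (baseᶜ paths (suc j) _) h = put (spin j h)
        where
        a : ∀ κ j → (1 + j) * (2 + κ) + 1 + (6 + (κ + κ) + j) ≡ (3 + j) * (3 + κ)
        a = solve-∀
        put : (∃ λ L → Chain G (suc j) x v L × Unique L × (∀ {z} → z ∈ L → z ∉ v ∷ W)) → Off (expansion (3 + κ) (path (suc j))) W ((3 + j) * (3 + κ))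
        put (L , ch , uL , avL) = mkOff (path-emb ch (Unique-++ uL ([] ∷ []) (λ { p (here refl) → avL p (here refl) })))
          (≤-trans (≤-reflexive (trans (length-++ L) (cong (_+ 1) (chain-length ch)))) (≤-by (6 + (κ + κ) + j) (a κ j)))
          (λ p → [ (λ r s → avL r (there s)) , (λ { (here refl) → av (here refl) }) ]′ (∈-++⁻ L p))
      pick (baseᶜ cycles (suc zero) (s≤s ())) h
      pick (baseᶜ cycles (suc (suc j)) _) h = put (spin j (≤-trans (+-monoʳ-≤ (length W) (*-monoˡ-≤ (3 + κ) (n≤1+n (3 + j)))) h))
        where
        a : ∀ κ j → (2 + j) * (2 + κ) + (8 + (κ + κ) + j) ≡ (4 + j) * (3 + κ)
        a = solve-∀
        b : ∀ w κ j → suc (w + (1 + j) * (2 + κ)) + (9 + (κ + κ + κ) + j) ≡ w + (4 + j) * (3 + κ)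
        b = solve-∀
        put : (∃ λ L → Chain G (suc j) x v L × Unique L × (∀ {z} → z ∈ L → z ∉ v ∷ W)) → Off (expansion (3 + κ) (cycle (suc (suc j)))) W ((4 + j) * (3 + κ))
        put (L , ch , uL , avL) = close (refresh (v ∷ x ∷ []) E refl e (v ∷ W ++ L)
            (≤-trans (≤-by (9 + (κ + κ + κ) + j) (trans (cong (λ l → suc l + (9 + (κ + κ + κ) + j)) (trans (length-++ W) (cong (length W +_) (chain-length ch)))) (b (length W) κ j))) h))
          where
          close : (Σ (Vec (Fin n) (suc κ)) λ E′ → Edge G (v ∷ x ∷ toList E′) × (∀ {z} → z ∈ toList E′ → z ∉ v ∷ W ++ L)) → Off (expansion (3 + κ) (cycle (suc (suc j)))) W ((4 + j) * (3 + κ))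
          close (E′ , e′ , av′) = mkOff (cycle-emb (link E′ e′ ch)
              (Unique-∷ (λ p → case ∈-++⁻ (toList E′) p of λ { (inj₁ r) → av′ r (here refl) ; (inj₂ r) → avL r (here refl) })
                (Unique-++ (tail₂ (edge-unique E′ e′)) uL (λ p r → av′ p (there (∈-++⁺ʳ W r))))))
            (≤-trans (≤-reflexive (chain-length (link E′ e′ ch))) (≤-by (8 + (κ + κ) + j) (a κ j)))
            λ { (here refl) → av (here refl) ; (there p) r → case ∈-++⁻ (toList E′) p of λ { (inj₁ s) → av′ s (there (∈-++⁺ˡ r)) ; (inj₂ s) → avL s (there r) } }

budget : ℕ → List Comp → ℕ
budget κ []       = 0
budget κ (c ∷ cs) = (2 + order c) * (3 + κ) + budget κ cs

full-embed : ∀ {κ n} (G : RGraph (3 + κ) n) D → Full D G → (Σ (Vec (Fin n) (3 + κ)) λ l → Edge G (toList l)) → ∀ cs W → length W + budget κ cs ≤ D →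
  Σ (List (Fin n)) λ L → Embs G (map (hyp κ) cs) L × (∀ {z} → z ∈ L → z ∉ W)
full-embed G D full e [] W W≤ = [] , [] , λ ()
full-embed {κ} {n} G D full e (c ∷ cs) W W≤ = first (component G D full c W e (≤-trans (+-monoʳ-≤ (length W) (m≤m+n _ _)) W≤))
  where
  Goal : Set₁
  Goal = Σ (List (Fin n)) λ L → Embs G (map (hyp κ) (c ∷ cs)) L × (∀ {z} → z ∈ L → z ∉ W)
  first : Off G D full (hyp κ c) W ((2 + order c) * (3 + κ)) → Goal
  first (mkOff {L} cp L≤ av) = rest (full-embed G D full e cs (L ++ W) (≤-trans (+-monoˡ-≤ (budget κ cs) (≤-trans (≤-reflexive (trans (length-++ L) (+-comm (length L) (length W)))) (+-monoʳ-≤ (length W) L≤))) (≤-trans (≤-reflexive (+-assoc (length W) _ _)) W≤)))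
    where
    rest : (Σ (List (Fin n)) λ L′ → Embs G (map (hyp κ) cs) L′ × (∀ {z} → z ∈ L′ → z ∉ L ++ W)) → Goal
    rest (L′ , es , av′) = L ++ L′ , emb cp (λ p r → av′ r (∈-++⁺ˡ p)) es , λ p → [ av , (λ r s → av′ r (∈-++⁺ʳ L s)) ]′ (∈-++⁻ L p)

-- Deleting cliques

nC0≡1 : ∀ m → m C 0 ≡ 1
nC0≡1 m = trans (nCk≡nC[n∸k] {0} {m} z≤n) (nCn≡1 m)

count-none : ∀ {A : Set} {P : A → Set} (P? : ∀ x → Dec (P x)) → (∀ x → ¬ P x) → ∀ xs → count P? xs ≤ 0
count-none P? h xs = ≤-trans (∑-mono xs (λ x → ≤-reflexive (ind-no (P? x) (h x)))) (≤-reflexive (∑-0 xs))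

count-allSubsets : ∀ {n} {P : Subset (suc n) → Set} (P? : ∀ S → Dec (P S)) →
  count P? (allSubsets (suc n)) ≡ count (λ S → P? (true ∷ S)) (allSubsets n) + count (λ S → P? (false ∷ S)) (allSubsets n)
count-allSubsets {n} P? = trans (∑-++ (map (true ∷_) (allSubsets n)) _ _) (cong₂ _+_ (∑-map (true ∷_) (allSubsets n) _) (∑-map (false ∷_) (allSubsets n) _))

Between : Subset n → Subset n → ℕ → Subset n → Set
Between f U s K = f ⊆ K × K ⊆ U × ∣ K ∣ ≡ s

Between? : ∀ (f U : Subset n) s K → Dec (Between f U s K)
Between? f U s K = (f ⊆? K) ×-dec (K ⊆? U) ×-dec (∣ K ∣ ℕₚ.≟ s)

in⊈out : ∀ {n} {p q : Subset n} → ¬ (true ∷ p ⊆ false ∷ q)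
in⊈out h with h Vec.here
... | ()

-- A set between `f` and `U` amounts to a choice of `j` among at most `u` elements; the induction
-- over the ground set follows Pascal's rule.
between-count : ∀ {n} (f U : Subset n) s u j → ∣ U ∣ ≤ u + ∣ f ∣ → s ≡ j + ∣ f ∣ → count (Between? f U s) (allSubsets n) ≤ u C j
between-count [] [] s u zero    U≤ refl = ≤-trans (≤-trans (≤-reflexive (+-identityʳ _)) (ind-≤1 (Between? [] [] 0 []))) (≤-reflexive (sym (nC0≡1 u)))
between-count [] [] s u (suc j) U≤ refl = ≤-trans (count-none (Between? [] [] (suc j + 0)) (λ { [] (_ , _ , ()) }) [ [] ]) z≤n
between-count {suc n} (true ∷ f) (true ∷ U) s u j U≤ s≡ = ≤-trans (≤-reflexive (count-allSubsets (Between? (true ∷ f) (true ∷ U) s))) (≤-trans (+-mono-≤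
    (≤-trans (count-mono (λ K → Between? (true ∷ f) (true ∷ U) s (true ∷ K)) (Between? f U (j + ∣ f ∣)) (allSubsets n)
      (λ { K (a , b , c) → drop-∷-⊆ a , drop-∷-⊆ b , cong pred (trans c (trans s≡ (+-suc j ∣ f ∣))) }))
      (between-count f U (j + ∣ f ∣) u j (+-cancelˡ-≤ 1 _ _ (≤-trans U≤ (≤-reflexive (+-suc u ∣ f ∣)))) refl))
    (count-none (λ K → Between? (true ∷ f) (true ∷ U) s (false ∷ K)) (λ { K (a , _) → in⊈out a }) (allSubsets n))) (≤-reflexive (+-identityʳ _)))
between-count {suc n} (true ∷ f) (false ∷ U) s u j U≤ s≡ = ≤-trans (count-none (Between? (true ∷ f) (false ∷ U) s) none (allSubsets (suc n))) z≤n
  where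
  none : ∀ K → ¬ Between (true ∷ f) (false ∷ U) s K
  none (true ∷ K)  (_ , b , _) = in⊈out b
  none (false ∷ K) (a , _)     = in⊈out a
between-count {suc n} (false ∷ f) (false ∷ U) s u j U≤ s≡ = ≤-trans (≤-reflexive (count-allSubsets (Between? (false ∷ f) (false ∷ U) s))) (+-mono-≤
    (count-none (λ K → Between? (false ∷ f) (false ∷ U) s (true ∷ K)) (λ { K (_ , b , _) → in⊈out b }) (allSubsets n))
    (≤-trans (count-mono (λ K → Between? (false ∷ f) (false ∷ U) s (false ∷ K)) (Between? f U s) (allSubsets n)
      (λ { K (a , b , c) → drop-∷-⊆ a , drop-∷-⊆ b , c })) (between-count f U s u j U≤ s≡)))
between-count {suc n} (false ∷ f) (true ∷ U) s zero j U≤ s≡ = ≤-trans (count-none (Between? (false ∷ f) (true ∷ U) s) none (allSubsets (suc n))) z≤n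
  where
  none : ∀ K → ¬ Between (false ∷ f) (true ∷ U) s K
  none (c ∷ K) (a , b , _) = <⇒≱ U≤ (p⊆q⇒∣p∣≤∣q∣ (λ p → drop-∷-⊆ b (drop-∷-⊆ a p)))
between-count {suc n} (false ∷ f) (true ∷ U) s (suc u) j U≤ s≡ = ≤-trans (≤-reflexive (count-allSubsets (Between? (false ∷ f) (true ∷ U) s)))
    (≤-trans (+-mono-≤ (left j s≡) (≤-trans (count-mono (λ K → Between? (false ∷ f) (true ∷ U) s (false ∷ K)) (Between? f U s) (allSubsets n)
      (λ { K (a , b , c) → drop-∷-⊆ a , drop-∷-⊆ b , c })) (between-count f U s u j (≤-pred U≤) s≡))) (pascal j))
  where
  part : ℕ → ℕ
  part zero    = 0
  part (suc j) = u C j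
  pascal : ∀ j → part j + u C j ≤ suc u C j
  pascal zero    = ≤-reflexive (trans (nC0≡1 u) (sym (nC0≡1 (suc u))))
  pascal (suc j) = ≤-reflexive (nCk+nC[k+1]≡[n+1]C[k+1] u j)
  left : ∀ j → s ≡ j + ∣ f ∣ → count (λ K → Between? (false ∷ f) (true ∷ U) s (true ∷ K)) (allSubsets n) ≤ part j
  left zero    e = count-none (λ K → Between? (false ∷ f) (true ∷ U) s (true ∷ K)) (λ { K (a , _ , c) → <-irrefl refl (≤-trans (≤-reflexive (trans c e)) (p⊆q⇒∣p∣≤∣q∣ (drop-∷-⊆ a))) }) (allSubsets n)
  left (suc j) e = ≤-trans (count-mono (λ K → Between? (false ∷ f) (true ∷ U) s (true ∷ K)) (Between? f U (j + ∣ f ∣)) (allSubsets n)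
      (λ { K (a , b , c) → drop-∷-⊆ a , drop-∷-⊆ b , cong pred (trans c e) })) (between-count f U (j + ∣ f ∣) u j (≤-pred U≤) refl)

all-sets : ∀ n k → count (λ S → ∣ S ∣ ℕₚ.≟ k) (allSubsets n) ≤ n C k
all-sets n k = ≤-trans (count-mono (λ S → ∣ S ∣ ℕₚ.≟ k) (Between? ⊥ ⊤ k) (allSubsets n) (λ S e → (λ p → ⊥-elim (∉⊥ p)) , (λ _ → ∈⊤) , e))
    (between-count {n} ⊥ ⊤ k n k (≤-trans (∣p∣≤n ⊤) (m≤m+n n _)) (sym (trans (cong (k +_) (∣⊥∣≡0 n)) (+-identityʳ k))))

anySubset? : ∀ {n} {P : Subset n → Set} → (∀ S → Dec (P S)) → Dec (∃ λ S → P S)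
anySubset? {n} P? = map′ Any.satisfied (λ { (S , p) → lose (∈-allSubsets S) p }) (Any.any? P? (allSubsets n))

Family : ℕ → Set
Family n = Subset n → Bool

module _ {n : ℕ} where

  Alive : Family n → Subset n → Set
  Alive K f = ∃ λ S → T (K S) × f ⊆ S

  Alive? : ∀ K f → Dec (Alive K f)
  Alive? K f = anySubset? (λ S → T? (K S) ×-dec (f ⊆? S))

  Reach : Family n → Subset n → Fin n → Set
  Reach K f v = ∃ λ S → T (K S) × f ⊆ S × v ∈ₛ S

  Reach? : ∀ K f v → Dec (Reach K f v)
  Reach? K f v = anySubset? (λ S → T? (K S) ×-dec (f ⊆? S) ×-dec (v ∈ₛ? S))

  -- The union of the members through `f`. If it exceeds `f` by at most `u` vertices, the members
  -- through `f` are few, namely at most `u C j`.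
  span : Family n → Subset n → Subset n
  span K f = tabulate (λ v → does (Reach? K f v))

  ∈span⁺ : ∀ K f {v} → Reach K f v → v ∈ₛ span K f
  ∈span⁺ K f {v} r = Vecₚ.lookup⇒[]= v (span K f) (trans (Vecₚ.lookup∘tabulate _ v) (dec-true (Reach? K f v) r))

  ∈span⁻ : ∀ K f {v} → v ∈ₛ span K f → Reach K f v
  ∈span⁻ K f {v} p = witness (Reach? K f v) (Equivalence.from T-≡ (trans (sym (Vecₚ.lookup∘tabulate _ v)) (Vecₚ.[]=⇒lookup p)))

  size : Family n → ℕ
  size K = count (λ S → T? (K S)) (allSubsets n)

  _without_ : Family n → Subset n → Family n
  (K without f) S = K S ∧ not (does (f ⊆? S))

  without⁻ : ∀ K f S → T ((K without f) S) → T (K S) × ¬ (f ⊆ S)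
  without⁻ K f S h with Equivalence.to (T-∧ {K S}) h
  ... | a , b = a , λ s → no-way (f ⊆? S) s b
    where
    no-way : ∀ {Q : Set} (d : Dec Q) → Q → ¬ T (not (does d))
    no-way (yes _) _ ()
    no-way (no ¬q) q _ = ¬q q

  without-size : ∀ K f s u j → (∀ S → T (K S) → ∣ S ∣ ≡ s) → ∣ span K f ∣ ≤ u + ∣ f ∣ → s ≡ j + ∣ f ∣ → size K ≤ size (K without f) + u C j
  without-size K f s u j Ks U≤ s≡ = ≤-trans (count-∪ (λ S → T? (K S)) (λ S → T? ((K without f) S)) (Between? f (span K f) s) (allSubsets n) split)
      (+-monoʳ-≤ (size (K without f)) (between-count f (span K f) s u j U≤ s≡))
    where
    split : ∀ S → T (K S) → T ((K without f) S) ⊎ Between f (span K f) s S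
    split S h = go (f ⊆? S)
      where
      go : Dec (f ⊆ S) → T ((K without f) S) ⊎ Between f (span K f) s S
      go (yes p) = inj₂ (p , (λ v∈ → ∈span⁺ K f (S , h , p , v∈)) , Ks S h)
      go (no ¬p) = inj₁ (Equivalence.from (T-∧ {K S}) (h , subst (T ∘ not) (sym (dec-false (f ⊆? S) ¬p)) tt))

  record Purged (K : Family n) (Φ : List (Subset n)) (u c : ℕ) : Set where
    field
      core : Family n
      sub  : ∀ S → T (core S) → T (K S)
      few  : size K ≤ size core + length Φ * c
      wide : ∀ f → f ∈ Φ → Alive core f → u + ∣ f ∣ < ∣ span core f ∣

  -- Each face is struck out at most once, and striking it out costs at most u C j members.
  purge : ∀ m Φ → length Φ ≤ m → ∀ K s u j h → (∀ S → T (K S) → ∣ S ∣ ≡ s) → (∀ {f} → f ∈ Φ → ∣ f ∣ ≡ h) → s ≡ j + h → Purged K Φ u (u C j)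
  purge zero [] Φ≤ K s u j h Ks Φh s≡ = record { core = K ; sub = λ _ p → p ; few = m≤m+n _ _ ; wide = λ _ () }
  purge (suc m) Φ Φ≤ K s u j h Ks Φh s≡ = go (Any.any? narrow? Φ)
    where
    Narrow : Subset n → Set
    Narrow f = Alive K f × ∣ span K f ∣ ≤ u + ∣ f ∣
    narrow? : ∀ f → Dec (Narrow f)
    narrow? f = Alive? K f ×-dec (∣ span K f ∣ ≤? u + ∣ f ∣)
    go : Dec (Any Narrow Φ) → Purged K Φ u (u C j)
    go (no ¬a) = record { core = K ; sub = λ _ p → p ; few = m≤m+n _ _ ; wide = λ f f∈ al → ≰⇒> (λ le → ¬a (lose f∈ (al , le))) }
    go (yes a) = remove₁ (find a)
      where
      remove₁ : (∃ λ f → f ∈ Φ × Narrow f) → Purged K Φ u (u C j)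
      remove₁ (f , f∈ , al , nar) = split (∈-∃++ f∈)
        where
        split : (∃₂ λ as bs → Φ ≡ as ++ [ f ] ++ bs) → Purged K Φ u (u C j)
        split (as , bs , refl) = combine₁ (purge m (as ++ bs) len K₁ s u j h (λ S p → Ks S (proj₁ (without⁻ K f S p))) (λ p → Φh (keep p)) s≡)
          where
          K₁ = K without f
          L≡ : length (as ++ f ∷ bs) ≡ suc (length (as ++ bs))
          L≡ = trans (length-++ as) (trans (+-suc (length as) (length bs)) (cong suc (sym (length-++ as))))
          len : length (as ++ bs) ≤ m
          len = ≤-pred (≤-trans (≤-reflexive (sym L≡)) Φ≤)
          keep : ∀ {g} → g ∈ as ++ bs → g ∈ as ++ f ∷ bs
          keep p = [ ∈-++⁺ˡ , (λ r → ∈-++⁺ʳ as (there r)) ]′ (∈-++⁻ as p)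
          combine₁ : Purged K₁ (as ++ bs) u (u C j) → Purged K (as ++ f ∷ bs) u (u C j)
          combine₁ pg = record
            { core = P.core ; sub = λ S p → proj₁ (without⁻ K f S (P.sub S p))
            ; few = begin
                size K                                                        ≤⟨ without-size K f s u j Ks nar (trans s≡ (cong (j +_) (sym (Φh f∈)))) ⟩
                size K₁ + u C j                                               ≤⟨ +-monoˡ-≤ (u C j) P.few ⟩
                size P.core + length (as ++ bs) * (u C j) + u C j             ≡⟨ +-assoc (size P.core) _ _ ⟩
                size P.core + (length (as ++ bs) * (u C j) + u C j)           ≡⟨ cong (size P.core +_) (trans (+-comm _ (u C j)) (cong (_* (u C j)) (sym L≡))) ⟩
                size P.core + length (as ++ f ∷ bs) * (u C j)                 ∎
            ; wide = wide′ }
            where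
            open ≤-Reasoning
            module P = Purged pg
            wide′ : ∀ g → g ∈ as ++ f ∷ bs → Alive P.core g → u + ∣ g ∣ < ∣ span P.core g ∣
            wide′ g g∈ al′@(S , S∈ , g⊆) with ∈-++⁻ as g∈
            ... | inj₁ p           = P.wide g (∈-++⁺ˡ p) al′
            ... | inj₂ (there p)   = P.wide g (∈-++⁺ʳ as p) al′
            ... | inj₂ (here refl) = ⊥-elim (proj₂ (without⁻ K f S (P.sub S S∈)) g⊆)

-- The shadow of a family of cliques

shift-subset : ∀ {n k} (f : Vec (Fin n) k) → toSubset (toList (Vec.map suc f)) ≡ false ∷ toSubset (toList f)
shift-subset [] = refl
shift-subset (x ∷ f) = cong (⁅ suc x ⁆ ∪_) (shift-subset f)

tuple-of : ∀ {n k} (S : Subset n) → ∣ S ∣ ≡ k → Σ (Vec (Fin n) k) λ f → toSubset (toList f) ≡ S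
tuple-of [] refl = [] , refl
tuple-of {suc n} (true ∷ S) refl with tuple-of S refl
... | f , e = zero ∷ Vec.map suc f , trans (cong (⁅ zero ⁆ ∪_) (trans (shift-subset f) (cong (false ∷_) e))) (cong (true ∷_) (∪-identityˡ S))
tuple-of {suc n} (false ∷ S) refl with tuple-of S refl
... | f , e = Vec.map suc f , trans (shift-subset f) (cong (false ∷_) e)

∈-allTup : ∀ {n k} (f : Vec (Fin n) k) → f ∈ allTup n k
∈-allTup [] = here refl
∈-allTup {n} {suc k} (x ∷ f) = go (∈-allFin x)
  where
  go : ∀ {xs} → x ∈ xs → x ∷ f ∈ concatMap (λ x → map (x ∷_) (allTup n k)) xs
  go (here refl) = ∈-++⁺ˡ (∈-map⁺ (x ∷_) (∈-allTup f))
  go {y ∷ xs} (there p) = ∈-++⁺ʳ (map (y ∷_) (allTup n k)) (go p)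

_≟ᵥ_ : ∀ {n} (S S′ : Subset n) → Dec (S ≡ S′)
_≟ᵥ_ = Vecₚ.≡-dec _≟ᵇ_

count-≡ : ∀ {n} (S : Subset n) → count (λ S′ → S ≟ᵥ S′) (allSubsets n) ≤ 1
count-≡ [] = ≤-refl
count-≡ {suc n} (true ∷ S) = ≤-trans (≤-reflexive (count-allSubsets (λ S′ → (true ∷ S) ≟ᵥ S′))) (+-mono-≤
  (≤-trans (count-mono (λ S′ → (true ∷ S) ≟ᵥ (true ∷ S′)) (λ S′ → S ≟ᵥ S′) (allSubsets n) (λ _ e → Vecₚ.∷-injectiveʳ e)) (count-≡ S))
  (count-none (λ S′ → (true ∷ S) ≟ᵥ (false ∷ S′)) (λ _ ()) (allSubsets n)))
count-≡ {suc n} (false ∷ S) = ≤-trans (≤-reflexive (count-allSubsets (λ S′ → (false ∷ S) ≟ᵥ S′))) (+-mono-≤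
  (count-none (λ S′ → (false ∷ S) ≟ᵥ (true ∷ S′)) (λ _ ()) (allSubsets n))
  (≤-trans (count-mono (λ S′ → (false ∷ S) ≟ᵥ (false ∷ S′)) (λ S′ → S ≟ᵥ S′) (allSubsets n) (λ _ e → Vecₚ.∷-injectiveʳ e)) (count-≡ S)))

-- Every set is counted through at least one of its orderings. The factor `k !` is given away, since
-- only the order of magnitude is wanted.
sets≤tuples : ∀ {n k} {P : Subset n → Set} (P? : ∀ S → Dec (P S)) {Q : Vec (Fin n) k → Set} (Q? : ∀ f → Dec (Q f)) → (∀ S → P S → ∣ S ∣ ≡ k) →
  (∀ f → P (toSubset (toList f)) → Q f) → count P? (allSubsets n) ≤ count Q? (allTup n k)
sets≤tuples {n} {k} {P} P? {Q} Q? Pk PQ = begin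
  count P? (allSubsets n)                                                 ≤⟨ ∑-mono (allSubsets n) (λ S → point S (P? S)) ⟩
  ∑ (allSubsets n) (λ S → ∑ (allTup n k) (λ f → ind (both? f S)))         ≡⟨ ∑-swap (allSubsets n) (allTup n k) _ ⟩
  ∑ (allTup n k) (λ f → ∑ (allSubsets n) (λ S → ind (both? f S)))         ≤⟨ ∑-mono (allTup n k) (λ f → fibre≤ f (Q? f)) ⟩
  count Q? (allTup n k)                                                   ∎
  where
  open ≤-Reasoning
  both? : ∀ f S → Dec (toSubset (toList f) ≡ S × P S)
  both? f S = (toSubset (toList f) ≟ᵥ S) ×-dec P? S
  point : ∀ S (d : Dec (P S)) → ind d ≤ ∑ (allTup n k) (λ f → ind (both? f S))
  point S (no _)  = z≤n
  point S (yes p) with tuple-of S (Pk S p)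
  ... | f , e = ≤-trans (≤-reflexive (sym (ind-yes (both? f S) (e , p)))) (∑-≥ (λ f → ind (both? f S)) (∈-allTup f))
  fibre≤ : ∀ f (d : Dec (Q f)) → ∑ (allSubsets n) (λ S → ind (both? f S)) ≤ ind d
  fibre≤ f (yes _) = ≤-trans (∑-mono (allSubsets n) (λ S → ind-mono (both? f S) (toSubset (toList f) ≟ᵥ S) proj₁)) (count-≡ (toSubset (toList f)))
  fibre≤ f (no ¬q) = count-none (both? f) (λ { S (refl , p) → ¬q (PQ f p) }) (allSubsets n)

beyond : ∀ {n} (U : Subset n) (l : List (Fin n)) → length l < ∣ U ∣ → ∃ λ v → v ∈ₛ U × v ∉ l
beyond U l h = go (any? (λ v → (v ∈ₛ? U) ×-dec ¬? (v ∈? l)))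
  where
  go : Dec (∃ λ v → v ∈ₛ U × v ∉ l) → ∃ λ v → v ∈ₛ U × v ∉ l
  go (yes p) = p
  go (no ¬p) = contradiction (≤-trans (p⊆q⇒∣p∣≤∣q∣ {p = U} {toSubset l} (λ {v} v∈ → ∈-toSubset⁺ (inside? v v∈ (v ∈? l)))) (∣toSubset∣≤ l)) (<⇒≱ h)
    where
    inside? : ∀ v → v ∈ₛ U → Dec (v ∈ l) → v ∈ l
    inside? v v∈ (yes q) = q
    inside? v v∈ (no ¬q) = ⊥-elim (¬p (v , v∈ , ¬q))

-- For a family of cliques this is a subgraph of the given hypergraph, so a forbidden copy found
-- here is one there.
shadow : ∀ {n} r → Family n → RGraph r n
shadow r K = record
  { edge    = λ S → does ((∣ S ∣ ℕₚ.≟ r) ×-dec Alive? K S)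
  ; uniform = λ S p → proj₁ (witness ((∣ S ∣ ℕₚ.≟ r) ×-dec Alive? K S) p) }

shadow⁺ : ∀ {n} r (K : Family n) {S} → ∣ S ∣ ≡ r → Alive K S → T (edge (shadow r K) S)
shadow⁺ r K {S} e a = subst T (sym (dec-true ((∣ S ∣ ℕₚ.≟ r) ×-dec Alive? K S) (e , a))) tt

shadow⁻ : ∀ {n} r (K : Family n) {S} → T (edge (shadow r K) S) → Alive K S
shadow⁻ r K {S} h = proj₂ (witness ((∣ S ∣ ℕₚ.≟ r) ×-dec Alive? K S) h)

module _ {n : ℕ} (r u : ℕ) (K : Family n) (wide : ∀ f → suc ∣ f ∣ ≡ r → Alive K f → u + ∣ f ∣ < ∣ span K f ∣) where

  extend : ∀ l → Unique l → suc (length l) ≡ r → Alive K (toSubset l) → ∀ W → length W ≤ u → ∃ λ w → w ∉ W × Edge (shadow r K) (w ∷ l)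
  extend l uq len al W W≤ = get (beyond (span K (toSubset l)) (W ++ l) (≤-<-trans (≤-trans (≤-reflexive (length-++ W)) (+-mono-≤ W≤ (≤-reflexive (sym size-l)))) (wide (toSubset l) (trans (cong suc size-l) len) al)))
    where
    size-l : ∣ toSubset l ∣ ≡ length l
    size-l = Unique⇒∣toSubset∣ uq
    get : (∃ λ w → w ∈ₛ span K (toSubset l) × w ∉ W ++ l) → ∃ λ w → w ∉ W × Edge (shadow r K) (w ∷ l)
    get (w , w∈ , w∉) with ∈span⁻ K (toSubset l) w∈
    ... | S , S∈ , l⊆ , wS = w , (λ p → w∉ (∈-++⁺ˡ p)) , mkEdge (shadow⁺ r K (trans (Unique⇒∣toSubset∣ (Unique-∷ (λ p → w∉ (∈-++⁺ʳ W p)) uq)) len)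
        (S , S∈ , λ {v} v∈ → case x∈p∪q⁻ ⁅ w ⁆ (toSubset l) v∈ of λ { (inj₁ p) → subst (_∈ₛ S) (sym (x∈⁅y⁆⇒x≡y w p)) wS ; (inj₂ p) → l⊆ p }))

  shadow-full : Full u (shadow r K)
  shadow-full f v len e W W≤ = extend f (AllPairs.tail uq) len (sub (shadow⁻ r K (isEdge e))) W W≤
    where
    uq : Unique (v ∷ f)
    uq = Edge-Unique (shadow r K) len e
    sub : Alive K (toSubset (v ∷ f)) → Alive K (toSubset f)
    sub (S , S∈ , ⊆S) = S , S∈ , λ p → ⊆S (x∈p∪q⁺ {p = ⁅ v ⁆} (inj₂ p))

  face-deg : ∀ f → suc (length f) ≡ r → Unique f → Alive K (toSubset f) → suc u ≤ deg (shadow r K) f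
  face-deg f len uq al = ≰⇒> (λ le → clash (extend f uq len al (nbr (shadow r K) f) le))
    where
    clash : ¬ (∃ λ w → w ∉ nbr (shadow r K) f × Edge (shadow r K) (w ∷ f))
    clash (w , w∉ , e) = w∉ (∈-filter⁺ (λ v → Edge? (shadow r K) (v ∷ f)) (∈-allFin w) e)

  -- An exchanged tuple lies inside an edge of the shadow, hence inside a member of `K`. It is
  -- therefore an alive face again, and the hypothesis `wide` applies to it as well.
  face-deep : ∀ {k} (f : Vec (Fin n) k) → suc k ≡ r → ∣ toSubset (toList f) ∣ ≡ k → Alive K (toSubset (toList f)) → Deep (suc u) (shadow r K) f
  face-deep f refl sz al = face-deg (toList f) (cong suc (Vecₚ.length-toList f)) (∣toSubset∣⇒Unique (toList f) (trans sz (sym (Vecₚ.length-toList f)))) al , next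
    where
    next : ∀ v → Edge (shadow r K) (v ∷ toList f) → ∀ i → suc u ≤ deg (shadow r K) (toList (f [ i ]≔ v))
    next v e i = face-deg (toList (f [ i ]≔ v)) len (AllPairs.tail (Edge-Unique (shadow r K) len e′)) (sub (shadow⁻ r K (isEdge e′)))
      where
      len : suc (length (toList (f [ i ]≔ v))) ≡ r
      len = cong suc (Vecₚ.length-toList (f [ i ]≔ v))
      e′ : Edge (shadow r K) (lookup f i ∷ toList (f [ i ]≔ v))
      e′ = Edge-↭ (shadow r K) (update-↭ f i v) e
      sub : Alive K (toSubset (lookup f i ∷ toList (f [ i ]≔ v))) → Alive K (toSubset (toList (f [ i ]≔ v)))
      sub (S , S∈ , ⊆S) = S , S∈ , λ p → ⊆S (x∈p∪q⁺ {p = ⁅ lookup f i ⁆} (inj₂ p))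

⊆ᵇ-complete : ∀ {n} (S U : Subset n) → S ⊆ U → T (S ⊆ᵇ U)
⊆ᵇ-complete [] [] h = tt
⊆ᵇ-complete (true ∷ S) (true ∷ U) h = ⊆ᵇ-complete S U (drop-∷-⊆ h)
⊆ᵇ-complete (true ∷ S) (false ∷ U) h = ⊥-elim (in⊈out h)
⊆ᵇ-complete (false ∷ S) (b ∷ U) h = ⊆ᵇ-complete S U (drop-∷-⊆ h)

all⁻ : ∀ {A : Set} (p : A → Bool) (xs : List A) → T (all p xs) → ∀ {x} → x ∈ xs → T (p x)
all⁻ p (y ∷ xs) h (here refl) = proj₁ (Equivalence.to (T-∧ {p y}) h)
all⁻ p (y ∷ xs) h (there x∈)  = all⁻ p xs (proj₂ (Equivalence.to (T-∧ {p y}) h)) x∈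

clique-size : ∀ {r n} (G : RGraph r n) s S → T (isClique G s S) → ∣ S ∣ ≡ s
clique-size G s S h = ≡ᵇ⇒≡ ∣ S ∣ s (proj₁ (Equivalence.to (T-∧ {∣ S ∣ ≡ᵇ s}) h))

clique-edge : ∀ {r n} (G : RGraph r n) s S → T (isClique G s S) → ∀ R → R ⊆ S → ∣ R ∣ ≡ r → T (edge G R)
clique-edge {r} {n} G s S h R R⊆ e = imp (R ⊆ᵇ S) (∣ R ∣ ≡ᵇ r) (edge G R) (⊆ᵇ-complete R S R⊆) (≡⇒≡ᵇ ∣ R ∣ r e)
    (all⁻ _ (allSubsets n) (proj₂ (Equivalence.to (T-∧ {∣ S ∣ ≡ᵇ s}) h)) (∈-allSubsets R))
  where
  imp : ∀ a b c → T a → T b → T (not (a ∧ b) ∨ c) → T c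
  imp true true true _ _ _ = tt

Embs⇒Forb : ∀ {κ n} {G : RGraph (3 + κ) n} K k ℓ p ts (ℓ≥ : ∀ i → 5 ≤ ℓ i) (ts≥ : ∀ j → 1 ≤ ts j) {L} →
  Embs G (map (hyp κ) (List.tabulate {n = p} (λ j → starᶜ (ts j) (ts≥ j)) ++ List.tabulate {n = k} (λ i → baseᶜ K (ℓ i) (ℓ≥ i)))) L → Contains G (Forb (3 + κ) K k ℓ p ts)
Embs⇒Forb {κ} {n} {G} K k ℓ p ts ℓ≥ ts≥ {L} es = finish (Embs-++⁻ (map (hyp κ) stars) (subst (λ Hs → Embs G Hs L) (map-++ (hyp κ) stars bases) es))
  where
  stars = List.tabulate {n = p} (λ j → starᶜ (ts j) (ts≥ j))
  bases = List.tabulate {n = k} (λ i → baseᶜ K (ℓ i) (ℓ≥ i))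
  finish : (∃₂ λ L₁ L₂ → Embs G (map (hyp κ) stars) L₁ × Embs G (map (hyp κ) bases) L₂ × (∀ {v} → v ∈ L₁ → v ∉ L₂) × (∀ {v} → v ∈ L₁ ++ L₂ → v ∈ L)) → Contains G (Forb (3 + κ) K k ℓ p ts)
  finish (L₁ , L₂ , e₁ , e₂ , d , _) = Emb⇒Contains (Emb-⊔
    (Emb-⨆ (λ i → expansion (3 + κ) (base K (ℓ i))) (subst (λ Hs → Embs G Hs L₂) (map-tabulate (λ i → baseᶜ K (ℓ i) (ℓ≥ i)) (hyp κ)) e₂))
    (Emb-⨆ (λ j → expansion (3 + κ) (star (ts j))) (subst (λ Hs → Embs G Hs L₁) (map-tabulate (λ j → starᶜ (ts j) (ts≥ j)) (hyp κ)) e₁)) (λ a b → d b a))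

-- The upper bound

binomial-falling : ∀ n k → (suc n C suc k) * suc k ! ≡ suc n * ((n C k) * k !)
binomial-falling zero zero    = refl
binomial-falling zero (suc k) = trans (cong (_* suc (suc k) !) (k>n⇒nCk≡0 {1} {suc (suc k)} (s≤s (s≤s z≤n)))) (cong (λ x → 1 * (x * suc k !)) (sym (k>n⇒nCk≡0 {0} {suc k} (s≤s z≤n))))
binomial-falling (suc n) k = trans (pascal (suc n) k) (trans (cong (suc k * F k +_) (binomial-falling n k)) (go k))
  where
  open ≡-Reasoning
  F f : ℕ → ℕ
  F k = (suc n C k) * k !
  f k = (n C k) * k !
  pascal : ∀ n k → (suc n C suc k) * suc k ! ≡ suc k * ((n C k) * k !) + (n C suc k) * suc k !
  pascal n k = trans (cong (_* suc k !) (sym (nCk+nC[k+1]≡[n+1]C[k+1] n k))) (e (n C k) (n C suc k) k (k !))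
    where
    e : ∀ a b k g → (a + b) * ((1 + k) * g) ≡ (1 + k) * (a * g) + b * ((1 + k) * g)
    e = solve-∀
  go : ∀ k → suc k * F k + suc n * f k ≡ suc (suc n) * F k
  go zero = begin
    1 * F 0 + suc n * f 0     ≡⟨ cong₂ (λ a b → 1 * (a * 1) + suc n * (b * 1)) (nC0≡1 (suc n)) (nC0≡1 n) ⟩
    1 * 1 + suc n * 1         ≡⟨ cong (λ x → suc (suc n) * (x * 1)) (nC0≡1 (suc n)) ⟨
    suc (suc n) * F 0         ∎
  go (suc k) = begin
    suc (suc k) * F (suc k) + suc n * f (suc k)                     ≡⟨ +-assoc (F (suc k)) (suc k * F (suc k)) _ ⟩
    F (suc k) + (suc k * F (suc k) + suc n * f (suc k))             ≡⟨ cong (λ x → F (suc k) + (suc k * x + suc n * f (suc k))) (binomial-falling n k) ⟩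
    F (suc k) + (suc k * (suc n * f k) + suc n * f (suc k))         ≡⟨ cong (F (suc k) +_) (e k n (f k) (f (suc k))) ⟩
    F (suc k) + suc n * (suc k * f k + f (suc k))                   ≡⟨ cong (λ x → F (suc k) + suc n * x) (pascal n k) ⟨
    suc (suc n) * F (suc k)                                         ∎
    where
    e : ∀ k n a b → (1 + k) * ((1 + n) * a) + (1 + n) * b ≡ (1 + n) * ((1 + k) * a + b)
    e = solve-∀

binomial-≤ : ∀ n k → (n C k) * k ! ≤ n ^ k
binomial-≤ n zero = ≤-reflexive (trans (*-identityʳ _) (nC0≡1 n))
binomial-≤ zero (suc k) = ≤-trans (≤-reflexive (cong (_* suc k !) (k>n⇒nCk≡0 {0} {suc k} (s≤s z≤n)))) z≤n
binomial-≤ (suc n) (suc k) = ≤-trans (≤-reflexive (binomial-falling n k)) (*-monoʳ-≤ (suc n) (≤-trans (binomial-≤ n k) (^-monoˡ-≤ k (n≤1+n n))))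

binomial-≥ : ∀ x k → x ^ k ≤ ((x + k) C k) * k !
binomial-≥ x zero = ≤-reflexive (sym (trans (*-identityʳ _) (nC0≡1 (x + 0))))
binomial-≥ x (suc k) = ≤-trans (*-mono-≤ (≤-trans (m≤m+n x k) (n≤1+n (x + k))) (binomial-≥ x k)) (≤-reflexive (trans (sym (binomial-falling (x + k) k)) (cong (λ y → (y C suc k) * suc k !) (sym (+-suc x k)))))

-- The mean value estimate for the growth of `x ^ h` over a step `q`, multiplied by `x + q` so that
-- no exponent below `h` occurs.
power-gap : ∀ x q h → (x + q) * (x + q) ^ h ≤ (x + q) * x ^ h + q * h * (x + q) ^ h
power-gap x q zero = m≤m+n _ _
power-gap x q (suc h) = begin
  N * (N * N ^ h)                                       ≤⟨ *-monoʳ-≤ N (power-gap x q h) ⟩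
  N * (N * x ^ h + q * h * N ^ h)                       ≡⟨ e₁ x q h (x ^ h) (N ^ h) ⟩
  N * (x * x ^ h) + q * (N * x ^ h) + q * h * (N * N ^ h) ≤⟨ +-monoˡ-≤ (q * h * (N * N ^ h)) (+-monoʳ-≤ (N * (x * x ^ h)) (*-monoʳ-≤ q (*-monoʳ-≤ N (^-monoˡ-≤ h (m≤m+n x q))))) ⟩
  N * (x * x ^ h) + q * (N * N ^ h) + q * h * (N * N ^ h) ≡⟨ e₂ (N * (x * x ^ h)) q h (N * N ^ h) ⟩
  N * x ^ suc h + q * suc h * N ^ suc h                 ∎
  where
  open ≤-Reasoning
  N = x + q
  e₁ : ∀ x q h a b → (x + q) * ((x + q) * a + q * h * b) ≡ (x + q) * (x * a) + q * ((x + q) * a) + q * h * ((x + q) * b)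
  e₁ = solve-∀
  e₂ : ∀ a q h b → a + q * b + q * h * b ≡ a + q * (1 + h) * b
  e₂ = solve-∀

total-++ : ∀ xs ys → total (xs ++ ys) ≡ total xs + total ys
total-++ []       ys = refl
total-++ (x ∷ xs) ys = trans (cong (cost x +_) (total-++ xs ys)) (sym (+-assoc (cost x) (total xs) (total ys)))

module Components (K : Kind) (k : ℕ) (ℓ : Fin k → ℕ) (p : ℕ) (ts : Fin p → ℕ) (ℓ≥ : ∀ i → 5 ≤ ℓ i) (ts≥ : ∀ j → 1 ≤ ts j) where

  stars : List Comp
  stars = List.tabulate (λ j → starᶜ (ts j) (ts≥ j))

  bases : List Comp
  bases = List.tabulate (λ i → baseᶜ K (ℓ i) (ℓ≥ i))

  -- Stars come first: as long as one is left, the paths or cycles behind it keep the total at three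
  -- or more.
  components : List Comp
  components = stars ++ bases

private
  total-stars : ∀ p (ts : Fin p → ℕ) (ts≥ : ∀ j → 1 ≤ ts j) → total (List.tabulate (λ j → starᶜ (ts j) (ts≥ j))) ≡ p
  total-stars zero    ts ts≥ = refl
  total-stars (suc p) ts ts≥ = cong suc (total-stars p (ts ∘ suc) (ts≥ ∘ suc))

  total-bases : ∀ K k (ℓ : Fin k → ℕ) (ℓ≥ : ∀ i → 5 ≤ ℓ i) → total (List.tabulate (λ i → baseᶜ K (ℓ i) (ℓ≥ i))) ≡ sum (map (λ i → ⌊ ℓ i + 1 /2⌋) (allFin k))
  total-bases K zero    ℓ ℓ≥ = refl
  total-bases K (suc k) ℓ ℓ≥ = cong (⌊ ℓ zero + 1 /2⌋ +_) (trans (total-bases K k (ℓ ∘ suc) (ℓ≥ ∘ suc))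
    (cong sum (trans (map-∘ (allFin k)) (cong (map (λ i → ⌊ ℓ i + 1 /2⌋)) (map-tabulate id suc)))))

  cost≥3 : ∀ K ℓ (ℓ≥ : 5 ≤ ℓ) → 3 ≤ cost (baseᶜ K ℓ ℓ≥)
  cost≥3 K ℓ ℓ≥ with halve ℓ ℓ≥
  ... | q′ , e , _ = ≤-trans (m≤m+n 3 q′) (≤-reflexive (sym e))

  Ok-bases : ∀ K k (ℓ : Fin k → ℕ) (ℓ≥ : ∀ i → 5 ≤ ℓ i) → Ok (List.tabulate (λ i → baseᶜ K (ℓ i) (ℓ≥ i)))
  Ok-bases K zero    ℓ ℓ≥ = refl
  Ok-bases K (suc k) ℓ ℓ≥ = ≤-trans (cost≥3 K (ℓ zero) (ℓ≥ zero)) (m≤m+n _ _) , Ok-bases K k (ℓ ∘ suc) (ℓ≥ ∘ suc)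

  Ok-++ : ∀ xs ys → 3 ≤ total ys → Ok ys → Ok (xs ++ ys)
  Ok-++ []       ys h ok = ok
  Ok-++ (x ∷ xs) ys h ok = ≤-trans h (≤-trans (m≤n+m (total ys) (cost x + total xs)) (≤-reflexive (trans (+-assoc (cost x) (total xs) (total ys)) (cong (cost x +_) (sym (total-++ xs ys)))))) , Ok-++ xs ys h ok

module _ (K : Kind) (k : ℕ) (ℓ : Fin k → ℕ) (p : ℕ) (ts : Fin p → ℕ) (ℓ≥ : ∀ i → 5 ≤ ℓ i) (ts≥ : ∀ j → 1 ≤ ts j) (1≤k : 1 ≤ k) where
  open Components K k ℓ p ts ℓ≥ ts≥

  bases≥3 : 3 ≤ total bases
  bases≥3 = go K k ℓ ℓ≥ 1≤k
    where
    go : ∀ K k (ℓ : Fin k → ℕ) (ℓ≥ : ∀ i → 5 ≤ ℓ i) → 1 ≤ k → 3 ≤ total (List.tabulate (λ i → baseᶜ K (ℓ i) (ℓ≥ i)))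
    go K (suc k) ℓ ℓ≥ _ = ≤-trans (cost≥3 K (ℓ zero) (ℓ≥ zero)) (m≤m+n _ _)

  components-ok : Ok components
  components-ok = Ok-++ stars bases bases≥3 (Ok-bases K k ℓ ℓ≥)

  -- The subtraction in `tParam` does not truncate, because the sum is positive; so the components
  -- cost as many extensions as the first purge guarantees to a face.
  total-components : total components ≡ suc (tParam k ℓ p)
  total-components = trans eq (sym (suc∸1 eq (≤-trans (s≤s z≤n) (≤-trans bases≥3 (≤-trans (m≤n+m (total bases) (total stars)) (≤-reflexive (sym (total-++ stars bases))))))))
    where
    eq : total components ≡ sum (map (λ i → ⌊ ℓ i + 1 /2⌋) (allFin k)) + p
    eq = trans (total-++ stars bases) (trans (cong₂ _+_ (total-stars p ts ts≥) (total-bases K k ℓ ℓ≥)) (+-comm p _))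
    suc∸1 : ∀ {T S} → T ≡ S → 1 ≤ T → suc (S ∸ 1) ≡ S
    suc∸1 refl = m+[n∸m]≡n

  -- The cliques that survive the first purge live on few faces, since otherwise the shadow would be dense and contain F.
  clique-bound : ∀ κ s → 3 + κ ≤ s → ∀ m → ∃ λ N → ∀ {n} → N ≤ n → (G : RGraph (3 + κ) n) → Free G (Forb (3 + κ) K k ℓ p ts) →
    ∃ λ faces → m * faces ≤ n ^ (2 + κ) ×
      numK s G ≤ (n C (2 + κ)) * (tParam k ℓ p C (s ∸ (3 + κ) + 1)) + faces * (budget κ components C (s ∸ (3 + κ) + 1))
  clique-bound κ s r≤s m = proj₁ ea , λ {n} N≤ G free → Main.result {n} N≤ G free
    where
    r h j t D : ℕ
    r = 3 + κ
    h = 2 + κ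
    j = s ∸ r + 1
    t = tParam k ℓ p
    D = budget κ components
    ea = embed-all κ components components-ok m
    s≡ : s ≡ j + h
    s≡ = trans (sym (m∸n+n≡m r≤s)) (e (s ∸ r) κ)
      where
      e : ∀ a κ → a + (3 + κ) ≡ a + 1 + (2 + κ)
      e = solve-∀
    module Main {n : ℕ} (N≤ : proj₁ ea ≤ n) (G : RGraph r n) (free : Free G (Forb r K k ℓ p ts)) where
      Cl : Family n
      Cl = isClique G s
      face? : ∀ f → Dec (∣ f ∣ ≡ h)
      face? f = ∣ f ∣ ℕₚ.≟ h
      Φ₁ : List (Subset n)
      Φ₁ = filter face? (allSubsets n)
      into : ∀ K₁ → (∀ S → T (K₁ S) → T (Cl S)) → ∀ S → T (edge (shadow r K₁) S) → T (edge G S)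
      into K₁ sub S e with shadow⁻ r K₁ e
      ... | Q , Q∈ , S⊆ = clique-edge G s Q (sub Q Q∈) S S⊆ (uniform (shadow r K₁) S e)
      no-packing : ∀ K₁ → (∀ S → T (K₁ S) → T (Cl S)) → ∀ {L} → ¬ Embs (shadow r K₁) (map (hyp κ) components) L
      no-packing K₁ sub es = no-copy (Embs⇒Forb K k ℓ p ts ℓ≥ ts≥ es)
        where
        no-copy : ¬ Contains (shadow r K₁) (Forb r K k ℓ p ts)
        no-copy (φ , φ-inj , φ-edge) = free (φ , φ-inj , λ e → into K₁ sub _ (φ-edge e))
      result : ∃ λ faces → m * faces ≤ n ^ h × numK s G ≤ (n C h) * (t C j) + faces * (D C j)
      result = step₁ (purge (length Φ₁) Φ₁ ≤-refl Cl s t j h (clique-size G s) (λ p → proj₂ (∈-filter⁻ face? {xs = allSubsets n} p)) s≡)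
        where
        step₁ : Purged Cl Φ₁ t (t C j) → ∃ λ faces → m * faces ≤ n ^ h × numK s G ≤ (n C h) * (t C j) + faces * (D C j)
        -- The faces that survive are purged once more, with threshold `D`. A nonempty core would be
        -- `Full` and contain the forbidden hypergraph, so nothing survives, and `faces * (D C j)`
        -- bounds the cliques that the first purge left.
        step₁ pg = faces , few-faces (n ^ h ≤? m * faces) , bound (purge (length Φ₂) Φ₂ ≤-refl P.core s D j h (λ S p → clique-size G s S (P.sub S p)) (λ p → proj₁ (proj₂ (∈-filter⁻ live? {xs = allSubsets n} p))) s≡)
          where
          module P = Purged pg
          live? : ∀ f → Dec (∣ f ∣ ≡ h × Alive P.core f)
          live? f = face? f ×-dec Alive? P.core f
          Φ₂ : List (Subset n)
          Φ₂ = filter live? (allSubsets n)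
          faces : ℕ
          faces = count live? (allSubsets n)
          wide₁ : ∀ f → suc ∣ f ∣ ≡ r → Alive P.core f → t + ∣ f ∣ < ∣ span P.core f ∣
          wide₁ f e al = P.wide f (∈-filter⁺ face? (∈-allSubsets f) (cong pred e)) al
          few-faces : Dec (n ^ h ≤ m * faces) → m * faces ≤ n ^ h
          few-faces (no ¬d) = ≰⇒≥ ¬d
          few-faces (yes d) = ⊥-elim (no-packing P.core P.sub (proj₁ (proj₂ (proj₂ ea N≤ (shadow r P.core)
            (≤-trans d (*-monoʳ-≤ m (sets≤tuples live? (Deep? (total components) (shadow r P.core)) (λ S → proj₁)
              (λ f q → subst (λ Θ → Deep Θ (shadow r P.core) f) (sym total-components) (face-deep r t P.core wide₁ f refl (proj₁ q) (proj₂ q))))))))))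
          bound : Purged P.core Φ₂ D (D C j) → numK s G ≤ (n C h) * (t C j) + faces * (D C j)
          bound pg′ = begin
            numK s G                                                          ≡⟨ length-filter-count (λ S → T? (isClique G s S)) (allSubsets n) ⟩
            size Cl                                                           ≤⟨ P.few ⟩
            size P.core + length Φ₁ * (t C j)                                 ≤⟨ +-mono-≤ P′.few (*-monoˡ-≤ (t C j) (≤-trans (≤-reflexive (length-filter-count face? (allSubsets n))) (all-sets n h))) ⟩
            size P′.core + length Φ₂ * (D C j) + (n C h) * (t C j)              ≤⟨ +-monoˡ-≤ ((n C h) * (t C j)) (+-monoˡ-≤ (length Φ₂ * (D C j)) (≮⇒≥ (λ lt → nonempty (count-∃ (λ S → T? (P′.core S)) (allSubsets n) lt)))) ⟩
            length Φ₂ * (D C j) + (n C h) * (t C j)                             ≡⟨ cong (λ x → x * (D C j) + (n C h) * (t C j)) (length-filter-count live? (allSubsets n)) ⟩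
            faces * (D C j) + (n C h) * (t C j)                                 ≡⟨ +-comm (faces * (D C j)) _ ⟩
            (n C h) * (t C j) + faces * (D C j)                                 ∎
            where
            open ≤-Reasoning
            module P′ = Purged pg′
            wide₂ : ∀ f → suc ∣ f ∣ ≡ r → Alive P′.core f → D + ∣ f ∣ < ∣ span P′.core f ∣
            wide₂ f e al@(S , S∈ , f⊆) = P′.wide f (∈-filter⁺ live? (∈-allSubsets f) (cong pred e , S , P′.sub S S∈ , f⊆)) al
            nonempty : ¬ (∃ λ S → S ∈ allSubsets n × T (P′.core S))
            nonempty (S , _ , S∈) = no-packing P′.core (λ S p → P.sub S (P′.sub S p)) (proj₁ (proj₂ (full-embed (shadow r P′.core) D (shadow-full r D P′.core wide₂) (an-edge (tuple-of S (trans (clique-size G s S (P.sub S (P′.sub S S∈))) (sym (m+[n∸m]≡n r≤s))))) components [] ≤-refl)))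
              where
              an-edge : (Σ (Vec (Fin n) (r + (s ∸ r))) λ f → toSubset (toList f) ≡ S) → Σ (Vec (Fin n) r) λ l → Edge (shadow r P′.core) (toList l)
              an-edge (f , e) = Vec.take r f , mkEdge (shadow⁺ r P′.core (trans (Unique⇒∣toSubset∣ (proj₁ (Unique-++⁻ (toList (Vec.take r f)) u))) (Vecₚ.length-toList (Vec.take r f)))
                  (S , S∈ , λ {v} v∈ → subst (v ∈ₛ_) e (∈-toSubset⁺ (subst (v ∈_) (sym split) (∈-++⁺ˡ (∈-toSubset⁻ (toList (Vec.take r f)) v∈))))))
                where
                split : toList f ≡ toList (Vec.take r f) ++ toList (Vec.drop r f)
                split = trans (cong toList (sym (Vecₚ.take++drop≡id r f))) (Vecₚ.toList-++ (Vec.take r f) (Vec.drop r f))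
                u : Unique (toList (Vec.take r f) ++ toList (Vec.drop r f))
                u = subst Unique split (∣toSubset∣⇒Unique (toList f) (trans (cong ∣_∣ e) (trans (clique-size G s S (P.sub S (P′.sub S S∈))) (trans (sym (m+[n∸m]≡n r≤s)) (sym (Vecₚ.length-toList f))))))

  upper-bound : ∀ κ s → 3 + κ ≤ s → ∀ m → ∃ λ N → ∀ {n} → N ≤ n → (G : RGraph (3 + κ) n) → Free G (Forb (3 + κ) K k ℓ p ts) →
    suc m * (2 + κ) ! * numK s G ≤ suc m * (tParam k ℓ p C (s ∸ (3 + κ) + 1)) * n ^ (2 + κ) + (2 + κ) ! * n ^ (2 + κ)
  upper-bound κ s r≤s m = proj₁ cb , λ {n} N≤ G free → finish {n} {G} (proj₂ cb N≤ G free)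
    where
    c c′ d : ℕ
    c  = tParam k ℓ p C (s ∸ (3 + κ) + 1)
    c′ = budget κ components C (s ∸ (3 + κ) + 1)
    d  = (2 + κ) !
    -- Each surviving face accounts for up to `c′` cliques, so the faces must be rarer by this
    -- factor than the error term allows.
    cb = clique-bound κ s r≤s (suc m * c′)
    finish : ∀ {n} {G : RGraph (3 + κ) n} → (∃ λ faces → suc m * c′ * faces ≤ n ^ (2 + κ) × numK s G ≤ (n C (2 + κ)) * c + faces * c′) →
      suc m * d * numK s G ≤ suc m * c * n ^ (2 + κ) + d * n ^ (2 + κ)
    finish {n} {G} (faces , a , b) = begin
      suc m * d * numK s G                                              ≤⟨ *-monoʳ-≤ (suc m * d) b ⟩
      suc m * d * ((n C (2 + κ)) * c + faces * c′)                        ≡⟨ e m d (n C (2 + κ)) c faces c′ ⟩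
      suc m * c * ((n C (2 + κ)) * d) + d * (suc m * c′ * faces)          ≤⟨ +-mono-≤ (*-monoʳ-≤ (suc m * c) (binomial-≤ n (2 + κ))) (*-monoʳ-≤ d a) ⟩
      suc m * c * n ^ (2 + κ) + d * n ^ (2 + κ)                         ∎
      where
      open ≤-Reasoning
      e : ∀ m d b c f c′ → (1 + m) * d * (b * c + f * c′) ≡ (1 + m) * c * (b * d) + d * ((1 + m) * c′ * f)
      e = solve-∀

-- The extremal construction

-- With the ground set written as `t + b`, recursion on `t` separates the fixed `t` vertices of the
-- construction from the others.
low high : ∀ t {b} → Subset (t + b) → ℕ
low zero    S           = 0
low (suc t) (true  ∷ S) = suc (low t S)
low (suc t) (false ∷ S) = low t S
high zero    S       = ∣ S ∣
high (suc t) (x ∷ S) = high t S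

low+high : ∀ t {b} (S : Subset (t + b)) → ∣ S ∣ ≡ low t S + high t S
low+high zero    S           = refl
low+high (suc t) (true  ∷ S) = cong suc (low+high t S)
low+high (suc t) (false ∷ S) = low+high t S

sets-≥ : ∀ n k → n C k ≤ count (λ S → ∣ S ∣ ℕₚ.≟ k) (allSubsets n)
sets-≥ zero zero    = ≤-refl
sets-≥ zero (suc k) = ≤-trans (≤-reflexive (k>n⇒nCk≡0 {0} {suc k} (s≤s z≤n))) z≤n
sets-≥ (suc n) k = ≤-trans (go k) (≤-reflexive (sym (count-allSubsets {n} (λ S → ∣ S ∣ ℕₚ.≟ k))))
  where
  go : ∀ k → suc n C k ≤ count (λ S → suc ∣ S ∣ ℕₚ.≟ k) (allSubsets n) + count (λ S → ∣ S ∣ ℕₚ.≟ k) (allSubsets n)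
  go zero    = ≤-trans (≤-reflexive (trans (nC0≡1 (suc n)) (sym (nC0≡1 n)))) (≤-trans (sets-≥ n 0) (m≤n+m _ _))
  go (suc k) = ≤-trans (≤-reflexive (sym (nCk+nC[k+1]≡[n+1]C[k+1] n k))) (+-mono-≤
    (≤-trans (sets-≥ n k) (count-mono (λ S → ∣ S ∣ ℕₚ.≟ k) (λ S → suc ∣ S ∣ ℕₚ.≟ suc k) (allSubsets n) (λ _ → cong suc))) (sets-≥ n (suc k)))

split? : ∀ t {b} j h (S : Subset (t + b)) → Dec (low t S ≡ j × high t S ≡ h)
split? t j h S = (low t S ℕₚ.≟ j) ×-dec (high t S ℕₚ.≟ h)

split-count : ∀ t b j h → (t C j) * (b C h) ≤ count (split? t {b} j h) (allSubsets (t + b))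
split-count zero b zero h = ≤-trans (≤-reflexive (*-identityˡ _)) (≤-trans (sets-≥ b h) (count-mono (λ S → ∣ S ∣ ℕₚ.≟ h) (split? zero 0 h) (allSubsets b) (λ _ e → refl , e)))
split-count zero b (suc j) h = ≤-trans (≤-reflexive (cong (_* (b C h)) (k>n⇒nCk≡0 {0} {suc j} (s≤s z≤n)))) z≤n
split-count (suc t) b j h = ≤-trans (go j) (≤-reflexive (sym (count-allSubsets (split? (suc t) {b} j h))))
  where
  go : ∀ j → (suc t C j) * (b C h) ≤ count (λ S → split? (suc t) {b} j h (true ∷ S)) (allSubsets (t + b)) + count (λ S → split? (suc t) {b} j h (false ∷ S)) (allSubsets (t + b))
  go zero = ≤-trans (≤-reflexive (cong (_* (b C h)) (trans (nC0≡1 (suc t)) (sym (nC0≡1 t))))) (≤-trans (split-count t b 0 h) (m≤n+m _ _))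
  go (suc j) = ≤-trans (≤-reflexive (trans (cong (_* (b C h)) (sym (nCk+nC[k+1]≡[n+1]C[k+1] t j))) (*-distribʳ-+ (b C h) (t C j) (t C suc j)))) (+-mono-≤
    (≤-trans (split-count t b j h) (count-mono (split? t {b} j h) (λ S → split? (suc t) {b} (suc j) h (true ∷ S)) (allSubsets (t + b)) (λ { S (a , c) → cong suc a , c }))) (split-count t b (suc j) h))

⊆ᵇ-high : ∀ t {b} (R S : Subset (t + b)) → T (R ⊆ᵇ S) → high t R ≤ high t S
⊆ᵇ-high zero R S h = p⊆q⇒∣p∣≤∣q∣ (⊆ᵇ-sound R S h)
  where
  ⊆ᵇ-sound : ∀ {n} (R S : Subset n) → T (R ⊆ᵇ S) → R ⊆ S
  ⊆ᵇ-sound (true  ∷ R) (true ∷ S) h Vec.here      = Vec.here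
  ⊆ᵇ-sound (true  ∷ R) (true ∷ S) h (Vec.there p) = Vec.there (⊆ᵇ-sound R S h p)
  ⊆ᵇ-sound (false ∷ R) (b ∷ S)    h (Vec.there p) = Vec.there (⊆ᵇ-sound R S h p)
⊆ᵇ-high (suc t) (x ∷ R) (y ∷ S) h = ⊆ᵇ-high t R S (proj₂ (Equivalence.to (T-∧ {not x ∨ y}) h))

low-witness : ∀ t {b} (S : Subset (t + b)) → 1 ≤ low t S → ∃ λ i → lookup S i ≡ true × toℕ i < t
low-witness (suc t) (true  ∷ S) h = zero , refl , s≤s z≤n
low-witness (suc t) (false ∷ S) h with low-witness t S h
... | i , e , lt = suc i , e , s≤s lt

any⁺ : ∀ {A : Set} (p : A → Bool) {xs : List A} {x} → x ∈ xs → T (p x) → T (any p xs)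
any⁺ p {y ∷ xs} (here refl) h = Equivalence.from (T-∨ {p y}) (inj₁ h)
any⁺ p {y ∷ xs} (there q)   h = Equivalence.from (T-∨ {p y}) (inj₂ (any⁺ p q h))

any⁻ : ∀ {A : Set} (p : A → Bool) (xs : List A) → T (any p xs) → ∃ λ x → T (p x)
any⁻ p (y ∷ xs) h with Equivalence.to (T-∨ {p y}) h
... | inj₁ a = y , a
... | inj₂ b = any⁻ p xs b

all⁺ : ∀ {A : Set} (p : A → Bool) (xs : List A) → (∀ x → T (p x)) → T (all p xs)
all⁺ p []       h = tt
all⁺ p (x ∷ xs) h = Equivalence.from (T-∧ {p x}) (h x , all⁺ p xs h)

-- An `r`-subset does not fit into the part of `S` beyond the first `t` vertices, so it contains one
-- of these.
Snt-clique : ∀ r t b s (S : Subset (t + b)) → ∣ S ∣ ≡ s → high t S < r → T (isClique (Snt r (t + b) t) s S)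
Snt-clique r t b s S e hi = Equivalence.from (T-∧ {∣ S ∣ ≡ᵇ s}) (≡⇒≡ᵇ ∣ S ∣ s e , all⁺ _ (allSubsets (t + b)) each)
  where
  each : ∀ R → T (not ((R ⊆ᵇ S) ∧ (∣ R ∣ ≡ᵇ r)) ∨ edge (Snt r (t + b) t) R)
  each R = imp ((R ⊆ᵇ S) ∧ (∣ R ∣ ≡ᵇ r)) (λ c → go (Equivalence.to (T-∧ {R ⊆ᵇ S}) c))
    where
    imp : ∀ a {c} → (T a → T c) → T (not a ∨ c)
    imp true  f = f tt
    imp false f = tt
    go : T (R ⊆ᵇ S) × T (∣ R ∣ ≡ᵇ r) → T (edge (Snt r (t + b) t) R)
    go (sub , sz) = found (low-witness t R (+-cancelʳ-≤ (high t R) 1 (low t R) (≤-trans (s≤s (⊆ᵇ-high t R S sub)) (≤-trans hi (≤-reflexive (trans (sym (≡ᵇ⇒≡ ∣ R ∣ r sz)) (low+high t R)))))))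
      where
      found : (∃ λ i → lookup R i ≡ true × toℕ i < t) → T (edge (Snt r (t + b) t) R)
      found (i , e , lt) = Equivalence.from (T-∧ {∣ R ∣ ≡ᵇ r}) (sz , any⁺ (λ i → lookup R i ∧ (toℕ i <ᵇ t)) (∈-allFin i) (Equivalence.from (T-∧ {lookup R i}) (subst T (sym e) tt , <⇒<ᵇ lt)))

-- Used with `h = r - 1`, the most vertices that a clique can have outside the fixed `t`; such
-- cliques give the leading term.
Snt-count : ∀ r t b s j h → s ≡ j + h → h < r → (t C j) * (b C h) ≤ numK s (Snt r (t + b) t)
Snt-count r t b s j h s≡ h<r = ≤-trans (split-count t b j h) (≤-trans (count-mono (split? t {b} j h) (λ S → T? (isClique (Snt r (t + b) t) s S)) (allSubsets (t + b))
    (λ { S (a , c) → Snt-clique r t b s S (trans (low+high t S) (trans (cong₂ _+_ a c) (sym s≡))) (≤-trans (s≤s (≤-reflexive c)) h<r) }))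
  (≤-reflexive (sym (length-filter-count (λ S → T? (isClique (Snt r (t + b) t) s S)) (allSubsets (t + b))))))

lower-bound : ∀ r t s j h → s ≡ j + h → h < r → ∀ m → ∃ λ N → ∀ n → N ≤ n →
  suc m * (t C j) * n ^ h ≤ suc m * h ! * numK s (Snt r n t) + h ! * n ^ h
lower-bound r t s j h s≡ h<r m = suc (q + M * (q * h)) , main
  where
  c d q M : ℕ
  c = t C j
  d = h !
  -- For `n = x + q` there are `x + h` vertices outside the first `t`; `binomial-≥` bounds the
  -- number of their `h`-subsets through `x ^ h`, and `power-gap` pays for the shift by `q`.
  q = t + h
  M = suc m * c
  main : ∀ n → suc (q + M * (q * h)) ≤ n → suc m * c * n ^ h ≤ suc m * d * numK s (Snt r n t) + d * n ^ h
  main n N≤ = subst (λ n → suc m * c * n ^ h ≤ suc m * d * numK s (Snt r n t) + d * n ^ h) n≡ (bound (n ∸ q) (subst (λ n → M * (q * h) ≤ n) (sym (trans n≡′ refl)) (≤-trans (m≤n+m _ q) (<⇒≤ N≤))) (subst (1 ≤_) (sym n≡′) (≤-trans (s≤s z≤n) N≤)))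
    where
    q≤n : q ≤ n
    q≤n = ≤-trans (m≤m+n q _) (<⇒≤ N≤)
    n≡′ : n ∸ q + q ≡ n
    n≡′ = m∸n+n≡m q≤n
    n≡ : t + (n ∸ q + h) ≡ n
    n≡ = trans (e t (n ∸ q) h) n≡′
      where
      e : ∀ t x h → t + (x + h) ≡ x + (t + h)
      e = solve-∀
    bound : ∀ x → M * (q * h) ≤ x + q → 1 ≤ x + q → suc m * c * (t + (x + h)) ^ h ≤ suc m * d * numK s (Snt r (t + (x + h)) t) + d * (t + (x + h)) ^ h
    bound x big pos = subst (λ y → M * y ^ h ≤ suc m * d * numK s (Snt r (t + (x + h)) t) + d * y ^ h) (e₀ t x h) (*-cancelˡ-≤ Y {{>-nonZero pos}} (begin
      Y * (M * Y ^ h)                                               ≡⟨ e₁ Y M (Y ^ h) ⟩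
      M * (Y * Y ^ h)                                               ≤⟨ *-monoʳ-≤ M (power-gap x q h) ⟩
      M * (Y * x ^ h + q * h * Y ^ h)                               ≡⟨ e₂ M Y (x ^ h) (q * h) (Y ^ h) ⟩
      Y * (M * x ^ h) + M * (q * h) * Y ^ h                         ≤⟨ +-mono-≤ (*-monoʳ-≤ Y (*-monoʳ-≤ M (binomial-≥ x h))) (*-monoˡ-≤ (Y ^ h) big) ⟩
      Y * (M * (((x + h) C h) * d)) + Y * Y ^ h                     ≡⟨ e₃ Y (suc m) c ((x + h) C h) d (Y ^ h) ⟩
      Y * (suc m * d * (c * ((x + h) C h)) + 1 * Y ^ h)             ≤⟨ *-monoʳ-≤ Y (+-mono-≤ (*-monoʳ-≤ (suc m * d) (Snt-count r t (x + h) s j h s≡ h<r)) (*-monoˡ-≤ (Y ^ h) (n!>0 h))) ⟩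
      Y * (suc m * d * numK s (Snt r (t + (x + h)) t) + d * Y ^ h)  ∎))
      where
      open ≤-Reasoning
      Y : ℕ
      Y = x + q
      e₀ : ∀ t x h → x + (t + h) ≡ t + (x + h)
      e₀ = solve-∀
      e₁ : ∀ y m p → y * (m * p) ≡ m * (y * p)
      e₁ = solve-∀
      e₂ : ∀ m y a g p → m * (y * a + g * p) ≡ y * (m * a) + m * g * p
      e₂ = solve-∀
      e₃ : ∀ y m c b d p → y * (m * c * (b * d)) + y * p ≡ y * (m * d * (c * b) + 1 * p)
      e₃ = solve-∀
      n!>0 : ∀ h → 1 ≤ h !
      n!>0 zero    = ≤-refl
      n!>0 (suc h) = ≤-trans (n!>0 h) (m≤m+n (h !) _)

-- The construction contains no forbidden copy

module _ {n t : ℕ} {X : Set} (φ : X → Fin n) where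

  struck : ∀ r vs → T (edge (Snt r n t) (toSubset (map φ vs))) → ∃ λ x → x ∈ vs × toℕ (φ x) < t
  struck r vs h = locate (any⁻ _ (allFin n) (proj₂ (Equivalence.to (T-∧ {∣ toSubset (map φ vs) ∣ ≡ᵇ r}) h)))
    where
    locate : (∃ λ i → T (lookup (toSubset (map φ vs)) i ∧ (toℕ i <ᵇ t))) → ∃ λ x → x ∈ vs × toℕ (φ x) < t
    locate (i , q) with Equivalence.to (T-∧ {lookup (toSubset (map φ vs)) i}) q
    ... | a , b with ∈-map⁻ φ (∈-toSubset⁻ (map φ vs) (Vecₚ.lookup⇒[]= i _ (Equivalence.to T-≡ a)))
    ... | x , x∈ , refl = x , x∈ , <ᵇ⇒< (toℕ (φ x)) t b

-- A vertex of a path or cycle starts at most one edge and ends at most one, so t vertices cover at most 2t edges.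
module Cover {n t ℓ κ : ℕ} {X : Set} (start end : Fin ℓ → X) (start-inj : Inj start) (end-inj : Inj end)
  (ψ : X ⊎ (Fin ℓ × Fin κ) → Fin n) (ψ-inj : ∀ {x y} → ψ x ≡ ψ y → x ≡ y)
  (hit : ∀ e → ∃ λ x → x ∈ inj₁ (start e) ∷ inj₁ (end e) ∷ map (λ j → inj₂ (e , j)) (allFin κ) × toℕ (ψ x) < t) where

  at-hit : Fin ℓ → Fin t
  at-hit e = fromℕ< (proj₂ (proj₂ (hit e)))

  Own : Fin t → Set
  Own a = ∃ λ e → at-hit e ≡ a

  Own? : ∀ a → Dec (Own a)
  Own? a = any? (λ e → at-hit e ≟ a)

  same : ∀ {e e′} → at-hit e ≡ at-hit e′ → proj₁ (hit e) ≡ proj₁ (hit e′)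
  same {e} {e′} eq = ψ-inj (toℕ-injective (trans (sym (toℕ-fromℕ< (proj₂ (proj₂ (hit e))))) (trans (cong toℕ eq) (toℕ-fromℕ< (proj₂ (proj₂ (hit e′)))))))

  Starts : Fin ℓ → Set
  Starts e = proj₁ (hit e) ≡ inj₁ (start e)

  -- The end of an edge and its expansion vertices form one class: different edges have different
  -- ends, an expansion vertex belongs to one edge, and the two sorts never coincide. So a vertex
  -- accounts for at most one edge in this class.
  data Later (e : Fin ℓ) : X ⊎ (Fin ℓ × Fin κ) → Set where
    final : Later e (inj₁ (end e))
    extra : ∀ j → Later e (inj₂ (e , j))

  place : ∀ e → Starts e ⊎ Later e (proj₁ (hit e))
  place e with hit e
  ... | x , here refl , _ = inj₁ refl
  ... | x , there (here refl) , _ = inj₂ final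
  ... | x , there (there p) , _ with ∈-map⁻ (λ j → inj₂ (e , j)) p
  ... | j , _ , refl = inj₂ (extra j)

  starts : ∀ {e} → Starts e ⊎ Later e (proj₁ (hit e)) → Bool
  starts (inj₁ _) = true
  starts (inj₂ _) = false

  starts-unique : ∀ {e e′} → at-hit e ≡ at-hit e′ → Starts e → Starts e′ → e ≡ e′
  starts-unique eq a b = inj start-inj (inj₁-injective (trans (sym a) (trans (same eq) b)))

  later-unique : ∀ {e e′} → at-hit e ≡ at-hit e′ → Later e (proj₁ (hit e)) → Later e′ (proj₁ (hit e′)) → e ≡ e′
  later-unique {e} {e′} eq a b = go (same eq) a b
    where
    go : ∀ {x y} → x ≡ y → Later e x → Later e′ y → e ≡ e′
    go p final final = inj end-inj (inj₁-injective p)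
    go refl (extra j) (extra .j) = refl

  cover : ℓ ≤ 2 * count Own? (allFin t)
  cover = begin
    ℓ                                                                ≡⟨ trans (sym (*-identityʳ ℓ)) (trans (cong (_* 1) (sym (length-allFin ℓ))) (sym (∑-const (allFin ℓ) 1))) ⟩
    ∑ (allFin ℓ) (λ _ → 1)                                           ≤⟨ ∑-mono (allFin ℓ) (λ e → ≤-trans (≤-reflexive (sym (ind-yes (at-hit e ≟ at-hit e) refl))) (∑-≥ (λ a → ind (at-hit e ≟ a)) (∈-allFin (at-hit e)))) ⟩
    ∑ (allFin ℓ) (λ e → ∑ (allFin t) (λ a → ind (at-hit e ≟ a)))     ≡⟨ ∑-swap (allFin ℓ) (allFin t) _ ⟩
    ∑ (allFin t) (λ a → count (λ e → at-hit e ≟ a) (allFin ℓ))       ≤⟨ ∑-mono (allFin t) (λ a → two a (Own? a)) ⟩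
    ∑ (allFin t) (λ a → 2 * ind (Own? a))                            ≡⟨ ∑-* (allFin t) 2 _ ⟩
    2 * count Own? (allFin t)                                        ∎
    where
    open ≤-Reasoning
    S? : ∀ a e → Dec (at-hit e ≡ a × T (starts (place e)))
    S? a e = (at-hit e ≟ a) ×-dec T? (starts (place e))
    L? : ∀ a e → Dec (at-hit e ≡ a × T (not (starts (place e))))
    L? a e = (at-hit e ≟ a) ×-dec T? (not (starts (place e)))
    get-s : ∀ {e} (p : Starts e ⊎ Later e (proj₁ (hit e))) → T (starts p) → Starts e
    get-s (inj₁ s) _ = s
    get-l : ∀ {e} (p : Starts e ⊎ Later e (proj₁ (hit e))) → T (not (starts p)) → Later e (proj₁ (hit e))
    get-l (inj₂ l) _ = l
    two : ∀ a (d : Dec (Own a)) → count (λ e → at-hit e ≟ a) (allFin ℓ) ≤ 2 * ind d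
    two a (no ¬o) = count-none (λ e → at-hit e ≟ a) (λ e q → ¬o (e , q)) (allFin ℓ)
    two a (yes _) = ≤-trans (count-∪ (λ e → at-hit e ≟ a) (S? a) (L? a) (allFin ℓ) (λ e q → which e q (starts (place e)) refl))
        (+-mono-≤ (at-most-one (S? a) (λ { e e′ (p , s) (p′ , s′) → starts-unique (trans p (sym p′)) (get-s (place e) s) (get-s (place e′) s′) }))
          (at-most-one (L? a) (λ { e e′ (p , s) (p′ , s′) → later-unique (trans p (sym p′)) (get-l (place e) s) (get-l (place e′) s′) })))
      where
      which : ∀ e → at-hit e ≡ a → ∀ b → starts (place e) ≡ b → (at-hit e ≡ a × T (starts (place e))) ⊎ (at-hit e ≡ a × T (not (starts (place e))))
      which e q true  eq = inj₁ (q , subst T (sym eq) tt)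
      which e q false eq = inj₂ (q , subst (T ∘ not) (sym eq) tt)

suc-mod-injective : ∀ {m} {i j : Fin (suc m)} → suc (toℕ i) mod suc m ≡ suc (toℕ j) mod suc m → i ≡ j
suc-mod-injective {m} {i} {j} eq = go (suc (toℕ i) <? suc m) (suc (toℕ j) <? suc m)
  where
  rem : suc (toℕ i) % suc m ≡ suc (toℕ j) % suc m
  rem = trans (sym (toℕ-fromℕ< _)) (trans (cong toℕ eq) (toℕ-fromℕ< _))
  top : ∀ (i : Fin (suc m)) → ¬ (suc (toℕ i) < suc m) → suc (toℕ i) ≡ suc m
  top i ¬lt = ≤-antisym (toℕ<n i) (≮⇒≥ ¬lt)
  wrap : ∀ (i : Fin (suc m)) → ¬ (suc (toℕ i) < suc m) → suc (toℕ i) % suc m ≡ 0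
  wrap i ¬lt = trans (cong (_% suc m) (top i ¬lt)) (n%n≡0 (suc m))
  go : Dec (suc (toℕ i) < suc m) → Dec (suc (toℕ j) < suc m) → i ≡ j
  go (yes a) (yes b) = toℕ-injective (cong pred (trans (sym (m<n⇒m%n≡m a)) (trans rem (m<n⇒m%n≡m b))))
  go (no a)  (no b)  = toℕ-injective (cong pred (trans (top i a) (sym (top j b))))
  go (yes a) (no b)  = case trans (sym (m<n⇒m%n≡m a)) (trans rem (wrap j b)) of λ ()
  go (no a)  (yes b) = case trans (sym (wrap i a)) (trans rem (m<n⇒m%n≡m b)) of λ ()

Touches : ∀ {n} t {X : Set} → (X → Fin n) → Fin t → Set
Touches t ψ a = ∃ λ x → toℕ (ψ x) ≡ toℕ a

-- The vertices below `t` that a component claims. Each is an image under the embedding, so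
-- different components claim different ones.
Owners : ∀ {n} t {X : Set} → (X → Fin n) → ℕ → Set₁
Owners t ψ q = Σ (Fin t → Set) λ Own → Σ (∀ a → Dec (Own a)) λ Own? → (∀ a → Own a → Touches t ψ a) × q ≤ count Own? (allFin t)

half-≤ : ∀ {ℓ c} → ℓ ≤ 2 * c → ⌊ ℓ + 1 /2⌋ ≤ c
half-≤ {ℓ} {c} h = ≤-trans (⌊n/2⌋-mono (+-monoˡ-≤ 1 h)) (≤-reflexive (go c))
  where
  go : ∀ c → ⌊ 2 * c + 1 /2⌋ ≡ c
  go zero    = refl
  go (suc c) = trans (cong (λ x → ⌊ suc x + 1 /2⌋) (+-suc c (c + 0))) (cong suc (go c))

base-owners : ∀ {n t} κ K ℓ → 1 ≤ ℓ → (ψ : V (expansion (3 + κ) (base K ℓ)) → Fin n) → (∀ {x y} → ψ x ≡ ψ y → x ≡ y) →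
  (∀ e → ∃ λ x → x ∈ verts (expansion (3 + κ) (base K ℓ)) e × toℕ (ψ x) < t) → Owners t ψ ⌊ ℓ + 1 /2⌋
base-owners {n} {t} κ paths ℓ _ ψ ψ-inj hit = Own , Own? , (λ { a (e , refl) → proj₁ (hit e) , sym (toℕ-fromℕ< (proj₂ (proj₂ (hit e)))) }) , half-≤ cover
  where open Cover {t = t} {κ = suc κ} (inject₁ {ℓ}) suc inject₁-Inj suc-Inj ψ ψ-inj hit
base-owners {n} {t} κ cycles (suc m) _ ψ ψ-inj hit = Own , Own? , (λ { a (e , refl) → proj₁ (hit e) , sym (toℕ-fromℕ< (proj₂ (proj₂ (hit e)))) }) , half-≤ cover
  where open Cover {t = t} {κ = suc κ} id (λ i → suc (toℕ i) mod suc m) (mkInj id) (mkInj suc-mod-injective) ψ ψ-inj hit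

star-owners : ∀ {n t} κ ℓ → 1 ≤ ℓ → (ψ : V (expansion (3 + κ) (star ℓ)) → Fin n) →
  (∀ e → ∃ λ x → x ∈ verts (expansion (3 + κ) (star ℓ)) e × toℕ (ψ x) < t) → Owners t ψ 1
star-owners {n} {t} κ (suc ℓ) _ ψ hit = (λ a → b ≡ a) , (λ a → b ≟ a) , (λ { a refl → proj₁ (hit zero) , sym (toℕ-fromℕ< (proj₂ (proj₂ (hit zero)))) }) ,
    ≤-trans (≤-reflexive (sym (ind-yes (b ≟ b) refl))) (∑-≥ (λ a → ind (b ≟ a)) (∈-allFin b))
  where
  b : Fin t
  b = fromℕ< (proj₂ (proj₂ (hit zero)))

sum-allFin : ∀ k (f : Fin k → ℕ) → sum (map f (allFin k)) ≡ ∑ (allFin k) f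
sum-allFin k f = go (allFin k)
  where
  go : ∀ xs → sum (map f xs) ≡ ∑ xs f
  go []       = refl
  go (x ∷ xs) = cong (f x +_) (go xs)

-- The components claim disjoint subsets of the fixed `t` vertices, yet the sizes of their claims
-- add up to at least `t + 1`.
Snt-free : ∀ κ n K k ℓ p ts → 1 ≤ k → (∀ i → 5 ≤ ℓ i) → (∀ j → 1 ≤ ts j) → Free (Snt (3 + κ) n (tParam k ℓ p)) (Forb (3 + κ) K k ℓ p ts)
Snt-free κ n K k ℓ p ts 1≤k ℓ≥ ts≥ (φ , φ-inj , φ-edge) = <-irrefl refl (≤-trans short enough)
  where
  r t Σq : ℕ
  r  = 3 + κ
  t  = tParam k ℓ p
  Σq = sum (map (λ i → ⌊ ℓ i + 1 /2⌋) (allFin k))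
  short : suc t ≤ Σq + p
  short = ≤-reflexive (m+[n∸m]≡n (≤-trans (pos k ℓ ℓ≥ 1≤k) (m≤m+n Σq p)))
    where
    pos : ∀ k (ℓ : Fin k → ℕ) → (∀ i → 5 ≤ ℓ i) → 1 ≤ k → 1 ≤ sum (map (λ i → ⌊ ℓ i + 1 /2⌋) (allFin k))
    pos (suc k) ℓ ℓ≥ _ = ≤-trans (≤-trans (s≤s z≤n) (⌊n/2⌋-mono (+-monoˡ-≤ 1 (ℓ≥ zero)))) (m≤m+n _ _)
  ψ : ∀ i → V (expansion r (base K (ℓ i))) → Fin n
  ψ i x = φ (inj₁ (i , x))
  χ : ∀ j → V (expansion r (star (ts j))) → Fin n
  χ j x = φ (inj₂ (j , x))
  pull : ∀ {X Y : Set} {vs : List X} (g : X → Y) (f : Y → Fin n) → (∃ λ y → y ∈ map g vs × toℕ (f y) < t) → ∃ λ x → x ∈ vs × toℕ (f (g x)) < t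
  pull g f (y , y∈ , lt) with ∈-map⁻ g y∈
  ... | x , x∈ , refl = x , x∈ , lt
  ow : ∀ i → Owners t (ψ i) ⌊ ℓ i + 1 /2⌋
  ow i = base-owners κ K (ℓ i) (≤-trans (s≤s z≤n) (ℓ≥ i)) (ψ i) (λ e → strip (φ-inj e)) (λ e → pull (λ x → i , x) (φ ∘ inj₁) (pull inj₁ φ (struck φ r _ (φ-edge (inj₁ (i , e))))))
    where
    strip : ∀ {x y} → _≡_ {A = V (Forb r K k ℓ p ts)} (inj₁ (i , x)) (inj₁ (i , y)) → x ≡ y
    strip refl = refl
  ow′ : ∀ j → Owners t (χ j) 1
  ow′ j = star-owners κ (ts j) (ts≥ j) (χ j) (λ e → pull (λ x → j , x) (φ ∘ inj₂) (pull inj₂ φ (struck φ r _ (φ-edge (inj₂ (j , e))))))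
  Own : ∀ i → Fin t → Set
  Own i = proj₁ (ow i)
  Own? : ∀ i a → Dec (Own i a)
  Own? i = proj₁ (proj₂ (ow i))
  Own′ : ∀ j → Fin t → Set
  Own′ j = proj₁ (ow′ j)
  Own′? : ∀ j a → Dec (Own′ j a)
  Own′? j = proj₁ (proj₂ (ow′ j))
  touch : ∀ {i a} → Own i a → Touches t (ψ i) a
  touch {i} {a} = proj₁ (proj₂ (proj₂ (ow i))) a
  touch′ : ∀ {j a} → Own′ j a → Touches t (χ j) a
  touch′ {j} {a} = proj₁ (proj₂ (proj₂ (ow′ j))) a
  bb : ∀ a i i′ → Own i a → Own i′ a → i ≡ i′
  bb a i i′ o o′ = go (touch o) (touch o′)
    where
    go : Touches t (ψ i) a → Touches t (ψ i′) a → i ≡ i′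
    go (x , e) (x′ , e′) with φ-inj {inj₁ (i , x)} {inj₁ (i′ , x′)} (toℕ-injective (trans e (sym e′)))
    ... | refl = refl
  ss : ∀ a j j′ → Own′ j a → Own′ j′ a → j ≡ j′
  ss a j j′ o o′ = go (touch′ o) (touch′ o′)
    where
    go : Touches t (χ j) a → Touches t (χ j′) a → j ≡ j′
    go (x , e) (x′ , e′) with φ-inj {inj₂ (j , x)} {inj₂ (j′ , x′)} (toℕ-injective (trans e (sym e′)))
    ... | refl = refl
  bs : ∀ a i j → Own i a → ¬ Own′ j a
  bs a i j o o′ = go (touch o) (touch′ o′)
    where
    go : Touches t (ψ i) a → ¬ Touches t (χ j) a
    go (x , e) (x′ , e′) with φ-inj {inj₁ (i , x)} {inj₂ (j , x′)} (toℕ-injective (trans e (sym e′)))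
    ... | ()
  one : ∀ a → count (λ i → Own? i a) (allFin k) + count (λ j → Own′? j a) (allFin p) ≤ 1
  one a = go (any? (λ i → Own? i a))
    where
    go : Dec (∃ λ i → Own i a) → count (λ i → Own? i a) (allFin k) + count (λ j → Own′? j a) (allFin p) ≤ 1
    go (yes (i , o)) = +-mono-≤ (at-most-one (λ i → Own? i a) (bb a)) (count-none (λ j → Own′? j a) (λ j → bs a i j o) (allFin p))
    go (no ¬o) = +-mono-≤ (count-none (λ i → Own? i a) (λ i o → ¬o (i , o)) (allFin k)) (at-most-one (λ j → Own′? j a) (ss a))
  enough : Σq + p ≤ t
  enough = begin
    Σq + p                                                                             ≡⟨ cong₂ _+_ (sum-allFin k _) (trans (sym (*-identityʳ p)) (trans (cong (_* 1) (sym (length-allFin p))) (sym (∑-const (allFin p) 1)))) ⟩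
    ∑ (allFin k) (λ i → ⌊ ℓ i + 1 /2⌋) + ∑ (allFin p) (λ _ → 1)                        ≤⟨ +-mono-≤ (∑-mono (allFin k) (λ i → proj₂ (proj₂ (proj₂ (ow i))))) (∑-mono (allFin p) (λ j → proj₂ (proj₂ (proj₂ (ow′ j))))) ⟩
    ∑ (allFin k) (λ i → count (Own? i) (allFin t)) + ∑ (allFin p) (λ j → count (Own′? j) (allFin t)) ≡⟨ cong₂ _+_ (∑-swap (allFin k) (allFin t) _) (∑-swap (allFin p) (allFin t) _) ⟩
    ∑ (allFin t) (λ a → count (λ i → Own? i a) (allFin k)) + ∑ (allFin t) (λ a → count (λ j → Own′? j a) (allFin p)) ≡⟨ ∑-+ (allFin t) _ _ ⟨
    ∑ (allFin t) (λ a → count (λ i → Own? i a) (allFin k) + count (λ j → Own′? j a) (allFin p)) ≤⟨ ∑-≤* (allFin t) _ 1 one ⟩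
    length (allFin t) * 1                                                              ≡⟨ trans (*-identityʳ _) (length-allFin t) ⟩
    t                                                                                  ∎
    where open ≤-Reasoning

-- Combining the two bounds

binomial-pos : ∀ n k → k ≤ n → 1 ≤ n C k
binomial-pos n zero _ = ≤-reflexive (sym (nC0≡1 n))
binomial-pos (suc n) (suc k) (s≤s h) = ≤-trans (binomial-pos n k h) (≤-trans (m≤m+n (n C k) _) (≤-reflexive (nCk+nC[k+1]≡[n+1]C[k+1] n k)))

-- Here `x` stands for `n ^ h`. As `c` is positive, the lower bound gives `x ≤ 2 * d * s`, which
-- turns the gap `2 * x` between the two bounds into `4 * d * s`. Cancelling `4 * d` leaves the
-- error `s`, whence the value of `M`.
ratio : ∀ d m c g s x M → .{{_ : NonZero d}} → .{{_ : NonZero M}} → M ≡ 4 * d * suc m → 1 ≤ c → M * d * g ≤ M * c * x + d * x → M * c * x ≤ M * d * s + d * x →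
  suc m * g ≤ suc m * s + s
ratio d m c g s x M M≡ 1≤c up lo = *-cancelˡ-≤ (4 * d) {{m*n≢0 4 d}} (begin
  4 * d * (suc m * g)              ≡⟨ trans (sym (*-assoc (4 * d) (suc m) g)) (cong (_* g) (sym M≡)) ⟩
  M * g                            ≤⟨ Mg ⟩
  M * s + 2 * x                    ≤⟨ +-monoʳ-≤ (M * s) (*-monoʳ-≤ 2 small) ⟩
  M * s + 2 * (2 * d * s)          ≡⟨ cong (λ y → y * s + 2 * (2 * d * s)) M≡ ⟩
  4 * d * suc m * s + 2 * (2 * d * s) ≡⟨ e₂ d (suc m) s ⟩
  4 * d * (suc m * s + s)          ∎)
  where
  open ≤-Reasoning
  e₂ : ∀ d m s → 4 * d * m * s + 2 * (2 * d * s) ≡ 4 * d * (m * s + s)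
  e₂ = solve-∀
  Mg : M * g ≤ M * s + 2 * x
  Mg = *-cancelˡ-≤ d (begin
    d * (M * g)                    ≡⟨ e₁ d M g ⟩
    M * d * g                      ≤⟨ ≤-trans up (+-monoˡ-≤ (d * x) lo) ⟩
    M * d * s + d * x + d * x      ≡⟨ e₃ M d s x ⟩
    d * (M * s + 2 * x)            ∎)
    where
    e₁ : ∀ d M g → d * (M * g) ≡ M * d * g
    e₁ = solve-∀
    e₃ : ∀ M d s x → M * d * s + d * x + d * x ≡ d * (M * s + 2 * x)
    e₃ = solve-∀
  small : x ≤ 2 * d * s
  small = *-cancelˡ-≤ M (+-cancelʳ-≤ (M * x) _ _ (begin
    M * x + M * x                                ≤⟨ +-mono-≤ Mx Mx ⟩
    M * d * s + d * x + (M * d * s + d * x)      ≡⟨ e₁ M d s x ⟩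
    M * (2 * d * s) + 2 * d * x                  ≤⟨ +-monoʳ-≤ (M * (2 * d * s)) (*-monoˡ-≤ x 2d≤M) ⟩
    M * (2 * d * s) + M * x                      ∎))
    where
    e₁ : ∀ M d s x → M * d * s + d * x + (M * d * s + d * x) ≡ M * (2 * d * s) + 2 * d * x
    e₁ = solve-∀
    Mx : M * x ≤ M * d * s + d * x
    Mx = ≤-trans (*-monoˡ-≤ x (≤-trans (≤-reflexive (sym (*-identityʳ M))) (*-monoʳ-≤ M 1≤c))) lo
    2d≤M : 2 * d ≤ M
    2d≤M = ≤-trans (≤-by (2 * d + 4 * d * m) (e₄ d m)) (≤-reflexive (sym M≡))
      where
      e₄ : ∀ d m → 2 * d + (2 * d + 4 * d * m) ≡ 4 * d * (1 + m)
      e₄ = solve-∀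

theorem2p10 : (r k p : ℕ) (ℓ : Fin k → ℕ) (ts : Fin p → ℕ) (s : ℕ) (κ : Kind)
    → 3 ≤ r → 1 ≤ k → (∀ i → 5 ≤ ℓ i) → (∀ j → 2 ≤ ts j) → r ≤ s
    → let t = tParam k ℓ p
          F = Forb r κ k ℓ p ts
          c = t C (s ∸ r + 1)
          d = (r ∸ 1) !
      in
      -- (i): ex = (1+o(1)) N(K_s, S_{n,t}) and ex = c n^{r-1}/(r-1)! + o(n^{r-1})
      (s ≤ t + r ∸ 1
        → (∀ m → ∃ λ N → ∀ n → N ≤ n
             → ((G : RGraph r n) → Free G F
                  → suc m * numK s G ≤ suc m * numK s (Snt r n t) + numK s (Snt r n t))
             × Σ (RGraph r n) (λ G → Free G F
                  × suc m * numK s (Snt r n t) ≤ suc m * numK s G + numK s (Snt r n t)))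
        × (∀ m → ∃ λ N → ∀ n → N ≤ n
             → ((G : RGraph r n) → Free G F
                  → suc m * d * numK s G ≤ suc m * c * n ^ (r ∸ 1) + d * n ^ (r ∸ 1))
             × Σ (RGraph r n) (λ G → Free G F
                  × suc m * c * n ^ (r ∸ 1) ≤ suc m * d * numK s G + d * n ^ (r ∸ 1))))
      -- (ii): ex = o(n^{r-1})
      × (t + r ≤ s
        → ∀ m → ∃ λ N → ∀ n → N ≤ n
             → (G : RGraph r n) → Free G F → suc m * numK s G ≤ n ^ (r ∸ 1))
theorem2p10 (suc (suc (suc κ′))) k p ℓ ts s κ (s≤s (s≤s (s≤s z≤n))) 1≤k ℓ≥ ts≥ r≤s =
    (λ s≤ → relative s≤ , absolute) , vanishing
  where
  r h j t c d : ℕ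
  r = 3 + κ′
  h = 2 + κ′
  j = s ∸ r + 1
  t = tParam k ℓ p
  c = t C j
  d = h !
  F : Hyp
  F = Forb r κ k ℓ p ts
  ts≥1 : ∀ i → 1 ≤ ts i
  ts≥1 i = ≤-trans (s≤s z≤n) (ts≥ i)
  s≡ : s ≡ j + h
  s≡ = trans (sym (m∸n+n≡m r≤s)) (e (s ∸ r) κ′)
    where
    e : ∀ a κ → a + (3 + κ) ≡ a + 1 + (2 + κ)
    e = solve-∀
  up : ∀ m → ∃ λ N → ∀ {n} → N ≤ n → (G : RGraph r n) → Free G F → suc m * d * numK s G ≤ suc m * c * n ^ h + d * n ^ h
  up = upper-bound κ k ℓ p ts ℓ≥ ts≥1 1≤k κ′ s r≤s
  lo : ∀ m → ∃ λ N → ∀ n → N ≤ n → suc m * c * n ^ h ≤ suc m * d * numK s (Snt r n t) + d * n ^ h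
  lo = lower-bound r t s j h s≡ ≤-refl
  Snt-F : ∀ n → Free (Snt r n t) F
  Snt-F n = Snt-free κ′ n κ k ℓ p ts 1≤k ℓ≥ ts≥1
  absolute : ∀ m → ∃ λ N → ∀ n → N ≤ n
    → ((G : RGraph r n) → Free G F → suc m * d * numK s G ≤ suc m * c * n ^ h + d * n ^ h)
    × Σ (RGraph r n) (λ G → Free G F × suc m * c * n ^ h ≤ suc m * d * numK s G + d * n ^ h)
  absolute m = proj₁ (up m) + proj₁ (lo m) , λ n N≤ →
    proj₂ (up m) (m+n≤o⇒m≤o _ N≤) , Snt r n t , Snt-F n , proj₂ (lo m) n (m+n≤o⇒n≤o (proj₁ (up m)) N≤)
  instance
    d≢0 : NonZero d
    d≢0 = h !≢0
  c≥1 : s ≤ t + r ∸ 1 → 1 ≤ c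
  c≥1 s≤ = binomial-pos t j (+-cancelʳ-≤ h j t (≤-trans (≤-reflexive (sym s≡)) (≤-trans s≤ (≤-reflexive (cong (_∸ 1) (+-suc t h))))))
  relative : s ≤ t + r ∸ 1 → ∀ m → ∃ λ N → ∀ n → N ≤ n
    → ((G : RGraph r n) → Free G F → suc m * numK s G ≤ suc m * numK s (Snt r n t) + numK s (Snt r n t))
    × Σ (RGraph r n) (λ G → Free G F × suc m * numK s (Snt r n t) ≤ suc m * numK s G + numK s (Snt r n t))
  relative s≤ m = proj₁ (up m₁) + proj₁ (lo m₁) , λ n N≤ →
      (λ G fr → ratio d m c (numK s G) (numK s (Snt r n t)) (n ^ h) (suc m₁) M≡ (c≥1 s≤) (proj₂ (up m₁) (m+n≤o⇒m≤o _ N≤) G fr) (proj₂ (lo m₁) n (m+n≤o⇒n≤o (proj₁ (up m₁)) N≤))) ,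
      Snt r n t , Snt-F n , m≤m+n _ _
    where
    m₁ : ℕ
    -- The bounds are stated for successors, so the accuracy demanded by `ratio` enters through its
    -- predecessor.
    m₁ = pred (4 * d * suc m)
    M≡ : suc m₁ ≡ 4 * d * suc m
    M≡ = suc-pred (4 * d * suc m) {{m*n≢0 (4 * d) (suc m) {{m*n≢0 4 d}}}}
  vanishing : t + r ≤ s → ∀ m → ∃ λ N → ∀ n → N ≤ n → (G : RGraph r n) → Free G F → suc m * numK s G ≤ n ^ h
  vanishing t≤ m = proj₁ (up m) , λ n N≤ G fr → *-cancelˡ-≤ d (begin
      d * (suc m * numK s G)                       ≡⟨ e d (suc m) (numK s G) ⟩
      suc m * d * numK s G                         ≤⟨ proj₂ (up m) N≤ G fr ⟩
      suc m * c * n ^ h + d * n ^ h                ≡⟨ cong (λ x → suc m * x * n ^ h + d * n ^ h) c≡0 ⟩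
      suc m * 0 * n ^ h + d * n ^ h                ≡⟨ cong (λ x → x * n ^ h + d * n ^ h) (*-zeroʳ (suc m)) ⟩
      d * n ^ h                                    ∎)
    where
    open ≤-Reasoning
    e : ∀ d m g → d * (m * g) ≡ m * d * g
    e = solve-∀
    -- Here `j` exceeds `t`: the main term disappears and only the error of the upper bound is left.
    c≡0 : c ≡ 0
    c≡0 = k>n⇒nCk≡0 (+-cancelʳ-≤ h (suc t) j (≤-trans (≤-reflexive (sym (+-suc t h))) (≤-trans t≤ (≤-reflexive s≡))))
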